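{- Let $G=(V,E,w,s)$ be a graph with $n$ vertices in which each vertex $v$ has a weight $w(v)$ and a size $s(v)$, let $l$ and $u$ be two non-negative integers with $l\leq u$, and let $p\leq n$ be a positive integer. Write $s(V)=\sum_{v\in V}s(v)$. The MinMax-$p$-$(l,u)$-partition problem and the MaxMin-$p$-$(l,u)$-partition problem can each be solved in $\mathcal{O}(u^2p^2n\log(s(V)))$ time if $G$ is a tree and in $\mathcal{O}(u^2p^2n^2\log(s(V)))$ time if $G$ is a cactus graph.
   Context: Graphs are finite, simple and connected. A cactus graph is a graph in which any two simple cycles have at most one vertex in common (equivalently, every edge belongs to at most one simple cycle). Vertex weights and vertex sizes are non-negative integers. A partition of $G=(V,E)$ is a partition of $V$ into disjoint non-empty subsets (clusters), each inducing a connected subgraph of $G$. The weight and the size of a cluster $V_i$ are $w(V_i)=\sum_{v\in V_i}w(v)$ and $s(V_i)=\sum_{v\in V_i}s(v)$. A $p$-$(l,u)$-partition of $G$ is a partition of $G$ into exactly $p$ clusters $V_1,\ldots,V_p$ with $l\leq w(V_i)\leq u$ for all $i$. The MinMax-$p$-$(l,u)$-partition problem is to find a $p$-$(l,u)$-partition $\{V_1,\ldots,V_p\}$ of $G$ minimizing $\max_i s(V_i)$ over all $p$-$(l,u)$-partitions of $G$; the MaxMin-$p$-$(l,u)$-partition problem is to find one maximizing $\min_i s(V_i)$; in both cases, if no $p$-$(l,u)$-partition exists, this is to be determined. Running time counts elementary operations, where arithmetic operations on and comparisons of integers have unit cost; in the time bounds a factor $u$ is read as $\max(u,1)$ and $\log(s(V))$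 as $\log(\max(s(V),2))$. -}

module Defs where

open import Data.Bool.Base using (Bool; true; false; if_then_else_; _∧_)
open import Data.Fin.Base using (Fin; toℕ)
open import Data.Fin.Properties using (_≟_)
open import Data.List.Base as List using (List; []; _∷_; _∷ʳ_; length; zip; filter; allFin)
open import Data.List.Membership.Propositional using (_∈_)
open import Data.List.Relation.Unary.All using (All)
open import Data.List.Relation.Unary.AllPairs using (AllPairs)
open import Data.List.Relation.Unary.Unique.Propositional using (Unique)
open import Data.Nat.Base
open import Data.Nat.ListAction using (sum)
open import Data.Product.Base using (_×_; _,_; proj₁; proj₂; ∃-syntax; uncurry; swap)
open import Data.Sum.Base using (_⊎_)
open import Data.Vec.Functional using (foldr; head; tail)
open import Function.Base using (_∘_)
open import Function.Bundles using (_⇔_)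
open import Relation.Binary.Construct.Closure.ReflexiveTransitive using (Star)
open import Relation.Binary.PropositionalEquality using (_≡_; _≢_)
open import Relation.Nullary using (¬_)
open import Relation.Unary using (Pred; U)
open import Level using (0ℓ)

------------------------------------------------------------------------
-- Graphs

-- A finite simple graph on Fin n is given by listing each of its edges
-- exactly once, in an arbitrary order and with arbitrary orientations.

SameEdge : ∀ {n} → Fin n × Fin n → Fin n × Fin n → Set
SameEdge e f = e ≡ f ⊎ e ≡ swap f

record Graph (n : ℕ) : Set where
  field
    edges    : List (Fin n × Fin n)
    loopless : All (uncurry _≢_) edges
    simple   : AllPairs (λ e f → ¬ SameEdge e f) edges

  Adj : Fin n → Fin n → Set
  Adj x y = (x , y) ∈ edges ⊎ (y , x) ∈ edges

InducesConnected : ∀ {n} → Graph n → Pred (Fin n) 0ℓ → Set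
InducesConnected G P =
  ∀ {x y} → P x → P y → Star (λ a b → Graph.Adj G a b × P a × P b) x y

Connected : ∀ {n} → Graph n → Set
Connected G = InducesConnected G U

-- x₁ … xₖ ↦ (x₁,x₂) … (xₖ₋₁,xₖ) (xₖ,x₁)
cyclicPairs : ∀ {A : Set} → List A → List (A × A)
cyclicPairs []       = []
cyclicPairs (x ∷ xs) = zip (x ∷ xs) (xs ∷ʳ x)

record SimpleCycle {n : ℕ} (G : Graph n) : Set where
  field
    vertices : List (Fin n)
    long     : 3 ≤ length vertices
    distinct : Unique vertices
    closed   : All (uncurry (Graph.Adj G)) (cyclicPairs vertices)

  CycleEdge : Fin n → Fin n → Set
  CycleEdge x y = (x , y) ∈ cyclicPairs vertices ⊎ (y , x) ∈ cyclicPairs vertices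

open SimpleCycle using (vertices; CycleEdge)

-- Cycles are identified with the subgraphs they trace out, so starting
-- point and direction are immaterial.
SameCycle : ∀ {n} {G : Graph n} → SimpleCycle G → SimpleCycle G → Set
SameCycle C D = ∀ x y → CycleEdge C x y ⇔ CycleEdge D x y

IsTree : ∀ {n} → Graph n → Set
IsTree G = Connected G × ¬ SimpleCycle G

IsCactus : ∀ {n} → Graph n → Set
IsCactus G = Connected G ×
  (∀ (C D : SimpleCycle G) → ¬ SameCycle C D →
   ∀ {x y} → x ∈ vertices C → x ∈ vertices D →
             y ∈ vertices C → y ∈ vertices D → x ≡ y)

------------------------------------------------------------------------
-- Partition problems

record Instance : Set where
  field
    n     : ℕ
    graph : Graph n
    w s   : Fin n → ℕ
    l u p : ℕ
    l≤u   : l ≤ u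
    0<p   : 0 < p
    p≤n   : p ≤ n

  total : (Fin n → ℕ) → ℕ
  total f = sum (List.map f (allFin n))

  -- A family of p disjoint vertex sets covering V is a map V → Fin p;
  -- the i-th cluster is the fibre over i.
  Labelling : Set
  Labelling = Fin n → Fin p

  clusterSum : (Fin n → ℕ) → Labelling → Fin p → ℕ
  clusterSum f c i = sum (List.map f (filter (λ v → c v ≟ i) (allFin n)))

  record IsBoundedPartition (c : Labelling) : Set where
    field
      nonempty  : ∀ i → ∃[ v ] c v ≡ i
      connected : ∀ i → InducesConnected graph (λ v → c v ≡ i)
      lower     : ∀ i → l ≤ clusterSum w c i
      upper     : ∀ i → clusterSum w c i ≤ u

maximum : ∀ {k} → (Fin k → ℕ) → ℕ
maximum = foldr _⊔_ 0

-- The value at k = 0 is junk; it is only used with k = p > 0.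
minimum : ∀ {k} → (Fin k → ℕ) → ℕ
minimum {zero}  f = 0
minimum {suc k} f = foldr _⊓_ (head f) (tail f)

data Problem : Set where
  MinMax MaxMin : Problem

AtLeastAsGood : Problem → (I : Instance) → (c d : Instance.Labelling I) → Set
AtLeastAsGood MinMax I c d = maximum (clusterSum s c) ≤ maximum (clusterSum s d)
  where open Instance I
AtLeastAsGood MaxMin I c d = minimum (clusterSum s d) ≤ minimum (clusterSum s c)
  where open Instance I

IsOptimal : Problem → (I : Instance) → Instance.Labelling I → Set
IsOptimal P I c = IsBoundedPartition c × (∀ d → IsBoundedPartition d → AtLeastAsGood P I c d)
  where open Instance I

------------------------------------------------------------------------
-- Unit-cost random access machine, programmed by while-programs

-- Memory consists of arrays of natural numbers.  Array names are
-- literals in the program text, whereas indices are computed, so a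
-- program uses a fixed number of arrays and has indirect addressing
-- within each of them.
Store : Set
Store = ℕ → ℕ → ℕ

_[_,_↦_] : Store → ℕ → ℕ → ℕ → Store
(σ [ a , i ↦ x ]) b j = if (a ≡ᵇ b) ∧ (i ≡ᵇ j) then x else σ b j

data Op : Set where
  add sub mul div less equal : Op

fromBool : Bool → ℕ
fromBool true  = 1
fromBool false = 0

applyOp : Op → ℕ → ℕ → ℕ
applyOp add   x y       = x + y
applyOp sub   x y       = x ∸ y
applyOp mul   x y       = x * y
applyOp div   x zero    = 0
applyOp div   x (suc y) = x / suc y
applyOp less  x y       = fromBool (x <ᵇ y)
applyOp equal x y       = fromBool (x ≡ᵇ y)

data Exp : Set where
  lit  : ℕ → Exp
  read : ℕ → Exp → Exp
  op   : Op → Exp → Exp → Exp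

eval : Exp → Store → ℕ
eval (lit k)     σ = k
eval (read a e)  σ = σ a (eval e σ)
eval (op o e e′) σ = applyOp o (eval e σ) (eval e′ σ)

cost : Exp → ℕ
cost (lit k)     = 1
cost (read a e)  = 1 + cost e
cost (op o e e′) = 1 + cost e + cost e′

infixr 5 _⨟_

data Program : Set where
  skip  : Program
  write : (a : ℕ) (index value : Exp) → Program
  _⨟_   : Program → Program → Program
  cond  : (guard : Exp) (yes no : Program) → Program
  while : (guard : Exp) (body : Program) → Program

-- Run c σ t τ: started in σ, c halts in τ after t elementary operations.
-- A guard holds when its value is nonzero.
data Run : Program → Store → ℕ → Store → Set where
  skip     : ∀ {σ} → Run skip σ 1 σ
  write    : ∀ {a e e′ σ} →
             Run (write a e e′) σ (1 + cost e + cost e′) (σ [ a , eval e σ ↦ eval e′ σ ])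
  seq      : ∀ {c d σ τ υ t t′} →
             Run c σ t τ → Run d τ t′ υ → Run (c ⨟ d) σ (t + t′) υ
  cond-true  : ∀ {b c d σ τ t} → eval b σ ≢ 0 →
             Run c σ t τ → Run (cond b c d) σ (1 + cost b + t) τ
  cond-false : ∀ {b c d σ τ t} → eval b σ ≡ 0 →
             Run d σ t τ → Run (cond b c d) σ (1 + cost b + t) τ
  while-true : ∀ {b c σ τ υ t t′} → eval b σ ≢ 0 →
             Run c σ t τ → Run (while b c) τ t′ υ →
             Run (while b c) σ (1 + cost b + t + t′) υ
  while-false : ∀ {b c σ} → eval b σ ≡ 0 →
             Run (while b c) σ (1 + cost b) σ

------------------------------------------------------------------------
-- Solving a problem within a time bound

contents : List ℕ → ℕ → ℕ
contents []       i       = 0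
contents (x ∷ xs) zero    = x
contents (x ∷ xs) (suc i) = contents xs i

-- Array 0 holds the parameters, arrays 1 and 2 the weights and sizes,
-- arrays 3 and 4 the two endpoints of each edge; all else is 0.
input : Instance → Store
input I = array
  where
  open Instance I
  open Graph graph
  array : ℕ → ℕ → ℕ
  array 0 = contents (n ∷ length edges ∷ l ∷ u ∷ p ∷ [])
  array 1 = contents (List.map w (allFin n))
  array 2 = contents (List.map s (allFin n))
  array 3 = contents (List.map (toℕ ∘ proj₁) edges)
  array 4 = contents (List.map (toℕ ∘ proj₂) edges)
  array _ = contents []

-- Cell 0 of array 5 reports whether a partition exists; if so, array 6
-- holds the cluster index of every vertex.
CorrectOutput : Problem → Instance → Store → Set
CorrectOutput P I σ =
  (σ 5 0 ≡ 0 × (∀ c → ¬ IsBoundedPartition c)) ⊎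
  (σ 5 0 ≡ 1 × ∃[ c ] IsOptimal P I c × (∀ v → σ 6 (toℕ v) ≡ toℕ (c v)))
  where open Instance I

-- A single program and a single constant serve all instances.
SolvableInO : Problem → (∀ {n} → Graph n → Set) → (Instance → ℕ) → Set
SolvableInO P Class f =
  ∃[ c ] ∃[ K ] ∀ (I : Instance) → Class (Instance.graph I) →
  ∃[ t ] ∃[ σ ] Run c (input I) t σ × t ≤ K * f I × CorrectOutput P I σ

{-# OPTIONS --safe #-}
module Submission where

-- Deleting from every cycle of a cactus an edge that joins two clusters, or
-- any edge if the cycle lies in a single cluster, leaves all clusters
-- connected; so the partitions of a cactus are those of its spanning trees.
-- A graph search roots the cactus.  Its blocks (bridges and cycles) pairwise
-- share at most a top vertex, and they are contracted into their tops from
-- the leaves up.  For a cycle with k further vertices all k + 1 deletions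
-- are tried, at the price of O(k²) merges of tables, which amounts to O(n)
-- merges for a tree and O(n²) for a cactus.
--
-- Once a bound for the sizes of the clusters is fixed, the table of a
-- rooted part says, for every number k of finished clusters and every weight
-- ω ≤ u of the cluster of the root, how good the size of the latter can be.
-- As indices (k , ω) add up, merging two tables takes O(u²p²) steps.  The
-- least feasible bound is found by bisection, in O(log s(V)) rounds.
--
-- Machine integers are unbounded, so a table entry carries its partial
-- solution along, as a number with one digit in base n + 1 for each vertex:
-- uniting disjoint solutions is addition, and nothing is traced back.
-- Adjacency lists are coded as numbers as well, which makes concatenation
-- a matter of one multiplication and keeps the search linear.

open import Defs
open import Data.Bool.Base using (Bool; true; false; if_then_else_; _∧_; not; T)
open import Data.Empty using (⊥; ⊥-elim)
open import Data.Fin.Base as Fin using (Fin; zero; suc; toℕ; fromℕ<)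
open import Data.Fin.Properties as Finₚ using (toℕ<n; toℕ-fromℕ<; fromℕ<-toℕ; toℕ-injective)
open import Data.List.Base as List
  using (List; []; _∷_; _∷ʳ_; _++_; length; map; filter; allFin; tabulate; zip; lookup; reverse; _ʳ++_;
         InitLast; initLast; _∷ʳ′_)
open import Data.List.Membership.Propositional using (_∈_; _∉_)
open import Data.List.Properties using (length-++; ++-assoc; ++-identityʳ)
open import Data.List.Relation.Unary.All as All using (All; []; _∷_)
open import Data.List.Relation.Unary.AllPairs as AllPairs using (AllPairs; []; _∷_)
open import Data.List.Relation.Unary.Any as Any using (Any; here; there)
open import Data.List.Relation.Unary.Unique.Propositional using (Unique)
open import Data.Nat.Base
open import Data.Nat.DivMod using (m≡m%n+[m/n]*n; m%n<n)
open import Data.Nat.ListAction using (sum)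
open import Data.Nat.Logarithm using (⌊log₂_⌋)
open import Data.Nat.Properties renaming (_≟_ to _≟ℕ_)
open import Data.Nat.Tactic.RingSolver using (solve-∀)
open import Data.Product.Base using (_×_; _,_; proj₁; proj₂; ∃; ∃-syntax; Σ; uncurry)
open import Data.Sum.Base using (_⊎_; inj₁; inj₂; [_,_]′)
open import Data.Unit.Base using (⊤; tt)
open import Data.Vec.Functional using (foldr)
open import Function.Base using (_∘_; _$_; id; case_of_)
open import Function.Bundles using (module Equivalence)
open import Relation.Binary.Construct.Closure.ReflexiveTransitive as Star using (Star; ε; _◅_; _◅◅_)
open import Relation.Binary.Definitions using (tri<; tri≈; tri>)
open import Relation.Binary.PropositionalEquality
open import Relation.Nullary using (¬_; Dec; yes; no; does)
open import Relation.Nullary.Negation using (contradiction)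

-- A program logic with running times

≡ᵇ-refl : ∀ n → (n ≡ᵇ n) ≡ true
≡ᵇ-refl zero    = refl
≡ᵇ-refl (suc n) = ≡ᵇ-refl n

≢⇒≡ᵇ : ∀ {m n} → m ≢ n → (m ≡ᵇ n) ≡ false
≢⇒≡ᵇ {zero}  {zero}  m≢n = contradiction refl m≢n
≢⇒≡ᵇ {zero}  {suc n} m≢n = refl
≢⇒≡ᵇ {suc m} {zero}  m≢n = refl
≢⇒≡ᵇ {suc m} {suc n} m≢n = ≢⇒≡ᵇ (m≢n ∘ cong suc)

if-same : ∀ {i j x y : ℕ} → i ≡ j → (if i ≡ᵇ j then x else y) ≡ x
if-same {i} refl rewrite ≡ᵇ-refl i = refl

if-other : ∀ {i j x y : ℕ} → i ≢ j → (if i ≡ᵇ j then x else y) ≡ y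
if-other i≢j rewrite ≢⇒≡ᵇ i≢j = refl

fromBool-<ᵇ-true : ∀ {m n} → m < n → fromBool (m <ᵇ n) ≡ 1
fromBool-<ᵇ-true {m} {n} m<n with m <ᵇ n | <⇒<ᵇ m<n
... | true | _ = refl

fromBool-<ᵇ-false : ∀ {m n} → n ≤ m → fromBool (m <ᵇ n) ≡ 0
fromBool-<ᵇ-false {m} {n} n≤m with m <ᵇ n in eq
... | false = refl
... | true  = contradiction (<ᵇ⇒< m n (subst T (sym eq) tt)) (≤⇒≯ n≤m)

less≢0 : ∀ {m n} → fromBool (m <ᵇ n) ≢ 0 → m < n
less≢0 {m} {n} h with m <ᵇ n in eq
... | true  = <ᵇ⇒< m n (subst T (sym eq) tt)
... | false = contradiction refl h

less≡0 : ∀ {m n} → fromBool (m <ᵇ n) ≡ 0 → n ≤ m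
less≡0 h = ≮⇒≥ λ m<n → 0≢1+n (trans (sym h) (fromBool-<ᵇ-true m<n))

equal≢0 : ∀ {m n} → fromBool (m ≡ᵇ n) ≢ 0 → m ≡ n
equal≢0 {m} {n} h with m ≡ᵇ n in eq
... | true  = ≡ᵇ⇒≡ m n (subst T (sym eq) tt)
... | false = contradiction refl h

equal≡0 : ∀ {m n} → fromBool (m ≡ᵇ n) ≡ 0 → m ≢ n
equal≡0 {m} h refl rewrite ≡ᵇ-refl m = contradiction h λ ()

free : ℕ → Program → Bool
free a skip          = true
free a (write b _ _) = not (b ≡ᵇ a)
free a (c ⨟ d)       = free a c ∧ free a d
free a (cond _ c d)  = free a c ∧ free a d
free a (while _ c)   = free a c

Agree : Program → Store → Store → Set
Agree c σ τ = ∀ a → T (free a c) → ∀ j → τ a j ≡ σ a j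

T-∧ˡ : ∀ {x y} → T (x ∧ y) → T x
T-∧ˡ {true} _ = tt

T-∧ʳ : ∀ {x y} → T (x ∧ y) → T y
T-∧ʳ {true} t = t

run-agree : ∀ {c σ t τ} → Run c σ t τ → Agree c σ τ
run-agree skip a _ j = refl
run-agree (write {b} {e} {e′} {σ}) a fr j with b ≡ᵇ a
... | false = refl
run-agree (seq r s) a fr j =
  trans (run-agree s a (T-∧ʳ fr) j) (run-agree r a (T-∧ˡ fr) j)
run-agree (cond-true _ r)  a fr j = run-agree r a (T-∧ˡ fr) j
run-agree (cond-false {c = c} _ r) a fr j = run-agree r a (T-∧ʳ {free a c} fr) j
run-agree (while-true _ r s) a fr j = trans (run-agree s a fr j) (run-agree r a fr j)
run-agree (while-false _) a fr j = refl

-- The bound has the shape k * (1 + x): k collects the cost of the program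
-- text and is always a numeral, x measures the data.
record Exec (x : ℕ) (c : Program) (σ : Store) (k : ℕ) (Q : Store → Set) : Set where
  constructor exec
  field
    {time}  : ℕ
    {final} : Store
    run     : Run c σ time final
    bound   : time ≤ k * suc x
    post    : Q final

scale : ∀ {x y c σ k Q} → x ≤ y → Exec x c σ k Q → Exec y c σ k Q
scale {k = k} x≤y (exec r b q) = exec r (≤-trans b (*-monoʳ-≤ k (s≤s x≤y))) q

weaken : ∀ {x c σ k k′ Q} → T (k ≤ᵇ k′) → Exec x c σ k Q → Exec x c σ k′ Q
weaken {x} {k = k} {k′} k≤k′ (exec r b q) =
  exec r (≤-trans b (*-monoˡ-≤ (suc x) (≤ᵇ⇒≤ k k′ k≤k′))) q

mapE : ∀ {x c σ k} {Q R : Store → Set} → (∀ τ → Q τ → R τ) → Exec x c σ k Q → Exec x c σ k R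
mapE f (exec r b q) = exec r b (f _ q)

agreeMap : ∀ {x c σ k} {Q R : Store → Set} → (∀ τ → Agree c σ τ → Q τ → R τ) →
           Exec x c σ k Q → Exec x c σ k R
agreeMap f (exec r b q) = exec r b (f _ (run-agree r) q)

skipE : ∀ {x σ Q} → Q σ → Exec x skip σ 1 Q
skipE {x} q = exec skip (m≤m*n 1 (suc x)) q

writeE : ∀ {x a e e′ σ Q} → Q (σ [ a , eval e σ ↦ eval e′ σ ]) →
         Exec x (write a e e′) σ (1 + cost e + cost e′) Q
writeE {x} {e = e} {e′} q = exec write (m≤m*n (1 + cost e + cost e′) (suc x)) q

seqE : ∀ {x c d σ k k′ Q} → Exec x c σ k (λ τ → Exec x d τ k′ Q) → Exec x (c ⨟ d) σ (k + k′) Q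
seqE {x} {k = k} {k′} (exec r b (exec r′ b′ q)) =
  exec (seq r r′) (≤-trans (+-mono-≤ b b′) (≤-reflexive (sym (*-distribʳ-+ (suc x) k k′)))) q

condE : ∀ {x b c d σ k k′ Q} →
        (eval b σ ≢ 0 → Exec x c σ k Q) → (eval b σ ≡ 0 → Exec x d σ k′ Q) →
        Exec x (cond b c d) σ (1 + cost b + (k ⊔ k′)) Q
condE {x} {b} {σ = σ} {k} {k′} f g = go (eval b σ) refl
  where
  B = 1 + cost b
  le : ∀ {t i} → t ≤ i * suc x → i ≤ k ⊔ k′ → B + t ≤ (B + (k ⊔ k′)) * suc x
  le t≤ i≤ = ≤-trans (+-mono-≤ (m≤m*n B (suc x)) (≤-trans t≤ (*-monoˡ-≤ (suc x) i≤)))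
                     (≤-reflexive (sym (*-distribʳ-+ (suc x) B (k ⊔ k′))))
  go : ∀ v → eval b σ ≡ v → Exec x (cond b _ _) σ (B + (k ⊔ k′)) _
  go zero eq with exec r b≤ q ← g eq = exec (cond-false eq r) (le b≤ (m≤n⊔m k k′)) q
  go (suc v) eq with exec r b≤ q ← f (λ z → 1+n≢0 (trans (sym eq) z)) =
    exec (cond-true (λ z → 1+n≢0 (trans (sym eq) z)) r) (le b≤ (m≤m⊔n k k′)) q

-- The invariant carries a budget out of which every iteration is paid.
whileE : ∀ {b c k Q} (Inv : ℕ → Store → Set) →
         (∀ B σ → Inv B σ → (eval b σ ≡ 0 × Q σ) ⊎
            (eval b σ ≢ 0 × ∃[ x ] ∃[ B′ ] suc x + B′ ≤ B × Exec x c σ k (Inv B′))) →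
         ∀ B {σ} → Inv B σ → Exec B (while b c) σ (k + (1 + cost b)) Q
whileE {b} {c} {k} {Q} Inv step = λ B inv → go B B ≤-refl inv
  where
  G = 1 + cost b
  go : ∀ f B → B ≤ f → ∀ {σ} → Inv B σ → Exec B (while b c) σ (k + G) Q
  go f B B≤f {σ} inv with step B σ inv
  ... | inj₁ (z , q) = exec (while-false z)
          (≤-trans (m≤n+m G k) (m≤m*n (k + G) (suc B))) q
  go zero B B≤f inv | inj₂ (nz , x , B′ , le , _) =
    contradiction (≤-trans le B≤f) λ ()
  go (suc f) B B≤f inv | inj₂ (nz , x , B′ , le , exec {t} r t≤ inv′)
    with exec {t′} r′ t′≤ q ← go f B′ (s≤s⁻¹ (≤-trans (s≤s (m≤n+m B′ x)) (≤-trans le B≤f))) inv′ =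
    exec (while-true nz r r′) bnd q
    where
    bnd : G + t + t′ ≤ (k + G) * suc B
    bnd = begin
      G + t + t′                              ≤⟨ +-mono-≤ (+-mono-≤ (m≤m*n G (suc x)) t≤) t′≤ ⟩
      G * suc x + k * suc x + (k + G) * suc B′ ≡⟨ lem G k (suc x) (suc B′) ⟩
      (k + G) * (suc x + suc B′)              ≤⟨ *-monoʳ-≤ (k + G)
          (≤-trans (≤-reflexive (+-suc (suc x) B′)) (s≤s le)) ⟩
      (k + G) * suc B                         ∎
      where
      open ≤-Reasoning
      lem : ∀ g k x b → g * x + k * x + (k + g) * b ≡ (k + g) * (x + b)
      lem = solve-∀

var : ℕ → Exp
var a = read a (lit 0)

set : ℕ → Exp → Program
set a e = write a (lit 0) e

for : ℕ → Exp → Program → Program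
for i e b = set i (lit 0) ⨟ while (op less (var i) e) (b ⨟ set i (op add (var i) (lit 1)))

sumTo : ℕ → (ℕ → ℕ) → ℕ
sumTo zero    f = 0
sumTo (suc n) f = f n + sumTo n f

sumTo-split : ∀ (f : ℕ → ℕ) k d → sumTo (k + d) f ≡ sumTo k f + sumTo d (λ j → f (k + j))
sumTo-split f k zero rewrite +-identityʳ k | +-identityʳ (sumTo k f) = refl
sumTo-split f k (suc d) rewrite +-suc k d | sumTo-split f k d =
  lem (f (k + d)) (sumTo k f) _
  where
  lem : ∀ a b c → a + (b + c) ≡ b + (a + c)
  lem = solve-∀

sumTo-const : ∀ n c → sumTo n (λ _ → c) ≡ n * c
sumTo-const zero c = refl
sumTo-const (suc n) c = cong (c +_) (sumTo-const n c)

forΣ : ∀ {i e b σ k} N (X : ℕ → ℕ) (Inv : ℕ → Store → Set) →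
       {T (free i b)} →
       (∀ τ → Agree (for i e b) σ τ → eval e τ ≡ N) →
       Inv 0 (σ [ i , 0 ↦ 0 ]) →
       (∀ j τ → j < N → Agree (for i e b) σ τ → τ i 0 ≡ j → Inv j τ →
          Exec (X j) b τ k (λ υ → ∀ x → Inv (suc j) (υ [ i , 0 ↦ x ]))) →
       Exec (sumTo N (suc ∘ X)) (for i e b) σ (k + (13 + cost e)) (Inv N)
forΣ {i} {e} {b} {σ} {k} N X Inv {fr} ev init body =
  weaken′ (seqE (writeE (whileE Inv′ step S inv₀)))
  where
  S = sumTo N (suc ∘ X)
  P = for i e b
  weaken′ : ∀ {c Q} → Exec S c σ (3 + (k + 6 + (4 + cost e))) Q → Exec S c σ (k + (13 + cost e)) Q
  weaken′ {c} {Q} = subst (λ m → Exec S c σ m Q) (lem k (cost e))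
    where
    lem : ∀ k c → 3 + (k + 6 + (4 + c)) ≡ k + (13 + c)
    lem = solve-∀
  Inv′ : ℕ → Store → Set
  Inv′ B τ = ∃[ j ] ∃[ d ] j + d ≡ N × sumTo d (λ m → suc (X (j + m))) ≤ B × τ i 0 ≡ j ×
             Agree P σ τ × Inv j τ
  write-other : ∀ τ v a → T (free a P) → ∀ j → (τ [ i , 0 ↦ v ]) a j ≡ τ a j
  write-other τ v a fr j = run-agree (write {i} {lit 0} {lit v} {τ}) a
    (T-∧ˡ {free a (set i (lit 0))} fr) j
  same : ∀ (τ : Store) v → (τ [ i , 0 ↦ v ]) i 0 ≡ v
  same τ v rewrite ≡ᵇ-refl i = refl
  inv₀ : Inv′ S (σ [ i , 0 ↦ 0 ])
  inv₀ = 0 , N , refl , ≤-refl , same σ 0 , write-other σ 0 , init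
  step : ∀ B τ → Inv′ B τ → _
  step B τ (j , zero , eq , le , ti , ag , inv) =
    inj₁ (trans (cong₂ (λ m n → fromBool (m <ᵇ n)) ti (ev τ ag))
        (fromBool-<ᵇ-false (≤-reflexive (trans (sym eq) (+-identityʳ j))))
         , subst (λ m → Inv m τ) (trans (sym (+-identityʳ j)) eq) inv)
  step B τ (j , suc d , eq , le , ti , ag , inv) =
    inj₂ (subst (_≢ 0) (sym (trans (cong₂ (λ m n → fromBool (m <ᵇ n)) ti (ev τ ag))
        (fromBool-<ᵇ-true j<N))) (λ ())
         , X j , sumTo d (λ m → suc (X (suc j + m))) , le′
         , seqE (agreeMap (λ υ ag′ q → writeE (next υ ag′ q)) (body j τ j<N ag ti inv)))
    where
    j<N : j < N
    j<N = subst (j <_) eq (m<m+n j z<s)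
    le′ : suc (X j) + sumTo d (λ m → suc (X (suc j + m))) ≤ B
    le′ = ≤-trans (≤-reflexive (sym (begin
        sumTo (1 + d) (λ m → suc (X (j + m)))  ≡⟨ sumTo-split (λ m → suc (X (j + m))) 1 d ⟩
        suc (X (j + 0)) + 0 + sumTo d (λ m → suc (X (j + (1 + m))))
          ≡⟨ cong₂ _+_ (trans (+-identityʳ _) (cong (suc ∘ X) (+-identityʳ j)))
               (cong (λ (f : ℕ → ℕ) → sumTo d f) refl) ⟩
        suc (X j) + sumTo d (λ m → suc (X (j + (1 + m))))
          ≡⟨ cong (suc (X j) +_) (sumTo-cong d λ m → cong (suc ∘ X) (+-suc j m)) ⟩
        suc (X j) + sumTo d (λ m → suc (X (suc j + m))) ∎))) le
      where
      open ≡-Reasoning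
      sumTo-cong : ∀ d {f g : ℕ → ℕ} → (∀ m → f m ≡ g m) → sumTo d f ≡ sumTo d g
      sumTo-cong zero h = refl
      sumTo-cong (suc d) h = cong₂ _+_ (h d) (sumTo-cong d h)
    next : ∀ υ → Agree b τ υ → (∀ x → Inv (suc j) (υ [ i , 0 ↦ x ])) →
           Inv′ (sumTo d (λ m → suc (X (suc j + m)))) (υ [ i , 0 ↦ υ i 0 + 1 ])
    next υ ag′ q = suc j , d , trans (sym (+-suc j d)) eq , ≤-refl
      , trans (same υ _) (trans (cong (_+ 1) (trans (ag′ i fr 0) ti)) (+-comm j 1))
      , (λ a f m → trans (write-other υ _ a f m)
            (trans (ag′ a (T-∧ˡ {free a b} (T-∧ʳ {free a (set i (lit 0))} f)) m) (ag a f m)))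
      , q _

forE : ∀ {i e b σ k x} N (Inv : ℕ → Store → Set) →
       {T (free i b)} →
       (∀ τ → Agree (for i e b) σ τ → eval e τ ≡ N) →
       Inv 0 (σ [ i , 0 ↦ 0 ]) →
       (∀ j τ → j < N → Agree (for i e b) σ τ → τ i 0 ≡ j → Inv j τ →
          Exec x b τ k (λ υ → ∀ x → Inv (suc j) (υ [ i , 0 ↦ x ]))) →
       Exec (N * suc x) (for i e b) σ (k + (13 + cost e)) (Inv N)
forE {x = x} N Inv {fr} ev init body =
  scale (≤-reflexive (sumTo-const N (suc x))) (forΣ N (λ _ → x) Inv {fr} ev init body)

-- Merging tables

record Cell : Set where
  constructor cell
  field flag size mask hist : ℕ

open Cell

cell-≡ : ∀ {a a′ b b′ c c′ d d′} → a ≡ a′ → b ≡ b′ → c ≡ c′ → d ≡ d′ → cell a b c d ≡ cell a′ b′ c′ d′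
cell-≡ refl refl refl refl = refl

Table : Set
Table = ℕ → Cell

-- The arrays of the program:
--   0–6     input and output
--   10      powers of n + 1
--   11, 12  coded adjacency lists, powers of their base
--   13      marks of the vertices found by the search
--   14, 15  vertices in the order of the search, positions in that order
--   16      parents in the search tree
--   17      where the second pointer of a walk that closes a block starts
--   18      marks of the vertices whose block is known
--   19–21   start, length and members of the blocks
--   22–25   s(V), length N = (p + 1)(u + 1) of a table, p (u + 1), u + 1
--   40–43   tables
--   44–46   threshold and its bracket
--   50–53   addresses of the two arguments and of the result of a merge, and
--           the name under which it also finishes clusters (0 for none)
--   54–     scratch
table : Store → Table
table σ j = cell (σ 40 j) (σ 41 j) (σ 42 j) (σ 43 j)

On : Cell → Set
On c = flag c ≢ 0

dir : Problem → ℕ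
dir MinMax = 0
dir MaxMin = 1

AtLeast : Problem → ℕ → ℕ → Set
AtLeast MinMax x y = x ≤ y
AtLeast MaxMin x y = y ≤ x

-- A threshold t stands for the size bound t in MinMax and for the size
-- bound s(V) ∸ t in MaxMin, so that in both problems the least t is sought.
Fits : Problem → ℕ → ℕ → ℕ → Set
Fits MinMax S t z = z ≤ t
Fits MaxMin S t z = S ≤ z + t

select : Problem → Exp → Exp → Exp
select P e e′ = op add (op mul (lit (1 ∸ dir P)) e) (op mul (lit (dir P)) e′)

betterE : Problem → Exp → Exp → Exp
betterE P e e′ = select P (op less e e′) (op less e′ e)

fitsE : Problem → Exp → Exp
fitsE P e = select P (op less e (op add (var 44) (lit 1)))
                     (op less (var 22) (op add e (op add (var 44) (lit 1))))

AtLeast-refl : ∀ P {x} → AtLeast P x x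
AtLeast-refl MinMax = ≤-refl
AtLeast-refl MaxMin = ≤-refl

AtLeast-trans : ∀ P {x y z} → AtLeast P x y → AtLeast P y z → AtLeast P x z
AtLeast-trans MinMax = ≤-trans
AtLeast-trans MaxMin p q = ≤-trans q p

AtLeast-+ : ∀ P {x y x′ y′} → AtLeast P x y → AtLeast P x′ y′ → AtLeast P (x + x′) (y + y′)
AtLeast-+ MinMax = +-mono-≤
AtLeast-+ MaxMin = +-mono-≤

Fits-AtLeast : ∀ P {S t x y} → AtLeast P x y → Fits P S t y → Fits P S t x
Fits-AtLeast MinMax p q = ≤-trans p q
Fits-AtLeast MaxMin {t = t} p q = ≤-trans q (+-monoˡ-≤ t p)

mul≢0 : ∀ m n → m * n ≢ 0 → m ≢ 0 × n ≢ 0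
mul≢0 m n h = (λ { refl → h refl }) , (λ { refl → h (*-zeroʳ m) })

≢0-mul : ∀ m n → m ≢ 0 → n ≢ 0 → m * n ≢ 0
≢0-mul zero n p q = contradiction refl p
≢0-mul (suc m) zero p q = contradiction refl q
≢0-mul (suc m) (suc n) p q ()

choose : Problem → Exp → Exp → Exp
choose MinMax e e′ = e
choose MaxMin e e′ = e′

select-eval : ∀ P e e′ σ → eval (select P e e′) σ ≡ eval (choose P e e′) σ
select-eval MinMax e e′ σ = trans (+-identityʳ _) (+-identityʳ _)
select-eval MaxMin e e′ σ = +-identityʳ _

betterE-true : ∀ P e e′ σ → eval (betterE P e e′) σ ≢ 0 → AtLeast P (eval e σ) (eval e′ σ)
betterE-true P e e′ σ h with P | select-eval P (op less e e′) (op less e′ e) σ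
... | MinMax | eq = <⇒≤ (less≢0 (λ z → h (trans eq z)))
... | MaxMin | eq = <⇒≤ (less≢0 (λ z → h (trans eq z)))

betterE-false : ∀ P e e′ σ → eval (betterE P e e′) σ ≡ 0 → AtLeast P (eval e′ σ) (eval e σ)
betterE-false P e e′ σ h with P | select-eval P (op less e e′) (op less e′ e) σ
... | MinMax | eq = less≡0 (trans (sym eq) h)
... | MaxMin | eq = less≡0 (trans (sym eq) h)

fitsE-true : ∀ P e σ → eval (fitsE P e) σ ≢ 0 → Fits P (σ 22 0) (σ 44 0) (eval e σ)
fitsE-true P e σ h with P | select-eval P (op less e (op add (var 44) (lit 1)))
                     (op less (var 22) (op add e (op add (var 44) (lit 1)))) σ
... | MinMax | eq = s≤s⁻¹ (subst (eval e σ <_) (+-comm (σ 44 0) 1) (less≢0 (λ z → h (trans eq z))))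
... | MaxMin | eq = s≤s⁻¹ (subst (σ 22 0 <_) (trans (cong (eval e σ +_) (+-comm (σ 44 0) 1))
    (+-suc (eval e σ) (σ 44 0))) (less≢0 (λ z → h (trans eq z))))

fitsE-false : ∀ P e σ → eval (fitsE P e) σ ≡ 0 → ¬ Fits P (σ 22 0) (σ 44 0) (eval e σ)
fitsE-false P e σ h f with P | select-eval P (op less e (op add (var 44) (lit 1)))
                     (op less (var 22) (op add e (op add (var 44) (lit 1)))) σ
... | MinMax | eq = <⇒≱ (s≤s f) (subst (_≤ eval e σ) (+-comm (σ 44 0) 1) (less≡0 (trans (sym eq) h)))
... | MaxMin | eq = <⇒≱ (s≤s f) (subst (_≤ σ 22 0) (trans (cong (eval e σ +_) (+-comm (σ 44 0) 1))
    (+-suc (eval e σ) (σ 44 0))) (less≡0 (trans (sym eq) h)))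

-- The candidate is held in cells 57 to 59, its address in cell 60.
put : Problem → Program
put P = cond (op add (op equal (read 40 (var 60)) (lit 0)) (betterE P (var 57) (read 41 (var 60))))
          (write 40 (var 60) (lit 1) ⨟ write 41 (var 60) (var 57) ⨟
           write 42 (var 60) (var 58) ⨟ write 43 (var 60) (var 59))
          skip

record Put (P : Problem) (t : ℕ) (new : Cell) (A B : Table) : Set where
  field
    others : ∀ j → j ≢ t → B j ≡ A j
    on     : On (B t)
    source : B t ≡ new ⊎ B t ≡ A t
    beats  : AtLeast P (size (B t)) (size new)
    keeps  : On (A t) → AtLeast P (size (B t)) (size (A t))

putE : ∀ P τ → Exec 0 (put P) τ 80 (λ υ → Put P (τ 60 0) (cell 1 (τ 57 0) (τ 58 0) (τ 59 0)) (table τ)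
    (table υ))
putE P τ = weaken tt (condE
    (λ h → seqE (writeE (seqE (writeE (seqE (writeE (writeE (new h))))))))
    (λ h → skipE (old h)))
  where
  t = τ 60 0
  new : eval (op add (op equal (read 40 (var 60)) (lit 0)) (betterE P (var 57) (read 41 (var 60)))) τ ≢
      0 → _
  new h = record
    { others = λ j j≢t → cell-≡ (if-other (≢-sym j≢t)) (if-other (≢-sym j≢t)) (if-other (≢-sym j≢t))
      (if-other (≢-sym j≢t))
    ; on = λ z → 1+n≢0 (trans (sym (if-same {t} refl)) z)
    ; source = inj₁ (cell-≡ (if-same {t} refl) (if-same {t} refl) (if-same {t} refl) (if-same {t} refl))
    ; beats = subst (λ z → AtLeast P z (τ 57 0)) (sym (if-same {t} refl)) (AtLeast-refl P)
    ; keeps = λ on → subst (λ z → AtLeast P z (τ 41 t)) (sym (if-same {t} refl))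
        (betterE-true P (var 57) (read 41 (var 60)) τ λ b → h (cong₂ _+_ (e0 on) b))
    }
    where
    e0 : τ 40 t ≢ 0 → fromBool (τ 40 t ≡ᵇ 0) ≡ 0
    e0 on with τ 40 t
    ... | zero = contradiction refl on
    ... | suc _ = refl
  old : eval (op add (op equal (read 40 (var 60)) (lit 0)) (betterE P (var 57) (read 41 (var 60)))) τ ≡
      0 → _
  old h = record
    { others = λ _ _ → refl
    ; on = equal≡0 (m+n≡0⇒m≡0 (fromBool (τ 40 t ≡ᵇ 0)) h)
    ; source = inj₂ refl
    ; beats = betterE-false P (var 57) (read 41 (var 60)) τ (m+n≡0⇒n≡0 (fromBool (τ 40 t ≡ᵇ 0)) h)
    ; keeps = λ _ → AtLeast-refl P
    }

modE : Exp → Exp → Exp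
modE e d = op sub e (op mul (op div e d) d)

modulo : ℕ → ℕ → ℕ
modulo i d = i ∸ applyOp div i d * d

joinBody closeBody mergeBody merge : Problem → Program
closeBody P =
  cond (op mul (var 53) (op mul (op less (read 0 (lit 2)) (op add (var 56) (lit 1)))
      (fitsE P (var 57))))
    (set 59 (op add (var 59) (op mul (var 53) (var 58))) ⨟ set 58 (lit 0) ⨟ set 57 (lit 0) ⨟
     set 60 (op add (var 52) (op add (op sub (op add (var 54) (var 55)) (var 56)) (var 25))) ⨟ put P)
    skip
joinBody P =
  set 57 (op add (read 41 (op add (var 50) (var 54))) (read 41 (op add (var 51) (var 55)))) ⨟
  set 58 (op add (read 42 (op add (var 50) (var 54))) (read 42 (op add (var 51) (var 55)))) ⨟
  set 59 (op add (read 43 (op add (var 50) (var 54))) (read 43 (op add (var 51) (var 55)))) ⨟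
  set 60 (op add (var 52) (op add (var 54) (var 55))) ⨟
  put P ⨟ closeBody P
mergeBody P =
  cond (read 40 (op add (var 50) (var 54))) (cond (read 40 (op add (var 51) (var 55)))
    (set 56 (op add (modE (var 54) (var 25)) (modE (var 55) (var 25))) ⨟
     cond (op mul (op less (var 56) (var 25)) (op less (op add (var 54) (var 55)) (var 24)))
       (joinBody P) skip) skip) skip
merge P = for 54 (var 23) (for 55 (var 23) (mergeBody P))

ix : ℕ → ℕ → ℕ → ℕ
ix u k w = k * suc u + w

divmod-unique : ∀ d q r → r < suc d → (q * suc d + r) / suc d ≡ q
divmod-unique d q r r<d = *-cancelʳ-≡ _ q (suc d) (+-cancelˡ-≡ ((q * suc d + r) % suc d) _ _
    (trans (sym (m≡m%n+[m/n]*n (q * suc d + r) (suc d)))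
    (trans (+-comm (q * suc d) r) (cong (_+ q * suc d) (sym eq)))))
  where
  open import Data.Nat.DivMod using ([m+kn]%n≡m%n; m<n⇒m%n≡m)
  eq : (q * suc d + r) % suc d ≡ r
  eq = trans (cong (_% suc d) (+-comm (q * suc d) r)) (trans ([m+kn]%n≡m%n r q (suc d)) (m<n⇒m%n≡m r<d))

modulo-ix : ∀ d q r → r < suc d → modulo (q * suc d + r) (suc d) ≡ r
modulo-ix d q r r<d rewrite divmod-unique d q r r<d = m+n∸m≡n (q * suc d) r

index-split : ∀ u i → i ≡ ix u (i / suc u) (i % suc u)
index-split u i = trans (m≡m%n+[m/n]*n i (suc u)) (+-comm (i % suc u) _)

CloseStep : Problem → (l S t c e i j d w z m h : ℕ) → Table → Table → Set
CloseStep P l S t c e i j d w z m h A B =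
  ((e ≢ 0 × l ≤ w × Fits P S t z) × Put P (c + (i + j ∸ w + d)) (cell 1 0 0 (h + e * m)) A B) ⊎
  (¬ (e ≢ 0 × l ≤ w × Fits P S t z) × B ≡ A)

closeE : ∀ P τ {l S t c e i j d w z m h} → τ 0 2 ≡ l → τ 22 0 ≡ S → τ 44 0 ≡ t →
         τ 52 0 ≡ c → τ 53 0 ≡ e → τ 54 0 ≡ i → τ 55 0 ≡ j → τ 25 0 ≡ d →
         τ 56 0 ≡ w → τ 57 0 ≡ z → τ 58 0 ≡ m → τ 59 0 ≡ h →
         Exec 0 (closeBody P) τ 200 (λ υ → CloseStep P l S t c e i j d w z m h (table τ) (table υ))
closeE P τ refl refl refl refl refl refl refl refl refl refl refl refl = weaken tt $ condE
    (λ g → seqE $ writeE $ seqE $ writeE $ seqE $ writeE $ seqE $ writeE $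
        mapE (λ υ r → inj₁ (holds g , r)) (putE P _))
    (λ g → skipE (inj₂ (fails g , refl)))
  where
  holds : τ 53 0 * (fromBool (τ 0 2 <ᵇ τ 56 0 + 1) * eval (fitsE P (var 57)) τ) ≢ 0 → _
  holds g = let g₁ , g₂₃ = mul≢0 (τ 53 0) _ g ; g₂ , g₃ = mul≢0 _ (eval (fitsE P (var 57)) τ) g₂₃
    in g₁ , s≤s⁻¹ (subst (τ 0 2 <_) (+-comm _ 1) (less≢0 g₂)) , fitsE-true P (var 57) τ g₃
  fails : τ 53 0 * (fromBool (τ 0 2 <ᵇ τ 56 0 + 1) * eval (fitsE P (var 57)) τ) ≡ 0 → _
  fails g (h₁ , h₂ , h₃) = ≢0-mul _ _ h₁ (≢0-mul _ _
     (λ z → 1+n≢0 (trans (sym (fromBool-<ᵇ-true (subst (τ 0 2 <_) (+-comm 1 _) (s≤s h₂)))) z))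
     (λ z → fitsE-false P (var 57) τ z h₃)) g

JoinStep : Problem → (l S t c e i j d w : ℕ) → (X Y : Cell) → Table → Table → Set
JoinStep P l S t c e i j d w X Y A C =
  let z = size X + size Y
      m = mask X + mask Y
      h = hist X + hist Y
  in ∃[ B ] Put P (c + (i + j)) (cell 1 z m h) A B × CloseStep P l S t c e i j d w z m h B C

joinE : ∀ P τ {l S t a b c e i j d w} → τ 0 2 ≡ l → τ 22 0 ≡ S → τ 44 0 ≡ t →
        τ 50 0 ≡ a → τ 51 0 ≡ b → τ 52 0 ≡ c → τ 53 0 ≡ e → τ 54 0 ≡ i → τ 55 0 ≡ j → τ 25 0 ≡ d →
        τ 56 0 ≡ w → Exec 0 (joinBody P) τ 400 (λ υ → JoinStep P l S t c e i j d w (table τ (a + i))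
            (table τ (b + j)) (table τ) (table υ))
joinE P τ refl refl refl refl refl refl refl refl refl refl refl =
  weaken tt $ seqE $ writeE $ seqE $ writeE $ seqE $ writeE $ seqE $ writeE $ seqE $
  agreeMap
    (λ υ ag r → mapE (λ _ s → table υ , r , s)
       (closeE P υ (ag 0 tt 2) (ag 22 tt 0) (ag 44 tt 0) (ag 52 tt 0) (ag 53 tt 0) (ag 54 tt 0)
           (ag 55 tt 0)
          (ag 25 tt 0) (ag 56 tt 0) (ag 57 tt 0) (ag 58 tt 0) (ag 59 tt 0)))
    (putE P _)

Joinable : (a b i j d q w : ℕ) → Table → Set
Joinable a b i j d q w A = On (A (a + i)) × On (A (b + j)) × w < d × i + j < q

mergeBodyE : ∀ P τ {l S t a b c e i j d q} → τ 0 2 ≡ l → τ 22 0 ≡ S → τ 44 0 ≡ t →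
        τ 50 0 ≡ a → τ 51 0 ≡ b → τ 52 0 ≡ c → τ 53 0 ≡ e → τ 54 0 ≡ i → τ 55 0 ≡ j → τ 25 0 ≡ d →
            τ 24 0 ≡ q →
        let w = modulo i d + modulo j d in
        Exec 0 (mergeBody P) τ 500 (λ υ →
          (Joinable a b i j d q w (table τ) × JoinStep P l S t c e i j d w (table τ (a + i))
              (table τ (b + j)) (table τ) (table υ)) ⊎
          (¬ Joinable a b i j d q w (table τ) × table υ ≡ table τ))
mergeBodyE P τ refl refl refl refl refl refl refl refl refl refl refl = weaken tt $ condE
  (λ f → condE
    (λ g → seqE $ writeE $ condE
      (λ h → let h₁ , h₂ = mul≢0 _ _ h in mapE (λ _ s → inj₁ ((f , g , less≢0 h₁ , less≢0 h₂) , s))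
               (joinE P _ refl refl refl refl refl refl refl refl refl refl refl))
      (λ h → skipE (inj₂ ((λ (_ , _ , x , y) → ≢0-mul _ _ (ne x) (ne y) h) , refl))))
    (λ g → skipE (inj₂ ((λ (_ , x , _) → x g) , refl))))
  (λ f → skipE (inj₂ ((λ (x , _) → x f) , refl)))
  where
  ne : ∀ {m n} → m < n → fromBool (m <ᵇ n) ≢ 0
  ne m<n z = 1+n≢0 (trans (sym (fromBool-<ᵇ-true m<n)) z)

module Tables (P : Problem) (n l u p S t : ℕ) where

  N = suc p * suc u

  Pred5 : Set₁
  Pred5 = (k w z m h : ℕ) → Set

  at : Table → ℕ → ℕ → ℕ → Cell
  at A c k w = A (c + ix u k w)

  Sound : Pred5 → Table → ℕ → Set
  Sound Q A c = ∀ k w → k ≤ p → w ≤ u → On (at A c k w) →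
                Q k w (size (at A c k w)) (mask (at A c k w)) (hist (at A c k w))

  record Dom (A : Table) (c k w z : ℕ) : Set where
    constructor dom
    field
      k≤p   : k ≤ p
      w≤u   : w ≤ u
      on    : On (at A c k w)
      beats : AtLeast P (size (at A c k w)) z

  Dom-≡ : ∀ {A c k k′ w w′ z z′} → k ≡ k′ → w ≡ w′ → z ≡ z′ → Dom A c k w z → Dom A c k′ w′ z′
  Dom-≡ refl refl refl D = D

  ix<N : ∀ {k w} → k ≤ p → w ≤ u → ix u k w < N
  ix<N {k} {w} k≤p w≤u = begin-strict
    k * suc u + w <⟨ +-monoʳ-< (k * suc u) (s≤s w≤u) ⟩
    k * suc u + suc u ≡⟨ +-comm (k * suc u) (suc u) ⟩
    suc k * suc u ≤⟨ *-monoˡ-≤ (suc u) (s≤s k≤p) ⟩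
    N ∎
    where open ≤-Reasoning

  ix-injective : ∀ k {w} k′ {w′} → w ≤ u → w′ ≤ u → ix u k w ≡ ix u k′ w′ → k ≡ k′ × w ≡ w′
  ix-injective k {w} k′ {w′} w≤ w′≤ eq =
    trans (sym (divmod-unique u k w (s≤s w≤)))
        (trans (cong (_/ suc u) eq) (divmod-unique u k′ w′ (s≤s w′≤))) ,
    trans (sym (modulo-ix u k w (s≤s w≤))) (trans (cong (λ i → modulo i (suc u)) eq)
        (modulo-ix u k′ w′ (s≤s w′≤)))

  ix-/ : ∀ {i} → i < N → i / suc u ≤ p
  ix-/ {i} i<N = ≮⇒≥ λ p< → <⇒≱ i<N (≤-trans (*-monoˡ-≤ (suc u) p<)
    (≤-trans (m≤m+n _ (i % suc u)) (≤-reflexive (sym (index-split u i)))))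

  ix-% : ∀ i → i % suc u ≤ u
  ix-% i = s≤s⁻¹ (m%n<n i (suc u))

  record Acc (c : ℕ) (Q : Pred5) (A B : Table) : Set where
    field
      others : ∀ j → (∀ i → i < N → j ≢ c + i) → B j ≡ A j
      sound  : Sound Q A c → Sound Q B c
      keeps  : ∀ {k w z} → Dom A c k w z → Dom B c k w z

  Acc-refl : ∀ {c Q A} → Acc c Q A A
  Acc-refl = record { others = λ _ _ → refl ; sound = id ; keeps = id }

  Acc-trans : ∀ {c Q A B C} → Acc c Q A B → Acc c Q B C → Acc c Q A C
  Acc-trans p q = record
    { others = λ j h → trans (Acc.others q j h) (Acc.others p j h)
    ; sound = Acc.sound q ∘ Acc.sound p
    ; keeps = Acc.keeps q ∘ Acc.keeps p }

  put-Acc : ∀ {c Q A B k w z m h} → k ≤ p → w ≤ u → Q k w z m h →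
            Put P (c + ix u k w) (cell 1 z m h) A B → Acc c Q A B × Dom B c k w z
  put-Acc {c} {Q} {A} {B} {k} {w} {z} {m} {h} k≤p w≤u q r = record
    { others = λ j f → R.others j (f (ix u k w) (ix<N k≤p w≤u))
    ; sound = snd
    ; keeps = kps } , dom k≤p w≤u R.on R.beats
    where
    module R = Put r
    snd : Sound Q A c → Sound Q B c
    snd s k′ w′ k′≤ w′≤ on with c + ix u k′ w′ ≟ℕ c + ix u k w
    ... | no ne rewrite R.others (c + ix u k′ w′) ne = s k′ w′ k′≤ w′≤ on
    ... | yes eq with ix-injective k′ k w′≤ w≤u (+-cancelˡ-≡ c _ _ eq)
    ... | refl , refl with R.source
    ... | inj₁ e rewrite e = q
    ... | inj₂ e rewrite e = s k′ w′ k′≤ w′≤ on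
    kps : ∀ {k w z} → Dom A c k w z → Dom B c k w z
    kps {k′} {w′} {z′} (dom k′≤ w′≤ on b) with c + ix u k′ w′ ≟ℕ c + ix u k w
    ... | no ne = dom k′≤ w′≤ (subst On (sym (R.others _ ne)) on)
        (subst (λ x → AtLeast P (size x) z′) (sym (R.others _ ne)) b)
    ... | yes eq = dom k′≤ w′≤ (subst (On ∘ B) (sym eq) R.on)
           (AtLeast-trans P (subst (λ x → AtLeast P (size (B x)) (size (A x))) (sym eq)
               (R.keeps (subst (On ∘ A) eq on))) b)

  record Params (σ : Store) : Set where
    field
      at-n : σ 0 0 ≡ n
      at-l : σ 0 2 ≡ l
      at-S : σ 22 0 ≡ S
      at-N : σ 23 0 ≡ N
      at-q : σ 24 0 ≡ p * suc u
      at-d : σ 25 0 ≡ suc u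
      at-t : σ 44 0 ≡ t

  Params-agree : ∀ {c σ τ} → {T (free 0 c)} → {T (free 22 c)} → {T (free 23 c)} → {T (free 24 c)} →
      {T (free 25 c)} →
                 {T (free 44 c)} → Agree c σ τ → Params σ → Params τ
  Params-agree {_} {_} {_} {f0} {f22} {f23} {f24} {f25} {f44} ag ps = record
    { at-n = trans (ag 0 f0 0) at-n ; at-l = trans (ag 0 f0 2) at-l ; at-S = trans (ag 22 f22 0) at-S
    ; at-N = trans (ag 23 f23 0) at-N ; at-q = trans (ag 24 f24 0) at-q ; at-d =
      trans (ag 25 f25 0) at-d
    ; at-t = trans (ag 44 f44 0) at-t }
    where open Params ps

  Apart : ℕ → ℕ → Set
  Apart a c = ∀ i j → i < N → j < N → a + i ≢ c + j

  Combines : Pred5 → ℕ → (k w z m h : ℕ) → Set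
  Combines Q e k w z m h =
    Q k w z m h × (e ≢ 0 → l ≤ w → Fits P S t z → Q (suc k) 0 0 0 (h + e * m))

  Yields : Table → (c e k w z : ℕ) → Set
  Yields B c e k w z = Dom B c k w z × (e ≢ 0 → l ≤ w → Fits P S t z → Dom B c (suc k) 0 0)

  private
    modulo-% : ∀ i → modulo i (suc u) ≡ i % suc u
    modulo-% i = trans (cong (λ x → modulo x (suc u)) (index-split u i))
      (modulo-ix u (i / suc u) (i % suc u) (s≤s (ix-% i)))

    index-+ : ∀ i j → i + j ≡ ix u (i / suc u + j / suc u) (i % suc u + j % suc u)
    index-+ i j = trans (cong₂ _+_ (index-split u i) (index-split u j))
      (lem (i / suc u) (suc u) (i % suc u) (j / suc u) (j % suc u))
      where
      lem : ∀ a d b a′ b′ → a * d + b + (a′ * d + b′) ≡ (a + a′) * d + (b + b′)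
      lem = solve-∀

    Pair : Table → (a b c e i j : ℕ) → Table → Set
    Pair A a b c e i j B =
      let k = i / suc u + j / suc u ; w = i % suc u + j % suc u in
      On (A (a + i)) → On (A (b + j)) → w ≤ u → k < p →
      Yields B c e k w (size (A (a + i)) + size (A (b + j)))

  bodyE : ∀ {Q A a b c e} → Apart a c → Apart b c → ∀ {i j} → i < N → j < N →
      (let k = i / suc u + j / suc u ; w = i % suc u + j % suc u in
       On (A (a + i)) → On (A (b + j)) → w ≤ u → k < p →
       Combines Q e k w (size (A (a + i)) + size (A (b + j))) (mask (A (a + i)) + mask (A (b + j)))
                        (hist (A (a + i)) + hist (A (b + j)))) →
      ∀ {τ} → Params τ → τ 50 0 ≡ a → τ 51 0 ≡ b → τ 52 0 ≡ c → τ 53 0 ≡ e → τ 54 0 ≡ i → τ 55 0 ≡ j →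
      Acc c Q A (table τ) →
      Exec 0 (mergeBody P) τ 500 (λ υ → Acc c Q (table τ) (table υ) × Pair A a b c e i j (table υ))
  bodyE {Q} {A} {a} {b} {c} {e} apA apB {i} {j} i<N j<N comb {τ} ps pa pb pc pe pi pj acc =
    mapE (λ υ → [ joined υ , idle υ ]′)
      (mergeBodyE P τ at-l at-S at-t pa pb pc pe pi pj at-d at-q)
    where
    open Params ps
    k = i / suc u + j / suc u
    w = i % suc u + j % suc u
    weq : modulo i (suc u) + modulo j (suc u) ≡ w
    weq = cong₂ _+_ (modulo-% i) (modulo-% j)
    Aa : table τ (a + i) ≡ A (a + i)
    Aa = Acc.others acc _ (λ x x<N → apA i x i<N x<N)
    Ab : table τ (b + j) ≡ A (b + j)
    Ab = Acc.others acc _ (λ x x<N → apB j x j<N x<N)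
    k<p⇒ : k < p → w ≤ u → i + j < p * suc u
    k<p⇒ k<p w≤u = subst (_< p * suc u) (sym (index-+ i j)) (≤-trans (+-monoʳ-< (k * suc u) (s≤s w≤u))
      (≤-trans (≤-reflexive (+-comm (k * suc u) (suc u))) (*-monoˡ-≤ (suc u) k<p)))
    ⇒k<p : i + j < p * suc u → k < p
    ⇒k<p h = *-cancelʳ-< (suc u) k p (≤-trans
      (s≤s (≤-trans (m≤m+n _ w) (≤-reflexive (sym (index-+ i j))))) h)
    idle : ∀ υ → ¬ Joinable a b i j (suc u) (p * suc u) (modulo i (suc u) + modulo j (suc u))
        (table τ) × table υ ≡ table τ → _
    idle υ (nj , eq) = subst (Acc c Q (table τ)) (sym eq) Acc-refl , λ onA onB w≤u k<p →
      contradiction (subst On (sym Aa) onA , subst On (sym Ab) onB , s≤s (subst (_≤ u) (sym weq) w≤u) ,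
          k<p⇒ k<p w≤u) nj
    joined : ∀ υ → Joinable a b i j (suc u) (p * suc u) (modulo i (suc u) + modulo j (suc u))
        (table τ) ×
                   JoinStep P l S t c e i j (suc u) (modulo i (suc u) + modulo j (suc u))
                       (table τ (a + i)) (table τ (b + j)) (table τ) (table υ) →
                   Acc c Q (table τ) (table υ) × Pair A a b c e i j (table υ)
    joined υ ((onA , onB , w<d , ij<) , js) = go _ _ _ Aa Ab weq onA onB w<d js
      where
      go : ∀ X Y v → X ≡ A (a + i) → Y ≡ A (b + j) → v ≡ w → On X → On Y → v < suc u →
           JoinStep P l S t c e i j (suc u) v X Y (table τ) (table υ) →
           Acc c Q (table τ) (table υ) × Pair A a b c e i j (table υ)
      go _ _ _ refl refl refl onA onB w<d (B , putB , cl) =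
       let
          k<p = ⇒k<p ij<
          w≤u = s≤s⁻¹ w<d
          cb , cb′ = comb onA onB w≤u k<p
          acc₁ , dom₁ = put-Acc {Q = Q} (<⇒≤ k<p) w≤u cb (subst (λ x → Put P (c + x)
              (cell 1 (size (A (a + i)) + size (A (b + j))) (mask (A (a + i)) + mask (A (b + j)))
                      (hist (A (a + i)) + hist (A (b + j)))) (table τ) B) (index-+ i j) putB)
       in finish cb′ acc₁ dom₁ k<p cl
       where
       closeix : i + j ∸ w + suc u ≡ ix u (suc k) 0
       closeix = trans (cong (λ x → x ∸ w + suc u) (index-+ i j))
         (trans (cong (_+ suc u) (m+n∸n≡m (k * suc u) w))
        (trans (+-comm (k * suc u) (suc u)) (sym (+-identityʳ _))))
       z = size (A (a + i)) + size (A (b + j))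
       finish : ∀ {m h} → (e ≢ 0 → l ≤ w → Fits P S t z → Q (suc k) 0 0 0 (h + e * m)) →
                Acc c Q (table τ) B → Dom B c k w z → k < p →
                CloseStep P l S t c e i j (suc u) w z m h B (table υ) →
                Acc c Q (table τ) (table υ) × Pair A a b c e i j (table υ)
       finish {m} {h} cb′ acc₁ dom₁ k<p (inj₁ ((g₁ , g₂ , g₃) , putC)) =
         let acc₂ , dom₂ = put-Acc {Q = Q} k<p z≤n (cb′ g₁ g₂ g₃)
               (subst (λ x → Put P (c + x) (cell 1 0 0 (h + e * m)) B (table υ)) closeix putC)
         in Acc-trans acc₁ acc₂ , λ _ _ _ _ → Acc.keeps acc₂ dom₁ , λ _ _ _ → dom₂
       finish cb′ acc₁ dom₁ k<p (inj₂ (ng , eq)) =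
         subst (Acc c Q (table τ)) (sym eq) acc₁ , λ _ _ _ _ →
         subst (λ X → Dom X c k w _) (sym eq) dom₁ , λ g₁ g₂ g₃ → contradiction (g₁ , g₂ , g₃) ng

  mergeE : ∀ {σ Q a b c e} → Apart a c → Apart b c →
      (∀ {k w k′ w′} → k ≤ p → w ≤ u → k′ ≤ p → w′ ≤ u →
       let X = at (table σ) a k w ; Y = at (table σ) b k′ w′ in
       On X → On Y → w + w′ ≤ u → k + k′ < p →
       Combines Q e (k + k′) (w + w′) (size X + size Y) (mask X + mask Y) (hist X + hist Y)) →
      Params σ → σ 50 0 ≡ a → σ 51 0 ≡ b → σ 52 0 ≡ c → σ 53 0 ≡ e →
      Exec (N * suc (N * 1)) (merge P) σ 600 (λ τ → Acc c Q (table σ) (table τ) ×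
        (∀ {k w z k′ w′ z′} → Dom (table σ) a k w z → Dom (table σ) b k′ w′ z′ → w + w′ ≤ u →
            k + k′ < p →
         Yields (table τ) c e (k + k′) (w + w′) (z + z′)))
  mergeE {σ} {Q} {a} {b} {c} {e} apA apB comb ps pa pb pc pe =
    mapE finish (weaken tt (forE N Outer {tt} (λ τ ag → trans (ag 23 tt 0) at-N)
      (Acc-refl , λ _ _ ())
      (λ i τ i<N ag ti (acc , done) → mapE (λ υ (acc′ , done′ , row) x → acc′ , extend done′ row)
        (forE N (Inner i) {tt} (λ υ ag′ → trans (ag′ 23 tt 0) (trans (ag 23 tt 0) at-N))
          (acc , (λ i′ j i′<i j<N → done i′ j i′<i j<N) , λ _ ())
          (λ j υ j<N ag′ tj (acc , done , row) → mapE (λ ω (acc′ , pr) x →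
               Acc-trans acc acc′ , (λ i′ j′ i′<i j′<N → keep acc′ (done i′ j′ i′<i j′<N))
               , extendRow (λ j′ j′<j → keep acc′ (row j′ j′<j)) pr)
            (bodyE apA apB i<N j<N (comb′ i<N j<N)
               (Params-agree {for 55 (var 23) (mergeBody P)} ag′ (Params-agree {merge P} ag ps))
               (trans (ag′ 50 tt 0) (trans (ag 50 tt 0) pa))
                   (trans (ag′ 51 tt 0) (trans (ag 51 tt 0) pb))
               (trans (ag′ 52 tt 0) (trans (ag 52 tt 0) pc))
                   (trans (ag′ 53 tt 0) (trans (ag 53 tt 0) pe))
               (trans (ag′ 54 tt 0) ti) tj acc))))))
    where
    open Params ps
    A = table σ
    PairAt : ℕ → ℕ → Table → Set
    PairAt = Pair A a b c e
    keep : ∀ {i j B C} → Acc c Q B C → PairAt i j B → PairAt i j C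
    keep acc pr x y z w = let d , f = pr x y z w in Acc.keeps acc d , λ g₁ g₂ g₃ →
      Acc.keeps acc (f g₁ g₂ g₃)
    Outer : ℕ → Store → Set
    Outer i τ = Acc c Q A (table τ) × (∀ i′ j → i′ < i → j < N → PairAt i′ j (table τ))
    Inner : ℕ → ℕ → Store → Set
    Inner i j τ = Acc c Q A (table τ) × (∀ i′ j → i′ < i → j < N → PairAt i′ j (table τ)) ×
                  (∀ j′ → j′ < j → PairAt i j′ (table τ))
    extendRow : ∀ {i j B} → (∀ j′ → j′ < j → PairAt i j′ B) → PairAt i j B → ∀ j′ → j′ < suc j →
        PairAt i j′ B
    extendRow {i} {j} {B} f pr j′ lt with m≤n⇒m<n∨m≡n (s≤s⁻¹ lt)
    ... | inj₁ lt′ = f j′ lt′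
    ... | inj₂ refl = pr
    extend : ∀ {i B} → (∀ i′ j → i′ < i → j < N → PairAt i′ j B) → (∀ j → j < N → PairAt i j B) →
             ∀ i′ j → i′ < suc i → j < N → PairAt i′ j B
    extend {i} f row i′ j lt with m≤n⇒m<n∨m≡n (s≤s⁻¹ lt)
    ... | inj₁ lt′ = f i′ j lt′
    ... | inj₂ refl = row j
    comb′ : ∀ {i j} → i < N → j < N →
      let k = i / suc u + j / suc u ; w = i % suc u + j % suc u ; X = A (a + i) ; Y = A (b + j) in
      On X → On Y → w ≤ u → k < p →
      Combines Q e k w (size X + size Y) (mask X + mask Y) (hist X + hist Y)
    comb′ {i} {j} i<N j<N = go _ _ (cong (λ x → A (a + x)) (sym (index-split u i)))
                                   (cong (λ x → A (b + x)) (sym (index-split u j)))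
      where
      go : ∀ X Y → at A a (i / suc u) (i % suc u) ≡ X → at A b (j / suc u) (j % suc u) ≡ Y → On X →
          On Y →
           let k = i / suc u + j / suc u ; w = i % suc u + j % suc u in w ≤ u → k < p →
           Combines Q e k w (size X + size Y) (mask X + mask Y) (hist X + hist Y)
      go _ _ refl refl = comb (ix-/ i<N) (ix-% i) (ix-/ j<N) (ix-% j)
    finish : ∀ τ → Outer N τ → _
    finish τ (acc , done) = acc , λ {k} {w} {z} {k′} {w′} {z′} (dom k≤ w≤ on b₁) (dom k′≤ w′≤ on′ b₁′)
      w+≤ k+< →
      let pr = done (ix u k w) (ix u k′ w′) (ix<N k≤ w≤) (ix<N k′≤ w′≤)
      in go (/-ix k w≤) (%-ix k w≤) (/-ix k′ w′≤) (%-ix k′ w′≤) pr on on′ w+≤ k+< (AtLeast-+ P b₁ b₁′)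
      where
      /-ix : ∀ k {w} → w ≤ u → ix u k w / suc u ≡ k
      /-ix k {w} w≤ = divmod-unique u k w (s≤s w≤)
      %-ix : ∀ k {w} → w ≤ u → ix u k w % suc u ≡ w
      %-ix k {w} w≤ = trans (sym (modulo-% (ix u k w))) (modulo-ix u k w (s≤s w≤))
      go : ∀ {i j k w k′ w′ z} → i / suc u ≡ k → i % suc u ≡ w → j / suc u ≡ k′ → j % suc u ≡ w′ →
           PairAt i j (table τ) → On (A (a + i)) → On (A (b + j)) → w + w′ ≤ u → k + k′ < p →
           AtLeast P (size (A (a + i)) + size (A (b + j))) z → Yields (table τ) c e (k + k′) (w + w′) z
      go refl refl refl refl pr on on′ w≤ k< be = let d , f = pr on on′ w≤ k< in
        dom (Dom.k≤p d) (Dom.w≤u d) (Dom.on d) (AtLeast-trans P (Dom.beats d) be) ,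
        λ g₁ g₂ g₃ → f g₁ g₂ (Fits-AtLeast P be g₃)

-- Partial solutions

∑ : ∀ {n} → (Fin n → ℕ) → ℕ
∑ {zero}  f = 0
∑ {suc n} f = f zero + ∑ (f ∘ suc)

∑-cong : ∀ {n} {f g : Fin n → ℕ} → (∀ x → f x ≡ g x) → ∑ f ≡ ∑ g
∑-cong {zero}  h = refl
∑-cong {suc n} h = cong₂ _+_ (h zero) (∑-cong (h ∘ suc))

∑-mono : ∀ {n} {f g : Fin n → ℕ} → (∀ x → f x ≤ g x) → ∑ f ≤ ∑ g
∑-mono {zero}  h = z≤n
∑-mono {suc n} h = +-mono-≤ (h zero) (∑-mono (h ∘ suc))

∑-zero : ∀ {n} {f : Fin n → ℕ} → (∀ x → f x ≡ 0) → ∑ f ≡ 0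
∑-zero {zero}  h = refl
∑-zero {suc n} h = cong₂ _+_ (h zero) (∑-zero (h ∘ suc))

+-interchange : ∀ a b c d → a + b + (c + d) ≡ a + c + (b + d)
+-interchange = solve-∀

∑-+ : ∀ {n} (f g : Fin n → ℕ) → ∑ (λ x → f x + g x) ≡ ∑ f + ∑ g
∑-+ {zero}  f g = refl
∑-+ {suc n} f g rewrite ∑-+ (f ∘ suc) (g ∘ suc) = +-interchange (f zero) (g zero) _ _

δ : ∀ {n} → Fin n → Fin n → ℕ
δ i j = fromBool (does (i Finₚ.≟ j))

δ-refl : ∀ {n} (i : Fin n) → δ i i ≡ 1
δ-refl i with i Finₚ.≟ i
... | yes _ = refl
... | no ne = contradiction refl ne

δ-other : ∀ {n} {i j : Fin n} → i ≢ j → δ i j ≡ 0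
δ-other {i = i} {j} ne with i Finₚ.≟ j
... | yes e = contradiction e ne
... | no _ = refl

δ-suc : ∀ {n} (i j : Fin n) → δ (suc i) (suc j) ≡ δ i j
δ-suc i j with i Finₚ.≟ j
... | yes _ = refl
... | no _ = refl

∑-δ : ∀ {n} (v : Fin n) (f : Fin n → ℕ) → ∑ (λ x → δ x v * f x) ≡ f v
∑-δ {suc n} zero f = trans (cong₂ _+_ (+-identityʳ (f zero))
  (∑-zero {f = λ x → δ (suc x) zero * f (suc x)} λ x → refl)) (+-identityʳ (f zero))
∑-δ {suc n} (suc v) f = trans (∑-cong {f = λ x → δ (suc x) (suc v) * f (suc x)} λ x →
  cong (_* f (suc x)) (δ-suc x v)) (∑-δ v (f ∘ suc))

∑-δ1 : ∀ {n} (v : Fin n) → ∑ (λ x → δ x v) ≡ 1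
∑-δ1 v = trans (∑-cong λ x → sym (*-identityʳ (δ x v))) (∑-δ v (λ _ → 1))

∑-const1 : ∀ n → ∑ {n} (λ _ → 1) ≡ n
∑-const1 zero = refl
∑-const1 (suc n) = cong suc (∑-const1 n)

-- Digits are listed from the least significant one.
enc : ∀ {n} → ℕ → (Fin n → ℕ) → ℕ
enc {zero}  b f = 0
enc {suc n} b f = f zero + b * enc b (f ∘ suc)

enc-cong : ∀ {n} b {f g : Fin n → ℕ} → (∀ x → f x ≡ g x) → enc b f ≡ enc b g
enc-cong {zero}  b h = refl
enc-cong {suc n} b h = cong₂ (λ x y → x + b * y) (h zero) (enc-cong b (h ∘ suc))

enc-zero : ∀ {n} b {f : Fin n → ℕ} → (∀ x → f x ≡ 0) → enc b f ≡ 0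
enc-zero {zero}  b h = refl
enc-zero {suc n} b h rewrite h zero | enc-zero b (h ∘ suc) = *-zeroʳ b

enc-+ : ∀ {n} b (f g : Fin n → ℕ) → enc b (λ x → f x + g x) ≡ enc b f + enc b g
enc-+ {zero}  b f g = refl
enc-+ {suc n} b f g rewrite enc-+ b (f ∘ suc) (g ∘ suc) = lem (f zero) (g zero) b _ _
  where
  lem : ∀ a c b x y → a + c + b * (x + y) ≡ a + b * x + (c + b * y)
  lem = solve-∀

enc-* : ∀ {n} b c (f : Fin n → ℕ) → enc b (λ x → c * f x) ≡ c * enc b f
enc-* {zero}  b c f = sym (*-zeroʳ c)
enc-* {suc n} b c f rewrite enc-* b c (f ∘ suc) = lem c (f zero) b _
  where
  lem : ∀ c a b x → c * a + b * (c * x) ≡ c * (a + b * x)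
  lem = solve-∀

enc-δ : ∀ {n} b (v : Fin n) → enc b (λ x → δ x v) ≡ b ^ toℕ v
enc-δ {suc n} b zero = cong (1 +_) (trans (cong (b *_) (enc-zero {n} b {λ x → δ (suc x) zero} λ x →
  refl)) (*-zeroʳ b))
enc-δ {suc n} b (suc v) = cong (b *_) (trans (enc-cong b λ x → δ-suc x v) (enc-δ b v))

sum-tabulate : ∀ {n} (f : Fin n → ℕ) → sum (tabulate f) ≡ ∑ f
sum-tabulate {zero}  f = refl
sum-tabulate {suc n} f = cong (f zero +_) (sum-tabulate (f ∘ suc))

sum-allFin : ∀ {n} (f : Fin n → ℕ) → sum (map f (allFin n)) ≡ ∑ f
sum-allFin f = trans (cong sum (Data.List.Properties.map-tabulate id f)) (sum-tabulate f)
  where import Data.List.Properties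

sum-filter : ∀ {n k} (c : Fin n → Fin k) i (f : Fin n → ℕ) xs →
             sum (map f (filter (λ v → c v Finₚ.≟ i) xs)) ≡ sum (map (λ v → δ (c v) i * f v) xs)
sum-filter c i f [] = refl
sum-filter c i f (x ∷ xs) with c x Finₚ.≟ i
... | yes _ = cong₂ _+_ (sym (+-identityʳ (f x))) (sum-filter c i f xs)
... | no _  = sum-filter c i f xs

clusterSum-∑ : ∀ I (f : Fin (Instance.n I) → ℕ) c i → Instance.clusterSum I f c i ≡
    ∑ (λ v → δ (c v) i * f v)
clusterSum-∑ I f c i = trans (sum-filter c i f (allFin _))
  (sum-allFin {Instance.n I} (λ v → δ (c v) i * f v))

-- The state of a vertex in a partial solution: not yet reached, in the
-- cluster that may still grow, or in a finished cluster with a given name.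
data Code (n : ℕ) : Set where
  out open′ : Code n
  closed    : Fin n → Code n

closed-injective : ∀ {n} {i j : Fin n} → closed i ≡ closed j → i ≡ j
closed-injective refl = refl

isOpen : ∀ {n} → Code n → ℕ
isOpen open′ = 1
isOpen _     = 0

isClosed : ∀ {n} → Fin n → Code n → ℕ
isClosed i (closed j) = δ j i
isClosed i _          = 0

label : ∀ {n} → Code n → ℕ
label (closed i) = suc (toℕ i)
label _          = 0

_∪_ : ∀ {n} → Code n → Code n → Code n
out ∪ d = d
c   ∪ d = c

Disjoint : ∀ {n} → Code n → Code n → Set
Disjoint c d = c ≡ out ⊎ d ≡ out

∪-additive : ∀ {n} (ι : Code n → ℕ) → ι out ≡ 0 → ∀ {c d} → Disjoint c d → ι (c ∪ d) ≡ ι c + ι d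
∪-additive ι z {d = d} (inj₁ refl) = cong (_+ ι d) (sym z)
∪-additive ι z {out} (inj₂ refl) = trans z (sym (cong₂ _+_ z z))
∪-additive ι z {open′} (inj₂ refl) = sym (trans (cong (ι open′ +_) z) (+-identityʳ _))
∪-additive ι z {closed i} (inj₂ refl) = sym (trans (cong (ι (closed i) +_) z) (+-identityʳ _))

∪-left : ∀ {n} {c d e : Code n} → c ≡ e → e ≢ out → c ∪ d ≡ e
∪-left {c = out}      refl ne = contradiction refl ne
∪-left {c = open′}    refl ne = refl
∪-left {c = closed _} refl ne = refl

∪-right : ∀ {n} {c d e : Code n} → Disjoint c d → d ≡ e → e ≢ out → c ∪ d ≡ e
∪-right (inj₁ refl) refl ne = refl
∪-right (inj₂ refl) refl ne = contradiction refl ne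

∪-split : ∀ {n} {c d e : Code n} → c ∪ d ≡ e → e ≢ out → c ≡ e ⊎ d ≡ e
∪-split {c = out}      refl ne = inj₂ refl
∪-split {c = open′}    refl ne = inj₁ refl
∪-split {c = closed _} refl ne = inj₁ refl

shut : ∀ {n} → Fin n → Code n → Code n
shut r open′ = closed r
shut r c     = c

module Codes (P : Problem) (I : Instance) (t : ℕ) where
  open Instance I
  open Graph graph

  Within : (Fin n → Code n) → Code n → Fin n → Fin n → Set
  Within f c a b = Adj a b × f a ≡ c × f b ≡ c

  record Offer (V : Fin n → Set) (v : Fin n) (k ω z m h : ℕ) (f : Fin n → Code n) : Set where
    field
      inside      : ∀ x → f x ≢ out → V x
      covers      : ∀ x → V x → f x ≢ out
      open-conn   : ∀ x → f x ≡ open′ → f v ≡ open′ × Star (Within f open′) x v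
      closed-conn : ∀ x i → f x ≡ closed i → f i ≡ closed i × Star (Within f (closed i)) x i
      weight      : ∑ (λ x → isOpen (f x) * w x) ≡ ω
      size        : ∑ (λ x → isOpen (f x) * s x) ≡ z
      lower       : ∀ i → f i ≡ closed i → l ≤ ∑ (λ x → isClosed i (f x) * w x)
      upper       : ∀ i → f i ≡ closed i → ∑ (λ x → isClosed i (f x) * w x) ≤ u
      fits        : ∀ i → f i ≡ closed i → Fits P (∑ s) t (∑ (λ x → isClosed i (f x) * s x))
      count       : ∑ (λ i → isClosed i (f i)) ≡ k
      mask        : enc (suc n) (λ x → isOpen (f x)) ≡ m
      hist        : enc (suc n) (λ x → label (f x)) ≡ h
      unfinished  : ∀ x → f x ≡ open′ → k < p

  -- A part of the graph is offered to its parent with the cluster of its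
  -- root v either open or just finished; in raw solutions it is open.
  Offered Raw : (Fin n → Set) → Fin n → (k w z m h : ℕ) → Set
  Offered V v k ω z m h = ∃[ f ] Offer V v k ω z m h f
  Raw V v k ω z m h = ∃[ f ] f v ≡ open′ × Offer V v k ω z m h f

  raw⇒offered : ∀ {V v k ω z m h} → Raw V v k ω z m h → Offered V v k ω z m h
  raw⇒offered (f , _ , o) = f , o

  reindex : ∀ {V V′ v k ω z m h} → (∀ x → V x → V′ x) → (∀ x → V′ x → V x) →
            Raw V v k ω z m h → Raw V′ v k ω z m h
  reindex to from (f , fv , o) = f , fv , record
    { Offer o hiding (inside; covers)
    ; inside = λ x → to x ∘ Offer.inside o x ; covers = λ x → Offer.covers o x ∘ from x }

  offered-nothing : ∀ {V v} → (∀ x → ¬ V x) → Offered V v 0 0 0 0 0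
  offered-nothing none = (λ _ → out) , record
    { inside = λ x ne → contradiction refl ne ; covers = λ x → ⊥-elim ∘ none x ; open-conn = λ _ () ;
      closed-conn = λ _ _ ()
    ; weight = ∑-zero {n} (λ _ → refl) ; size = ∑-zero {n} (λ _ → refl)
    ; lower = λ _ () ; upper = λ _ () ; fits = λ _ ()
    ; count = ∑-zero {n} (λ _ → refl) ; mask = enc-zero {n} _ (λ _ → refl) ; hist =
      enc-zero {n} _ (λ _ → refl)
    ; unfinished = λ _ () }

  raw-single : ∀ v → Raw (_≡ v) v 0 (w v) (s v) (suc n ^ toℕ v) 0
  raw-single v = f , fv , record
    { inside = λ x → inv x ; covers = λ { x refl → subst (_≢ out) (sym fv) λ () }
    ; open-conn = λ x e → fv , subst (λ y → Star (Within f open′) x y)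
      (inv x (subst (_≢ out) (sym e) λ ())) ε
    ; closed-conn = λ x i e → contradiction e (none x i)
    ; weight = trans (∑-cong λ x → cong (_* w x) (fδ x)) (∑-δ v w)
    ; size = trans (∑-cong λ x → cong (_* s x) (fδ x)) (∑-δ v s)
    ; lower = λ i e → contradiction e (none i i) ; upper = λ i e → contradiction e (none i i)
    ; fits = λ i e → contradiction e (none i i)
    ; count = ∑-zero λ i → z i i ; mask = trans (enc-cong (suc n) fδ) (enc-δ (suc n) v)
    ; hist = enc-zero (suc n) zl ; unfinished = λ _ _ → 0<p }
    where
    pick : ∀ {x} → Dec (x ≡ v) → Code n
    pick (yes _) = open′
    pick (no _) = out
    f : Fin n → Code n
    f x = pick (x Finₚ.≟ v)
    fv : f v ≡ open′
    fv with v Finₚ.≟ v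
    ... | yes _ = refl
    ... | no ne = contradiction refl ne
    inv : ∀ x → f x ≢ out → x ≡ v
    inv x ne with x Finₚ.≟ v
    ... | yes e = e
    ... | no _ = contradiction refl ne
    none : ∀ x i → f x ≢ closed i
    none x i with x Finₚ.≟ v
    ... | yes _ = λ ()
    ... | no _ = λ ()
    fδ : ∀ x → isOpen (f x) ≡ δ x v
    fδ x with x Finₚ.≟ v
    ... | yes _ = refl
    ... | no _ = refl
    z : ∀ i x → isClosed i (f x) ≡ 0
    z i x with x Finₚ.≟ v
    ... | yes _ = refl
    ... | no _ = refl
    zl : ∀ x → label (f x) ≡ 0
    zl x with x Finₚ.≟ v
    ... | yes _ = refl
    ... | no _ = refl

  raw-join : ∀ {V V₁ V₂ r v k₁ ω₁ z₁ m₁ h₁ k₂ ω₂ z₂ m₂ h₂} →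
             (∀ x → V₁ x → V₂ x → ⊥) → (∀ x → V₂ x → Adj v r) →
             (∀ x → V₁ x ⊎ V₂ x → V x) → (∀ x → V x → V₁ x ⊎ V₂ x) → k₁ + k₂ < p →
             Raw V₁ r k₁ ω₁ z₁ m₁ h₁ → Offered V₂ v k₂ ω₂ z₂ m₂ h₂ →
             Raw V r (k₁ + k₂) (ω₁ + ω₂) (z₁ + z₂) (m₁ + m₂) (h₁ + h₂)
  raw-join {V} {V₁} {V₂} {r} {v} apart adj to from k<p (f , fr , F) (g , G) = h , hr , record
    { inside = λ x ne → to x (inside′ x ne)
    ; covers = λ x Vx → covers′ x (from x Vx)
    ; open-conn = λ x e → hr , open-conn′ x e
    ; closed-conn = closed-conn′
    ; weight = ∑-open w F.weight G.weight
    ; size = ∑-open s F.size G.size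
    ; lower = λ i e → [ (λ e₁ → subst (l ≤_) (sym (∑-closedˡ w e₁)) (F.lower i e₁)) ,
      (λ e₂ → subst (l ≤_) (sym (∑-closedʳ w e₂)) (G.lower i e₂)) ]′ (split e λ ())
    ; upper = λ i e → [ (λ e₁ → subst (_≤ u) (sym (∑-closedˡ w e₁)) (F.upper i e₁)) ,
      (λ e₂ → subst (_≤ u) (sym (∑-closedʳ w e₂)) (G.upper i e₂)) ]′ (split e λ ())
    ; fits = λ i e → [ (λ e₁ → subst (Fits P (∑ s) t) (sym (∑-closedˡ s e₁)) (F.fits i e₁)) ,
      (λ e₂ → subst (Fits P (∑ s) t) (sym (∑-closedʳ s e₂)) (G.fits i e₂)) ]′ (split e λ ())
    ; count = trans (∑-cong λ i → ∪-additive (isClosed i) refl (dis i))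
      (trans (∑-+ (λ i → isClosed i (f i)) (λ i → isClosed i (g i))) (cong₂ _+_ F.count G.count))
    ; mask = enc-∪ isOpen refl F.mask G.mask
    ; hist = enc-∪ label refl F.hist G.hist
    ; unfinished = λ _ _ → k<p }
    where
    module F = Offer F
    module G = Offer G
    h : Fin n → Code n
    h x = f x ∪ g x
    dis : ∀ x → Disjoint (f x) (g x)
    dis x with f x in eq | g x in eq′
    ... | out | _ = inj₁ refl
    ... | _ | out = inj₂ refl
    ... | open′    | open′    = ⊥-elim (apart x (F.inside x (subst (_≢ out) (sym eq) λ ()))
        (G.inside x (subst (_≢ out) (sym eq′) λ ())))
    ... | open′    | closed _ = ⊥-elim (apart x (F.inside x (subst (_≢ out) (sym eq) λ ()))
        (G.inside x (subst (_≢ out) (sym eq′) λ ())))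
    ... | closed _ | open′    = ⊥-elim (apart x (F.inside x (subst (_≢ out) (sym eq) λ ()))
        (G.inside x (subst (_≢ out) (sym eq′) λ ())))
    ... | closed _ | closed _ = ⊥-elim (apart x (F.inside x (subst (_≢ out) (sym eq) λ ()))
        (G.inside x (subst (_≢ out) (sym eq′) λ ())))
    split : ∀ {x e} → h x ≡ e → e ≢ out → f x ≡ e ⊎ g x ≡ e
    split = ∪-split
    inˡ : ∀ {x e} → e ≢ out → f x ≡ e → h x ≡ e
    inˡ ne eq = ∪-left eq ne
    inʳ : ∀ {x e} → e ≢ out → g x ≡ e → h x ≡ e
    inʳ {x} ne eq = ∪-right (dis x) eq ne
    starˡ : ∀ {e x y} → e ≢ out → Star (Within f e) x y → Star (Within h e) x y
    starˡ ne = Star.map λ (a , b , c) → a , inˡ ne b , inˡ ne c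
    starʳ : ∀ {e x y} → e ≢ out → Star (Within g e) x y → Star (Within h e) x y
    starʳ ne = Star.map λ (a , b , c) → a , inʳ ne b , inʳ ne c
    hr = inˡ (λ ()) fr
    inside′ : ∀ x → h x ≢ out → V₁ x ⊎ V₂ x
    inside′ x ne with f x in eq
    ... | out      = inj₂ (G.inside x ne)
    ... | open′    = inj₁ (F.inside x (subst (_≢ out) (sym eq) λ ()))
    ... | closed _ = inj₁ (F.inside x (subst (_≢ out) (sym eq) λ ()))
    covers′ : ∀ x → V₁ x ⊎ V₂ x → h x ≢ out
    covers′ x (inj₁ V₁x) z = F.covers x V₁x (∪-outˡ z)
      where
      ∪-outˡ : h x ≡ out → f x ≡ out
      ∪-outˡ z with f x
      ... | out = refl
    covers′ x (inj₂ V₂x) z with f x in eq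
    ... | out = G.covers x V₂x z
    open-conn′ : ∀ x → h x ≡ open′ → Star (Within h open′) x r
    open-conn′ x e with split e (λ ())
    ... | inj₁ e₁ = starˡ (λ ()) (proj₂ (F.open-conn x e₁))
    ... | inj₂ e₂ = let gv , st = G.open-conn x e₂ in
      starʳ (λ ()) st ◅◅ ((adj x (G.inside x (subst (_≢ out) (sym e₂) λ ())) , inʳ (λ ()) gv , hr) ◅ ε)
    closed-conn′ : ∀ x i → h x ≡ closed i → h i ≡ closed i × Star (Within h (closed i)) x i
    closed-conn′ x i e with split e (λ ())
    ... | inj₁ e₁ = let a , b = F.closed-conn x i e₁ in inˡ (λ ()) a , starˡ (λ ()) b
    ... | inj₂ e₂ = let a , b = G.closed-conn x i e₂ in inʳ (λ ()) a , starʳ (λ ()) b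
    ∑-∪ : ∀ (ι : Code n → ℕ) (y : Fin n → ℕ) → ι out ≡ 0 → ∑ (λ x → ι (h x) * y x) ≡
        ∑ (λ x → ι (f x) * y x) + ∑ (λ x → ι (g x) * y x)
    ∑-∪ ι y z = trans (∑-cong λ x → trans (cong (_* y x) (∪-additive ι z (dis x)))
      (*-distribʳ-+ (y x) (ι (f x)) (ι (g x))))
                      (∑-+ (λ x → ι (f x) * y x) (λ x → ι (g x) * y x))
    ∑-open : ∀ y {a b} → ∑ (λ x → isOpen (f x) * y x) ≡ a → ∑ (λ x → isOpen (g x) * y x) ≡ b →
        ∑ (λ x → isOpen (h x) * y x) ≡ a + b
    ∑-open y refl refl = ∑-∪ isOpen y refl
    enc-∪ : ∀ (ι : Code n → ℕ) → ι out ≡ 0 → ∀ {a b} → enc (suc n) (ι ∘ f) ≡ a → enc (suc n) (ι ∘ g) ≡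
        b → enc (suc n) (ι ∘ h) ≡ a + b
    enc-∪ ι z refl refl = trans (enc-cong (suc n) λ x → ∪-additive ι z (dis x))
      (enc-+ (suc n) (ι ∘ f) (ι ∘ g))
    noClosed : ∀ {i} (c : Code n) → c ≢ closed i → isClosed i c ≡ 0
    noClosed out ne = refl
    noClosed open′ ne = refl
    noClosed (closed j) ne = δ-other (ne ∘ cong closed)
    clash : ∀ {i c d} → Disjoint c d → c ≡ closed i → d ≡ closed i → ⊥
    clash (inj₁ refl) () _
    clash (inj₂ refl) _ ()
    ∑-closedˡ : ∀ y {i} → f i ≡ closed i → ∑ (λ x → isClosed i (h x) * y x) ≡
        ∑ (λ x → isClosed i (f x) * y x)
    ∑-closedˡ y {i} fi = trans (∑-∪ (isClosed i) y refl) (trans (cong (_ +_) (∑-zero λ x →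
      cong (_* y x) (noClosed (g x) λ gx → clash (dis i) fi (proj₁ (G.closed-conn x i gx)))))
          (+-identityʳ _))
    ∑-closedʳ : ∀ y {i} → g i ≡ closed i → ∑ (λ x → isClosed i (h x) * y x) ≡
        ∑ (λ x → isClosed i (g x) * y x)
    ∑-closedʳ y {i} gi = trans (∑-∪ (isClosed i) y refl) (cong (_+ _) (∑-zero λ x →
      cong (_* y x) (noClosed (f x) λ fx → clash (dis i) (proj₁ (F.closed-conn x i fx)) gi)))

  offered-close : ∀ {V r k ω z m h} → l ≤ ω → ω ≤ u → Fits P (∑ s) t z →
                  Raw V r k ω z m h → Offered V r (suc k) 0 0 0 (h + suc (toℕ r) * m)
  offered-close {V} {r} l≤ ≤u fit (f , fr , F) = h , record
    { inside = λ x ne → F.inside x (ne ∘ cong (shut r))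
    ; covers = λ x Vx z → F.covers x Vx (shut-out (f x) z)
    ; open-conn = λ x e → contradiction e (no-open (f x))
    ; closed-conn = closed-conn′
    ; weight = ∑-zero λ x → cong (_* w x) (open-zero (f x))
    ; size = ∑-zero λ x → cong (_* s x) (open-zero (f x))
    ; lower = λ i e → [ (λ { refl → subst (l ≤_) (sym (trans (∑-new w) F.weight)) l≤ }) ,
      (λ e′ → subst (l ≤_) (sym (∑-old w e′)) (F.lower i e′)) ]′ (cases i e)
    ; upper = λ i e → [ (λ { refl → subst (_≤ u) (sym (trans (∑-new w) F.weight)) ≤u }) ,
      (λ e′ → subst (_≤ u) (sym (∑-old w e′)) (F.upper i e′)) ]′ (cases i e)
    ; fits = λ i e → [ (λ { refl → subst (Fits P (∑ s) t) (sym (trans (∑-new s) F.size)) fit }) ,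
      (λ e′ → subst (Fits P (∑ s) t) (sym (∑-old s e′)) (F.fits i e′)) ]′ (cases i e)
    ; count = trans (∑-cong count′) (trans (∑-+ (λ i → δ i r) (λ i → isClosed i (f i)))
      (cong₂ _+_ (∑-δ1 r) F.count))
    ; mask = enc-zero (suc n) λ x → open-zero (f x)
    ; hist = trans (enc-cong (suc n) λ x → label′ (f x))
      (trans (enc-+ (suc n) (label ∘ f) (λ x → suc (toℕ r) * isOpen (f x)))
        (cong₂ _+_ F.hist (trans (enc-* (suc n) (suc (toℕ r)) (isOpen ∘ f))
            (cong (suc (toℕ r) *_) F.mask))))
    ; unfinished = λ x e → contradiction e (no-open (f x)) }
    where
    module F = Offer F
    h : Fin n → Code n
    h x = shut r (f x)
    shut-out : ∀ (c : Code n) → shut r c ≡ out → c ≡ out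
    shut-out out _ = refl
    no-open : ∀ (c : Code n) → shut r c ≢ open′
    no-open out ()
    no-open open′ ()
    no-open (closed _) ()
    open-zero : ∀ (c : Code n) → isOpen (shut r c) ≡ 0
    open-zero out = refl
    open-zero open′ = refl
    open-zero (closed _) = refl
    label′ : ∀ (c : Code n) → label (shut r c) ≡ label c + suc (toℕ r) * isOpen c
    label′ out = sym (*-zeroʳ (toℕ r))
    label′ open′ = sym (*-identityʳ _)
    label′ (closed i) = sym (trans (cong (suc (toℕ i) +_) (*-zeroʳ (toℕ r))) (+-identityʳ _))
    shut-cases : ∀ (c : Code n) {i} → shut r c ≡ closed i → (c ≡ open′ × i ≡ r) ⊎ c ≡ closed i
    shut-cases open′ refl = inj₁ (refl , refl)
    shut-cases (closed _) refl = inj₂ refl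
    cases : ∀ i → h i ≡ closed i → i ≡ r ⊎ f i ≡ closed i
    cases i e with shut-cases (f i) e
    ... | inj₁ (_ , eq) = inj₁ eq
    ... | inj₂ eq = inj₂ eq
    hr : h r ≡ closed r
    hr = cong (shut r) fr
    closed-conn′ : ∀ x i → h x ≡ closed i → h i ≡ closed i × Star (Within h (closed i)) x i
    closed-conn′ x i e with shut-cases (f x) e
    ... | inj₁ (e′ , refl) = hr , Star.map (λ (a , b , c) → a , cong (shut r) b , cong (shut r) c)
        (proj₂ (F.open-conn x e′))
    ... | inj₂ e′ = let a , b = F.closed-conn x i e′ in
      cong (shut r) a , Star.map (λ (a , b , c) → a , cong (shut r) b , cong (shut r) c) b
    not-r : ∀ x → f x ≢ closed r
    not-r x e = contradiction (trans (sym fr) (proj₁ (F.closed-conn x r e))) λ ()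
    ∑-new : ∀ y → ∑ (λ x → isClosed r (h x) * y x) ≡ ∑ (λ x → isOpen (f x) * y x)
    ∑-new y = ∑-cong λ x → cong (_* y x) (go (f x) (not-r x))
      where
      go : ∀ (c : Code n) → c ≢ closed r → isClosed r (shut r c) ≡ isOpen c
      go out ne = refl
      go open′ ne = δ-refl r
      go (closed j) ne = δ-other (ne ∘ cong closed)
    ∑-old : ∀ y {i} → f i ≡ closed i → ∑ (λ x → isClosed i (h x) * y x) ≡
        ∑ (λ x → isClosed i (f x) * y x)
    ∑-old y {i} fi = ∑-cong λ x → cong (_* y x) (go (f x))
      where
      go : ∀ (c : Code n) → isClosed i (shut r c) ≡ isClosed i c
      go out = refl
      go open′ = δ-other {i = r} {i} λ { refl → not-r i fi }
      go (closed j) = refl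
    count′ : ∀ i → isClosed i (h i) ≡ δ i r + isClosed i (f i)
    count′ i with i Finₚ.≟ r
    ... | yes refl = trans (cong (isClosed r) hr)
        (trans (δ-refl r) (sym (cong suc (cong (isClosed r) fr))))
    ... | no ne = go (f i)
      where
      go : ∀ (c : Code n) → isClosed i (shut r c) ≡ isClosed i c
      go out = refl
      go open′ = δ-other (ne ∘ sym)
      go (closed j) = refl

-- Rooted block decompositions

pairs : ∀ {A : Set} → List A → List (A × A)
pairs []           = []
pairs (x ∷ [])     = []
pairs (x ∷ y ∷ zs) = (x , y) ∷ pairs (y ∷ zs)

Linked : ∀ {A : Set} → A → A → List A → Set
Linked x y zs = (x , y) ∈ pairs zs ⊎ (y , x) ∈ pairs zs

pairs-left : ∀ {A : Set} {x y : A} zs → (x , y) ∈ pairs zs → x ∈ zs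
pairs-left (_ ∷ _ ∷ _)  (here refl) = here refl
pairs-left (_ ∷ y ∷ zs) (there i)   = there (pairs-left (y ∷ zs) i)

pairs-right : ∀ {A : Set} {x y : A} zs → (x , y) ∈ pairs zs → y ∈ zs
pairs-right (_ ∷ _ ∷ _)  (here refl) = there (here refl)
pairs-right (_ ∷ y ∷ zs) (there i)   = there (pairs-right (y ∷ zs) i)

Linked-left : ∀ {A : Set} {x y : A} zs → Linked x y zs → x ∈ zs
Linked-left zs = [ pairs-left zs , pairs-right zs ]′

Linked-sym : ∀ {A : Set} {x y : A} zs → Linked x y zs → Linked y x zs
Linked-sym zs = [ inj₂ , inj₁ ]′

successor : ∀ {A : Set} {a b : A} ps {qs} → a ∉ ps → a ∉ qs → (a , b) ∈ pairs (ps ++ a ∷ qs) →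
    ∃[ qs′ ] qs ≡ b ∷ qs′
successor [] {_ ∷ qs} a∉ps a∉qs (here refl) = qs , refl
successor [] {q ∷ qs} a∉ps a∉qs (there i) = contradiction (pairs-left (q ∷ qs) i) a∉qs
successor (p ∷ []) a∉ps a∉qs (here refl) = contradiction (here refl) a∉ps
successor (p ∷ []) a∉ps a∉qs (there i) = successor [] (λ ()) a∉qs i
successor (p ∷ p′ ∷ ps) a∉ps a∉qs (here refl) = contradiction (here refl) a∉ps
successor (p ∷ p′ ∷ ps) a∉ps a∉qs (there i) = successor (p′ ∷ ps) (a∉ps ∘ there) a∉qs i

predecessor : ∀ {A : Set} {a b : A} ps {qs} → a ∉ ps → a ∉ qs → (b , a) ∈ pairs (ps ++ a ∷ qs) →
    ∃[ ps′ ] ps ≡ ps′ ∷ʳ b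
predecessor [] {_ ∷ qs} a∉ps a∉qs (here refl) = contradiction (here refl) a∉qs
predecessor [] {q ∷ qs} a∉ps a∉qs (there i) = contradiction (pairs-right (q ∷ qs) i) a∉qs
predecessor (p ∷ []) a∉ps a∉qs (here refl) = [] , refl
predecessor (p ∷ []) a∉ps a∉qs (there i) with predecessor [] (λ ()) a∉qs i
... | [] , ()
... | _ ∷ _ , ()
predecessor (p ∷ p′ ∷ ps) a∉ps a∉qs (here refl) = contradiction (there (here refl)) a∉ps
predecessor (p ∷ p′ ∷ ps) a∉ps a∉qs (there i) with predecessor (p′ ∷ ps) (a∉ps ∘ there) a∉qs i
... | ps′ , eq = p ∷ ps′ , cong (p ∷_) eq

∈-++ˡ : ∀ {A : Set} {x : A} {xs ys} → x ∈ xs → x ∈ xs ++ ys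
∈-++ˡ = Data.List.Membership.Propositional.Properties.∈-++⁺ˡ
  where import Data.List.Membership.Propositional.Properties

∈-++ʳ : ∀ {A : Set} {x : A} xs {ys} → x ∈ ys → x ∈ xs ++ ys
∈-++ʳ = Data.List.Membership.Propositional.Properties.∈-++⁺ʳ
  where import Data.List.Membership.Propositional.Properties

∈-++⁻ : ∀ {A : Set} {x : A} xs {ys} → x ∈ xs ++ ys → x ∈ xs ⊎ x ∈ ys
∈-++⁻ = Data.List.Membership.Propositional.Properties.∈-++⁻
  where import Data.List.Membership.Propositional.Properties

∈-∷⁺ : ∀ {A : Set} {x y : A} {ys} → x ∈ y ∷ [] ⊎ x ∈ ys → x ∈ y ∷ ys
∈-∷⁺ (inj₁ (here e)) = here e
∈-∷⁺ (inj₂ i)        = there i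

∈-∷⁻ : ∀ {A : Set} {x y : A} {ys} → x ∈ y ∷ ys → x ∈ y ∷ [] ⊎ x ∈ ys
∈-∷⁻ (here e)  = inj₁ (here e)
∈-∷⁻ (there i) = inj₂ i

∈-split : ∀ {A : Set} {x : A} {xs} → x ∈ xs → ∃[ ps ] ∃[ qs ] xs ≡ ps ++ x ∷ qs
∈-split = Data.List.Membership.Propositional.Properties.∈-∃++
  where import Data.List.Membership.Propositional.Properties

unique-++⁻ : ∀ {A : Set} (xs : List A) {ys} → Unique (xs ++ ys) →
             Unique xs × Unique ys × (∀ {x} → x ∈ xs → x ∉ ys)
unique-++⁻ [] un = [] , un , λ ()
unique-++⁻ (x ∷ xs) (x∉ ∷ un) = let u₁ , u₂ , dis = unique-++⁻ xs un in
  All.tabulate (λ i → All.lookup x∉ (∈-++ˡ i)) ∷ u₁ , u₂ ,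
  λ { (here refl) j → All.lookup x∉ (∈-++ʳ xs j) refl ; (there i) → dis i }

crossing : ∀ {A : Set} {a b : A} (X seg Y : List A) → Unique seg → a ∈ seg → a ∉ X → a ∉ Y → b ∉ seg →
           Linked a b (X ++ seg ++ Y) →
           (∃[ Y′ ] ∃[ s ] Y ≡ b ∷ Y′ × seg ≡ s ∷ʳ a) ⊎ (∃[ X′ ] ∃[ s ] X ≡ X′ ∷ʳ b × seg ≡ a ∷ s)
crossing {a = a} {b} X seg Y un a∈ a∉X a∉Y b∉ lk with ∈-split a∈
... | ps , qs , refl with unique-++⁻ ps un
... | _ , a∉qs ∷ _ , dis = go lk
  where
  a∉ps : a ∉ ps
  a∉ps i = dis i (here refl)
  a∉Xps : a ∉ X ++ ps
  a∉Xps i = [ a∉X , a∉ps ]′ (∈-++⁻ X i)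
  a∉qsY : a ∉ qs ++ Y
  a∉qsY i = [ (λ j → All.lookup a∉qs j refl) , a∉Y ]′ (∈-++⁻ qs i)
  shape : X ++ (ps ++ a ∷ qs) ++ Y ≡ (X ++ ps) ++ a ∷ (qs ++ Y)
  shape = trans (cong (X ++_) (++-assoc ps (a ∷ qs) Y)) (sym (++-assoc X ps (a ∷ qs ++ Y)))
  Exit : Set
  Exit = (∃[ Y′ ] ∃[ s ] Y ≡ b ∷ Y′ × ps ++ a ∷ qs ≡ s ∷ʳ a) ⊎
    (∃[ X′ ] ∃[ s ] X ≡ X′ ∷ʳ b × ps ++ a ∷ qs ≡ a ∷ s)
  go : Linked a b (X ++ (ps ++ a ∷ qs) ++ Y) → Exit
  go (inj₁ i) with successor (X ++ ps) a∉Xps a∉qsY (subst (λ l → (a , b) ∈ pairs l) shape i)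
  ... | Y′ , eq = after qs refl eq
    where
    after : ∀ qs₀ → qs₀ ≡ qs → qs₀ ++ Y ≡ b ∷ Y′ → Exit
    after [] refl eq = inj₁ (Y′ , ps , eq , refl)
    after (q ∷ qs₀) refl refl = contradiction (∈-++ʳ ps (there (here refl))) b∉
  go (inj₂ i) with predecessor (X ++ ps) a∉Xps a∉qsY (subst (λ l → (b , a) ∈ pairs l) shape i)
  ... | X′ , eq = before (initLast ps) eq {refl}
    where
    open import Data.List.Properties using (∷ʳ-injective)
    before : ∀ {ps₀} → InitLast ps₀ → X ++ ps₀ ≡ X′ ∷ʳ b → {ps₀ ≡ ps} → Exit
    before [] eq {refl} = inj₂ (X′ , qs , trans (sym (++-identityʳ X)) eq , refl)
    before (s ∷ʳ′ z) eq {refl} = contradiction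
      (∈-++ˡ (∈-++ʳ s (here (sym (proj₂
          (∷ʳ-injective (X ++ s) X′ (trans (++-assoc X s (z ∷ [])) eq))))))) b∉

module _ {n : ℕ} where
  open import Data.List.Membership.DecPropositional (Finₚ._≟_ {n}) public using (_∈?_)

mem : ∀ {n} → List (Fin n) → Fin n → ℕ
mem L y = fromBool (does (y ∈? L))

mem-yes : ∀ {n} {L : List (Fin n)} {y} → y ∈ L → mem L y ≡ 1
mem-yes {L = L} {y} i with y ∈? L
... | yes _ = refl
... | no ne = contradiction i ne

mem-no : ∀ {n} {L : List (Fin n)} {y} → y ∉ L → mem L y ≡ 0
mem-no {L = L} {y} i with y ∈? L
... | yes p = contradiction p i
... | no _ = refl

mem-split : ∀ {n} {A B C : List (Fin n)} y → (y ∈ A → y ∉ B) → (y ∈ A ⊎ y ∈ B → y ∈ C) →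
    (y ∈ C → y ∈ A ⊎ y ∈ B) →
            mem C y ≡ mem A y + mem B y
mem-split {A = A} {B} {C} y dis to from with y ∈? A | y ∈? B
... | yes a | yes b = contradiction b (dis a)
... | yes a | no b = mem-yes (to (inj₁ a))
... | no a | yes b = mem-yes (to (inj₂ b))
... | no a | no b = mem-no (λ c → [ a , b ]′ (from c))

record Decomposition {n} (G : Graph n) : Set where
  open Graph G
  field
    root : Fin n
    par  : Fin n → Fin n
    num  : Fin n → ℕ
    ord  : ℕ → Fin n
    -- The vertices other than the top of the block (a bridge or a cycle)
    -- of which v is the member visited first; empty for other v.
    blk  : Fin n → List (Fin n)

  cyc : Fin n → List (Fin n)
  cyc v = par v ∷ blk v ++ (par v ∷ [])

  field
    num<n     : ∀ v → num v < n
    num-ord   : ∀ {i} → i < n → num (ord i) ≡ i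
    ord-num   : ∀ v → ord (num v) ≡ v
    num-root  : num root ≡ 0
    par<      : ∀ {v} → v ≢ root → num (par v) < num v
    root∉     : ∀ {v} → root ∉ blk v
    key∈      : ∀ {v x} → x ∈ blk v → v ∈ blk v
    key≤      : ∀ {v x} → x ∈ blk v → num v ≤ num x
    disjoint  : ∀ {v v′ x} → x ∈ blk v → x ∈ blk v′ → v ≡ v′
    unique    : ∀ v → Unique (blk v)
    cover     : ∀ {x} → x ≢ root → ∃[ v ] x ∈ blk v
    adjacent  : ∀ {v} → v ∈ blk v → ∀ {x y} → (x , y) ∈ pairs (cyc v) → Adj x y
    edge-in   : ∀ {x y} → Adj x y → ∃[ v ] v ∈ blk v × Linked x y (cyc v)

module Own {n} {G : Graph n} (D : Decomposition G) where
  open Decomposition D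
  open Graph G

  num-injective : ∀ {x y} → num x ≡ num y → x ≡ y
  num-injective {x} {y} eq = trans (sym (ord-num x)) (trans (cong ord eq) (ord-num y))

  key : ℕ → Fin n
  key j = ord (n ∸ suc j)

  -- The representative of x after the blocks of the last j vertices have
  -- been contracted to their tops.
  own : ℕ → Fin n → Fin n
  own zero    x = x
  own (suc j) x = if does (own j x ∈? blk (key j)) then par (key j) else own j x

  Done : ℕ → Fin n → Set
  Done j v = n ≤ num v + j

  Live : ℕ → Fin n → Set
  Live j y = ∀ v → Done j v → y ∉ blk v

  own-in : ∀ {j x} → own j x ∈ blk (key j) → own (suc j) x ≡ par (key j)
  own-in {j} {x} i with own j x ∈? blk (key j)
  ... | yes _ = refl
  ... | no ne = contradiction i ne

  own-out : ∀ {j x} → own j x ∉ blk (key j) → own (suc j) x ≡ own j x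
  own-out {j} {x} i with own j x ∈? blk (key j)
  ... | yes p = contradiction p i
  ... | no _ = refl

  num-key : ∀ {j} → j < n → num (key j) + suc j ≡ n
  num-key {j} j<n = trans (cong (_+ suc j) (num-ord (∸-monoʳ-< {n} z<s j<n))) (m∸n+n≡m j<n)

  Done-suc : ∀ {j v} → Done j v → Done (suc j) v
  Done-suc {j} {v} d = ≤-trans d (+-monoʳ-≤ (num v) (n≤1+n j))

  Done-key : ∀ {j} → j < n → Done (suc j) (key j)
  Done-key j<n = ≤-reflexive (sym (num-key j<n))

  Done-pred : ∀ {j v} → j < n → Done (suc j) v → v ≡ key j ⊎ Done j v
  Done-pred {j} {v} j<n d with m≤n⇒m<n∨m≡n d
  ... | inj₁ lt = inj₂ (s≤s⁻¹ (≤-trans lt (≤-reflexive (+-suc (num v) j))))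
  ... | inj₂ eq = inj₁ (num-injective (+-cancelʳ-≡ (suc j) _ _ (trans (sym eq) (sym (num-key j<n)))))

  Done-num : ∀ {j v} → j < n → Done (suc j) v → num (key j) ≤ num v
  Done-num {j} j<n d = +-cancelʳ-≤ (suc j) _ _ (≤-trans (≤-reflexive (num-key j<n)) d)

  ¬Done-key : ∀ {j} → j < n → ¬ Done j (key j)
  ¬Done-key {j} j<n d = 1+n≰n (≤-trans (≤-reflexive (trans (sym (+-suc _ j)) (num-key j<n))) d)

  nonroot : ∀ {v x} → x ∈ blk v → x ≢ root
  nonroot i refl = root∉ i

  par-live : ∀ {j} → j < n → key j ≢ root → Live (suc j) (par (key j))
  par-live j<n ne v dv i = <⇒≱ (par< ne) (≤-trans (Done-num j<n dv) (key≤ i))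

  member-live : ∀ {j x} → j < n → x ∈ blk (key j) → Live j x
  member-live j<n i v dv i′ rewrite disjoint i′ i = ¬Done-key j<n dv

  live-pred : ∀ {j y} → Live (suc j) y → Live j y
  live-pred {j} lv v d = lv v (Done-suc {j} {v} d)

  own-live : ∀ {j} → j ≤ n → ∀ {y} → Live j y → own j y ≡ y
  own-live {zero} _ lv = refl
  own-live {suc j} j<n {y} lv = trans
    (own-out (λ i → lv (key j) (Done-key j<n) (subst (_∈ blk (key j)) eq i))) eq
    where eq = own-live (<⇒≤ j<n) (live-pred {j} {y} lv)

  live-own : ∀ {j} → j ≤ n → ∀ x → Live j (own j x)
  live-own {zero} _ x v d i = <⇒≱ (num<n v) (subst (n ≤_) (+-identityʳ _) d)
  live-own {suc j} j<n x with own j x ∈? blk (key j)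
  ... | yes i = par-live j<n (nonroot (key∈ i))
  ... | no ne = λ v d i → [ (λ { refl → ne i }) , (λ d′ → live-own (<⇒≤ j<n) x v d′ i) ]′
      (Done-pred j<n d)

  own-block : ∀ {j} → j ≤ n → ∀ {v x y} → Done j v → v ∈ blk v → x ∈ par v ∷ blk v → y ∈ par v ∷ blk v →
      own j x ≡ own j y
  own-block {zero} _ {v} d _ _ _ = contradiction (subst (n ≤_) (+-identityʳ _) d) (<⇒≱ (num<n v))
  own-block {suc j} j<n {v} {x} {y} d vv i i′ with Done-pred j<n d
  ... | inj₂ d′ = cong (λ z → if does (z ∈? blk (key j)) then par (key j) else z)
      (own-block (<⇒≤ j<n) d′ vv i i′)
  ... | inj₁ refl = trans (go i) (sym (go i′))
    where
    go : ∀ {x} → x ∈ par (key j) ∷ blk (key j) → own (suc j) x ≡ par (key j)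
    go (here refl) = own-live j<n (par-live j<n (nonroot vv))
    go (there i) = own-in (subst (_∈ blk (key j)) (sym (own-live (<⇒≤ j<n) (member-live j<n i))) i)

  in-cyc : ∀ {v x} → x ∈ cyc v → x ∈ par v ∷ blk v
  in-cyc (here refl) = here refl
  in-cyc {v} (there i) with ∈-++⁻ (blk v) i
  ... | inj₁ i′ = there i′
  ... | inj₂ (here refl) = here refl

  live-top : ∀ {j v} → j < n → v ∈ blk v → ¬ Done j v → Live j (par v)
  live-top {j} {v} j<n vv nd v′ d i =
    nd (≤-trans d (+-monoˡ-≤ j (≤-trans (key≤ i) (<⇒≤ (par< (nonroot vv))))))

  boundary : ∀ {j} → j < n → ∀ {L} → (∀ {x} → x ∈ L → x ∈ blk (key j)) → ∀ {a b} → Adj a b →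
             own j a ∈ L → own j b ∉ L → a ∈ L × Linked a b (cyc (key j))
  boundary {j} j<n {L} L⊆ {a} {b} ab a∈ b∉ with edge-in ab
  ... | v , vv , lk with n ≤? num v + j
  ... | yes d = contradiction (subst (_∈ L) (own-block (<⇒≤ j<n) d vv (in-cyc (Linked-left (cyc v) lk))
                   (in-cyc (Linked-left (cyc v) (Linked-sym (cyc v) lk)))) a∈) b∉
  ... | no nd with in-cyc (Linked-left (cyc v) lk)
  ...   | there i with subst (_∈ L) (own-live (<⇒≤ j<n) {a} λ v′ d i′ →
      nd (subst (Done j) (disjoint i′ i) d)) a∈
  ...     | aL rewrite disjoint i (L⊆ aL) = aL , lk
  boundary {j} j<n {L} L⊆ {a} {b} ab a∈ b∉ | v , vv , lk | no nd | here refl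
    with subst (_∈ L) (own-live (<⇒≤ j<n) {a} (live-top j<n vv nd)) a∈
  ...     | aL = contradiction (≤-trans (s≤s (key≤ (L⊆ aL))) (par< (nonroot vv)))
                 (≤⇒≯ (+-cancelʳ-≤ (suc j) _ _ (≤-trans (≤-trans (≤-reflexive (+-suc (num v) j))
                     (≰⇒> nd))
                    (≤-reflexive (sym (num-key j<n))))))

-- Partial solutions cut out of a partition

record Feasible (P : Problem) (I : Instance) (t : ℕ) (d : Instance.Labelling I) : Set where
  open Instance I
  field
    partition : IsBoundedPartition d
    fit       : ∀ i → Fits P (∑ s) t (clusterSum s d i)

hd : ∀ {A : Set} → A → List A → A
hd r []      = r
hd r (y ∷ _) = y

mem-cong : ∀ {n} {L L′ : List (Fin n)} {y y′} → (y ∈ L → y′ ∈ L′) → (y′ ∈ L′ → y ∈ L) → mem L y ≡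
    mem L′ y′
mem-cong {L = L} {y = y} to from with y ∈? L
... | yes i = sym (mem-yes (to i))
... | no i = sym (mem-no (i ∘ from))

∈-ʳ++ : ∀ {A : Set} (xs : List A) {ys x} → x ∈ xs ʳ++ ys → x ∈ xs ⊎ x ∈ ys
∈-ʳ++ [] i = inj₂ i
∈-ʳ++ (z ∷ xs) i with ∈-ʳ++ xs i
... | inj₁ j = inj₁ (there j)
... | inj₂ (here refl) = inj₁ (here refl)
... | inj₂ (there j) = inj₂ j

ʳ++-∈ : ∀ {A : Set} (xs : List A) {ys x} → x ∈ xs ⊎ x ∈ ys → x ∈ xs ʳ++ ys
ʳ++-∈ [] (inj₂ i) = i
ʳ++-∈ (z ∷ xs) (inj₁ (here refl)) = ʳ++-∈ xs (inj₂ (here refl))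
ʳ++-∈ (z ∷ xs) (inj₁ (there i)) = ʳ++-∈ xs (inj₁ i)
ʳ++-∈ (z ∷ xs) (inj₂ i) = ʳ++-∈ xs (inj₂ (there i))

module Optimal (P : Problem) (I : Instance) (t : ℕ) (D : Decomposition (Instance.graph I))
               {d : Instance.Labelling I} (F : Feasible P I t d) where
  open Instance I
  open Graph graph
  open Tables P n l u p (∑ s) t
  open Decomposition D
  open Own D
  open Feasible F
  open IsBoundedPartition partition

  rep : Fin p → Fin n
  rep i = proj₁ (nonempty i)

  d-rep : ∀ i → d (rep i) ≡ i
  d-rep i = proj₂ (nonempty i)

  -- With respect to the cluster ℓ, the blob {x ∣ o x ∈ L} contains kOf
  -- other clusters and the part yOf of ℓ.
  kOf : (Fin n → Fin n) → List (Fin n) → Fin p → ℕ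
  kOf o L ℓ = ∑ (λ i → (1 ∸ δ i ℓ) * mem L (o (rep i)))

  yOf : (Fin n → ℕ) → (Fin n → Fin n) → List (Fin n) → Fin p → ℕ
  yOf y o L ℓ = ∑ (λ x → mem L (o x) * (δ (d x) ℓ * y x))

  DomS : Table → ℕ → (Fin n → Fin n) → List (Fin n) → Fin p → Set
  DomS A c o L ℓ = Dom A c (kOf o L ℓ) (yOf w o L ℓ) (yOf s o L ℓ)

  Sealed : (Fin n → Fin n) → List (Fin n) → Fin p → Set
  Sealed o L ℓ = ∀ x x′ → o x ∈ L → d x ≢ ℓ → d x′ ≡ d x → o x′ ∈ L

  mem≤1 : ∀ {n} (L : List (Fin n)) y → mem L y ≤ 1
  mem≤1 L y with y ∈? L
  ... | yes _ = ≤-refl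
  ... | no _ = z≤n

  kOf-cong : ∀ {o o′ L L′ ℓ} → (∀ x → mem L (o x) ≡ mem L′ (o′ x)) → kOf o L ℓ ≡ kOf o′ L′ ℓ
  kOf-cong {ℓ = ℓ} h = ∑-cong λ i → cong ((1 ∸ δ i ℓ) *_) (h (rep i))

  yOf-cong : ∀ y {o o′ L L′ ℓ} → (∀ x → mem L (o x) ≡ mem L′ (o′ x)) → yOf y o L ℓ ≡ yOf y o′ L′ ℓ
  yOf-cong y {ℓ = ℓ} h = ∑-cong λ x → cong (_* (δ (d x) ℓ * y x)) (h x)

  kOf-split : ∀ {o A B C ℓ} → (∀ z → mem C z ≡ mem A z + mem B z) → kOf o C ℓ ≡ kOf o A ℓ + kOf o B ℓ
  kOf-split {o} {A} {B} {ℓ = ℓ} h = trans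
    (∑-cong λ i → trans (cong ((1 ∸ δ i ℓ) *_) (h (o (rep i))))
        (*-distribˡ-+ (1 ∸ δ i ℓ) (mem A (o (rep i))) (mem B (o (rep i)))))
    (∑-+ (λ i → (1 ∸ δ i ℓ) * mem A (o (rep i))) (λ i → (1 ∸ δ i ℓ) * mem B (o (rep i))))

  yOf-split : ∀ y {o A B C ℓ} → (∀ z → mem C z ≡ mem A z + mem B z) → yOf y o C ℓ ≡
      yOf y o A ℓ + yOf y o B ℓ
  yOf-split y {o} {A} {B} {ℓ = ℓ} h = trans
    (∑-cong λ x → trans (cong (_* (δ (d x) ℓ * y x)) (h (o x)))
        (*-distribʳ-+ (δ (d x) ℓ * y x) (mem A (o x)) (mem B (o x))))
    (∑-+ (λ x → mem A (o x) * (δ (d x) ℓ * y x)) (λ x → mem B (o x) * (δ (d x) ℓ * y x)))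

  kOf-∑ : ∀ {o L ℓ} → suc (kOf o L ℓ) ≤ p
  kOf-∑ {o} {L} {ℓ} = begin
    suc (kOf o L ℓ)                          ≡⟨ cong (_+ kOf o L ℓ) (sym (∑-δ1 ℓ)) ⟩
    ∑ (λ i → δ i ℓ) + kOf o L ℓ              ≡⟨ sym (∑-+ (λ i → δ i ℓ) _) ⟩
    ∑ (λ i → δ i ℓ + (1 ∸ δ i ℓ) * mem L (o (rep i))) ≤⟨ ∑-mono
        (λ i → le (δ i ℓ) (δ≤1 i) (mem≤1 L (o (rep i)))) ⟩
    ∑ {p} (λ _ → 1)                          ≡⟨ ∑-const1 p ⟩
    p ∎
    where
    open ≤-Reasoning
    δ≤1 : ∀ i → δ i ℓ ≤ 1
    δ≤1 i with i Finₚ.≟ ℓ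
    ... | yes _ = ≤-refl
    ... | no _ = z≤n
    le : ∀ a → a ≤ 1 → ∀ {m} → m ≤ 1 → a + (1 ∸ a) * m ≤ 1
    le zero _ {m} m≤ = ≤-trans (≤-reflexive (+-identityʳ m)) m≤
    le (suc zero) (s≤s z≤n) _ = ≤-refl

  yOf≤ : ∀ y {o L ℓ} → yOf y o L ℓ ≤ clusterSum y d ℓ
  yOf≤ y {o} {L} {ℓ} = ≤-trans (∑-mono λ x → ≤-trans (*-monoˡ-≤ _ (mem≤1 L (o x)))
    (≤-reflexive (*-identityˡ _)))
                          (≤-reflexive (sym (clusterSum-∑ I y d ℓ)))

  wOf≤u : ∀ {o L ℓ} → yOf w o L ℓ ≤ u
  wOf≤u {o} {L} {ℓ} = ≤-trans (yOf≤ w {o} {L}) (upper ℓ)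

  yOf-whole : ∀ y {o L ℓ} → (∀ x → d x ≡ ℓ → o x ∈ L) → yOf y o L ℓ ≡ clusterSum y d ℓ
  yOf-whole y {o} {L} {ℓ} whole = trans (∑-cong go) (sym (clusterSum-∑ I y d ℓ))
    where
    go : ∀ x → mem L (o x) * (δ (d x) ℓ * y x) ≡ δ (d x) ℓ * y x
    go x with d x Finₚ.≟ ℓ
    ... | yes e rewrite mem-yes (whole x e) = *-identityˡ _
    ... | no _ = *-zeroʳ (mem L (o x))

  module Leave {o L ℓ ℓ′ y′} (ℓ≢ℓ′ : ℓ ≢ ℓ′) (d′ : d y′ ≡ ℓ′) (y′∉ : o y′ ∉ L)
               (sealed : Sealed o L ℓ) (whole : ∀ x → d x ≡ ℓ → o x ∈ L) where
    absent : ∀ x → o x ∈ L → d x ≢ ℓ′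
    absent x i refl = y′∉ (sealed x y′ i (ℓ≢ℓ′ ∘ sym) d′)

    kOf-leave : kOf o L ℓ′ ≡ suc (kOf o L ℓ)
    kOf-leave = trans (∑-cong go) (trans (∑-+ (λ i → δ i ℓ) (λ i → (1 ∸ δ i ℓ) * mem L (o (rep i))))
      (cong (_+ kOf o L ℓ) (∑-δ1 ℓ)))
      where
      go : ∀ i → (1 ∸ δ i ℓ′) * mem L (o (rep i)) ≡ δ i ℓ + (1 ∸ δ i ℓ) * mem L (o (rep i))
      go i with i Finₚ.≟ ℓ | i Finₚ.≟ ℓ′
      ... | yes e | yes e′ = contradiction (trans (sym e) e′) ℓ≢ℓ′
      ... | yes e | no _ = trans (+-identityʳ _) (mem-yes (whole (rep i) (trans (d-rep i) e)))
      ... | no _ | yes e = sym (trans (+-identityʳ _) (mem-no λ i∈ →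
          absent (rep i) i∈ (trans (d-rep i) e)))
      ... | no _ | no _ = refl

    yOf-leave : ∀ y → yOf y o L ℓ′ ≡ 0
    yOf-leave y = ∑-zero go
      where
      go : ∀ x → mem L (o x) * (δ (d x) ℓ′ * y x) ≡ 0
      go x with o x ∈? L
      ... | yes i rewrite δ-other (absent x i) = refl
      ... | no _ = refl

    sealed-leave : Sealed o L ℓ′
    sealed-leave x x′ i ne eq with d x Finₚ.≟ ℓ
    ... | yes e = whole x′ (trans eq e)
    ... | no ne′ = sealed x x′ i ne′ eq

  sealed-∪ : ∀ {o A B C ℓ} → (∀ {z} → z ∈ A ⊎ z ∈ B → z ∈ C) → (∀ {z} → z ∈ C → z ∈ A ⊎ z ∈ B) →
             Sealed o A ℓ → Sealed o B ℓ → Sealed o C ℓ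
  sealed-∪ to from sA sB x x′ i ne eq with from i
  ... | inj₁ a = to (inj₁ (sA x x′ a ne eq))
  ... | inj₂ b = to (inj₂ (sB x x′ b ne eq))

  merge-step : ∀ {T c e o A B C ℓ} → (∀ z → mem C z ≡ mem A z + mem B z) →
               (yOf w o A ℓ + yOf w o B ℓ ≤ u → kOf o A ℓ + kOf o B ℓ < p →
                Yields T c e (kOf o A ℓ + kOf o B ℓ) (yOf w o A ℓ + yOf w o B ℓ)
                    (yOf s o A ℓ + yOf s o B ℓ)) →
               Yields T c e (kOf o C ℓ) (yOf w o C ℓ) (yOf s o C ℓ)
  merge-step {T} {c} {e} {o} {A} {B} {C} {ℓ} h y =
    subst₂ (λ k (ωz : ℕ × ℕ) → Yields T c e k (proj₁ ωz) (proj₂ ωz)) (sym (kOf-split {o} {A} {B} {C} h))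
      (cong₂ _,_ (sym (yOf-split w {o} {A} {B} {C} h)) (sym (yOf-split s {o} {A} {B} {C} h)))
      (y (subst (_≤ u) (yOf-split w {o} {A} {B} {C} h) (wOf≤u {o} {C} {ℓ}))
         (subst (_< p) (kOf-split {o} {A} {B} {C} h) (kOf-∑ {o} {C} {ℓ})))

  leave-step : ∀ {T c e o L ℓ y′} → e ≢ 0 → o y′ ∉ L → Sealed o L ℓ →
               ℓ ≡ d y′ ⊎ (∀ x → d x ≡ ℓ → o x ∈ L) →
               Yields T c e (kOf o L ℓ) (yOf w o L ℓ) (yOf s o L ℓ) →
               DomS T c o L (d y′) × Sealed o L (d y′)
  leave-step {T} {c} {e} {o} {L} {ℓ} {y′} e≢0 y′∉ sealed alt (y₁ , y₂) with ℓ Finₚ.≟ d y′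
  ... | yes refl = y₁ , sealed
  ... | no ne with alt
  ...   | inj₁ eq = contradiction eq ne
  ...   | inj₂ whole = Dom-≡ (sym kOf-leave) (sym (yOf-leave w)) (sym (yOf-leave s))
            (y₂ e≢0 (subst (l ≤_) (sym (yOf-whole w {o} {L} whole)) (lower ℓ))
                    (subst (Fits P (∑ s) t) (sym (yOf-whole s {o} {L} whole)) (fit ℓ)))
          , sealed-leave
    where open Leave {o} {L} ne refl y′∉ sealed whole

  Steps : (Fin n → Fin n) → Fin n → List (Fin n) → Set
  Steps o r es = ∀ rp c post → es ≡ rp ʳ++ (c ∷ post) →
                 d c ≡ d (hd r post) ⊎ (∀ x → d x ≡ d c → o x ∈ c ∷ rp)

  -- The edge that enters ys is the one to delete; if ys is empty, it is the
  -- edge that closes the cycle, and the whole cycle lies in one cluster.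
  record Split (r : Fin n) (cs : List (Fin n)) : Set where
    field
      xs ys : List (Fin n)
      shape : cs ≡ xs ++ ys
      same  : ∀ {a} → a ∈ xs → d a ≡ d r
      cut   : ∀ {y ys′} → ys ≡ y ∷ ys′ → d y ≢ d r

  split : ∀ r cs → Split r cs
  split r [] = record { xs = [] ; ys = [] ; shape = refl ; same = λ () ; cut = λ () }
  split r (c ∷ cs) with d c Finₚ.≟ d r
  ... | no ne = record { xs = [] ; ys = c ∷ cs ; shape = refl ; same = λ () ; cut = λ { refl → ne } }
  ... | yes e = let open Split (split r cs) in
    record { xs = c ∷ xs ; ys = ys ; shape = cong (c ∷_) shape ; same =
      λ { (here refl) → e ; (there i) → same i } ; cut = cut }

  steps-same : ∀ {o r es} → (∀ {a} → a ∈ es → d a ≡ d r) → Steps o r es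
  steps-same h rp c [] refl = inj₁ (h (ʳ++-∈ rp (inj₂ (here refl))))
  steps-same h rp c (y ∷ post) refl =
    inj₁ (trans (h (ʳ++-∈ rp (inj₂ (here refl)))) (sym (h (ʳ++-∈ rp (inj₂ (there (here refl)))))))

  par∉ : ∀ {v} → par v ∉ blk v
  par∉ i = <⇒≱ (par< (nonroot (key∈ i))) (key≤ i)

  steps-cut : ∀ {j} → j < n → (sp : Split (par (key j)) (blk (key j))) → Steps (own j) (par (key j))
      (Split.ys sp)
  steps-cut {j} j<n sp rp c post eq with d c Finₚ.≟ d (hd (par (key j)) post)
  ... | yes e = inj₁ e
  ... | no ne = inj₂ λ x dx → walk (connected (d c) refl dx) (own-here c (here refl))
    where
    open Split sp
    open import Data.List.Properties using (ʳ++-defn; unfold-reverse; ∷ʳ-injective)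
    r = par (key j)
    L = c ∷ rp
    seg = reverse L
    ys-shape : ys ≡ seg ++ post
    ys-shape = trans eq (ʳ++-defn L)
    toSeg : ∀ {x} → x ∈ L → x ∈ seg
    toSeg i = subst (_ ∈_) (trans (ʳ++-defn L {[]}) (++-identityʳ seg)) (ʳ++-∈ L (inj₁ i))
    fromSeg : ∀ {x} → x ∈ seg → x ∈ L
    fromSeg i with ∈-ʳ++ L {[]} i
    ... | inj₁ k = k
    blk-shape : blk (key j) ≡ xs ++ seg ++ post
    blk-shape = trans shape (cong (xs ++_) ys-shape)
    L⊆ : ∀ {x} → x ∈ L → x ∈ blk (key j)
    L⊆ i = subst (_ ∈_) (sym blk-shape) (∈-++ʳ xs (∈-++ˡ (toSeg i)))
    own-here : ∀ x → x ∈ L → own j x ∈ L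
    own-here x i = subst (_∈ L) (sym (own-live (<⇒≤ j<n) (member-live j<n (L⊆ i)))) i
    cyc-shape : cyc (key j) ≡ (r ∷ xs) ++ seg ++ (post ++ (r ∷ []))
    cyc-shape = cong (r ∷_) (trans (cong (_++ (r ∷ [])) blk-shape)
      (trans (++-assoc xs (seg ++ post) (r ∷ [])) (cong (xs ++_) (++-assoc seg post (r ∷ [])))))
    un : Unique (xs ++ seg ++ post)
    un = subst Unique blk-shape (unique (key j))
    un′ = unique-++⁻ xs un
    un″ = unique-++⁻ seg (proj₁ (proj₂ un′))
    ¬cross : ∀ {a b} → a ∈ L → b ∉ L → Linked a b (cyc (key j)) → d a ≡ d c → d b ≡ d c → ⊥
    ¬cross {a} {b} a∈ b∉ lk da db with crossing (r ∷ xs) seg (post ++ (r ∷ [])) (proj₁ un″) (toSeg a∈)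
        a∉X a∉Y (b∉ ∘ fromSeg) (subst (Linked a b) cyc-shape lk)
      where
      a≢r : a ≢ r
      a≢r refl = par∉ (L⊆ a∈)
      a∉X : a ∉ r ∷ xs
      a∉X (here e) = a≢r e
      a∉X (there i) = proj₂ (proj₂ un′) i (∈-++ˡ (toSeg a∈))
      a∉Y : a ∉ post ++ (r ∷ [])
      a∉Y i with ∈-++⁻ post i
      ... | inj₁ k = proj₂ (proj₂ un″) (toSeg a∈) k
      ... | inj₂ (here e) = a≢r e
    ... | inj₁ (Y′ , s′ , eqY , eqS) = ne (trans (sym db) (cong d (next post eqY)))
      where
      next : ∀ post → post ++ (r ∷ []) ≡ b ∷ Y′ → b ≡ hd r post
      next [] refl = refl
      next (_ ∷ _) refl = refl
    ... | inj₂ (X′ , s′ , eqX , eqS) = cut (trans ys-shape (cong (_++ post) eqS))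
        (trans da (trans (sym db) (labelled b (subst (b ∈_) (sym eqX) (∈-++ʳ X′ (here refl))))))
      where
      labelled : ∀ b → b ∈ r ∷ xs → d b ≡ d r
      labelled b (here refl) = refl
      labelled b (there i) = same i
    walk : ∀ {a x} → Star (λ a b → Adj a b × d a ≡ d c × d b ≡ d c) a x → own j a ∈ L → own j x ∈ L
    walk ε i = i
    walk (_◅_ {j = b} (ab , da , db) st) i with own j b ∈? L
    ... | yes k = walk st k
    ... | no k = let a∈ , lk = boundary j<n L⊆ ab i k in ⊥-elim (¬cross a∈ (k ∘ own-here b) lk da db)

-- Contracting a block

clear : Program
clear = for 54 (var 23) (write 40 (op add (var 52) (var 54)) (lit 0))

slotE : Exp → Exp
slotE e = op mul e (var 23)

-- Slots 0 to n − 1 of the tables belong to the vertices; slot n holds a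
-- partly assembled cycle, slot n + 1 the optimum over its assemblies, slot
-- n + 2 the final result, slot n + 3 the table of the empty graph, and the
-- later slots those of growing paths.
slotR slotAcc slotFin slotX : Exp
slotR = slotE (read 0 (lit 0))
slotAcc = slotE (op add (lit 1) (read 0 (lit 0)))
slotFin = slotE (op add (lit 2) (read 0 (lit 0)))
slotX = op add (lit 3) (read 0 (lit 0))

mergeInto : Problem → (a b c e : Exp) → Program
mergeInto P a b c e = set 50 a ⨟ set 51 b ⨟ set 52 c ⨟ set 53 e ⨟ merge P

freshInto : Problem → (a b c e : Exp) → Program
freshInto P a b c e = set 50 a ⨟ set 51 b ⨟ set 52 c ⨟ set 53 e ⨟ clear ⨟ merge P

chain : Problem → (count element : Exp) → Program
chain P count element = for 61 count (set 62 element ⨟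
  freshInto P (slotE (var 62)) (slotE (op add (var 61) slotX))
      (slotE (op add (lit 1) (op add (var 61) slotX))) (op add (lit 1) (var 62)))

module Slots (P : Problem) (n l u p S t : ℕ) where
  open Tables P n l u p S t public

  slot-apart : ∀ {a c i j} → a ≢ c → i < N → j < N → a * N + i ≢ c * N + j
  slot-apart {a} {c} {i} {j} a≢c i<N j<N eq = a≢c (trans (sym (divmod-unique _ a i i<N))
    (trans (cong (_/ N) eq) (divmod-unique _ c j j<N)))

  Others : ℕ → Table → Table → Set
  Others c A B = ∀ a → a ≢ c → ∀ i → i < N → B (a * N + i) ≡ A (a * N + i)

  SameSlot : ℕ → Table → Table → Set
  SameSlot a A B = ∀ i → i < N → B (a * N + i) ≡ A (a * N + i)

  Sound-same : ∀ {a A B} {Q : Pred5} → SameSlot a A B → Sound Q A (a * N) → Sound Q B (a * N)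
  Sound-same {Q = Q} same snd k w k≤ w≤ on rewrite same (ix u k w) (ix<N k≤ w≤) = snd k w k≤ w≤ on

  Dom-same : ∀ {a A B k w z} → SameSlot a A B → Dom A (a * N) k w z → Dom B (a * N) k w z
  Dom-same {a} {A} {B} {k} {w} {z} same (dom k≤ w≤ on b) =
    dom k≤ w≤ (subst On (sym eq) on) (subst (λ c → AtLeast P (size c) z) (sym eq) b)
    where eq = same (ix u k w) (ix<N k≤ w≤)

  same-params : ∀ {σ τ} → τ 0 ≡ σ 0 → τ 22 ≡ σ 22 → τ 23 ≡ σ 23 → τ 24 ≡ σ 24 → τ 25 ≡ σ 25 → τ 44 ≡
      σ 44 →
                Params σ → Params τ
  same-params e0 e22 e23 e24 e25 e44 ps = record
    { at-n = trans (cong (_$ 0) e0) at-n ; at-l = trans (cong (_$ 2) e0) at-l ; at-S =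
      trans (cong (_$ 0) e22) at-S
    ; at-N = trans (cong (_$ 0) e23) at-N ; at-q = trans (cong (_$ 0) e24) at-q ; at-d =
      trans (cong (_$ 0) e25) at-d
    ; at-t = trans (cong (_$ 0) e44) at-t }
    where open Params ps

  unit : ℕ
  unit = N * suc (N * 1)

  clearE : ∀ {σ c} → σ 23 0 ≡ N → σ 52 0 ≡ c * N →
           Exec unit clear σ 30 (λ τ → Others c (table σ) (table τ) ×
               (∀ i → i < N → ¬ On (table τ (c * N + i))))
  clearE {σ} {c} eN ec = scale (*-monoʳ-≤ N (s≤s z≤n))
    (mapE (λ τ (o , f) → o , λ i i<N on → on (f i i<N))
    (weaken tt (forE N Inv {tt} (λ τ ag → trans (ag 23 tt 0) eN) ((λ _ _ _ _ → refl) , λ _ ())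
      (λ i τ i<N ag ti (o , f) → writeE λ _ →
        (λ a a≢c k k<N → trans (go τ (slot-apart (a≢c ∘ sym) i<N k<N ∘ trans
            (sym (cong₂ _+_ (trans (ag 52 tt 0) ec) ti)))) (o a a≢c k k<N)) ,
        λ k k<si → off τ (cong₂ _+_ (trans (ag 52 tt 0) ec) ti) k (m≤n⇒m<n∨m≡n (s≤s⁻¹ k<si)) f))))
    where
    Inv : ℕ → Store → Set
    Inv i τ = Others c (table σ) (table τ) × (∀ k → k < i → τ 40 (c * N + k) ≡ 0)
    go : ∀ τ {x y} → x ≢ y → cell ((τ [ 40 , x ↦ 0 ]) 40 y) (τ 41 y) (τ 42 y) (τ 43 y) ≡ table τ y
    go τ {x} {y} ne rewrite if-other {x} {y} {0} {τ 40 y} ne = refl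
    off : ∀ τ {i x} → x ≡ c * N + i → ∀ k → k < i ⊎ k ≡ i → (∀ k → k < i → τ 40 (c * N + k) ≡ 0) →
          (τ [ 40 , x ↦ 0 ]) 40 (c * N + k) ≡ 0
    off τ {i} {x} e k lt f with x ≟ℕ c * N + k
    ... | yes eq = if-same {x} eq
    ... | no ne with lt
    ...   | inj₁ k<i = trans (if-other ne) (f k k<i)
    ...   | inj₂ refl = contradiction e ne

  Combine : Pred5 → Table → (a b e : ℕ) → Set
  Combine Q A a b e = ∀ {k w k′ w′} → k ≤ p → w ≤ u → k′ ≤ p → w′ ≤ u →
    let X = at A (a * N) k w ; Y = at A (b * N) k′ w′ in
    On X → On Y → w + w′ ≤ u → k + k′ < p →
    Combines Q e (k + k′) (w + w′) (size X + size Y) (mask X + mask Y) (hist X + hist Y)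

  Complete : (A B : Table) → (a b c e : ℕ) → Set
  Complete A B a b c e = ∀ {k w z k′ w′ z′} → Dom A (a * N) k w z → Dom A (b * N) k′ w′ z′ →
    w + w′ ≤ u → k + k′ < p →
    Yields B (c * N) e (k + k′) (w + w′) (z + z′)

  Acc-others : ∀ {c A B} {Q : Pred5} → Acc (c * N) Q A B → Others c A B
  Acc-others acc a a≢c i i<N = Acc.others acc _ λ j j<N → slot-apart a≢c i<N j<N

  intoE : ∀ {σ a b c e ea eb ec ee} {Q : Pred5} → a ≢ c → b ≢ c → Combine Q (table σ) a b e → Params σ →
          eval ea σ ≡ a * N →
          (let σ₁ = σ [ 50 , 0 ↦ eval ea σ ]) → eval eb σ₁ ≡ b * N →
          (let σ₂ = σ₁ [ 51 , 0 ↦ eval eb σ₁ ]) → eval ec σ₂ ≡ c * N →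
          (let σ₃ = σ₂ [ 52 , 0 ↦ eval ec σ₂ ]) → eval ee σ₃ ≡ e →
          Exec unit (mergeInto P ea eb ec ee) σ (620 + (cost ea + cost eb + cost ec + cost ee)) (λ τ →
            Others c (table σ) (table τ) × (Sound Q (table σ) (c * N) → Sound Q (table τ) (c * N)) ×
            (∀ {k w z} → Dom (table σ) (c * N) k w z → Dom (table τ) (c * N) k w z) ×
            Complete (table σ) (table τ) a b c e)
  intoE {ea = ea} {eb} {ec} {ee} {Q} a≢c b≢c comb ps pa pb pc pe =
    weakenSum (seqE $ writeE $ seqE $ writeE $ seqE $ writeE $ seqE $ writeE $
      mapE (λ τ (acc , cmp) → Acc-others acc , Acc.sound acc , (λ {k} {w} {z} x → Acc.keeps acc x) ,
          λ {k} {w} {z} {k′} {w′} {z′} x y → cmp x y)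
        (mergeE {Q = Q} (λ i j i<N j<N → slot-apart a≢c i<N j<N) (λ i j i<N j<N →
          slot-apart b≢c i<N j<N) comb
           (same-params refl refl refl refl refl refl ps) pa pb pc pe))
    where
    weakenSum : ∀ {c σ R} → Exec unit c σ
        (2 + cost ea + (2 + cost eb + (2 + cost ec + (2 + cost ee + 600)))) R →
                Exec unit c σ (620 + (cost ea + cost eb + cost ec + cost ee)) R
    weakenSum (exec r b q) = exec r (≤-trans b
      (*-monoˡ-≤ (suc unit) (≤-trans (≤-reflexive (lem (cost ea) (cost eb) (cost ec) (cost ee)))
       (+-monoˡ-≤ _ (≤ᵇ⇒≤ 608 620 tt))))) q
      where
      lem : ∀ a b c d → 2 + a + (2 + b + (2 + c + (2 + d + 600))) ≡ 608 + (a + b + c + d)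
      lem = solve-∀

  freshE : ∀ {σ a b c e ea eb ec ee} {Q : Pred5} → a ≢ c → b ≢ c → Combine Q (table σ) a b e →
      Params σ →
          eval ea σ ≡ a * N →
          (let σ₁ = σ [ 50 , 0 ↦ eval ea σ ]) → eval eb σ₁ ≡ b * N →
          (let σ₂ = σ₁ [ 51 , 0 ↦ eval eb σ₁ ]) → eval ec σ₂ ≡ c * N →
          (let σ₃ = σ₂ [ 52 , 0 ↦ eval ec σ₂ ]) → eval ee σ₃ ≡ e →
          Exec unit (freshInto P ea eb ec ee) σ (650 + (cost ea + cost eb + cost ec + cost ee)) (λ τ →
            Others c (table σ) (table τ) × Sound Q (table τ) (c * N) × Complete (table σ) (table τ) a b
                c e)
  freshE {σ} {a} {b} {c} {e} {ea}  {eb} {ec} {ee} {Q} a≢c b≢c comb ps pa pb pc pe =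
    weakenSum (seqE $ writeE $ seqE $ writeE $ seqE $ writeE $ seqE $ writeE $ seqE $
      agreeMap (λ υ ag (oth , off) →
        mapE (λ τ (acc , cmp) →
           (λ a′ ne i i<N → trans (Acc-others acc a′ ne i i<N) (oth a′ ne i i<N)) ,
           Acc.sound acc (λ k w k≤ w≤ on → contradiction on (off (ix u k w) (ix<N k≤ w≤))) ,
           λ {k} {w} {z} {k′} {w′} {z′} x y → cmp (Dom-same {a} (oth a a≢c) x)
               (Dom-same {b} (oth b b≢c) y))
        (mergeE {Q = Q} (λ i j i<N j<N → slot-apart a≢c i<N j<N) (λ i j i<N j<N →
          slot-apart b≢c i<N j<N)
           (transport {table υ} (oth a a≢c) (oth b b≢c))
           (Params-agree {clear} ag (same-params refl refl refl refl refl refl ps))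
           (trans (ag 50 tt 0) pa) (trans (ag 51 tt 0) pb) (trans (ag 52 tt 0) pc)
               (trans (ag 53 tt 0) pe)))
      (clearE {c = c} (Params.at-N ps) pc))
    where
    weakenSum : ∀ {c σ R} → Exec unit c σ
        (2 + cost ea + (2 + cost eb + (2 + cost ec + (2 + cost ee + (30 + 600))))) R →
                Exec unit c σ (650 + (cost ea + cost eb + cost ec + cost ee)) R
    weakenSum (exec r b q) = exec r (≤-trans b
      (*-monoˡ-≤ (suc unit) (≤-trans (≤-reflexive (lem (cost ea) (cost eb) (cost ec) (cost ee)))
       (+-monoˡ-≤ _ (≤ᵇ⇒≤ 638 650 tt))))) q
      where
      lem : ∀ a b c d → 2 + a + (2 + b + (2 + c + (2 + d + (30 + 600)))) ≡ 638 + (a + b + c + d)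
      lem = solve-∀
    transport : ∀ {A} → SameSlot a (table σ) A → SameSlot b (table σ) A → ∀ {k w k′ w′} → k ≤ p →
        w ≤ u → k′ ≤ p → w′ ≤ u →
      On (at A (a * N) k w) → On (at A (b * N) k′ w′) → w + w′ ≤ u → k + k′ < p →
      Combines Q e (k + k′) (w + w′) (size (at A (a * N) k w) + size (at A (b * N) k′ w′))
          (mask (at A (a * N) k w) + mask (at A (b * N) k′ w′))
          (hist (at A (a * N) k w) + hist (at A (b * N) k′ w′))
    transport sa sb {k} {w} {k′} {w′} k≤ w≤ k′≤ w′≤ = go _ _ (sa (ix u k w) (ix<N k≤ w≤))
      (sb (ix u k′ w′) (ix<N k′≤ w′≤))
      where
      go : ∀ X Y → X ≡ at (table σ) (a * N) k w → Y ≡ at (table σ) (b * N) k′ w′ → On X → On Y →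
          w + w′ ≤ u → k + k′ < p →
           Combines Q e (k + k′) (w + w′) (size X + size Y) (mask X + mask Y) (hist X + hist Y)
      go _ _ refl refl = comb k≤ w≤ k′≤ w′≤

unique-ʳ++ : ∀ {A : Set} {xs ys : List A} → Unique xs → Unique ys → (∀ {x} → x ∈ xs → x ∉ ys) →
    Unique (xs ʳ++ ys)
unique-ʳ++ [] uy dis = uy
unique-ʳ++ {xs = x ∷ xs} (x∉ ∷ ux) uy dis = unique-ʳ++ ux
  (All.tabulate (λ i → λ { refl → dis (here refl) i }) ∷ uy)
  λ { i (here refl) → All.lookup x∉ i refl ; i (there k) → dis (there i) k }

pairs-infix : ∀ {A : Set} {x y : A} ps {qs} → (x , y) ∈ pairs (ps ++ x ∷ y ∷ qs)
pairs-infix [] = here refl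
pairs-infix (p ∷ []) = there (here refl)
pairs-infix (p ∷ p′ ∷ ps) = there (pairs-infix (p′ ∷ ps))

++-same-length : ∀ {A : Set} (xs xs′ : List A) {ys ys′} → xs ++ ys ≡ xs′ ++ ys′ → length xs ≡
    length xs′ → xs ≡ xs′ × ys ≡ ys′
++-same-length [] [] eq _ = refl , eq
++-same-length (x ∷ xs) (x′ ∷ xs′) eq len =
  let e , e′ = ++-same-length xs xs′ (proj₂ (∷-injective eq)) (suc-injective len)
  in cong₂ _∷_ (proj₁ (∷-injective eq)) e , e′
  where open import Data.List.Properties using (∷-injective)

nil∉ : ∀ {A : Set} {x : A} → x ∉ []
nil∉ ()

module Chains (P : Problem) (I : Instance) (t : ℕ) (D : Decomposition (Instance.graph I)) where
  open Instance I
  open Graph graph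
  open Slots P n l u p (∑ s) t
  open Codes P I t
  open Decomposition D
  open Own D

  V : ℕ → List (Fin n) → Fin n → Set
  V j L x = own j x ∈ L

  record IdTable (A : Table) : Set where
    field
      only : ∀ k w → k ≤ p → w ≤ u → On (at A ((3 + n) * N) k w) → at A ((3 + n) * N) k w ≡
          cell 1 0 0 0 × k ≡ 0 × w ≡ 0
      some : at A ((3 + n) * N) 0 0 ≡ cell 1 0 0 0

  id-sound : ∀ {A W v} → IdTable A → (∀ x → ¬ W x) → Sound (Offered W v) A ((3 + n) * N)
  id-sound it none k ω k≤ w≤ on with IdTable.only it k ω k≤ w≤ on
  ... | eq , refl , refl rewrite eq = offered-nothing none

  id-dom : ∀ {A} → IdTable A → Dom A ((3 + n) * N) 0 0 0
  id-dom {A} it = dom z≤n z≤n (subst On (sym some) λ ()) (subst (λ c → AtLeast P (size c) 0) (sym some)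
    (AtLeast-refl P))
    where open IdTable it

  DomF : ∀ {d} → Feasible P I t d → Table → ℕ → (Fin n → Fin n) → List (Fin n) → Fin p → Set
  DomF F = Optimal.DomS P I t D F

  SealedF : ∀ {d} → Feasible P I t d → (Fin n → Fin n) → List (Fin n) → Fin p → Set
  SealedF F = Optimal.Sealed P I t D F

  dom-nil : ∀ {d} (F : Feasible P I t d) {A c o ℓ} → Dom A c 0 0 0 → DomF F A c o [] ℓ
  dom-nil F {ℓ = ℓ} = Dom-≡ (sym (∑-zero λ i → *-zeroʳ (1 ∸ δ i ℓ))) (sym (∑-zero {n} λ _ → refl))
    (sym (∑-zero {n} λ _ → refl))

  dom-same : ∀ {d} (F : Feasible P I t d) {A B a o L ℓ} → SameSlot a A B → DomF F A (a * N) o L ℓ →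
      DomF F B (a * N) o L ℓ
  dom-same F {a = a} same dm = Dom-same {a} same dm

  record Tables-at (j : ℕ) (A : Table) (v : Fin n) : Set where
    field
      sound : Sound (Raw (V j (v ∷ [])) v) A (toℕ v * N)
      best  : ∀ {d} (F : Feasible P I t d) → DomF F A (toℕ v * N) (own j) (v ∷ []) (d v) ×
          SealedF F (own j) (v ∷ []) (d v)

  tables-same : ∀ {j A B v} → SameSlot (toℕ v) A B → Tables-at j A v → Tables-at j B v
  tables-same {j} {A} {B} {v} same ta = record
    { sound = Sound-same {toℕ v} {A} {B} {Raw (V j (v ∷ [])) v} same (Tables-at.sound ta)
    ; best = λ {d} F → dom-same F {A} {B} {toℕ v} {own j} {v ∷ []} {d v} same
      (proj₁ (Tables-at.best ta F)) , proj₂ (Tables-at.best ta F) }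

  record Path (j : ℕ) (r : Fin n) (es : List (Fin n)) : Set where
    field
      live   : ∀ {c} → c ∈ es → own j c ≡ c
      live-r : own j r ≡ r
      unique-es : Unique es
      r∉     : r ∉ es
      steps  : ∀ rp c post y → es ≡ (y ∷ rp) ʳ++ (c ∷ post) → Adj y c

    nodup : ∀ rp c post → es ≡ rp ʳ++ (c ∷ post) → c ∉ rp × own j (hd r post) ∉ c ∷ rp
    nodup rp c post eq = c∉ , next post refl
      where
      un = unique-++⁻ (reverse rp) (subst Unique (trans eq (ʳ++-defn rp)) unique-es)
        where open import Data.List.Properties using (ʳ++-defn)
      inR : ∀ {x} → x ∈ rp → x ∈ reverse rp
      inR i = ʳ++-∈ rp (inj₁ i)
      c∉ : c ∉ rp
      c∉ i = proj₂ (proj₂ un) (inR i) (here refl)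
      next : ∀ post′ → post′ ≡ post → own j (hd r post) ∉ c ∷ rp
      next [] refl i = r∉ (subst (r ∈_) (sym eq) (mem-of (subst (_∈ c ∷ rp) live-r i)))
        where
        mem-of : r ∈ c ∷ rp → r ∈ rp ʳ++ (c ∷ [])
        mem-of (here e) = ʳ++-∈ rp (inj₂ (here e))
        mem-of (there k) = ʳ++-∈ rp (inj₁ k)
      next (y ∷ ys) refl i with subst (_∈ c ∷ rp)
          (live (subst (y ∈_) (sym eq) (ʳ++-∈ rp (inj₂ (there (here refl)))))) i
      ... | here e = All.lookup (AllPairs.head (proj₁ (proj₂ un))) (here refl) (sym e)
      ... | there k = proj₂ (proj₂ un) (inR k) (there (here refl))

  Below : Table → Table → Set
  Below A B = ∀ a → a < 4 + n → SameSlot a A B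

  ChainPost : ℕ → Fin n → List (Fin n) → Table → (rp post : List (Fin n)) → Table → Set
  ChainPost j r es A rp post B = Below A B × Sound (Offered (V j rp) (hd root rp)) B
    ((length rp + (3 + n)) * N) ×
    (∀ {d} (F : Feasible P I t d) → Optimal.Steps P I t D F (own j) r es →
      DomF F B ((length rp + (3 + n)) * N) (own j) rp (d (hd r post)) ×
          SealedF F (own j) rp (d (hd r post)))

  chainE : ∀ {σ j r es count element} → Path j r es → IdTable (table σ) →
           (∀ {c} → c ∈ es → Tables-at j (table σ) c) → Params σ →
           (∀ τ → Agree (chain P count element) σ τ → eval count τ ≡ length es) →
           (∀ τ → Agree (chain P count element) σ τ → ∀ rp c post → es ≡ rp ʳ++ (c ∷ post) → τ 61 0 ≡
               length rp → eval element τ ≡ toℕ c) →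
           Exec (length es * suc unit) (chain P count element) σ (800 + (cost count + cost element))
               (λ τ →
             ∃[ rp ] es ≡ rp ʳ++ [] × length rp ≡ length es × ChainPost j r es (table σ) rp []
                 (table τ))
  chainE {σ} {j} {r} {es} {count} {element} path it tabs ps ev fetch =
    cheaper (mapE finish (forE {b = body} (length es) Inv {tt} ev
      ([] , es , refl , refl , (λ _ _ _ _ → refl) , id-sound it (λ _ → nil∉) ,
        λ F st → dom-nil F {table σ} {(3 + n) * N} {own j} (id-dom it) , λ _ _ ())
      step))
    where
    open import Data.List.Properties using (length-ʳ++)
    open Path path
    body = set 62 element ⨟ freshInto P (slotE (var 62)) (slotE (op add (var 61) slotX))
      (slotE (op add (lit 1) (op add (var 61) slotX))) (op add (lit 1) (var 62))
    cheaper : ∀ {x c R} → Exec x c σ (2 + cost element + 681 + (13 + cost count)) R →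
        Exec x c σ (800 + (cost count + cost element)) R
    cheaper {x} (exec rn b q) = exec rn
      (≤-trans b (*-monoˡ-≤ (suc x) (≤-trans (≤-reflexive (lem (cost element) (cost count)))
      (+-monoˡ-≤ (cost count + cost element) (≤ᵇ⇒≤ 696 800 tt))))) q
      where
      lem : ∀ e c → 2 + e + 681 + (13 + c) ≡ 696 + (c + e)
      lem = solve-∀
    Inv : ℕ → Store → Set
    Inv q τ = ∃[ rp ] ∃[ post ] es ≡ rp ʳ++ post × length rp ≡ q × ChainPost j r es (table σ) rp post
      (table τ)
    finish : ∀ τ → Inv (length es) τ → _
    finish τ (rp , [] , eq , len , cp) = rp , eq , len , cp
    finish τ (rp , c ∷ post , eq , len , cp) = contradiction
      (trans (sym (trans (cong length eq) (length-ʳ++ rp))) (trans (sym len) (sym (+-identityʳ _))))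
      (λ e → 1+n≢0 (+-cancelˡ-≡ (length rp) _ _ e))
    step : ∀ q τ → q < length es → Agree (chain P count element) σ τ → τ 61 0 ≡ q → Inv q τ →
           Exec unit body τ (2 + cost element + 681) (λ υ → ∀ x → Inv (suc q) (υ [ 61 , 0 ↦ x ]))
    step q τ q< ag tq (rp , [] , eq , len , _) = contradiction
      (trans (sym len) (sym (trans (cong length eq) (trans (length-ʳ++ rp) (+-identityʳ _))))) (<⇒≢ q<)
    step q τ q< ag tq (rp , c ∷ post , eq , refl , below , snd , best) =
      seqE (writeE (mapE fin
        (freshE {a = toℕ c} {b = length rp + (3 + n)} {c = suc (length rp + (3 + n))} {e = suc (toℕ c)}
          {slotE (var 62)} {slotE (op add (var 61) slotX)}
              {slotE (op add (lit 1) (op add (var 61) slotX))} {op add (lit 1) (var 62)}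
          {Q = Offered (V j (c ∷ rp)) c}
          (<⇒≢ c<) (<⇒≢ ≤-refl) comb (same-params refl refl refl refl refl refl ps′)
          (cong₂ _*_ fe at-N) (cong₂ _*_ slot at-N) (cong₂ _*_ (cong suc slot) at-N) (cong suc fe))))
      where
      ps′ : Params τ
      ps′ = Params-agree {chain P count element} ag ps
      open Params ps′
      c∈ : c ∈ es
      c∈ = subst (c ∈_) (sym eq) (ʳ++-∈ rp (inj₂ (here refl)))
      fe : eval element τ ≡ toℕ c
      fe = fetch τ ag rp c post eq tq
      slot : τ 61 0 + (3 + τ 0 0) ≡ length rp + (3 + n)
      slot = cong₂ (λ x y → x + (3 + y)) tq at-n
      c<4 : toℕ c < 4 + n
      c<4 = ≤-trans (toℕ<n c) (m≤n+m n 4)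
      c< : toℕ c < suc (length rp + (3 + n))
      c< = ≤-trans c<4 (s≤s (m≤n+m (3 + n) (length rp)))
      A = table τ
      tc : Tables-at j A c
      tc = tables-same (below (toℕ c) c<4) (tabs c∈)
      adj : ∀ x → V j rp x → Adj (hd root rp) c
      adj x i = go rp i eq
        where
        go : ∀ rp → own j x ∈ rp → es ≡ rp ʳ++ (c ∷ post) → Adj (hd root rp) c
        go (y ∷ rp) _ e = steps rp c post y e
      nd = nodup rp c post eq
      raw : ∀ {k₁ ω₁ z₁ m₁ h₁ k₂ ω₂ z₂ m₂ h₂} → k₁ + k₂ < p → Raw (V j (c ∷ [])) c k₁ ω₁ z₁ m₁ h₁ →
            Offered (V j rp) (hd root rp) k₂ ω₂ z₂ m₂ h₂ → Raw (V j (c ∷ rp)) c (k₁ + k₂) (ω₁ + ω₂)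
                (z₁ + z₂) (m₁ + m₂) (h₁ + h₂)
      raw = raw-join (λ x → λ { (here e) i → proj₁ nd (subst (_∈ rp) e i) }) adj
              (λ _ → ∈-∷⁺)
              (λ _ → ∈-∷⁻)
      comb : Combine (Offered (V j (c ∷ rp)) c) A (toℕ c) (length rp + (3 + n)) (suc (toℕ c))
      comb k≤ w≤ k′≤ w′≤ onX onY w+≤ k+< =
        let R = raw k+< (Tables-at.sound tc _ _ k≤ w≤ onX) (snd _ _ k′≤ w′≤ onY)
        in raw⇒offered R , λ _ l≤ fit → offered-close l≤ w+≤ fit R
      fin : ∀ υ → Others (suc (length rp + (3 + n))) A (table υ) × Sound (Offered (V j (c ∷ rp)) c)
          (table υ) (suc (length rp + (3 + n)) * N) ×
            Complete A (table υ) (toℕ c) (length rp + (3 + n)) (suc (length rp + (3 + n)))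
                (suc (toℕ c)) →
            ∀ x → Inv (suc (length rp)) (υ [ 61 , 0 ↦ x ])
      fin υ (oth , snd′ , cmp) x = c ∷ rp , post , eq , refl ,
        (λ a a< i i<N → trans (oth a (<⇒≢ (≤-trans a< (s≤s (m≤n+m (3 + n) (length rp))))) i i<N)
            (below a a< i i<N)) ,
        snd′ , λ F st → let open Optimal P I t D F
                            dX , sX = best F st
                            dC , sC = Tables-at.best tc F
                            sCX = sealed-∪ {own j} {c ∷ []} {rp} {c ∷ rp} ∈-∷⁺
                                     ∈-∷⁻ sC sX
                        in leave-step {table υ} {suc (length rp + (3 + n)) * N} {suc (toℕ c)} {own j}
                            {c ∷ rp} (λ ()) (proj₂ nd) sCX (st rp c post eq)
                             (merge-step {table υ} {suc (length rp + (3 + n)) * N} {suc (toℕ c)} {own j}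
                                 {c ∷ []} {rp} {c ∷ rp}
                               (λ z → mem-split {A = c ∷ []} {rp} {c ∷ rp} z
                                 (λ { (here refl) → proj₁ nd }) ∈-∷⁺
                                     ∈-∷⁻)
                               (cmp dC dX))

assemble block : Problem → Program
assemble P =
  chain P (var 65) (read 21 (op sub (op add (var 67) (var 65)) (op add (lit 1) (var 61)))) ⨟
  freshInto P (slotE (var 64)) (slotE (op add (var 65) slotX)) slotR (lit 0) ⨟
  chain P (op sub (var 66) (var 65)) (read 21 (op add (op add (var 67) (var 65)) (var 61))) ⨟
  mergeInto P slotR (slotE (op add (op sub (var 66) (var 65)) slotX)) slotAcc (lit 0)
block P =
  set 64 (read 16 (var 63)) ⨟ set 66 (read 20 (var 63)) ⨟ set 67 (read 19 (var 63)) ⨟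
  set 52 slotAcc ⨟ clear ⨟ for 65 (op add (lit 1) (var 66)) (assemble P) ⨟
  freshInto P slotAcc (slotE slotX) (slotE (var 64)) (lit 0)

reverse-flip : ∀ {A : Set} {xs rp post : List A} → reverse xs ≡ rp ʳ++ post → xs ≡ post ʳ++ rp
reverse-flip {xs = xs} {rp} {post} eq = trans (sym (reverse-involutive xs)) (trans (cong reverse eq)
  (trans (ʳ++-ʳ++ rp) (cong (post ʳ++_) (++-identityʳ rp))))
  where open import Data.List.Properties using (reverse-involutive; ʳ++-ʳ++)

record Stored {n} {G : Graph n} (D : Decomposition G) (σ : Store) : Set where
  open Decomposition D
  field
    at-ord : ∀ {i} → i < n → σ 14 i ≡ toℕ (ord i)
    at-par : ∀ {v} → v ∈ blk v → σ 16 (toℕ v) ≡ toℕ (par v)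
    at-len : ∀ v → σ 20 (toℕ v) ≡ length (blk v)
    at-blk : ∀ v pre c post → blk v ≡ pre ++ c ∷ post → σ 21 (σ 19 (toℕ v) + length pre) ≡ toℕ c

module Blocks (P : Problem) (I : Instance) (t : ℕ) (D : Decomposition (Instance.graph I)) where
  open Instance I
  open Graph graph
  open Slots P n l u p (∑ s) t
  open Codes P I t
  open Decomposition D
  open Own D
  open Chains P I t D
  open import Data.List.Properties using (ʳ++-defn; length-reverse; length-ʳ++)

  Adj-sym : ∀ {x y} → Adj x y → Adj y x
  Adj-sym = [ inj₂ , inj₁ ]′

  Kept : ℕ → Set
  Kept a = a < n ⊎ a ≡ 2 + n ⊎ a ≡ 3 + n

  Keep : Table → Table → Set
  Keep A B = ∀ a → Kept a → SameSlot a A B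

  Keep-trans : ∀ {A B C} → Keep A B → Keep B C → Keep A C
  Keep-trans f g a k i i<N = trans (g a k i i<N) (f a k i i<N)

  kept< : ∀ {a} → Kept a → a < 4 + n
  kept< (inj₁ lt) = ≤-trans lt (m≤n+m n 4)
  kept< (inj₂ (inj₁ refl)) = n≤1+n _
  kept< (inj₂ (inj₂ refl)) = ≤-refl

  kept≢n : ∀ {a} → Kept a → a ≢ n
  kept≢n (inj₁ lt) = <⇒≢ lt
  kept≢n (inj₂ (inj₁ refl)) = ≢-sym (<⇒≢ (m<n+m n z<s))
  kept≢n (inj₂ (inj₂ refl)) = ≢-sym (<⇒≢ (m<n+m n z<s))

  kept≢1+n : ∀ {a} → Kept a → a ≢ 1 + n
  kept≢1+n (inj₁ lt) = <⇒≢ (m≤n⇒m≤1+n lt)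
  kept≢1+n (inj₂ (inj₁ refl)) = ≢-sym (<⇒≢ ≤-refl)
  kept≢1+n (inj₂ (inj₂ refl)) = ≢-sym (<⇒≢ (m≤n⇒m≤1+n ≤-refl))

  keep-below : ∀ {A B} → Below A B → Keep A B
  keep-below b a k = b a (kept< k)

  keep-others : ∀ {A B} → Others n A B → Keep A B
  keep-others o a k = o a (kept≢n k)

  keep-others′ : ∀ {A B} → Others (1 + n) A B → Keep A B
  keep-others′ o a k = o a (kept≢1+n k)

  id-same : ∀ {A B} → SameSlot (3 + n) A B → IdTable A → IdTable B
  id-same {A} {B} same it = record
    { only = λ k ω k≤ w≤ → go k ω k≤ w≤ (same (ix u k ω) (ix<N k≤ w≤))
    ; some = trans (same 0 z<s) some }
    where
    open IdTable it
    go : ∀ k ω → k ≤ p → ω ≤ u → ∀ {c} → c ≡ at A ((3 + n) * N) k ω → On c → c ≡ cell 1 0 0 0 × k ≡ 0 ×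
        ω ≡ 0
    go k ω k≤ w≤ refl = only k ω k≤ w≤

  module _ {j} (j<n : j < n) (kk : key j ∈ blk (key j)) where
    private
      v r : Fin n
      v = key j
      r = par v
      cs : List (Fin n)
      cs = blk v

    own-cs : ∀ {c} → c ∈ cs → own j c ≡ c
    own-cs i = own-live (<⇒≤ j<n) (member-live j<n i)

    own-top : own j r ≡ r
    own-top = own-live (<⇒≤ j<n) (live-pred {j} {r} (par-live j<n (nonroot kk)))

    top∉ : r ∉ cs
    top∉ i = <⇒≱ (par< (nonroot kk)) (key≤ i)

    cyc-adj : ∀ ps {x y qs} → cyc v ≡ ps ++ x ∷ y ∷ qs → Adj x y
    cyc-adj ps eq = adjacent kk (subst (λ z → _ ∈ pairs z) (sym eq) (pairs-infix ps))

    module _ {xs ys} (shape : cs ≡ xs ++ ys) where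
      un : Unique xs × Unique ys × (∀ {x} → x ∈ xs → x ∉ ys)
      un = unique-++⁻ xs (subst Unique shape (unique v))

      inˡ : ∀ {c} → c ∈ xs → c ∈ cs
      inˡ i = subst (_ ∈_) (sym shape) (∈-++ˡ i)

      inʳ : ∀ {c} → c ∈ ys → c ∈ cs
      inʳ i = subst (_ ∈_) (sym shape) (∈-++ʳ xs i)

      cyc-shape : cyc v ≡ r ∷ xs ++ ys ++ (r ∷ [])
      cyc-shape = cong (r ∷_) (trans (cong (_++ (r ∷ [])) shape) (++-assoc xs ys (r ∷ [])))

      unrev : ∀ {c} → c ∈ reverse xs → c ∈ xs
      unrev i with ∈-ʳ++ xs {[]} i
      ... | inj₁ k = k

      path₁ : Path j r (reverse xs)
      path₁ = record
        { live = own-cs ∘ inˡ ∘ unrev ; live-r = own-top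
        ; unique-es = unique-ʳ++ (proj₁ un) [] (λ _ → nil∉)
        ; r∉ = top∉ ∘ inˡ ∘ unrev
        ; steps = λ rp c post y eq → Adj-sym (cyc-adj (r ∷ reverse post)
            (trans cyc-shape (cong (r ∷_) (trans
              (cong (_++ (ys ++ (r ∷ []))) (trans (reverse-flip {xs = xs} {rp = y ∷ rp} eq)
              (ʳ++-defn post)))
              (++-assoc (reverse post) (c ∷ y ∷ rp) (ys ++ (r ∷ []))))))) }

      path₂ : Path j r ys
      path₂ = record
        { live = own-cs ∘ inʳ ; live-r = own-top ; unique-es = proj₁ (proj₂ un) ; r∉ = top∉ ∘ inʳ
        ; steps = λ rp c post y eq → cyc-adj (r ∷ xs ++ reverse rp) (trans cyc-shape (cong (r ∷_)
            (trans (cong (λ z → xs ++ z ++ (r ∷ [])) (trans eq (ʳ++-defn rp)))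
            (trans (cong (xs ++_) (++-assoc (reverse rp) (y ∷ c ∷ post) (r ∷ [])))
                (sym (++-assoc xs (reverse rp) _)))))) }

      last₁ : ∀ {rp} → reverse xs ≡ rp ʳ++ [] → ∀ x → V j rp x → Adj (hd root rp) r
      last₁ {rp} eq x i = go rp i (reverse-flip {xs = xs} {rp = rp} eq)
        where
        go : ∀ rp → own j x ∈ rp → xs ≡ rp → Adj (hd root rp) r
        go (y ∷ rp) _ e = Adj-sym (cyc-adj []
          (trans cyc-shape (cong (λ z → r ∷ z ++ ys ++ (r ∷ [])) e)))

      last₂ : ∀ {rp} → ys ≡ rp ʳ++ [] → ∀ x → V j rp x → Adj (hd root rp) r
      last₂ {rp} eq x i = go rp i eq
        where
        go : ∀ rp → own j x ∈ rp → ys ≡ rp ʳ++ [] → Adj (hd root rp) r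
        go (y ∷ rp) _ e = cyc-adj (r ∷ xs ++ reverse rp) (trans cyc-shape (cong (r ∷_)
          (trans (cong (λ z → xs ++ z ++ (r ∷ [])) (trans e (ʳ++-defn rp)))
          (trans (cong (xs ++_) (++-assoc (reverse rp) (y ∷ []) (r ∷ [])))
              (sym (++-assoc xs (reverse rp) _))))))

    Q-acc : Pred5
    Q-acc = Raw (V j (r ∷ cs)) r

    BestAcc : Table → ∀ {d} → Feasible P I t d → Set
    BestAcc A {d} F = DomF F A ((1 + n) * N) (own j) (r ∷ cs) (d r) × SealedF F (own j) (r ∷ cs) (d r)

    splitAt : ∀ {d} (F : Feasible P I t d) → ℕ
    splitAt F = length (Optimal.Split.xs (Optimal.split P I t D F r cs))

    InvJ : Table → ℕ → Table → Set
    InvJ A jj B = Keep A B × Sound Q-acc B ((1 + n) * N) ×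
      (∀ {d} (F : Feasible P I t d) → splitAt F < jj → BestAcc B F)

    module _ (Dm : ℕ) (len≤ : length cs ≤ Dm) (1≤ : 1 ≤ Dm) where
      U : ℕ
      U = Dm * suc unit

      unit≤U : unit ≤ U
      unit≤U = ≤-trans (n≤1+n unit) (≤-trans (≤-reflexive (sym (+-identityʳ (suc unit))))
        (*-monoˡ-≤ (suc unit) 1≤))

      assembleE : ∀ {τ A xs ys} → cs ≡ xs ++ ys → IdTable (table τ) →
        (∀ {c} → c ∈ r ∷ cs → Tables-at j (table τ) c) → Params τ → Stored D τ →
        τ 64 0 ≡ toℕ r → τ 65 0 ≡ length xs → τ 66 0 ≡ length cs → τ 67 0 ≡ τ 19 (toℕ v) →
        InvJ A (length xs) (table τ) →
        Exec U (assemble P) τ 3200 (λ υ → InvJ A (suc (length xs)) (table υ))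
      assembleE {τ} {A} {xs} {ys} shape it tabs ps st e64 e65 e66 e67 (keep₀ , snd₀ , best₀) =
        weaken tt $
        seqE $ agreeMap (λ υ₁ ag₁ q → step₁ υ₁ ag₁ q) $
        scale (*-monoˡ-≤ (suc unit) (≤-trans (≤-reflexive (length-reverse xs))
            (≤-trans (≤-trans (m≤m+n (length xs) (length ys))
                 (≤-reflexive (sym (trans (cong length shape) (length-++ xs))))) len≤))) $
        chainE {es = reverse xs} (path₁ {xs} {ys} shape) it
          (λ i → tabs (there (inˡ shape (unrev {xs} {ys} shape i)))) ps
          (λ τ′ ag → trans (ag 65 tt 0) (trans e65 (sym (length-reverse xs))))
          (λ τ′ ag rp c post eq tq → trans (ag 21 tt _) (trans (cong (τ 21)
             (trans (cong₂ (λ a b → a ∸ (1 + b))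
                 (cong₂ _+_ (trans (ag 67 tt 0) e67) (trans (ag 65 tt 0) e65)) tq)
                 (index₁ rp c post eq)))
             (Stored.at-blk st v (reverse post) c (rp ++ ys)
               (trans shape (trans (cong (_++ ys) (trans (reverse-flip {xs = xs} {rp = rp} eq)
               (ʳ++-defn post)))
                (++-assoc (reverse post) (c ∷ rp) ys))))))
        where
        index₁ : ∀ rp c post → reverse xs ≡ rp ʳ++ (c ∷ post) →
                 τ 19 (toℕ v) + length xs ∸ (1 + length rp) ≡ τ 19 (toℕ v) + length (reverse post)
        index₁ rp c post eq = trans (cong (λ z → τ 19 (toℕ v) + z ∸ (1 + length rp))
            (trans (cong length (reverse-flip {xs = xs} {rp = rp} eq))
              (trans (length-ʳ++ post) (cong (_+ suc (length rp)) (sym (length-reverse post))))))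
          (trans (cong (_∸ suc (length rp))
              (sym (+-assoc (τ 19 (toℕ v)) (length (reverse post)) (suc (length rp)))))
                 (m+n∸n≡m _ (suc (length rp))))
        step₁ : ∀ υ₁ → Agree (chain P (var 65)
            (read 21 (op sub (op add (var 67) (var 65)) (op add (lit 1) (var 61))))) τ υ₁ →
          (∃[ rp ] reverse xs ≡ rp ʳ++ [] × length rp ≡ length (reverse xs) × ChainPost j r (reverse xs)
              (table τ) rp [] (table υ₁)) →
          Exec U _ υ₁ _ (λ υ → InvJ A (suc (length xs)) (table υ))
        step₁ υ₁ ag₁ (rp₁ , eq₁ , len₁ , below₁ , snd₁ , best₁) =
          seqE $ agreeMap (λ υ₂ ag₂ q → step₂ υ₂ ag₂ q) $ scale unit≤U $
          freshE {a = toℕ r} {b = length rp₁ + (3 + n)} {c = n} {e = 0} {Q = Raw (V j (r ∷ rp₁)) r}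
            (<⇒≢ (toℕ<n r)) (≢-sym (<⇒≢ (≤-trans (m<n+m n {3} z<s) (m≤n+m (3 + n) (length rp₁))))) comb₂
                ps₁
            (cong₂ _*_ (trans (ag₁ 64 tt 0) e64) (Params.at-N ps₁))
            (cong₂ _*_ (cong₂ (λ x y → x + (3 + y)) (trans (ag₁ 65 tt 0) (trans e65 (sym len-rp₁)))
                (Params.at-n ps₁)) (Params.at-N ps₁))
            (cong₂ _*_ (Params.at-n ps₁) (Params.at-N ps₁)) refl
          where
          xs≡ : xs ≡ rp₁
          xs≡ = reverse-flip {xs = xs} {rp = rp₁} eq₁
          len-rp₁ : length rp₁ ≡ length xs
          len-rp₁ = trans len₁ (length-reverse xs)
          ps₁ : Params υ₁
          ps₁ = Params-agree {chain P (var 65)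
            (read 21 (op sub (op add (var 67) (var 65)) (op add (lit 1) (var 61))))} ag₁ ps
          rp∉ : r ∉ rp₁
          rp∉ i = top∉ (inˡ shape (subst (r ∈_) (sym xs≡) i))
          tab-r : Tables-at j (table υ₁) r
          tab-r = tables-same (below₁ (toℕ r) (≤-trans (toℕ<n r) (m≤n+m n 4))) (tabs (here refl))
          comb₂ : Combine (Raw (V j (r ∷ rp₁)) r) (table υ₁) (toℕ r) (length rp₁ + (3 + n)) 0
          comb₂ k≤ w≤ k′≤ w′≤ onX onY w+≤ k+< =
            raw-join (λ x → λ { (here e) i → rp∉ (subst (_∈ rp₁) e i) })
            (last₁ {xs} {ys} shape {rp₁} eq₁)
              (λ _ → ∈-∷⁺)
              (λ _ → ∈-∷⁻) k+<
              (Tables-at.sound tab-r _ _ k≤ w≤ onX) (snd₁ _ _ k′≤ w′≤ onY) , λ ne →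
                  contradiction refl ne
          step₂ : ∀ υ₂ → Agree (freshInto P (slotE (var 64)) (slotE (op add (var 65) slotX)) slotR
              (lit 0)) υ₁ υ₂ →
            Others n (table υ₁) (table υ₂) × Sound (Raw (V j (r ∷ rp₁)) r) (table υ₂) (n * N) ×
              Complete (table υ₁) (table υ₂) (toℕ r) (length rp₁ + (3 + n)) n 0 →
            Exec U _ υ₂ _ (λ υ → InvJ A (suc (length xs)) (table υ))
          step₂ υ₂ ag₂ (oth₂ , snd₂ , cmp₂) =
            seqE $ agreeMap (λ υ₃ ag₃ q → step₃ υ₃ ag₃ q) $
            scale (*-monoˡ-≤ (suc unit) (≤-trans (≤-trans (m≤n+m (length ys) (length xs))
                (≤-reflexive (sym len-cs))) len≤)) $
            chainE {es = ys} (path₂ {xs} {ys} shape) (id-same (keep₂ _ (inj₂ (inj₂ refl))) it)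
              (λ {c} i → tables-same (keep₂ (toℕ c) (inj₁ (toℕ<n c))) (tabs (there (inʳ shape i)))) ps₂
              (λ τ′ ag → trans (cong₂ _∸_ (trans (ag 66 tt 0) e66₂) (trans (ag 65 tt 0) e65₂))
                  (trans (cong (_∸ length xs) len-cs) (m+n∸m≡n (length xs) (length ys))))
              (λ τ′ ag rp c post eq tq → trans (ag 21 tt _)
                  (trans (ag₂ 21 tt _) (trans (ag₁ 21 tt _) (trans (cong (τ 21)
                 (trans (cong₂ _+_ (cong₂ _+_ (trans (ag 67 tt 0) e67₂) (trans (ag 65 tt 0) e65₂)) tq)
                     (index₂ rp)))
                 (Stored.at-blk st v (xs ++ reverse rp) c post
                     (trans shape (trans (cong (xs ++_) (trans eq (ʳ++-defn rp)))
                   (sym (++-assoc xs (reverse rp) (c ∷ post)))))))))) 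
            where
            len-cs : length cs ≡ length xs + length ys
            len-cs = trans (cong length shape) (length-++ xs)
            index₂ : ∀ rp → τ 19 (toℕ v) + length xs + length rp ≡
                τ 19 (toℕ v) + length (xs ++ reverse rp)
            index₂ rp = trans (+-assoc (τ 19 (toℕ v)) (length xs) (length rp)) (cong (τ 19 (toℕ v) +_)
              (sym (trans (length-++ xs) (cong (length xs +_) (length-reverse rp)))))
            keep₂ : Keep (table τ) (table υ₂)
            keep₂ = Keep-trans {table τ} {table υ₁} {table υ₂} (keep-below {table τ} {table υ₁} below₁)
              (keep-others {table υ₁} {table υ₂} oth₂)
            ps₂ : Params υ₂
            ps₂ = Params-agree {freshInto P (slotE (var 64)) (slotE (op add (var 65) slotX)) slotR
              (lit 0)} ag₂ ps₁
            e65₂ : υ₂ 65 0 ≡ length xs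
            e65₂ = trans (ag₂ 65 tt 0) (trans (ag₁ 65 tt 0) e65)
            e66₂ : υ₂ 66 0 ≡ length cs
            e66₂ = trans (ag₂ 66 tt 0) (trans (ag₁ 66 tt 0) e66)
            e67₂ : υ₂ 67 0 ≡ τ 19 (toℕ v)
            e67₂ = trans (ag₂ 67 tt 0) (trans (ag₁ 67 tt 0) e67)
            step₃ : ∀ υ₃ → Agree (chain P (op sub (var 66) (var 65))
                (read 21 (op add (op add (var 67) (var 65)) (var 61)))) υ₂ υ₃ →
              (∃[ rp ] ys ≡ rp ʳ++ [] × length rp ≡ length ys × ChainPost j r ys (table υ₂) rp []
                  (table υ₃)) →
              Exec U (mergeInto P slotR (slotE (op add (op sub (var 66) (var 65)) slotX)) slotAcc
                  (lit 0)) υ₃ _ (λ υ → InvJ A (suc (length xs)) (table υ))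
            step₃ υ₃ ag₃ (rp₂ , eq₂ , len₂ , below₃ , snd₃ , best₃) =
              mapE fin $ scale unit≤U $
              intoE {a = n} {b = length rp₂ + (3 + n)} {c = 1 + n} {e = 0} {Q = Q-acc} (<⇒≢ ≤-refl)
                (≢-sym (<⇒≢ (≤-trans (n<1+n (1 + n))
                    (≤-trans (n≤1+n (2 + n)) (m≤n+m (3 + n) (length rp₂)))))) comb₄ ps₃
                (cong₂ _*_ (Params.at-n ps₃) (Params.at-N ps₃))
                (cong₂ _*_ (cong₂ (λ x y → x + (3 + y)) cnt (Params.at-n ps₃)) (Params.at-N ps₃))
                (cong₂ _*_ (cong suc (Params.at-n ps₃)) (Params.at-N ps₃)) refl
              where
              ps₃ : Params υ₃
              ps₃ = Params-agree {chain P (op sub (var 66) (var 65))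
                (read 21 (op add (op add (var 67) (var 65)) (var 61)))} ag₃ ps₂
              cnt : υ₃ 66 0 ∸ υ₃ 65 0 ≡ length rp₂
              cnt = trans (cong₂ _∸_ (trans (ag₃ 66 tt 0) e66₂) (trans (ag₃ 65 tt 0) e65₂))
                (trans (cong (_∸ length xs) len-cs) (trans (m+n∸m≡n (length xs) (length ys))
                    (sym len₂)))
              to-ys : ∀ {x} → x ∈ rp₂ → x ∈ ys
              to-ys i = subst (_ ∈_) (sym eq₂) (ʳ++-∈ rp₂ (inj₁ i))
              from-ys : ∀ {x} → x ∈ ys → x ∈ rp₂
              from-ys i with ∈-ʳ++ rp₂ {[]} (subst (_ ∈_) eq₂ i)
              ... | inj₁ k = k
              apart : ∀ {x} → x ∈ r ∷ rp₁ → x ∉ rp₂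
              apart (here refl) i = top∉ (inʳ shape (to-ys i))
              apart (there k) i = proj₂ (proj₂ (un shape)) (subst (_ ∈_) (sym xs≡) k) (to-ys i)
              to-cs : ∀ {x} → x ∈ r ∷ rp₁ ⊎ x ∈ rp₂ → x ∈ r ∷ cs
              to-cs (inj₁ (here e)) = here e
              to-cs (inj₁ (there i)) = there (inˡ shape (subst (_ ∈_) (sym xs≡) i))
              to-cs (inj₂ i) = there (inʳ shape (to-ys i))
              from-cs : ∀ {x} → x ∈ r ∷ cs → x ∈ r ∷ rp₁ ⊎ x ∈ rp₂
              from-cs (here e) = inj₁ (here e)
              from-cs (there i) with ∈-++⁻ xs (subst (_ ∈_) shape i)
              ... | inj₁ k = inj₁ (there (subst (_ ∈_) xs≡ k))
              ... | inj₂ k = inj₂ (from-ys k)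
              sndR : Sound (Raw (V j (r ∷ rp₁)) r) (table υ₃) (n * N)
              sndR = Sound-same {n} {table υ₂} {table υ₃} {Raw (V j (r ∷ rp₁)) r}
                (below₃ n (m<n+m n z<s)) snd₂
              comb₄ : Combine Q-acc (table υ₃) n (length rp₂ + (3 + n)) 0
              comb₄ k≤ w≤ k′≤ w′≤ onX onY w+≤ k+< = raw-join (λ x → apart) (last₂ shape {rp₂} eq₂)
                (λ x → to-cs) (λ x → from-cs) k+<
                (sndR _ _ k≤ w≤ onX) (snd₃ _ _ k′≤ w′≤ onY) , λ ne → contradiction refl ne
              A₃ = table υ₃
              keep₃ : Keep (table τ) A₃
              keep₃ = Keep-trans {table τ} {table υ₂} {A₃} keep₂ (keep-below {table υ₂} {A₃} below₃)
              acc-same : SameSlot (1 + n) (table τ) A₃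
              acc-same i i<N = trans (below₃ (1 + n) 1+n< i i<N)
                (trans (oth₂ (1 + n) (≢-sym (<⇒≢ ≤-refl)) i i<N) (below₁ (1 + n) 1+n< i i<N))
                where
                1+n< : 1 + n < 4 + n
                1+n< = s≤s (m<n+m n z<s)
              fin : ∀ υ → Others (1 + n) A₃ (table υ) ×
                  (Sound Q-acc A₃ ((1 + n) * N) → Sound Q-acc (table υ) ((1 + n) * N)) ×
                (∀ {k ω z} → Dom A₃ ((1 + n) * N) k ω z → Dom (table υ) ((1 + n) * N) k ω z) ×
                Complete A₃ (table υ) n (length rp₂ + (3 + n)) (1 + n) 0 →
                    InvJ A (suc (length xs)) (table υ)
              fin υ (oth , sndQ , keeps , cmp) =
                Keep-trans {A} {A₃} {table υ} (Keep-trans {A} {table τ} {A₃} keep₀ keep₃)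
                    (keep-others′ {A₃} {table υ} oth) ,
                sndQ (Sound-same {1 + n} {table τ} {A₃} {Q-acc} acc-same snd₀) ,
                λ F lt → [ (λ lt′ → let b , s′ =
                                          best₀ F lt′ in keeps (dom-same F {table τ} {A₃} {1 + n}
                                          {own j} {r ∷ cs} acc-same b) , s′) ,
                                          new F ]′ (m≤n⇒m<n∨m≡n (s≤s⁻¹ lt))
                where
                new : ∀ {d} (F : Feasible P I t d) → splitAt F ≡ length xs → BestAcc (table υ) F
                new {d} F eq =
                  let open Optimal P I t D F
                      sp = split r cs
                      ex , ey = ++-same-length (Split.xs sp) xs (trans (sym (Split.shape sp)) shape) eq
                      b₁ , s₁ = best₁ F (steps-same λ i →
                        Split.same sp (subst (_ ∈_) (sym ex) (unrev {xs} {ys} shape i)))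
                      b₃ , s₃ = best₃ F (subst (Steps (own j) r) ey (steps-cut j<n sp))
                      bR , sR = Tables-at.best tab-r F
                      bT = merge-step {table υ₂} {n * N} {0} {own j} {r ∷ []} {rp₁} {r ∷ rp₁}
                             (λ z → mem-split {A = r ∷ []} {rp₁} {r ∷ rp₁} z (λ { (here refl) → rp∉ })
                               ∈-∷⁺
                                     ∈-∷⁻) (cmp₂ bR b₁)
                      sT = sealed-∪ {own j} {r ∷ []} {rp₁} {r ∷ rp₁} ∈-∷⁺
                                     ∈-∷⁻ sR s₁
                      bA = merge-step {table υ} {(1 + n) * N} {0} {own j} {r ∷ rp₁} {rp₂} {r ∷ cs}
                             (λ z → mem-split {A = r ∷ rp₁} {rp₂} {r ∷ cs} z apart to-cs from-cs)
                             (cmp (dom-same F {table υ₂} {A₃} {n} {own j} {r ∷ rp₁}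
                                 (below₃ n (m<n+m n z<s)) (proj₁ bT)) b₃)
                  in proj₁ bA , sealed-∪ {own j} {r ∷ rp₁} {rp₂} {r ∷ cs} to-cs from-cs sT s₃

∈-single : ∀ {A : Set} {x y : A} → x ∈ y ∷ [] → x ≡ y
∈-single (here e) = e

index-unique : ∀ {A : Set} {R : A → A → Set} → (∀ {x y} → R x y → R y x) → ∀ {xs} →
    AllPairs (λ x y → ¬ R x y) xs →
               ∀ i j → R (lookup xs i) (lookup xs j) → i ≡ j
index-unique {R = R} flip = go
  where
  open import Data.List.Membership.Propositional.Properties using (∈-lookup)
  go : ∀ {xs} → AllPairs (λ x y → ¬ R x y) xs → ∀ i j → R (lookup xs i) (lookup xs j) → i ≡ j
  go (_ ∷ _)  zero    zero    _ = refl
  go (d ∷ _)  zero    (suc j) r = contradiction r (All.lookup d (∈-lookup j))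
  go (d ∷ _)  (suc i) zero    r = contradiction (flip r) (All.lookup d (∈-lookup i))
  go (_ ∷ ds) (suc i) (suc j) r = cong suc (go ds i j r)

unique-length : ∀ {n} {xs : List (Fin n)} → Unique xs → length xs ≤ n
unique-length {xs = xs} un = Finₚ.injective⇒≤ {f = lookup xs} (index-unique sym un _ _)

unique-++ : ∀ {A : Set} {xs ys : List A} → Unique xs → Unique ys → (∀ {x} → x ∈ xs → x ∉ ys) →
    Unique (xs ++ ys)
unique-++ [] uy dis = uy
unique-++ {xs = x ∷ xs} (x∉ ∷ ux) uy dis = All.tabulate
  (λ i → [ All.lookup x∉ , (λ k → λ { refl → dis (here refl) k }) ]′ (∈-++⁻ xs i)) ∷ unique-++ ux uy
      (dis ∘ there)

Stored-agree : ∀ {n} {G : Graph n} {D : Decomposition G} {c σ τ} → {T (free 14 c)} → {T (free 16 c)} →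
    {T (free 19 c)} →
               {T (free 20 c)} → {T (free 21 c)} → Agree c σ τ → Stored D σ → Stored D τ
Stored-agree {σ = σ} {_} {f14} {f16} {f19} {f20} {f21} ag st = record
  { at-ord = λ {i} i<n → trans (ag 14 f14 i) (at-ord i<n)
  ; at-par = λ {v} i → trans (ag 16 f16 (toℕ v)) (at-par i)
  ; at-len = λ v → trans (ag 20 f20 (toℕ v)) (at-len v)
  ; at-blk = λ v pre c post eq → trans (ag 21 f21 _)
    (trans (cong (λ z → σ 21 (z + length pre)) (ag 19 f19 (toℕ v))) (at-blk v pre c post eq)) }
  where open Stored st

module BlockStep (P : Problem) (I : Instance) (t : ℕ) (D : Decomposition (Instance.graph I)) where
  open Instance I
  open Graph graph
  open Slots P n l u p (∑ s) t
  open Codes P I t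
  open Decomposition D
  open Own D
  open Chains P I t D
  open Blocks P I t D

  record State (j : ℕ) (A : Table) : Set where
    field
      id-table : IdTable A
      fin-off  : ∀ i → i < N → ¬ On (A ((2 + n) * N + i))
      tables   : ∀ v → Live j v → Tables-at j A v

  dom-cong : ∀ {d} (F : Feasible P I t d) {A c o o′ L L′ ℓ} → (∀ x → mem L (o x) ≡ mem L′ (o′ x)) →
             DomF F A c o L ℓ → DomF F A c o′ L′ ℓ
  dom-cong F {A} {c} {o} {o′} {L} {L′} h = Dom-≡
      (kOf-cong {o} {o′} {L} {L′} h) (yOf-cong w {o} {o′} {L} {L′} h) (yOf-cong s {o} {o′} {L} {L′} h)
    where open Optimal P I t D F

  tables-step : ∀ {j j′ A v} → (∀ x → own j x ≡ v → own j′ x ≡ v) → (∀ x → own j′ x ≡ v → own j x ≡ v) →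
                Tables-at j A v → Tables-at j′ A v
  tables-step {j} {j′} {A} {v} to from ta = record
    { sound = λ k ω k≤ w≤ on → reindex to′ from′ (sound k ω k≤ w≤ on)
    ; best = λ {d} F → dom-cong F {A} {toℕ v * N} {own j} {own j′} {v ∷ []} {v ∷ []} {d v}
                  (λ x → mem-cong (to′ x) (from′ x)) (proj₁ (best F)) ,
               λ x x′ i ne eq → to′ x′ (proj₂ (best F) x x′ (from′ x i) ne eq) }
    where
    open Tables-at ta
    to′ : ∀ x → own j x ∈ v ∷ [] → own j′ x ∈ v ∷ []
    to′ x (here e) = here (to x e)
    from′ : ∀ x → own j′ x ∈ v ∷ [] → own j x ∈ v ∷ []
    from′ x (here e) = here (from x e)

  skip-step : ∀ {j A} → blk (key j) ≡ [] → State j A → State (suc j) A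
  skip-step {j} emp st = record { id-table = id-table ; fin-off = fin-off ; tables = λ v lv →
    tables-step (λ x e → trans (same x) e) (λ x e → trans (sym (same x)) e)
        (tables v (live-pred {j} {v} lv)) }
    where
    open State st
    same : ∀ x → own (suc j) x ≡ own j x
    same x = own-out {j} {x} λ i → nil∉ (subst (own j x ∈_) emp i)

  module _ {j} (j<n : j < n) (kk : key j ∈ blk (key j)) (Dm : ℕ) (len≤ : length (blk (key j)) ≤ Dm)
      (1≤ : 1 ≤ Dm) where
    private
      v r : Fin n
      v = key j
      r = par v
      cs : List (Fin n)
      cs = blk v
      B : ℕ
      B = suc (length cs) * suc (U j<n kk Dm len≤ 1≤)

    U≤B : U j<n kk Dm len≤ 1≤ ≤ B
    U≤B = ≤-trans (n≤1+n _) (m≤m+n _ _)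

    unit≤B : unit ≤ B
    unit≤B = ≤-trans (unit≤U j<n kk Dm len≤ 1≤) U≤B

    own-into : ∀ x → own j x ∈ r ∷ cs → own (suc j) x ≡ r
    own-into x (here e) = trans (own-out {j} {x} (λ i → top∉ j<n kk (subst (_∈ cs) e i))) e
    own-into x (there i) = own-in {j} {x} i

    own-from : ∀ x → own (suc j) x ≡ r → own j x ∈ r ∷ cs
    own-from x e with own j x ∈? blk (key j)
    ... | yes i = there i
    ... | no _ = here e

    blockE : ∀ {σ} → State j (table σ) → Params σ → Stored D σ → σ 63 0 ≡ toℕ v →
             Exec B (block P) σ 4500 (λ τ → State (suc j) (table τ))
    blockE {σ} state ps st e63 = weaken tt $ seqE $ writeE $ seqE $ writeE $ seqE $ writeE $ seqE $
      writeE $ seqE $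
      agreeMap (λ υ₁ ag₁ q → step₁ υ₁ ag₁ q) $ scale unit≤B $ clearE {c = 1 + n} (Params.at-N ps)
        (cong₂ _*_ (cong suc (Params.at-n ps)) (Params.at-N ps))
      where
      open State state
      σ₁ : Store
      σ₁ = (((σ [ 64 , 0 ↦ σ 16 (σ 63 0) ]) [ 66 , 0 ↦ σ 20 (σ 63 0) ]) [ 67 , 0 ↦ σ 19 (σ 63 0) ]) [
        52 , 0 ↦ (1 + σ 0 0) * σ 23 0 ]
      A₀ = table σ
      loop = for 65 (op add (lit 1) (var 66)) (assemble P)
      tabs : ∀ {c} → c ∈ r ∷ cs → Tables-at j A₀ c
      tabs (here refl) = tables r (live-pred {j} {r} (par-live j<n (nonroot kk)))
      tabs (there i) = tables _ (member-live j<n i)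
      step₁ : ∀ υ₁ → Agree clear σ₁ υ₁ → Others (1 + n) A₀ (table υ₁) ×
          (∀ i → i < N → ¬ On (table υ₁ ((1 + n) * N + i))) →
              Exec B (loop ⨟ freshInto P slotAcc (slotE slotX) (slotE (var 64)) (lit 0)) υ₁ _
                  (λ τ → State (suc j) (table τ))
      step₁ υ₁ ag₁ (oth₁ , off₁) = seqE $ agreeMap (λ υ₂ ag₂ q → step₂ υ₂ ag₂ q) $
        forE (suc (length cs)) (λ jj τ → InvJ j<n kk A₀ jj (table τ)) {tt}
          (λ τ ag → cong suc (trans (ag 66 tt 0) e66))
          (keep-others′ {A₀} {table υ₁} oth₁ ,
              (λ k ω k≤ w≤ on → contradiction on (off₁ (ix u k ω) (ix<N k≤ w≤))) , λ F ())
          (λ jj τ jj< ag tj inv → mapE (λ υ q x → subst (λ z → InvJ j<n kk A₀ (suc z) (table υ))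
              (len jj (s≤s⁻¹ jj<)) q)
             (assembleE j<n kk Dm len≤ 1≤ {A = A₀} {List.take jj cs} {List.drop jj cs}
               (sym (take++drop≡id jj cs))
                (id-same (proj₁ inv (3 + n) (inj₂ (inj₂ refl))) id-table)
                (λ {c} i → tables-same (proj₁ inv (toℕ c) (inj₁ (toℕ<n c))) (tabs i))
                (Params-agree {loop} ag ps₁) (Stored-agree {D = D} {loop} ag st₁)
                (trans (ag 64 tt 0) e64) (trans tj (sym (len jj (s≤s⁻¹ jj<)))) (trans (ag 66 tt 0) e66)
                (trans (ag 67 tt 0) (trans e67 (sym (ag 19 tt (toℕ v)))))
                (subst (λ z → InvJ j<n kk A₀ z (table τ)) (sym (len jj (s≤s⁻¹ jj<))) inv)))
        where
        open import Data.List.Properties using (take++drop≡id; length-take)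
        len : ∀ jj → jj ≤ length cs → length (List.take jj cs) ≡ jj
        len jj le = trans (length-take jj cs) (m≤n⇒m⊓n≡m le)
        ps₁ : Params υ₁
        ps₁ = Params-agree {clear} ag₁ (same-params refl refl refl refl refl refl ps)
        st₁ : Stored D υ₁
        st₁ = Stored-agree {D = D} {clear} ag₁ (record { Stored st })
        e64 : υ₁ 64 0 ≡ toℕ r
        e64 = trans (ag₁ 64 tt 0) (trans (cong (σ 16) e63) (Stored.at-par st kk))
        e66 : υ₁ 66 0 ≡ length cs
        e66 = trans (ag₁ 66 tt 0) (trans (cong (σ 20) e63) (Stored.at-len st v))
        e67 : υ₁ 67 0 ≡ υ₁ 19 (toℕ v)
        e67 = trans (ag₁ 67 tt 0) (trans (cong (σ 19) e63) (sym (ag₁ 19 tt (toℕ v))))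
        step₂ : ∀ υ₂ → Agree loop υ₁ υ₂ → InvJ j<n kk A₀ (suc (length cs)) (table υ₂) →
                Exec B (freshInto P slotAcc (slotE slotX) (slotE (var 64)) (lit 0)) υ₂ _
                    (λ τ → State (suc j) (table τ))
        step₂ υ₂ ag₂ (keep₂ , snd₂ , best₂) = mapE fin $ scale unit≤B $
          freshE {a = 1 + n} {b = 3 + n} {c = toℕ r} {e = 0} {Q = Raw (V (suc j) (r ∷ [])) r}
            (≢-sym (<⇒≢ (m≤n⇒m≤1+n (toℕ<n r)))) (≢-sym (<⇒≢ (≤-trans (toℕ<n r) (m≤n+m n 3)))) comb ps₂
            (cong₂ _*_ (cong suc (Params.at-n ps₂)) (Params.at-N ps₂))
            (cong₂ _*_ (cong (3 +_) (Params.at-n ps₂)) (Params.at-N ps₂))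
            (cong₂ _*_ (trans (ag₂ 64 tt 0) e64) (Params.at-N ps₂)) refl
          where
          ps₂ : Params υ₂
          ps₂ = Params-agree {loop} ag₂ ps₁
          A₂ = table υ₂
          it₂ : IdTable A₂
          it₂ = id-same (keep₂ (3 + n) (inj₂ (inj₂ refl))) id-table
          comb : Combine (Raw (V (suc j) (r ∷ [])) r) A₂ (1 + n) (3 + n) 0
          comb k≤ w≤ k′≤ w′≤ onX onY w+≤ k+< = raw-join (λ x _ → nil∉) (λ x i → ⊥-elim (nil∉ i))
            (λ x → λ { (inj₁ i) → here (own-into x i) }) (λ x i → inj₁ (own-from x (∈-single i))) k+<
            (snd₂ _ _ k≤ w≤ onX) (id-sound {A₂} {V j []} {root} it₂ (λ x → nil∉) _ _ k′≤ w′≤ onY) ,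
                λ ne → contradiction refl ne
          fin : ∀ υ → Others (toℕ r) A₂ (table υ) × Sound (Raw (V (suc j) (r ∷ [])) r) (table υ)
              (toℕ r * N) ×
                Complete A₂ (table υ) (1 + n) (3 + n) (toℕ r) 0 → State (suc j) (table υ)
          fin υ (oth , snd , cmp) = record
            { id-table = id-same (oth (3 + n) (≢-sym (<⇒≢ (≤-trans (toℕ<n r) (m≤n+m n 3))))) it₂
            ; fin-off = λ i i<N on → fin-off i i<N
              (subst On (trans (oth (2 + n) (≢-sym (<⇒≢ (≤-trans (toℕ<n r) (m≤n+m n 2)))) i i<N)
                 (keep₂ (2 + n) (inj₂ (inj₁ refl)) i i<N)) on)
            ; tables = tab }
            where
            tab : ∀ v′ → Live (suc j) v′ → Tables-at (suc j) (table υ) v′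
            tab v′ lv with v′ Finₚ.≟ r
            ... | yes refl = record { sound = snd ; best = λ {d} F →
                  let open Optimal P I t D F
                      b , se = best₂ F (s≤s (≤-trans (m≤m+n _ _)
                        (≤-reflexive (sym (trans (cong length (Split.shape (split r cs)))
                        (length-++ (Split.xs (split r cs))))))))
                      y = merge-step {table υ} {toℕ r * N} {0} {own j} {r ∷ cs} {[]} {r ∷ cs}
                            (λ z → sym (+-identityʳ (mem (r ∷ cs) z)))
                            (cmp b (dom-nil F {A₂} {(3 + n) * N} {own j} {d r} (id-dom it₂)))
                  in dom-cong F {table υ} {toℕ r * N} {own j} {own (suc j)} {r ∷ cs} {r ∷ []} {d r}
                       (λ x → mem-cong {L = r ∷ cs} {r ∷ []} (λ i → here (own-into x i))
                         (own-from x ∘ ∈-single)) (proj₁ y) ,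
                     λ x x′ i ne eq → here (own-into x′ (se x x′ (own-from x (∈-single i)) ne eq)) }
            ... | no ne = tables-same (λ i i<N → trans (oth (toℕ v′) (ne ∘ toℕ-injective) i i<N)
                (keep₂ (toℕ v′) (inj₁ (toℕ<n v′)) i i<N))
                  (tables-step to from (tables v′ (live-pred {j} {v′} lv)))
              where
              v′∉ : v′ ∉ cs
              v′∉ = lv v (Done-key j<n)
              to : ∀ x → own j x ≡ v′ → own (suc j) x ≡ v′
              to x refl = own-out {j} {x} v′∉
              from : ∀ x → own (suc j) x ≡ v′ → own j x ≡ v′
              from x e with own j x ∈? blk (key j)
              ... | yes i = contradiction (sym e) ne
              ... | no _ = e

-- Deciding a threshold

init : Program
init =
  for 54 (slotE (op add (lit 4) (read 0 (lit 0)))) (write 40 (var 54) (lit 0)) ⨟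
  write 40 (slotE slotX) (lit 1) ⨟ write 41 (slotE slotX) (lit 0) ⨟
  write 42 (slotE slotX) (lit 0) ⨟ write 43 (slotE slotX) (lit 0) ⨟
  for 61 (read 0 (lit 0)) (cond (op less (read 1 (var 61)) (var 25))
    (set 60 (op add (slotE (var 61)) (read 1 (var 61))) ⨟ write 40 (var 60) (lit 1) ⨟
     write 41 (var 60) (read 2 (var 61)) ⨟ write 42 (var 60) (read 10 (var 61)) ⨟
         write 43 (var 60) (lit 0))
    skip)

sweep decide : Problem → Program
sweep P = for 68 (op sub (read 0 (lit 0)) (lit 1))
  (set 63 (read 14 (op sub (read 0 (lit 0)) (op add (lit 1) (var 68)))) ⨟
      cond (read 20 (var 63)) (block P) skip)
decide P = init ⨟ sweep P ⨟
  mergeInto P (slotE (read 14 (lit 0))) (slotE slotX) slotFin (op add (lit 1) (read 14 (lit 0)))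

record Weighted (I : Instance) (σ : Store) : Set where
  open Instance I
  field
    at-w   : ∀ (v : Fin n) → σ 1 (toℕ v) ≡ w v
    at-s   : ∀ (v : Fin n) → σ 2 (toℕ v) ≡ s v
    at-pow : ∀ (v : Fin n) → σ 10 (toℕ v) ≡ suc n ^ toℕ v

module Decide (P : Problem) (I : Instance) (t : ℕ) (D : Decomposition (Instance.graph I)) where
  open Instance I
  open Graph graph
  open Slots P n l u p (∑ s) t
  open Codes P I t
  open Decomposition D
  open Own D
  open Chains P I t D
  open Blocks P I t D using (id-same)
  open BlockStep P I t D

  Off : Table → ℕ → Set
  Off A a = ∀ i → i < N → flag (A (a * N + i)) ≡ 0

  OnlyAt : Table → ℕ → ℕ → Cell → Set
  OnlyAt A a k c = A (a * N + k) ≡ c × (∀ i → i < N → i ≢ k → flag (A (a * N + i)) ≡ 0)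

  only-at : ∀ {A B a k c} → Off A a → (∀ j → j ≢ a * N + k → B j ≡ A j) → B (a * N + k) ≡ c →
      OnlyAt B a k c
  only-at {a = a} off oth eq = eq , λ i i<N ne →
    trans (cong flag (oth _ (ne ∘ +-cancelˡ-≡ (a * N) _ _))) (off i i<N)

  Off-same : ∀ {A B a} → SameSlot a A B → Off A a → Off B a
  Off-same same off i i<N = trans (cong flag (same i i<N)) (off i i<N)

  OnlyAt-same : ∀ {A B a k c} → SameSlot a A B → k < N → OnlyAt A a k c → OnlyAt B a k c
  OnlyAt-same same k<N (eq , off) = trans (same _ k<N) eq , λ i i<N ne → trans (cong flag (same i i<N))
    (off i i<N ne)

  single : Fin n → Cell
  single v = cell 1 (s v) (suc n ^ toℕ v) 0

  w<N : ∀ {v} → w v ≤ u → w v < N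
  w<N = ix<N z≤n

  InitInv : ℕ → Table → Set
  InitInv i A = OnlyAt A (3 + n) 0 (cell 1 0 0 0) × Off A (2 + n) ×
    (∀ (v : Fin n) → i ≤ toℕ v → Off A (toℕ v)) ×
    (∀ (v : Fin n) → toℕ v < i → (w v ≤ u × OnlyAt A (toℕ v) (w v) (single v)) ⊎
        (¬ w v ≤ u × Off A (toℕ v)))

  initE : ∀ {σ} → Params σ → Weighted I σ → Exec ((4 + n) * N) init σ 400 (λ τ → InitInv n (table τ))
  initE {σ} ps ws = weaken tt $ seqE $ agreeMap (λ υ₁ ag₁ q → step₁ υ₁ ag₁ q) $
    scale (≤-reflexive (*-identityʳ ((4 + n) * N))) $
    forE ((4 + n) * N) (λ i τ → ∀ k → k < i → τ 40 k ≡ 0) {tt}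
      (λ τ ag → cong₂ _*_ (cong (4 +_) (trans (ag 0 tt 0) at-n)) (trans (ag 23 tt 0) at-N)) (λ _ ())
      (λ i τ i< ag ti f → writeE λ x k k<si → off τ ti k (m≤n⇒m<n∨m≡n (s≤s⁻¹ k<si)) f)
    where
    open Params ps
    open Weighted ws
    off : ∀ τ {x i} → x ≡ i → ∀ k → k < i ⊎ k ≡ i → (∀ k → k < i → τ 40 k ≡ 0) →
        (τ [ 40 , x ↦ 0 ]) 40 k ≡ 0
    off τ {x} {i} e k lt f with x ≟ℕ k
    ... | yes eq = if-same {x} eq
    ... | no ne with lt
    ...   | inj₁ k<i = trans (if-other ne) (f k k<i)
    ...   | inj₂ refl = contradiction e ne
    loop₁ = for 54 (slotE (op add (lit 4) (read 0 (lit 0)))) (write 40 (var 54) (lit 0))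
    step₁ : ∀ υ₁ → Agree loop₁ σ υ₁ → (∀ k → k < (4 + n) * N → υ₁ 40 k ≡ 0) →
            Exec ((4 + n) * N) _ υ₁ _ (λ τ → InitInv n (table τ))
    step₁ υ₁ ag₁ off₁ = seqE $ writeE $ seqE $ writeE $ seqE $ writeE $ seqE $ writeE $
      scale (≤-trans (≤-reflexive (*-identityʳ n)) (≤-trans (m≤n+m n 4) (m≤m*n (4 + n) N))) $
      forE n (λ i τ → InitInv i (table τ)) {tt} (λ τ ag → trans (ag 0 tt 0) (Params.at-n ps₁))
        (only-at {table υ₁} {A₂} {3 + n} (offs (3 + n) ≤-refl) oth₂ new₂ ,
         Off-same {table υ₁} {A₂} {2 + n} (other-slot (2 + n) (<⇒≢ ≤-refl))
             (offs (2 + n) (n≤1+n (3 + n))) ,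
         (λ v _ → Off-same {table υ₁} {A₂} {toℕ v} (other-slot (toℕ v) (<⇒≢ (v<3+n v)))
             (offs (toℕ v) (≤-trans (v<3+n v) (n≤1+n (3 + n))))) ,
         λ v ())
        (λ i τ i<n ag ti inv → body i τ i<n ag ti inv)
      where
      x₀ = (3 + υ₁ 0 0) * υ₁ 23 0
      υ₂ : Store
      υ₂ = (((υ₁ [ 40 , x₀ ↦ 1 ]) [ 41 , x₀ ↦ 0 ]) [ 42 , x₀ ↦ 0 ]) [ 43 , x₀ ↦ 0 ]
      A₂ = table υ₂
      ps₁ : Params υ₁
      ps₁ = Params-agree {loop₁} ag₁ ps
      x₀≡ : x₀ ≡ (3 + n) * N + 0
      x₀≡ = trans (cong₂ _*_ (cong (3 +_) (Params.at-n ps₁)) (Params.at-N ps₁)) (sym (+-identityʳ _))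
      v<3+n : ∀ (v : Fin n) → toℕ v < 3 + n
      v<3+n v = ≤-trans (toℕ<n v) (m≤n+m n 3)
      offs : ∀ a → a < 4 + n → Off (table υ₁) a
      offs a a< i i<N = off₁ (a * N + i)
        (≤-trans (+-monoʳ-< (a * N) i<N) (≤-trans (≤-reflexive (+-comm (a * N) N)) (*-monoˡ-≤ N a<)))
      oth₂ : ∀ j → j ≢ (3 + n) * N + 0 → A₂ j ≡ table υ₁ j
      oth₂ j ne = let ne′ = λ e → ne (trans (sym e) x₀≡) in cell-≡ (if-other ne′) (if-other ne′)
        (if-other ne′) (if-other ne′)
      new₂ : A₂ ((3 + n) * N + 0) ≡ cell 1 0 0 0
      new₂ = cell-≡ (if-same x₀≡) (if-same x₀≡) (if-same x₀≡) (if-same x₀≡)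
      other-slot : ∀ a → a ≢ 3 + n → SameSlot a (table υ₁) A₂
      other-slot a ne i i<N = oth₂ _ (slot-apart ne i<N z<s)
      loop₂ = for 61 (read 0 (lit 0)) (cond (op less (read 1 (var 61)) (var 25))
        (set 60 (op add (slotE (var 61)) (read 1 (var 61))) ⨟ write 40 (var 60) (lit 1) ⨟
         write 41 (var 60) (read 2 (var 61)) ⨟ write 42 (var 60) (read 10 (var 61)) ⨟
             write 43 (var 60) (lit 0)) skip)
      body : ∀ i τ → i < n → Agree loop₂ υ₂ τ → τ 61 0 ≡ i → InitInv i (table τ) →
             Exec 0 _ τ _ (λ υ → ∀ x → InitInv (suc i) (table (υ [ 61 , 0 ↦ x ])))
      body i τ i<n ag ti (only , off2 , rest , done) = condE
        (λ g → seqE $ writeE $ seqE $ writeE $ seqE $ writeE $ seqE $ writeE $ writeE λ x →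
            entered (s≤s⁻¹ (subst₂ _<_ w-at d-at (less≢0 g))))
        (λ g → skipE λ x → only , off2 , (λ v le → rest v (<⇒≤ le)) ,
           λ v lt → [ done v , (λ { e → inj₂
               ((λ w≤ → <⇒≱ (s≤s w≤) (subst₂ _≤_ d-at (trans w-at (cong w (at-i v e))) (less≡0 g))) ,
               rest v (≤-reflexive (sym e))) }) ]′ (m≤n⇒m<n∨m≡n (s≤s⁻¹ lt)))
        where
        vi : Fin n
        vi = fromℕ< i<n
        toℕ-vi : toℕ vi ≡ i
        toℕ-vi = toℕ-fromℕ< i<n
        at-i : ∀ v → toℕ v ≡ i → vi ≡ v
        at-i v e = toℕ-injective (trans toℕ-vi (sym e))
        t61 : τ 61 0 ≡ toℕ vi
        t61 = trans ti (sym toℕ-vi)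
        w-at : τ 1 (τ 61 0) ≡ w vi
        w-at = trans (cong (τ 1) t61) (trans (ag 1 tt _) (trans (ag₁ 1 tt _) (at-w vi)))
        d-at : τ 25 0 ≡ suc u
        d-at = trans (ag 25 tt 0) (Params.at-d ps₁)
        x₁ = τ 61 0 * τ 23 0 + τ 1 (τ 61 0)
        x₁≡ : x₁ ≡ toℕ vi * N + w vi
        x₁≡ = cong₂ _+_ (cong₂ _*_ t61 (trans (ag 23 tt 0) (Params.at-N ps₁))) w-at
        B : Table
        B = table (((((τ [ 60 , 0 ↦ x₁ ]) [ 40 , x₁ ↦ 1 ]) [ 41 , x₁ ↦ τ 2 (τ 61 0) ]) [ 42 ,
          x₁ ↦ τ 10 (τ 61 0) ]) [ 43 , x₁ ↦ 0 ])
        oth : ∀ j → j ≢ toℕ vi * N + w vi → B j ≡ table τ j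
        oth j ne = let ne′ = λ e → ne (trans (sym e) x₁≡) in cell-≡ (if-other ne′) (if-other ne′)
          (if-other ne′) (if-other ne′)
        new : B (toℕ vi * N + w vi) ≡ single vi
        new = cell-≡ (if-same x₁≡)
          (trans (if-same x₁≡) (trans (cong (τ 2) t61)
              (trans (ag 2 tt _) (trans (ag₁ 2 tt _) (at-s vi)))))
          (trans (if-same x₁≡) (trans (cong (τ 10) t61)
              (trans (ag 10 tt _) (trans (ag₁ 10 tt _) (at-pow vi)))))
          (if-same x₁≡)
        entered : w vi ≤ u → InitInv (suc i) B
        entered w≤ = OnlyAt-same {table τ} {B} {3 + n} (same (3 + n) (≢-sym (<⇒≢ (v<3+n vi)))) z<s
          only ,
          Off-same {table τ} {B} {2 + n} (same (2 + n) (≢-sym (<⇒≢ (≤-trans (toℕ<n vi) (m≤n+m n 2)))))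
              off2 ,
          (λ v le → Off-same {table τ} {B} {toℕ v}
              (same (toℕ v) (λ e → <⇒≢ le (trans (sym toℕ-vi) (sym e)))) (rest v (<⇒≤ le))) ,
          λ v lt → [ (λ lt′ → [ (λ (a , b) →
              inj₁ (a , OnlyAt-same {table τ} {B} {toℕ v}
              (same (toℕ v) (λ e → <⇒≢ lt′ (trans e toℕ-vi))) (w<N a) b)) ,
                                (λ (a , b) → inj₂ (a , Off-same {table τ} {B} {toℕ v}
                                    (same (toℕ v) (λ e → <⇒≢ lt′ (trans e toℕ-vi))) b)) ]′ (done v lt′))
                                    ,
                     (λ e → inj₁ (subst (λ z → w z ≤ u × OnlyAt B (toℕ z) (w z) (single z)) (at-i v e)
                               (w≤ , only-at {table τ} {B} {toℕ vi} (rest vi (≤-reflexive (sym toℕ-vi)))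
                                   oth new))) ]′ (m≤n⇒m<n∨m≡n (s≤s⁻¹ lt))
          where
          same : ∀ a → a ≢ toℕ vi → SameSlot a (table τ) B
          same a ne i i<N = oth _ (slot-apart ne i<N (w<N w≤))

  state₀ : ∀ {A} → InitInv n A → State 0 A
  state₀ {A} ((id0 , idoff) , off2 , _ , done) = record
    { id-table = record
        { only = λ k ω k≤ w≤ on → only k ω k≤ w≤ on
        ; some = id0 }
    ; fin-off = λ i i<N on → on (off2 i i<N)
    ; tables = λ v _ → [ (λ (w≤ , oa) → tab v w≤ oa) , (λ (nw , off) → none v nw off) ]′
      (done v (toℕ<n v)) }
    where
    only : ∀ k ω → k ≤ p → ω ≤ u → On (at A ((3 + n) * N) k ω) → at A ((3 + n) * N) k ω ≡ cell 1 0 0 0 ×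
        k ≡ 0 × ω ≡ 0
    only k ω k≤ w≤ on with ix u k ω ≟ℕ 0
    ... | no ne = contradiction (idoff (ix u k ω) (ix<N k≤ w≤) ne) on
    ... | yes eq = trans (cong (λ z → A ((3 + n) * N + z)) eq) id0 , ix-injective k 0 w≤ z≤n eq
    module _ (v : Fin n) {d} (F : Feasible P I t d) where
      open Optimal P I t D F
      k-single : kOf (own 0) (v ∷ []) (d v) ≡ 0
      k-single = ∑-zero go
        where
        go : ∀ i → (1 ∸ δ i (d v)) * mem (v ∷ []) (rep i) ≡ 0
        go i with rep i Finₚ.≟ v
        ... | yes refl rewrite sym (d-rep i) | d-rep (d (rep i)) | δ-refl (d (rep i)) = refl
        ... | no ne = *-zeroʳ (1 ∸ δ i (d v))
      y-single : ∀ y → yOf y (own 0) (v ∷ []) (d v) ≡ y v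
      y-single y = trans (∑-cong go) (∑-δ v y)
        where
        go : ∀ x → mem (v ∷ []) x * (δ (d x) (d v) * y x) ≡ δ x v * y x
        go x with x Finₚ.≟ v
        ... | yes refl rewrite δ-refl (d x) = trans (+-identityʳ _) refl
        ... | no ne = refl
      sealed₀ : Sealed (own 0) (v ∷ []) (d v)
      sealed₀ x x′ (here refl) ne eq = contradiction refl ne
      w≤u : w v ≤ u
      w≤u = subst (_≤ u) (y-single w) (wOf≤u {own 0} {v ∷ []})
    tab : ∀ v → w v ≤ u → OnlyAt A (toℕ v) (w v) (single v) → Tables-at 0 A v
    tab v w≤ (eq , off) = record
      { sound = snd
      ; best = λ {d} F → Dom-≡ (sym (k-single v F)) (sym (y-single v F w)) (sym (y-single v F s))
             (dom z≤n w≤ (subst On (sym eq) λ ()) (subst (λ c → AtLeast P (size c) (s v)) (sym eq)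
                 (AtLeast-refl P))) ,
           sealed₀ v F }
      where
      snd : Sound (Raw (V 0 (v ∷ [])) v) A (toℕ v * N)
      snd k ω k≤ ω≤ on with ix u k ω ≟ℕ w v
      ... | no ne = contradiction (off (ix u k ω) (ix<N k≤ ω≤) ne) on
      ... | yes e with ix-injective k 0 ω≤ w≤ e
      ...   | refl , refl = subst (λ c → Raw (V 0 (v ∷ [])) v 0 (w v) (size c) (mask c) (hist c))
          (sym eq)
                (reindex (λ x e → here e) (λ x → ∈-single) (raw-single v))
    none : ∀ v → ¬ w v ≤ u → Off A (toℕ v) → Tables-at 0 A v
    none v nw off = record
      { sound = λ k ω k≤ ω≤ on → contradiction (off (ix u k ω) (ix<N k≤ ω≤)) on
      ; best = λ F → contradiction (w≤u v F) nw }

module Verdict (P : Problem) (I : Instance) (t : ℕ) (D : Decomposition (Instance.graph I))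
               (Dm : ℕ) (blk≤ : ∀ v → length (Decomposition.blk D v) ≤ Dm) (1≤Dm : 1 ≤ Dm) where
  open Instance I
  open Graph graph
  open Slots P n l u p (∑ s) t
  open Codes P I t
  open Decomposition D
  open Own D
  open Chains P I t D
  open Blocks P I t D using (U; unit≤U)
  open BlockStep P I t D
  open Decide P I t D

  S₁ : ℕ
  S₁ = suc (Dm * suc unit)

  len : ℕ → ℕ
  len j = length (blk (key j))

  gather : ℕ → List (Fin n)
  gather zero    = []
  gather (suc j) = blk (key j) ++ gather j

  gather-in : ∀ J {x} → x ∈ gather J → ∃[ j ] j < J × x ∈ blk (key j)
  gather-in (suc J) i with ∈-++⁻ (blk (key J)) i
  ... | inj₁ k = J , ≤-refl , k
  ... | inj₂ k = let j , j< , k′ = gather-in J k in j , m≤n⇒m≤1+n j< , k′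

  gather-unique : ∀ J → J ≤ n → Unique (gather J)
  gather-unique zero _ = []
  gather-unique (suc J) J<n = unique-++ (unique (key J)) (gather-unique J (<⇒≤ J<n)) λ i k →
    let j , j<J , k′ = gather-in J k
        eq : num (key J) + suc j ≡ n
        eq = trans (cong (λ z → num z + suc j) (disjoint i k′)) (num-key (<-trans j<J J<n))
    in <⇒≢ j<J (suc-injective (+-cancelˡ-≡ (num (key J)) _ _ (trans eq (sym (num-key J<n)))))

  gather-length : ∀ J → length (gather J) ≡ sumTo J len
  gather-length zero = refl
  gather-length (suc J) = trans (length-++ (blk (key J))) (cong (len J +_) (gather-length J))

  sum-len : ∀ J → J ≤ n → sumTo J len ≤ n
  sum-len J J≤n = subst (_≤ n) (gather-length J) (unique-length (gather-unique J J≤n))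

  X : ℕ → ℕ
  X j = suc (len j) * S₁

  sum-X : ∀ J → sumTo J (λ j → suc (X j)) ≤ (2 * J + sumTo J len) * S₁
  sum-X zero = z≤n
  sum-X (suc J) = ≤-trans (+-mono-≤ (s≤s {n = Dm * suc unit + suc (len J) * S₁}
    (m≤n+m _ (Dm * suc unit))) (sum-X J))
    (≤-reflexive (lem S₁ (len J) J (sumTo J len)))
    where
    lem : ∀ s a j b → s + (1 + a) * s + (2 * j + b) * s ≡ (2 * (1 + j) + (a + b)) * s
    lem = solve-∀

  Z : ℕ
  Z = 5 * (n * S₁)

  1≤n : 1 ≤ n
  1≤n = ≤-trans 0<p p≤n

  nS≤Z : ∀ {k} → k ≤ 5 → k * (n * S₁) ≤ Z
  nS≤Z k≤ = *-monoˡ-≤ (n * S₁) k≤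

  S≤Z : S₁ ≤ Z
  S≤Z = ≤-trans (≤-trans (≤-reflexive (sym (*-identityˡ S₁))) (*-monoˡ-≤ S₁ 1≤n))
          (≤-trans (≤-reflexive (sym (*-identityˡ (n * S₁)))) (nS≤Z (s≤s z≤n)))

  unit≤S : unit ≤ S₁
  unit≤S = ≤-trans (≤-trans (n≤1+n unit) (≤-trans (≤-reflexive (sym (*-identityˡ (suc unit))))
    (*-monoˡ-≤ (suc unit) 1≤Dm))) (n≤1+n _)

  init≤Z : (4 + n) * N ≤ Z
  init≤Z = ≤-trans (*-mono-≤ (≤-trans (+-monoˡ-≤ n (*-monoʳ-≤ 4 1≤n)) (≤-reflexive (lem n)))
    (≤-trans (m≤m*n N (suc (N * 1))) unit≤S)) (≤-reflexive (*-assoc 5 n S₁))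
    where
    lem : ∀ n → 4 * n + n ≡ 5 * n
    lem = solve-∀

  sweep≤Z : sumTo (n ∸ 1) (λ j → suc (X j)) ≤ Z
  sweep≤Z = ≤-trans (sum-X (n ∸ 1)) (≤-trans
    (*-monoˡ-≤ S₁ (+-mono-≤ (*-monoʳ-≤ 2 (m∸n≤m n 1)) (sum-len (n ∸ 1) (m∸n≤m n 1))))
    (≤-trans (≤-reflexive (lem n S₁)) (nS≤Z (≤ᵇ⇒≤ 3 5 tt))))
    where
    lem : ∀ n s → (2 * n + n) * s ≡ 3 * (n * s)
    lem = solve-∀

  sweepE : ∀ {σ} → InitInv n (table σ) → Params σ → Stored D σ →
           Exec (sumTo (n ∸ 1) (λ j → suc (X j))) (sweep P) σ 4600 (λ τ → State (n ∸ 1) (table τ))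
  sweepE {σ} inv ps st = weaken tt $ forΣ (n ∸ 1) X (λ j τ → State j (table τ)) {tt}
    (λ τ ag → cong (_∸ 1) (trans (ag 0 tt 0) (Params.at-n ps)))
    (state₀ inv)
    (λ j τ j< ag tj state →
      let j<n = ≤-trans j< (m∸n≤m n 1)
          ps′ = Params-agree {sweep P} ag ps
          st′ = Stored-agree {D = D} {sweep P} ag st
          e63 : τ 14 (τ 0 0 ∸ (1 + τ 68 0)) ≡ toℕ (key j)
          e63 = trans (cong (τ 14) (cong₂ (λ x y → x ∸ suc y) (Params.at-n ps′) tj))
            (Stored.at-ord st′ (∸-monoʳ-< {n} z<s j<n))
          elen : τ 20 (τ 14 (τ 0 0 ∸ (1 + τ 68 0))) ≡ len j
          elen = trans (cong (τ 20) e63) (Stored.at-len st′ (key j))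
      in seqE (writeE (condE
           (λ g → mapE (λ υ q x → q) (blockE j<n (occupied (blk (key j)) refl (λ z → g (trans elen z)))
               Dm (blk≤ (key j)) 1≤Dm state
                     (same-params refl refl refl refl refl refl ps′) (record { Stored st′ }) e63))
           (λ g → skipE (λ x → skip-step {j} (vacant (blk (key j)) refl (trans (sym elen) g)) state)))))
    where
    occupied : ∀ {v} L → L ≡ blk v → length L ≢ 0 → v ∈ blk v
    occupied [] e ne = contradiction refl ne
    occupied (x ∷ L) e ne = key∈ (subst (x ∈_) e (here refl))
    vacant : ∀ {v} L → L ≡ blk v → length L ≡ 0 → blk v ≡ []
    vacant [] e _ = sym e

  own-final : ∀ x → own (n ∸ 1) x ≡ root
  own-final x with own (n ∸ 1) x Finₚ.≟ root
  ... | yes e = e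
  ... | no ne with cover ne
  ...   | v , i = contradiction i (live-own (m∸n≤m n 1) x v (≤-trans (≤-reflexive (sym (m+[n∸m]≡n 1≤n)))
      (+-monoˡ-≤ (n ∸ 1) (n≢0⇒n>0 λ z →
            nonroot (key∈ i) (num-injective (trans z (sym num-root)))))))

  Spanning : Pred5
  Spanning = Offered (λ _ → ⊤) root

  Result : Table → Set
  Result A = Sound Spanning A ((2 + n) * N) × (∀ {d} → Feasible P I t d → On (at A ((2 + n) * N) p 0))

  decideE : ∀ {σ} → Params σ → Weighted I σ → Stored D σ →
      Exec Z (decide P) σ 6000 (λ τ → Result (table τ))
  decideE {σ} ps ws st = weaken tt $ seqE $ agreeMap (λ υ₁ ag₁ inv → seqE $
      agreeMap (λ υ₂ ag₂ state → step₂ υ₂ (Params-agree {sweep P} ag₂ (Params-agree {init} ag₁ ps))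
        (Stored-agree {D = D} {sweep P} ag₂ (Stored-agree {D = D} {init} ag₁ st)) state) $
      scale sweep≤Z $ sweepE inv (Params-agree {init} ag₁ ps) (Stored-agree {D = D} {init} ag₁ st)) $
    scale init≤Z $ initE ps ws
    where
    step₂ : ∀ υ₂ → Params υ₂ → Stored D υ₂ → State (n ∸ 1) (table υ₂) →
            Exec Z (mergeInto P (slotE (read 14 (lit 0))) (slotE slotX) slotFin
                (op add (lit 1) (read 14 (lit 0)))) υ₂ _ (λ τ → Result (table τ))
    step₂ υ₂ ps₂ st₂ state = mapE fin $ scale (≤-trans unit≤S S≤Z) $
      intoE {a = toℕ root} {b = 3 + n} {c = 2 + n} {e = suc (toℕ root)} {Q = Spanning}
        (<⇒≢ (≤-trans (toℕ<n root) (m≤n+m n 2))) (≢-sym (<⇒≢ ≤-refl)) comb ps₂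
        (cong₂ _*_ e14 (Params.at-N ps₂)) (cong₂ _*_ (cong (3 +_) (Params.at-n ps₂)) (Params.at-N ps₂))
        (cong₂ _*_ (cong (2 +_) (Params.at-n ps₂)) (Params.at-N ps₂)) (cong suc e14)
      where
      open State state
      A = table υ₂
      last = n ∸ 1
      e14 : υ₂ 14 0 ≡ toℕ root
      e14 = trans (Stored.at-ord st₂ 1≤n) (cong toℕ (trans (cong ord (sym num-root)) (ord-num root)))
      tr : Tables-at last A root
      tr = tables root (λ v d → root∉)
      comb : Combine Spanning A (toℕ root) (3 + n) (suc (toℕ root))
      comb k≤ w≤ k′≤ w′≤ onX onY w+≤ k+< =
        let R = raw-join (λ x _ → nil∉) (λ x i → ⊥-elim (nil∉ i)) (λ x _ → tt)
              (λ x _ → inj₁ (here (own-final x))) k+<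
                  (Tables-at.sound tr _ _ k≤ w≤ onX) (id-sound {A} {V last []} {root} id-table
                      (λ x → nil∉) _ _ k′≤ w′≤ onY)
        in raw⇒offered R , λ _ l≤ fit → offered-close l≤ w+≤ fit R
      fin : ∀ υ → Others (2 + n) A (table υ) ×
          (Sound Spanning A ((2 + n) * N) → Sound Spanning (table υ) ((2 + n) * N)) ×
            (∀ {k ω z} → Dom A ((2 + n) * N) k ω z → Dom (table υ) ((2 + n) * N) k ω z) ×
            Complete A (table υ) (toℕ root) (3 + n) (2 + n) (suc (toℕ root)) → Result (table υ)
      fin υ (_ , snd , _ , cmp) = snd (λ k ω k≤ w≤ on →
        contradiction on (fin-off (ix u k ω) (ix<N k≤ w≤))) , complete
        where
        complete : ∀ {d} → Feasible P I t d → On (at (table υ) ((2 + n) * N) p 0)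
        complete {d} F = subst (λ k → On (at (table υ) ((2 + n) * N) k 0)) all-k (Dom.on (proj₂ y (λ ())
            (subst (l ≤_) (sym (yOf-whole w {own last} {root ∷ []} whole))
                (IsBoundedPartition.lower (Feasible.partition F) (d root)))
            (subst (Fits P (∑ s) t) (sym (yOf-whole s {own last} {root ∷ []} whole))
                (Feasible.fit F (d root)))))
          where
          open Optimal P I t D F
          whole : ∀ x → d x ≡ d root → own last x ∈ root ∷ []
          whole x _ = here (own-final x)
          y : Yields (table υ) ((2 + n) * N) (suc (toℕ root)) (kOf (own last) (root ∷ []) (d root))
              (yOf w (own last) (root ∷ []) (d root)) (yOf s (own last) (root ∷ []) (d root))
          y = merge-step {table υ} {(2 + n) * N} {suc (toℕ root)} {own last} {root ∷ []} {[]}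
            {root ∷ []}
                (λ z → sym (+-identityʳ (mem (root ∷ []) z)))
                (cmp (proj₁ (Tables-at.best tr F)) (dom-nil F {A} {(3 + n) * N} {own last} {d root}
                    (id-dom id-table)))
          all-k : suc (kOf (own last) (root ∷ []) (d root)) ≡ p
          all-k = trans (cong (_+ kOf (own last) (root ∷ []) (d root)) (sym (∑-δ1 (d root))))
            (trans (sym (∑-+ (λ i → δ i (d root)) (λ i → (1 ∸ δ i (d root)) * mem (root ∷ [])
                (own last (rep i)))))
            (trans (∑-cong go) (∑-const1 p)))
            where
            go : ∀ i → δ i (d root) + (1 ∸ δ i (d root)) * mem (root ∷ []) (own last (rep i)) ≡ 1
            go i rewrite mem-yes {L = root ∷ []} (here (own-final (rep i))) with i Finₚ.≟ d root
            ... | yes _ = refl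
            ... | no _ = refl

-- Reading off a partition

∑-toℕ : ∀ n (g : ℕ → ℕ) → ∑ {n} (λ x → g (toℕ x)) ≡ sumTo n g
∑-toℕ zero g = refl
∑-toℕ (suc n) g = trans (cong (g 0 +_) (∑-toℕ n (λ k → g (suc k))))
  (trans (cong (_+ sumTo n (λ k → g (suc k))) (sym (+-identityʳ (g 0)))) (sym (sumTo-split g 1 n)))

sumTo-mono : ∀ g {i j} → i ≤ j → sumTo i g ≤ sumTo j g
sumTo-mono g {i} {j} i≤j = subst (λ z → sumTo i g ≤ sumTo z g) (m+[n∸m]≡n i≤j)
  (subst (sumTo i g ≤_) (sym (sumTo-split g i (j ∸ i))) (m≤m+n _ _))

sumTo-hit : ∀ (g : ℕ → ℕ) → (∀ k → g k ≤ 1) → ∀ k {m} → m < sumTo k g → ∃[ i ] i < k × g i ≡ 1 ×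
    sumTo i g ≡ m
sumTo-hit g g≤1 (suc k) {m} m< with m <? sumTo k g
... | yes lt = let i , i<k , gi , e = sumTo-hit g g≤1 k lt in i , m≤n⇒m≤1+n i<k , gi , e
... | no ge with g k in eq | g≤1 k
...   | zero | _ = contradiction m< ge
...   | suc zero | _ = k , ≤-refl , eq , ≤-antisym (≮⇒≥ ge) (s≤s⁻¹ m<)
...   | suc (suc _) | s≤s ()

horner : ℕ → (ℕ → ℕ) → ℕ → ℕ → ℕ
horner b g k zero    = 0
horner b g k (suc d) = g k + b * horner b g (suc k) d

horner-enc : ∀ {n} b (g : ℕ → ℕ) k (f : Fin n → ℕ) → (∀ x → g (k + toℕ x) ≡ f x) → enc b f ≡
    horner b g k n
horner-enc {zero}  b g k f h = refl
horner-enc {suc n} b g k f h = cong₂ (λ x y → x + b * y)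
  (sym (trans (cong g (sym (+-identityʳ k))) (h zero)))
  (horner-enc b g (suc k) (f ∘ suc) λ x → trans (cong g (sym (+-suc k (toℕ x)))) (h (suc x)))

cellFin : Exp
cellFin = op add slotFin (var 24)

base : Exp
base = op add (lit 1) (read 0 (lit 0))

peel readOff : Program
peel = for 72 (read 0 (lit 0)) (
  write 30 (var 72) (modE (var 70) base) ⨟ set 70 (op div (var 70) base) ⨟
  cond (op equal (read 30 (var 72)) (op add (lit 1) (var 72)))
    (write 31 (var 72) (var 71) ⨟ set 71 (op add (lit 1) (var 71))) skip)
readOff =
  set 70 (read 43 cellFin) ⨟ set 71 (lit 0) ⨟ peel ⨟
  for 72 (read 0 (lit 0)) (write 6 (var 72) (read 31 (op sub (read 30 (var 72)) (lit 1)))) ⨟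
  set 5 (lit 1)

module ReadOff (P : Problem) (I : Instance) (t : ℕ) (root : Fin (Instance.n I)) where
  open Instance I
  open Graph graph
  open Codes P I t

  module _ {z m h} (O : Offered (λ _ → ⊤) root p 0 z m h) where
    private
      f : Fin n → Code n
      f = proj₁ O
      module O = Offer (proj₂ O)

    isClosed′ : ∀ x → ∃[ i ] f x ≡ closed i
    isClosed′ x with f x in eq
    ... | out = contradiction eq (O.covers x tt)
    ... | open′ = contradiction (O.unfinished x eq) (<-irrefl refl)
    ... | closed i = i , refl

    top : Fin n → Fin n
    top x = proj₁ (isClosed′ x)

    f-top : ∀ x → f x ≡ closed (top x)
    f-top x = proj₂ (isClosed′ x)

    top-≡ : ∀ {x i} → f x ≡ closed i → top x ≡ i
    top-≡ {x} e = closed-injective (trans (sym (f-top x)) e)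

    top-top : ∀ x → top (top x) ≡ top x
    top-top x = top-≡ (proj₁ (O.closed-conn x (top x) (f-top x)))

    digit : ℕ → ℕ
    digit k with k <? n
    ... | yes lt = suc (toℕ (top (fromℕ< lt)))
    ... | no _ = 0

    digit-toℕ : ∀ x → digit (toℕ x) ≡ suc (toℕ (top x))
    digit-toℕ x with toℕ x <? n
    ... | yes lt = cong (suc ∘′ toℕ ∘′ top) (fromℕ<-toℕ x lt)
      where open import Function.Base using (_∘′_)
    ... | no ge = contradiction (toℕ<n x) ge

    digit≤n : ∀ k → digit k < suc n
    digit≤n k with k <? n
    ... | yes lt = s≤s (toℕ<n (top (fromℕ< lt)))
    ... | no _ = z<s

    isTop : ℕ → ℕ
    isTop k = fromBool (digit k ≡ᵇ suc k)

    isTop≤1 : ∀ k → isTop k ≤ 1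
    isTop≤1 k with digit k ≡ᵇ suc k
    ... | true = ≤-refl
    ... | false = z≤n

    isTop-yes : ∀ {x} → top x ≡ x → isTop (toℕ x) ≡ 1
    isTop-yes {x} e rewrite digit-toℕ x | e | ≡ᵇ-refl (toℕ x) = refl

    isTop-no : ∀ {k} → isTop k ≢ 0 → digit k ≡ suc k
    isTop-no {k} ne = equal≢0 {digit k} ne

    rank : ℕ → ℕ
    rank k = sumTo k isTop

    rank-n : rank n ≡ p
    rank-n = trans (sym (∑-toℕ n isTop)) (trans (∑-cong go) O.count)
      where
      go : ∀ x → isTop (toℕ x) ≡ isClosed x (f x)
      go x with top x Finₚ.≟ x
      ... | yes e = trans (isTop-yes e)
          (sym (trans (cong (isClosed x) (trans (f-top x) (cong closed e))) (δ-refl x)))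
      ... | no ne = trans no′ (sym (trans (cong (isClosed x) (f-top x)) (δ-other ne)))
        where
        no′ : isTop (toℕ x) ≡ 0
        no′ rewrite digit-toℕ x | ≢⇒≡ᵇ (ne ∘ toℕ-injective) = refl

    rank-< : ∀ {x} → top x ≡ x → ∀ {k} → toℕ x < k → rank (toℕ x) < rank k
    rank-< {x} e lt = ≤-trans (≤-reflexive (cong (_+ rank (toℕ x)) (sym (isTop-yes e))))
      (sumTo-mono isTop lt)

    rank-p : ∀ x → rank (toℕ (top x)) < p
    rank-p x = subst (rank (toℕ (top x)) <_) rank-n (rank-< (top-top x) (toℕ<n (top x)))

    rank-injective : ∀ {x y} → top x ≡ x → top y ≡ y → rank (toℕ x) ≡ rank (toℕ y) → x ≡ y
    rank-injective {x} {y} ex ey eq with <-cmp (toℕ x) (toℕ y)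
    ... | tri< lt _ _ = contradiction eq (<⇒≢ (rank-< ex lt))
    ... | tri≈ _ e _ = toℕ-injective e
    ... | tri> _ _ gt = contradiction (sym eq) (<⇒≢ (rank-< ey gt))

    labelling : Labelling
    labelling x = fromℕ< (rank-p x)

    labelling-toℕ : ∀ x → toℕ (labelling x) ≡ rank (toℕ (top x))
    labelling-toℕ x = toℕ-fromℕ< (rank-p x)

    leader : ∀ i → ∃[ v ] top v ≡ v × labelling v ≡ i
    leader i with sumTo-hit isTop isTop≤1 n (subst (toℕ i <_) (sym rank-n) (toℕ<n i))
    ... | k , k<n , e , r = v , tv , toℕ-injective
        (trans (labelling-toℕ v) (trans (cong (rank ∘ toℕ) tv) (trans (cong rank (toℕ-fromℕ< k<n)) r)))
      where
      v = fromℕ< k<n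
      tv : top v ≡ v
      tv = toℕ-injective (suc-injective
        (trans (sym (digit-toℕ v)) (isTop-no {toℕ v}
        (λ z → 1+n≢0 (trans (sym e) (trans (cong isTop (sym (toℕ-fromℕ< k<n))) z))))))

    fibre : ∀ {i v x} → top v ≡ v → labelling v ≡ i → labelling x ≡ i → f x ≡ closed v
    fibre {i} {v} {x} tv lv lx = trans (f-top x) (cong closed (rank-injective (top-top x) tv
      (trans (sym (labelling-toℕ x)) (trans (cong toℕ (trans lx (sym lv)))
          (trans (labelling-toℕ v) (cong (rank ∘ toℕ) tv))))))

    unfibre : ∀ {i v x} → top v ≡ v → labelling v ≡ i → f x ≡ closed v → labelling x ≡ i
    unfibre {i} {v} {x} tv lv fx = toℕ-injective
      (trans (labelling-toℕ x) (trans (cong (rank ∘ toℕ) (trans (top-≡ fx) (sym tv)))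
      (trans (sym (labelling-toℕ v)) (cong toℕ lv))))

    feasible : Feasible P I t labelling
    feasible = record
      { partition = record
        { nonempty = λ i → let v , _ , lv = leader i in v , lv
        ; connected = λ i {x} {y} lx ly → let v , tv , lv = leader i in
            Star.map (λ (a , b , c) → a , unfibre tv lv b , unfibre tv lv c)
              (proj₂ (O.closed-conn x v (fibre tv lv lx)) ◅◅
               Star.reverse (λ (a , b , c) → [ inj₂ , inj₁ ]′ a , c , b)
                   (proj₂ (O.closed-conn y v (fibre tv lv ly))))
        ; lower = λ i → let v , tv , lv = leader i in subst (l ≤_) (sym (sums w tv lv))
          (O.lower v (trans (f-top v) (cong closed tv)))
        ; upper = λ i → let v , tv , lv = leader i in subst (_≤ u) (sym (sums w tv lv))
          (O.upper v (trans (f-top v) (cong closed tv))) }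
      ; fit = λ i → let v , tv , lv = leader i in subst (Fits P (∑ s) t) (sym (sums s tv lv))
        (O.fits v (trans (f-top v) (cong closed tv))) }
      where
      sums : ∀ y {i v} → top v ≡ v → labelling v ≡ i → clusterSum y labelling i ≡
          ∑ (λ x → isClosed v (f x) * y x)
      sums y {i} {v} tv lv = trans (clusterSum-∑ I y labelling i) (∑-cong λ x → cong (_* y x) (go x))
        where
        go : ∀ x → δ (labelling x) i ≡ isClosed v (f x)
        go x with labelling x Finₚ.≟ i
        ... | yes e = sym (trans (cong (isClosed v) (fibre tv lv e)) (δ-refl v))
        ... | no ne = sym (trans (cong (isClosed v) (f-top x)) (δ-other λ e →
            ne (unfibre tv lv (trans (f-top x) (cong closed e)))))

    readOffE : ∀ {σ} → σ 0 0 ≡ n → eval (read 43 cellFin) σ ≡ h →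
               Exec n readOff σ 200 (λ τ → τ 5 0 ≡ 1 × (∀ v → τ 6 (toℕ v) ≡ toℕ (labelling v)))
    readOffE {σ} e0 eh = weaken tt $ seqE $ writeE $ seqE $ writeE $ seqE $ agreeMap step₁ $
      scale (≤-reflexive (*-identityʳ n)) $ forE n Inv {tt} (λ τ ag → trans (ag 0 tt 0) e0) inv₀ body
      where
      Inv : ℕ → Store → Set
      Inv k τ = (∃[ d ] k + d ≡ n × τ 70 0 ≡ horner (suc n) digit k d) × τ 71 0 ≡ rank k ×
                (∀ i → i < k → τ 30 i ≡ digit i) × (∀ i → i < k → digit i ≡ suc i → τ 31 i ≡ rank i)
      σ₀ : Store
      σ₀ = (σ [ 70 , 0 ↦ eval (read 43 cellFin) σ ]) [ 71 , 0 ↦ 0 ]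
      inv₀ : Inv 0 (σ₀ [ 72 , 0 ↦ 0 ])
      inv₀ = (n , refl , trans eh (trans (sym O.hist) (horner-enc (suc n) digit 0 (label ∘ f) λ x →
        trans (digit-toℕ x) (sym (cong label (f-top x)))))) ,
             refl , (λ _ ()) , λ _ ()
      extend : ∀ {a b g : ℕ → ℕ} {k} → (∀ i → i < k → a i ≡ g i) → b k ≡ g k →
          (∀ i → i ≢ k → b i ≡ a i) → ∀ i → i < suc k → b i ≡ g i
      extend old new oth i lt with m≤n⇒m<n∨m≡n (s≤s⁻¹ lt)
      ... | inj₁ lt′ = trans (oth i (<⇒≢ lt′)) (old i lt′)
      ... | inj₂ refl = new
      extend′ : ∀ {a b : ℕ → ℕ} {k} → (∀ i → i < k → digit i ≡ suc i → a i ≡ rank i) →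
          (digit k ≡ suc k → b k ≡ rank k) → (∀ i → i ≢ k → b i ≡ a i) →
                ∀ i → i < suc k → digit i ≡ suc i → b i ≡ rank i
      extend′ old new oth i lt e with m≤n⇒m<n∨m≡n (s≤s⁻¹ lt)
      ... | inj₁ lt′ = trans (oth i (<⇒≢ lt′)) (old i lt′ e)
      ... | inj₂ refl = new e
      shape : ∀ k d → horner (suc n) digit k (suc d) ≡ horner (suc n) digit (suc k) d * suc n + digit k
      shape k d = trans (+-comm (digit k) _) (cong (_+ digit k) (*-comm (suc n) _))
      body : ∀ k τ → k < n → Agree peel σ₀ τ → τ 72 0 ≡ k → Inv k τ →
          Exec 0 _ τ _ (λ υ → ∀ x → Inv (suc k) (υ [ 72 , 0 ↦ x ]))
      body k τ k<n ag tk ((zero , ed , eH) , _) = contradiction (trans (sym (+-identityʳ k)) ed)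
        (<⇒≢ k<n)
      body k τ k<n ag tk ((suc d , ed , eH) , ec , e30 , e31) = seqE $ writeE $ seqE $ writeE $ condE
        (λ g → seqE $ writeE $ writeE λ x → rest ,
            trans (cong suc ec) (sym (cong (_+ rank k) (is1 (digit-k g)))) , d30 ,
            extend′ {τ 31} e31 (λ _ → trans (if-same tk) ec)
                (λ i ne → if-other (λ e → ne (trans (sym e) tk))))
        (λ g → skipE λ x → rest , trans ec (sym (cong (_+ rank k) (is0 (no-digit g)))) , d30 ,
            extend′ {τ 31} e31 (λ e → contradiction e (no-digit g)) (λ i ne → refl))
        where
        bs : suc (τ 0 0) ≡ suc n
        bs = cong suc (trans (ag 0 tt 0) e0)
        mod-k : modulo (τ 70 0) (suc (τ 0 0)) ≡ digit k
        mod-k = trans (cong₂ modulo (trans eH (shape k d)) bs)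
          (modulo-ix n (horner (suc n) digit (suc k) d) (digit k) (digit≤n k))
        div-k : applyOp div (τ 70 0) (suc (τ 0 0)) ≡ horner (suc n) digit (suc k) d
        div-k = trans (cong₂ (applyOp div) (trans eH (shape k d)) bs)
          (divmod-unique n (horner (suc n) digit (suc k) d) (digit k) (digit≤n k))
        rest : ∃[ d ] suc k + d ≡ n × applyOp div (τ 70 0) (suc (τ 0 0)) ≡ horner (suc n) digit (suc k)
            d
        rest = d , trans (sym (+-suc k d)) ed , div-k
        x₀ : ℕ → ℕ
        x₀ i = if τ 72 0 ≡ᵇ i then modulo (τ 70 0) (suc (τ 0 0)) else τ 30 i
        d30 : ∀ i → i < suc k → x₀ i ≡ digit i
        d30 = extend {τ 30} e30 (trans (if-same tk) mod-k)
          (λ i ne → if-other (λ e → ne (trans (sym e) tk)))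
        here′ : x₀ (τ 72 0) ≡ digit k
        here′ = trans (if-same {τ 72 0} refl) mod-k
        digit-k : fromBool (x₀ (τ 72 0) ≡ᵇ suc (τ 72 0)) ≢ 0 → digit k ≡ suc k
        digit-k g = trans (sym here′) (trans (equal≢0 g) (cong suc tk))
        no-digit : fromBool (x₀ (τ 72 0) ≡ᵇ suc (τ 72 0)) ≡ 0 → digit k ≢ suc k
        no-digit g e = equal≡0 g (trans here′ (trans e (cong suc (sym tk))))
        is1 : digit k ≡ suc k → isTop k ≡ 1
        is1 e rewrite e | ≡ᵇ-refl k = refl
        is0 : digit k ≢ suc k → isTop k ≡ 0
        is0 ne rewrite ≢⇒≡ᵇ ne = refl
      step₁ : ∀ υ → Agree peel σ₀ υ → Inv n υ → Exec n _ υ _ _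
      step₁ υ ag (_ , _ , e30 , e31) = seqE $
        mapE (λ τ q → writeE (refl , λ v → q (toℕ v) (toℕ<n v) v refl)) $
        scale (≤-reflexive (*-identityʳ n)) $ forE n (λ k τ → ∀ i → i < k → ∀ v → toℕ v ≡ i → τ 6 i ≡
            toℕ (labelling v)) {tt}
          (λ τ ag′ → trans (ag′ 0 tt 0) (trans (ag 0 tt 0) e0)) (λ _ ())
          (λ k τ k<n ag′ tk inv → writeE λ x i lt →
              [ (λ lt′ v e → trans (if-other (λ e′ → <⇒≢ lt′ (trans (sym e′) tk))) (inv i lt′ v e)) ,
             (λ { refl v refl → trans (if-same tk)
                 (trans (cong (λ z → τ 31 (z ∸ 1))
                 (trans (cong (τ 30) tk) (trans (ag′ 30 tt _) (trans (e30 _ k<n) (digit-toℕ v)))))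
                 (trans (ag′ 31 tt _) (trans (e31 (toℕ (top v)) (toℕ<n (top v))
                     (trans (digit-toℕ (top v)) (cong (λ z → suc (toℕ z)) (top-top v))))
                     (sym (labelling-toℕ v))))) }) ]′
             (m≤n⇒m<n∨m≡n (s≤s⁻¹ lt)))

-- Bisection

probe search : Problem → Program
probe P = set 44 (op div (op add (var 45) (var 46)) (lit 2)) ⨟ decide P ⨟
  cond (read 40 cellFin) (set 46 (var 44)) (set 45 (op add (lit 1) (var 44)))
search P = set 45 (lit 0) ⨟ set 46 (var 22) ⨟ while (op less (var 45) (var 46)) (probe P) ⨟
  set 44 (var 45) ⨟ decide P ⨟ cond (read 40 cellFin) readOff skip

maximum-upper : ∀ {k} (f : Fin k → ℕ) i → f i ≤ maximum f
maximum-upper f zero = m≤m⊔n (f zero) _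
maximum-upper f (suc i) = ≤-trans (maximum-upper (f ∘ suc) i) (m≤n⊔m (f zero) _)

maximum-least : ∀ {k} (f : Fin k → ℕ) {m} → (∀ i → f i ≤ m) → maximum f ≤ m
maximum-least {zero}  f h = z≤n
maximum-least {suc k} f h = ⊔-lub (h zero) (maximum-least (f ∘ suc) (h ∘ suc))

foldr-⊓-lower : ∀ {k} (f : Fin k → ℕ) a → foldr _⊓_ a f ≤ a × (∀ i → foldr _⊓_ a f ≤ f i)
foldr-⊓-lower {zero}  f a = ≤-refl , λ ()
foldr-⊓-lower {suc k} f a = let p , q = foldr-⊓-lower (f ∘ suc) a in
  ≤-trans (m⊓n≤n (f zero) _) p , λ { zero → m⊓n≤m (f zero) _ ; (suc i) → ≤-trans (m⊓n≤n (f zero) _)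
      (q i) }

foldr-⊓-greatest : ∀ {k} (f : Fin k → ℕ) {a m} → m ≤ a → (∀ i → m ≤ f i) → m ≤ foldr _⊓_ a f
foldr-⊓-greatest {zero}  f h h′ = h
foldr-⊓-greatest {suc k} f h h′ = ⊓-glb (h′ zero) (foldr-⊓-greatest (f ∘ suc) h (h′ ∘ suc))

minimum-lower : ∀ {k} (f : Fin k → ℕ) i → minimum f ≤ f i
minimum-lower {suc k} f zero = proj₁ (foldr-⊓-lower (f ∘ suc) (f zero))
minimum-lower {suc k} f (suc i) = proj₂ (foldr-⊓-lower (f ∘ suc) (f zero)) i

minimum-greatest : ∀ {k} (f : Fin k → ℕ) {m} → 0 < k → (∀ i → m ≤ f i) → m ≤ minimum f
minimum-greatest {suc k} f _ h = foldr-⊓-greatest (f ∘ suc) (h zero) (h ∘ suc)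

clusterSum≤∑ : ∀ I y c i → Instance.clusterSum I y c i ≤ ∑ y
clusterSum≤∑ I y c i = ≤-trans (≤-reflexive (clusterSum-∑ I y c i)) (∑-mono λ x → δ* x)
  where
  δ* : ∀ x → δ (c x) i * y x ≤ y x
  δ* x with c x Finₚ.≟ i
  ... | yes _ = ≤-reflexive (+-identityʳ (y x))
  ... | no _ = z≤n

n<2^1+log : ∀ n → n < 2 ^ suc ⌊log₂ n ⌋
n<2^1+log n with n <? 2 ^ suc ⌊log₂ n ⌋
... | yes lt = lt
... | no ge = contradiction (≤-trans (≤-reflexive (sym (⌊log₂[2^n]⌋≡n (suc ⌊log₂ n ⌋))))
    (⌊log₂⌋-mono-≤ (≮⇒≥ ge))) 1+n≰n
  where open import Data.Nat.Logarithm using (⌊log₂[2^n]⌋≡n; ⌊log₂⌋-mono-≤)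

module Thresholds (P : Problem) (I : Instance) where
  open Instance I

  Solvable : ℕ → Set
  Solvable t = ∃[ d ] Feasible P I t d

  fits-mono : ∀ {t t′ z} P → t ≤ t′ → Fits P (∑ s) t z → Fits P (∑ s) t′ z
  fits-mono MinMax t≤ h = ≤-trans h t≤
  fits-mono {z = z} MaxMin t≤ h = ≤-trans h (+-monoʳ-≤ z t≤)

  solvable-mono : ∀ {t t′} → t ≤ t′ → Solvable t → Solvable t′
  solvable-mono t≤ (d , F) = d , record { partition = Feasible.partition F ; fit = λ i →
    fits-mono P t≤ (Feasible.fit F i) }

  solvable-top : ∀ {d} → IsBoundedPartition d → Solvable (∑ s)
  solvable-top {d} b = d , record { partition = b ; fit = λ i → go P i }
    where
    go : ∀ P i → Fits P (∑ s) (∑ s) (clusterSum s d i)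
    go MinMax i = clusterSum≤∑ I s d i
    go MaxMin i = m≤n+m (∑ s) _

  value : Problem → Labelling → ℕ
  value MinMax d = maximum (clusterSum s d)
  value MaxMin d = ∑ s ∸ minimum (clusterSum s d)

  solvable-value : ∀ {d} → IsBoundedPartition d → Solvable (value P d)
  solvable-value {d} b = d , record { partition = b ; fit = go P }
    where
    go : ∀ P i → Fits P (∑ s) (value P d) (clusterSum s d i)
    go MinMax i = maximum-upper (clusterSum s d) i
    go MaxMin i = ≤-trans (m≤n+m∸n (∑ s) (minimum (clusterSum s d)))
      (+-monoˡ-≤ _ (minimum-lower (clusterSum s d) i))

  optimal : ∀ {t c} → Feasible P I t c → (∀ t′ → t′ < t → ¬ Solvable t′) → IsOptimal P I c
  optimal {t} {c} F least = Feasible.partition F , λ d b →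
    go P d (Feasible.fit F) (≮⇒≥ (λ lt → least _ lt (solvable-value b)))
    where
    go : ∀ P d → (∀ i → Fits P (∑ s) t (clusterSum s c i)) → t ≤ value P d → AtLeastAsGood P I c d
    go MinMax d fit t≤ = ≤-trans (maximum-least (clusterSum s c) fit) t≤
    go MaxMin d fit t≤ = minimum-greatest (clusterSum s c) 0<p λ i →
      ≤-trans (≤-reflexive (sym (m∸[m∸n]≡n min≤))) (m≤n+o⇒m∸n≤o (∑ s) (∑ s ∸ minimum (clusterSum s d))
        (≤-trans (fit i) (≤-trans (+-monoʳ-≤ _ t≤) (≤-reflexive (+-comm (clusterSum s c i) _)))))
      where
      min≤ : minimum (clusterSum s d) ≤ ∑ s
      min≤ = ≤-trans (minimum-lower (clusterSum s d) (fromℕ< 0<p)) (clusterSum≤∑ I s d (fromℕ< 0<p))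

record Prepared (I : Instance) (D : Decomposition (Instance.graph I)) (σ : Store) : Set where
  open Instance I
  field
    at-n : σ 0 0 ≡ n
    at-l : σ 0 2 ≡ l
    at-S : σ 22 0 ≡ ∑ s
    at-N : σ 23 0 ≡ suc p * suc u
    at-q : σ 24 0 ≡ p * suc u
    at-d : σ 25 0 ≡ suc u
    at-5 : σ 5 0 ≡ 0
    weighted : Weighted I σ
    stored   : Stored D σ

module Bisection (P : Problem) (I : Instance) (D : Decomposition (Instance.graph I))
                 (Dm : ℕ) (blk≤ : ∀ v → length (Decomposition.blk D v) ≤ Dm) (1≤Dm : 1 ≤ Dm) where
  open Instance I
  open Thresholds P I
  module At (t : ℕ) where
    open Verdict P I t D Dm blk≤ 1≤Dm public
    open Slots P n l u p (∑ s) t public using (Params; N; at)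
  Z : ℕ
  Z = At.Z 0

  params : ∀ {σ} t → Prepared I D σ → σ 44 0 ≡ t → At.Params t σ
  params t pr e = record { Prepared pr ; at-t = e }

  prepared-agree : ∀ {σ τ} → Agree (decide P) σ τ → Prepared I D σ → Prepared I D τ
  prepared-agree ag pr = record
    { at-n = trans (ag 0 tt 0) at-n ; at-l = trans (ag 0 tt 2) at-l ; at-S = trans (ag 22 tt 0) at-S
    ; at-N = trans (ag 23 tt 0) at-N ; at-q = trans (ag 24 tt 0) at-q ; at-d = trans (ag 25 tt 0) at-d
    ; at-5 = trans (ag 5 tt 0) at-5
    ; weighted = record { at-w = λ v → trans (ag 1 tt _) (at-w v) ; at-s = λ v →
      trans (ag 2 tt _) (at-s v) ; at-pow = λ v → trans (ag 10 tt _) (at-pow v) }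
    ; stored = Stored-agree {D = D} {decide P} ag stored }
    where
    open Prepared pr
    open Weighted weighted

  prepared-set : ∀ {σ} k x → Prepared I D σ → Prepared I D (σ [ 44 + k , 0 ↦ x ])
  prepared-set k x pr = record
    { Prepared pr hiding (weighted; stored)
    ; weighted = record { Weighted (Prepared.weighted pr) } ; stored =
      record { Stored (Prepared.stored pr) } }

  final : ∀ {σ} → Prepared I D σ → eval cellFin σ ≡ (2 + n) * At.N 0 + ix u p 0
  final pr = cong₂ _+_ (cong₂ _*_ (cong (2 +_) at-n) at-N) (trans at-q (sym (+-identityʳ _)))
    where open Prepared pr

  probeE : ∀ {σ} → Prepared I D σ → ∀ t → σ 44 0 ≡ t →
           Exec Z (decide P) σ 6000 (λ τ → Agree (decide P) σ τ × Prepared I D τ ×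
               At.Result t (table τ))
  probeE pr t e = agreeMap (λ τ ag r → ag , prepared-agree ag pr , r)
    (At.decideE t (params t pr e) (Prepared.weighted pr) (Prepared.stored pr))

  positive : ∀ {t τ} → Prepared I D τ → At.Result t (table τ) → τ 40 (eval cellFin τ) ≢ 0 →
             Codes.Offered P I t (λ _ → ⊤) (Decomposition.root D) p 0 (τ 41 (eval cellFin τ))
                 (τ 42 (eval cellFin τ)) (τ 43 (eval cellFin τ))
  positive {t} {τ} pr (snd , _) on = go _ (final pr) on
    where
    go : ∀ i → i ≡ (2 + n) * At.N 0 + ix u p 0 → τ 40 i ≢ 0 → Codes.Offered P I t (λ _ → ⊤)
        (Decomposition.root D) p 0 (τ 41 i) (τ 42 i) (τ 43 i)
    go _ refl on = snd p 0 ≤-refl z≤n on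

  negative : ∀ {t τ} → Prepared I D τ → At.Result t (table τ) → τ 40 (eval cellFin τ) ≡ 0 → ¬ Solvable t
  negative {t} {τ} pr (_ , cmp) off (d , F) = cmp F (trans (cong (τ 40) (sym (final pr))) off)

  Bracket : ℕ → ℕ → Set
  Bracket lo hi = (∀ t → t < lo → ¬ Solvable t) × (∃ IsBoundedPartition → Solvable hi)

  Inv : ℕ → Store → Set
  Inv B τ = ∃[ k ] ∃[ lo ] ∃[ g ] B ≡ k * suc Z × τ 45 0 ≡ lo × τ 46 0 ≡ lo + g × g < 2 ^ k ×
    Prepared I D τ × Bracket lo (lo + g)

  Found : Store → Set
  Found τ = ∃[ lo ] τ 45 0 ≡ lo × Prepared I D τ × Bracket lo lo

  stepE : ∀ B σ → Inv B σ → (eval (op less (var 45) (var 46)) σ ≡ 0 × Found σ) ⊎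
            (eval (op less (var 45) (var 46)) σ ≢ 0 × ∃[ x ] ∃[ B′ ] suc x + B′ ≤ B ×
                Exec x (probe P) σ 6100 (Inv B′))
  stepE B σ (k , lo , zero , eB , e45 , e46 , _ , pr , br) =
    inj₁ (fromBool-<ᵇ-false (≤-reflexive (trans e46 (trans (+-identityʳ lo) (sym e45)))) , lo , e45 ,
        pr , subst (Bracket lo) (+-identityʳ lo) br)
  stepE B σ (zero , lo , suc g , eB , e45 , e46 , s≤s () , pr , br)
  stepE B σ (suc k , lo , g@(suc _) , eB , e45 , e46 , g< , pr , (below , above)) =
    inj₂ ((λ z → 1+n≢0 (trans (sym (fromBool-<ᵇ-true (subst₂ _<_ (sym e45) (sym e46) (m<m+n lo z<s))))
        z)) ,
      Z , k * suc Z , ≤-reflexive (sym eB) ,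
      weaken tt (seqE $ writeE $ seqE $ mapE (λ υ (ag , pr′ , res) → condE
        (λ on → writeE (k , lo , h , refl , trans (ag 45 tt 0) e45 , trans (ag 44 tt 0) mid , h< ,
            prepared-set 2 _ pr′ ,
              below , λ _ → _ , ReadOff.feasible P I (lo + h) (Decomposition.root D)
                  (positive pr′ res on)))
        (λ off → writeE (k , suc (lo + h) , g ∸ suc h , refl , cong suc (trans (ag 44 tt 0) mid) ,
            trans (ag 46 tt 0) (trans e46 (sym split-g)) , ≤-trans (s≤s rest≤) h< ,
              prepared-set 1 _ pr′ ,
              (λ t t< sol → negative pr′ res off (solvable-mono (s≤s⁻¹ t<) sol)) , λ b →
                  subst Solvable (sym split-g) (above b))))
        (probeE (prepared-set 0 _ pr) (lo + h) mid)))
    where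
    open import Data.Nat.DivMod using (m/n<m)
    h = g / 2
    g≡ : g ≡ g % 2 + h * 2
    g≡ = m≡m%n+[m/n]*n g 2
    mid : (σ 45 0 + σ 46 0) / 2 ≡ lo + h
    mid = trans (cong (_/ 2) (trans (cong₂ _+_ e45 e46)
      (trans (cong (λ z → lo + (lo + z)) g≡) (lem lo (g % 2) h))))
      (divmod-unique 1 (lo + h) (g % 2) (m%n<n g 2))
      where
      lem : ∀ a r h → a + (a + (r + h * 2)) ≡ (a + h) * 2 + r
      lem = solve-∀
    h< : h < 2 ^ k
    h< = *-cancelʳ-< 2 h (2 ^ k) (≤-trans (s≤s (≤-trans (m≤n+m (h * 2) (g % 2)) (≤-reflexive (sym g≡))))
      (≤-trans g< (≤-reflexive (*-comm 2 (2 ^ k)))))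
    h<g : suc h ≤ g
    h<g = m/n<m g 2 (s≤s (s≤s z≤n))
    split-g : suc (lo + h) + (g ∸ suc h) ≡ lo + g
    split-g = trans (cong (_+ (g ∸ suc h)) (sym (+-suc lo h)))
      (trans (+-assoc lo (suc h) _) (cong (lo +_) (m+[n∸m]≡n h<g)))
    rest≤ : g ∸ suc h ≤ h
    rest≤ = m≤n+o⇒m∸n≤o g (suc h) (≤-trans (≤-reflexive g≡)
      (≤-trans (+-monoˡ-≤ (h * 2) (s≤s⁻¹ (m%n<n g 2))) (≤-reflexive (lem h))))
      where
      lem : ∀ h → 1 + h * 2 ≡ suc h + h
      lem = solve-∀

  Y : ℕ
  Y = suc ⌊log₂ (∑ s ⊔ 2) ⌋ * suc Z

  Z≤Y : Z ≤ Y
  Z≤Y = ≤-trans (n≤1+n Z) (m≤m+n (suc Z) _)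

  n≤Y : n ≤ Y
  n≤Y = ≤-trans (≤-trans (m≤m*n n (At.S₁ 0)) (m≤m+n _ _)) Z≤Y

  searchE : ∀ {σ} → Prepared I D σ → Exec Y (search P) σ 13000 (λ τ → CorrectOutput P I τ)
  searchE {σ} pr = weaken tt $ seqE $ writeE $ seqE $ writeE $ seqE $
    mapE (λ υ (lo , e45 , pr′ , br) → finish υ lo e45 pr′ br) $
    whileE Inv stepE Y
      (suc ⌊log₂ (∑ s ⊔ 2) ⌋ , 0 , ∑ s , refl , refl , Prepared.at-S pr ,
       ≤-trans (s≤s (m≤m⊔n (∑ s) 2)) (n<2^1+log (∑ s ⊔ 2)) ,
       prepared-set 2 _ (prepared-set 1 _ pr) ,
       (λ _ ()) , λ (d , b) → solvable-top b)
    where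
    finish : ∀ υ lo → υ 45 0 ≡ lo → Prepared I D υ → Bracket lo lo →
        Exec Y _ υ _ (λ τ → CorrectOutput P I τ)
    finish υ lo e45 pr′ (below , above) = seqE $ writeE $ seqE $
      mapE (λ τ (ag , pr″ , res) → condE
        (λ on → let O = positive pr″ res on
                    open ReadOff P I lo (Decomposition.root D)
                in scale n≤Y (mapE (λ ω (e5 , e6) →
                    inj₂ (e5 , labelling O , optimal (feasible O) below , e6))
                     (readOffE O (Prepared.at-n pr″) refl)))
        (λ off → skipE (inj₁ (Prepared.at-5 pr″ , λ c b → negative pr″ res off (above (c , b)))))) $
      scale Z≤Y $ probeE (prepared-set 0 _ pr′) lo e45

-- Fundamental cycles

pairs-snoc : ∀ {A : Set} (zs : List A) {y z : A} {ab} → ab ∈ pairs (zs ++ y ∷ z ∷ []) →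
    ab ∈ pairs (zs ++ y ∷ []) ⊎ ab ≡ (y , z)
pairs-snoc [] (here refl) = inj₂ refl
pairs-snoc (x ∷ []) (here refl) = inj₁ (here refl)
pairs-snoc (x ∷ []) (there (here refl)) = inj₂ refl
pairs-snoc (x ∷ x′ ∷ zs) (here refl) = inj₁ (here refl)
pairs-snoc (x ∷ x′ ∷ zs) (there i) = [ inj₁ ∘ there , inj₂ ]′ (pairs-snoc (x′ ∷ zs) i)

snoc-pairs : ∀ {A : Set} (zs : List A) {y z : A} {ab} → ab ∈ pairs (zs ++ y ∷ []) →
    ab ∈ pairs (zs ++ y ∷ z ∷ [])
snoc-pairs (x ∷ []) (here refl) = here refl
snoc-pairs (x ∷ x′ ∷ zs) (here refl) = here refl
snoc-pairs (x ∷ x′ ∷ zs) (there i) = there (snoc-pairs (x′ ∷ zs) i)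

cyclicPairs-pairs : ∀ {A : Set} (x : A) zs → cyclicPairs (x ∷ zs) ≡ pairs (x ∷ zs ++ x ∷ [])
cyclicPairs-pairs x zs = go x x zs
  where
  go : ∀ {A : Set} (x y : A) zs → zip (x ∷ zs) (zs ∷ʳ y) ≡ pairs (x ∷ zs ++ y ∷ [])
  go x y [] = refl
  go x y (z ∷ zs) = cong ((x , z) ∷_) (go z y zs)

record SearchTree {n} (G : Graph n) : Set where
  open Graph G
  field
    root     : Fin n
    par      : Fin n → Fin n
    num      : Fin n → ℕ
    ord      : ℕ → Fin n
    num<n    : ∀ v → num v < n
    num-ord  : ∀ {i} → i < n → num (ord i) ≡ i
    ord-num  : ∀ v → ord (num v) ≡ v
    num-root : num root ≡ 0
    par<     : ∀ {v} → v ≢ root → num (par v) < num v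
    par-adj  : ∀ {v} → v ≢ root → Adj (par v) v

module Fundamental {n} {G : Graph n} (T : SearchTree G) where
  open SearchTree T
  open Graph G using (Adj)

  adj-sym : ∀ {x y} → Adj x y → Adj y x
  adj-sym = [ inj₂ , inj₁ ]′

  num-inj : ∀ {x y} → num x ≡ num y → x ≡ y
  num-inj {x} {y} eq = trans (sym (ord-num x)) (trans (cong ord eq) (ord-num y))

  above-root : ∀ {v k} → k < num v → v ≢ root
  above-root {k = k} lt refl = <⇒≱ (subst (k <_) num-root lt) z≤n

  -- The edges of the cycle that {q , y₀} closes with the search tree.
  data Link (q y₀ : Fin n) (mid : List (Fin n)) : Fin n × Fin n → Set where
    up    : ∀ {v} → v ∈ mid → Link q y₀ mid (v , par v)
    down  : ∀ {v} → v ∈ mid → Link q y₀ mid (par v , v)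
    chord : Link q y₀ mid (q , y₀)

  Link-⊆ : ∀ {q y₀ mid mid′ e} → (∀ {v} → v ∈ mid → v ∈ mid′) → Link q y₀ mid e → Link q y₀ mid′ e
  Link-⊆ f (up i) = up (f i)
  Link-⊆ f (down i) = down (f i)
  Link-⊆ f chord = chord

  -- Two pointers climb the search tree from q and y₀; mid is the path
  -- between them that has been passed over and κ its vertex visited first.
  record Walk (q y₀ x y κ : Fin n) (mid : List (Fin n)) : Set where
    field
      links  : ∀ {e} → e ∈ pairs (x ∷ mid ++ y ∷ []) → Link q y₀ mid e
      tree   : ∀ {v} → v ∈ mid → Linked v (par v) (x ∷ mid ++ y ∷ [])
      closes : (q , y₀) ∈ pairs (x ∷ mid ++ y ∷ [])
      x<     : ∀ {v} → v ∈ mid → num x < num v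
      y<     : ∀ {v} → v ∈ mid → num y < num v
      ≤q     : ∀ {v} → v ∈ mid → num v ≤ num q
      x≤q    : num x ≤ num q
      y≤q    : num y ≤ num q
      simple : Unique mid
      lowest : (mid ≡ [] × x ≡ q × y ≡ y₀) ⊎ (κ ∈ mid × (∀ {v} → v ∈ mid → num κ ≤ num v) ×
          (par κ ≡ x ⊎ par κ ≡ y))

  start : ∀ {q y₀ κ} → num y₀ ≤ num q → Walk q y₀ q y₀ κ []
  start le = record
    { links = λ { (here refl) → chord } ; tree = λ () ; closes = here refl ; x< = λ () ; y< = λ () ;
      ≤q = λ ()
    ; x≤q = ≤-refl ; y≤q = le ; simple = [] ; lowest = inj₁ (refl , refl , refl) }

  step-x : ∀ {q y₀ x y κ mid} → num y < num x → Walk q y₀ x y κ mid → Walk q y₀ (par x) y x (x ∷ mid)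
  step-x {x = x} {y} {mid = mid} lt W = record
    { links = λ { (here refl) → down (here refl) ; (there i) → Link-⊆ there (links i) }
    ; tree = λ { (here refl) → inj₂ (here refl) ; (there i) → [ inj₁ ∘ there ,
      inj₂ ∘ there ]′ (tree i) }
    ; closes = there closes
    ; x< = λ { (here refl) → px ; (there i) → <-trans px (x< i) }
    ; y< = λ { (here refl) → lt ; (there i) → y< i }
    ; ≤q = λ { (here refl) → x≤q ; (there i) → ≤q i }
    ; x≤q = ≤-trans (<⇒≤ px) x≤q ; y≤q = y≤q
    ; simple = All.tabulate (λ i → λ { refl → <-irrefl refl (x< i) }) ∷ simple
    ; lowest = inj₂ (here refl , (λ { (here refl) → ≤-refl ; (there i) → <⇒≤ (x< i) }) , inj₁ refl) }
    where
    open Walk W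
    px : num (par x) < num x
    px = par< (above-root lt)

  step-y : ∀ {q y₀ x y κ mid} → num x < num y → Walk q y₀ x y κ mid →
      Walk q y₀ x (par y) y (mid ++ y ∷ [])
  step-y {q} {y₀} {x} {y} {mid = mid} lt W = record
    { links = λ i → [ (λ k → Link-⊆ ∈-++ˡ (links k)) , (λ { refl → up (∈-++ʳ mid (here refl)) }) ]′
      (pairs-snoc (x ∷ mid) (subst (_ ∈_) shape i))
    ; tree = λ i → relink ([ (λ k → [ inj₁ ∘ snoc-pairs (x ∷ mid) , inj₂ ∘ snoc-pairs (x ∷ mid) ]′
      (tree k)) ,
                      (λ { (here refl) → inj₁ (last-pair (x ∷ mid)) }) ]′ (∈-++⁻ mid i))
    ; closes = subst (_ ∈_) (sym shape) (snoc-pairs (x ∷ mid) closes)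
    ; x< = λ i → [ x< , (λ { (here refl) → lt }) ]′ (∈-++⁻ mid i)
    ; y< = λ i → [ (λ k → <-trans py (y< k)) , (λ { (here refl) → py }) ]′ (∈-++⁻ mid i)
    ; ≤q = λ i → [ ≤q , (λ { (here refl) → y≤q }) ]′ (∈-++⁻ mid i)
    ; x≤q = x≤q ; y≤q = ≤-trans (<⇒≤ py) y≤q
    ; simple = unique-++ simple ([] ∷ []) λ { i (here refl) → <-irrefl refl (y< i) }
    ; lowest = inj₂ (∈-++ʳ mid (here refl) ,
      (λ i → [ <⇒≤ ∘ y< , (λ { (here refl) → ≤-refl }) ]′ (∈-++⁻ mid i)) , inj₂ refl) }
    where
    open Walk W
    py : num (par y) < num y
    py = par< (above-root lt)
    shape : pairs (x ∷ (mid ++ y ∷ []) ++ par y ∷ []) ≡ pairs (x ∷ mid ++ y ∷ par y ∷ [])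
    shape = cong (λ z → pairs (x ∷ z)) (++-assoc mid (y ∷ []) (par y ∷ []))
    relink : ∀ {a b} → Linked a b (x ∷ mid ++ y ∷ par y ∷ []) →
        Linked a b (x ∷ (mid ++ y ∷ []) ++ par y ∷ [])
    relink = [ inj₁ ∘ subst (_ ∈_) (sym shape) , inj₂ ∘ subst (_ ∈_) (sym shape) ]′
    last-pair : ∀ zs → (y , par y) ∈ pairs (zs ++ y ∷ par y ∷ [])
    last-pair zs = pairs-infix zs

  record Block (q y₀ κ : Fin n) (mid : List (Fin n)) : Set where
    cycle : List (Fin n)
    cycle = par κ ∷ mid ++ par κ ∷ []
    field
      links  : ∀ {e} → e ∈ pairs cycle → Link q y₀ mid e
      tree   : ∀ {v} → v ∈ mid → Linked v (par v) cycle
      closes : (q , y₀) ∈ pairs cycle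
      top<   : ∀ {v} → v ∈ mid → num (par κ) < num v
      ≤q     : ∀ {v} → v ∈ mid → num v ≤ num q
      simple : Unique mid
      κ∈     : κ ∈ mid
      κ≤     : ∀ {v} → v ∈ mid → num κ ≤ num v

    q∈ : q ∈ mid
    q∈ with pairs-left cycle closes
    ... | here refl = contradiction (≤q κ∈) (<⇒≱ (top< κ∈))
    ... | there i with ∈-++⁻ mid i
    ...   | inj₁ k = k
    ...   | inj₂ (here refl) = contradiction (≤q κ∈) (<⇒≱ (top< κ∈))

  finish : ∀ {q y₀ x κ mid} → num y₀ < num q → Walk q y₀ x x κ mid → Block q y₀ κ mid
  finish {x = x} {κ} lt W with Walk.lowest W
  ... | inj₁ (_ , refl , refl) = contradiction lt (<-irrefl refl)
  ... | inj₂ (κ∈ , κ≤ , top) with [ id , id ]′ top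
  ...   | refl = record { Walk W using (links; tree; closes; ≤q; simple) ; top< = Walk.x< W ; κ∈ = κ∈ ;
      κ≤ = κ≤ }

  bridge : ∀ {q} → q ≢ root → Block q (par q) q (q ∷ [])
  bridge ne = finish (par< ne) (step-x (par< ne) (start {κ = root} (<⇒≤ (par< ne))))

  walk-total : ∀ {q y₀} → num y₀ < num q → ∃[ κ ] ∃[ mid ] Block q y₀ κ mid
  walk-total {q} {y₀} lt = go (num q + num y₀) ≤-refl (start {κ = root} (<⇒≤ lt))
    where
    go : ∀ f {x y κ mid} → num x + num y ≤ f → Walk q y₀ x y κ mid → ∃[ κ ] ∃[ mid ] Block q y₀ κ mid
    go f {x} {y} le W with <-cmp (num x) (num y)
    ... | tri≈ _ e _ rewrite num-inj e = _ , _ , finish lt W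
    go zero {x} {y} le W | tri< lt′ _ _ =
      contradiction (≤-trans (≤-trans lt′ (m≤n+m (num y) (num x))) le) λ ()
    go (suc f) {x} {y} le W | tri< lt′ _ _ =
      go f (s≤s⁻¹ (≤-trans (≤-trans (≤-reflexive (sym (+-suc (num x) _)))
      (+-monoʳ-≤ (num x) (par< (above-root lt′)))) le)) (step-y lt′ W)
    go zero {x} {y} le W | tri> _ _ gt = contradiction (≤-trans (≤-trans gt (m≤m+n (num x) (num y))) le)
      λ ()
    go (suc f) {x} {y} le W | tri> _ _ gt =
      go f (s≤s⁻¹ (≤-trans (+-monoˡ-≤ (num y) (par< (above-root gt))) le)) (step-x gt W)

  Chord : Fin n → Fin n → Set
  Chord q y = Adj q y × num y < num q × y ≢ par q

  link-adj : ∀ {q y₀ mid e} → Adj q y₀ → (∀ {v} → v ∈ mid → v ≢ root) → Link q y₀ mid e → uncurry Adj e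
  link-adj adj nr (up i) = adj-sym (par-adj (nr i))
  link-adj adj nr (down i) = par-adj (nr i)
  link-adj adj nr chord = adj

  cycle-of : ∀ {q y₀ κ mid} → Chord q y₀ → Block q y₀ κ mid → SimpleCycle G
  cycle-of {q} {y₀} {κ} {mid} (adj , lt , ne) B = record
    { vertices = par κ ∷ mid
    ; long = s≤s (long mid refl)
    ; distinct = All.tabulate (λ i → λ { refl → <-irrefl refl (top< i) }) ∷ simple
    ; closed = All.tabulate λ i → link-adj adj (λ k → above-root (top< k))
      (links (subst (_ ∈_) (cyclicPairs-pairs (par κ) mid) i)) }
    where
    open Block B
    long : ∀ mid′ → mid′ ≡ mid → 2 ≤ length mid′
    long [] refl = contradiction κ∈ λ ()
    long (v ∷ []) refl with q∈ | tree (here refl) | closes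
    ... | here refl | _ | here refl = contradiction lt (<⇒≯ (top< (here refl)))
    ... | here refl | inj₁ (there (here e)) | there (here e′) =
        contradiction (trans (proj₂ (,-injective e′)) (sym (proj₂ (,-injective e)))) ne
      where open import Data.Product.Properties using (,-injective)
    ... | here refl | inj₂ (here e) | there (here e′) =
        contradiction (trans (proj₂ (,-injective e′)) (sym (proj₁ (,-injective e)))) ne
      where open import Data.Product.Properties using (,-injective)
    ... | here refl | inj₁ (here e) | there (here e′) = contradiction (cong num (proj₁ (,-injective e)))
        (≢-sym (<⇒≢ (top< (here refl))))
      where open import Data.Product.Properties using (,-injective)
    ... | here refl | inj₂ (there (here e)) | there (here e′) =
        contradiction (cong num (proj₂ (,-injective e))) (≢-sym (<⇒≢ (top< (here refl))))
      where open import Data.Product.Properties using (,-injective)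
    long (v ∷ v′ ∷ vs) refl = s≤s (s≤s z≤n)

  module Cactus (cactus : IsCactus G) where
    same-chord : ∀ {q y κ mid q′ y′ κ′ mid′ v} → Chord q y → Chord q′ y′ → Block q y κ mid →
        Block q′ y′ κ′ mid′ →
                 v ∈ mid → v ∈ mid′ → q ≡ q′ × y ≡ y′
    same-chord {q} {y} {κ} {mid} {q′} {y′} {κ′} {mid′} {v} c@(_ , lt , ne) c′@(_ , lt′ , _) B B′ i i′
        with q Finₚ.≟ q′ | y Finₚ.≟ y′ | clash
      where
      clash : ¬ (q ≡ q′ × y ≡ y′) → ⊥
      clash diff = contradiction (cong num (proj₂ cactus (cycle-of c B) (cycle-of c′ B′) notSame
          (there i) (there i′) (par∈ B i) (par∈ B′ i′)))
              (≢-sym (<⇒≢ (par< (above-root (Block.top< B i)))))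
        where
        par∈ : ∀ {q y κ mid} (B : Block q y κ mid) → v ∈ mid → par v ∈ par κ ∷ mid
        par∈ {κ = κ} {mid} B i with Linked-left (Block.cycle B)
          (Linked-sym (Block.cycle B) (Block.tree B i))
        ... | here e = here e
        ... | there k with ∈-++⁻ mid k
        ...   | inj₁ k′ = there k′
        ...   | inj₂ (here e) = here e
        impossible : Link q′ y′ mid′ (q , y) → ⊥
        impossible (up k) = ne refl
        impossible (down k) = <⇒≯ lt (par< (above-root (Block.top< B′ k)))
        impossible chord = diff (refl , refl)
        flipped : ∀ {a b} → Link q′ y′ mid′ (a , b) → a ≡ y → b ≡ q → ⊥
        flipped (up k) refl e = <⇒≯ lt (subst (λ z → num z < num y) e
          (par< (above-root (Block.top< B′ k))))
        flipped (down k) refl refl = ne refl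
        flipped chord refl refl = <⇒≯ lt lt′
        notSame : ¬ SameCycle (cycle-of c B) (cycle-of c′ B′)
        notSame same with Equivalence.to (same q y)
            (inj₁ (subst (_ ∈_) (sym (cyclicPairs-pairs (par κ) mid)) (Block.closes B)))
        ... | inj₁ k = impossible (Block.links B′ (subst (_ ∈_) (cyclicPairs-pairs (par κ′) mid′) k))
        ... | inj₂ k = flipped (Block.links B′ (subst (_ ∈_) (cyclicPairs-pairs (par κ′) mid′) k)) refl
            refl
    ... | yes e | yes e′ | _ = e , e′
    ... | no ne′ | _ | f = ⊥-elim (f (ne′ ∘ proj₁))
    ... | yes _ | no ne′ | f = ⊥-elim (f (ne′ ∘ proj₂))

    chord-unique : ∀ {q y y′} → Chord q y → Chord q y′ → y ≡ y′
    chord-unique c@(_ , lt , _) c′@(_ , lt′ , _) =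
      let _ , _ , B = walk-total lt ; _ , _ , B′ = walk-total lt′
      in proj₂ (same-chord c c′ B B′ (Block.q∈ B) (Block.q∈ B′))

SameEdge-sym : ∀ {n} {e f : Fin n × Fin n} → SameEdge e f → SameEdge f e
SameEdge-sym (inj₁ refl) = inj₁ refl
SameEdge-sym (inj₂ refl) = inj₂ refl

module Assembly {n} {G : Graph n} (T : SearchTree G) (cactus : IsCactus G) where
  open SearchTree T
  open Graph G
  open Fundamental T
  open Cactus cactus

  rising : ∀ {x y} → Adj x y → num x < num y ⊎ num y < num x
  rising {x} {y} adj with <-cmp (num x) (num y)
  ... | tri< lt _ _ = inj₁ lt
  ... | tri> _ _ gt = inj₂ gt
  ... | tri≈ _ e _ = ⊥-elim ([ (λ i → All.lookup loopless i (num-inj e)) ,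
      (λ i → All.lookup loopless i (sym (num-inj e))) ]′ adj)

  orient : ∀ x y → Dec (num x < num y) → Fin n × Fin n
  orient x y (yes _) = y , x
  orient x y (no _)  = x , y

  upper lower : Fin n × Fin n → Fin n
  upper (x , y) = proj₁ (orient x y (num x <? num y))
  lower (x , y) = proj₂ (orient x y (num x <? num y))

  upper-lower : ∀ e → uncurry Adj e → (e ≡ (upper e , lower e) ⊎ e ≡ (lower e , upper e)) ×
      num (lower e) < num (upper e) × Adj (upper e) (lower e)
  upper-lower (x , y) adj = go (num x <? num y)
    where
    go : ∀ d → let a , b = orient x y d in ((x , y) ≡ (a , b) ⊎ (x , y) ≡ (b , a)) × num b < num a ×
      Adj a b
    go (yes lt) = inj₂ refl , lt , adj-sym adj
    go (no ge) with rising adj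
    ... | inj₁ lt = contradiction lt ge
    ... | inj₂ gt = inj₁ refl , gt , adj

  kind : Fin n × Fin n → Fin 2
  kind e = if does (lower e Finₚ.≟ par (upper e)) then zero else suc zero

  determined : ∀ {e f} → uncurry Adj e → uncurry Adj f → kind e ≡ kind f → upper e ≡ upper f →
      SameEdge e f
  determined {e} {f} ae af ek eu = glue (proj₁ (upper-lower e ae)) (proj₁ (upper-lower f af)) (lows ek)
    where
    lows : kind e ≡ kind f → lower e ≡ lower f
    lows k with lower e Finₚ.≟ par (upper e) | lower f Finₚ.≟ par (upper f)
    ... | yes p | yes q = trans p (trans (cong par eu) (sym q))
    ... | no p | no q with upper-lower e ae | upper-lower f af
    ...   | _ , lt , a | _ , lt′ , a′ = chord-unique (a , lt , p)
              (subst (λ z → Adj z (lower f)) (sym eu) a′ , subst (λ z → num (lower f) < num z) (sym eu)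
                  lt′ , λ z → q (trans z (cong par eu)))
    lows () | yes _ | no _
    lows () | no _ | yes _
    glue : (e ≡ (upper e , lower e) ⊎ e ≡ (lower e , upper e)) →
        (f ≡ (upper f , lower f) ⊎ f ≡ (lower f , upper f)) → lower e ≡ lower f → SameEdge e f
    glue (inj₁ p) (inj₁ q) r = inj₁ (trans p (trans (cong₂ _,_ eu r) (sym q)))
    glue (inj₁ p) (inj₂ q) r = inj₂ (trans p
      (trans (cong₂ _,_ eu r) (sym (cong (λ (a , b) → b , a) q))))
    glue (inj₂ p) (inj₁ q) r = inj₂ (trans p
      (trans (cong₂ _,_ r eu) (sym (cong (λ (a , b) → b , a) q))))
    glue (inj₂ p) (inj₂ q) r = inj₁ (trans p (trans (cong₂ _,_ r eu) (sym q)))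

  edges≤ : length edges ≤ 2 * n
  edges≤ = Finₚ.injective⇒≤ {f = λ i → Fin.combine (kind (lookup edges i)) (upper (lookup edges i))}
    λ {i} {j} eq →
    let ek , eu = Finₚ.combine-injective (kind (lookup edges i)) (upper (lookup edges i))
          (kind (lookup edges j)) (upper (lookup edges j)) eq
    in index-unique SameEdge-sym simple i j (determined (inj₁ (∈-lookup i)) (inj₁ (∈-lookup j)) ek eu)
    where open import Data.List.Membership.Propositional.Properties using (∈-lookup)

  module _ (pt : Fin n → Fin n) (partner : ∀ {q} → q ≢ root → (pt q ≡ par q × (∀ y → ¬ Chord q y)) ⊎
      Chord q (pt q)) where

    Kind : Fin n → Fin n → List (Fin n) → Set
    Kind q κ mid = (κ ≡ q × mid ≡ q ∷ []) ⊎ Chord q (pt q)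

    record Found (j : ℕ) (blk : Fin n → List (Fin n)) : Set where
      field
        blocks  : ∀ v → blk v ≡ [] ⊎ (∃[ q ] Block q (pt q) v (blk v) × n ≤ num q + j ×
            Kind q v (blk v))
        apart   : ∀ {x v v′} → x ∈ blk v → x ∈ blk v′ → v ≡ v′
        reached : ∀ {q} → q ≢ root → n ≤ num q + j → ∃[ v ] q ∈ blk v
        chords  : ∀ {q} → Chord q (pt q) → n ≤ num q + j → ∃[ v ] Block q (pt q) v (blk v)

      block-of : ∀ {x v} → x ∈ blk v → ∃[ q ] Block q (pt q) v (blk v) × n ≤ num q + j ×
          Kind q v (blk v)
      block-of {x} {v} i with blocks v
      ... | inj₁ e = contradiction (subst (x ∈_) e i) λ ()
      ... | inj₂ b = b

    found₀ : Found 0 (λ _ → [])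
    found₀ = record { blocks = λ _ → inj₁ refl ; apart = λ () ; reached = λ _ le →
      contradiction (subst (n ≤_) (+-identityʳ _) le) (<⇒≱ (num<n _))
                    ; chords = λ _ le → contradiction (subst (n ≤_) (+-identityʳ _) le) (<⇒≱ (num<n _))
                      }

    update : (Fin n → List (Fin n)) → Fin n → List (Fin n) → Fin n → List (Fin n)
    update blk κ mid v = if does (v Finₚ.≟ κ) then mid else blk v

    module Next {j} (j<n : j < n) {blk} (F : Found j blk) where
      open Found F
      q : Fin n
      q = ord (n ∸ suc j)

      num-q : num q + suc j ≡ n
      num-q = trans (cong (_+ suc j) (num-ord (∸-monoʳ-< {n} z<s j<n))) (m∸n+n≡m j<n)

      later : ∀ {q′} → n ≤ num q′ + suc j → q′ ≡ q ⊎ n ≤ num q′ + j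
      later {q′} d with m≤n⇒m<n∨m≡n d
      ... | inj₁ lt = inj₂ (s≤s⁻¹ (≤-trans lt (≤-reflexive (+-suc (num q′) j))))
      ... | inj₂ eq = inj₁ (num-inj (+-cancelʳ-≡ (suc j) _ _ (trans (sym eq) (sym num-q))))

      above : ∀ {q′} → n ≤ num q′ + j → num q < num q′
      above {q′} le = +-cancelʳ-≤ j _ _ (≤-trans (≤-reflexive (trans (sym (+-suc (num q) j)) num-q)) le)

      more : ∀ {q′} → n ≤ num q′ + j → n ≤ num q′ + suc j
      more {q′} le = ≤-trans le (+-monoʳ-≤ (num q′) (n≤1+n j))

      no-chord : ∀ {v} → q ∈ blk v → ¬ Chord q (pt q)
      no-chord i c with block-of i
      ... | q′ , B , le , inj₁ (refl , e) with subst (q ∈_) e i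
      ...   | here e′ = <-irrefl (cong num e′) (above le)
      no-chord i c | q′ , B , le , inj₂ c′ = let _ , _ , B′ = walk-total (proj₁ (proj₂ c)) in
        <-irrefl (cong num (proj₁ (same-chord c c′ B′ B (Block.q∈ B′) i))) (above le)

      skip-found : ∀ {v} → q ∈ blk v → Found (suc j) blk
      skip-found {v} i = record
        { blocks = λ v → [ inj₁ , (λ (q′ , B , le , k) → inj₂ (q′ , B , more le , k)) ]′ (blocks v)
        ; apart = apart
        ; reached = λ ne le → [ (λ { refl → v , i }) , reached ne ]′ (later le)
        ; chords = λ c le → [ (λ { refl → contradiction c (no-chord i) }) , chords c ]′ (later le) }

      module _ (fresh : ∀ v → q ∉ blk v) {κ mid} (B : Block q (pt q) κ mid) (k : Kind q κ mid) where
        untouched : ∀ {x v} → x ∈ mid → x ∉ blk v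
        untouched {x} {v} i i′ = go k
          where
          go : Kind q κ mid → ⊥
          go (inj₁ (_ , refl)) = fresh v (subst (_∈ blk v) (∈-single i) i′)
          go (inj₂ c) with block-of i′
          ... | q′ , B′ , le , inj₁ (_ , e) with subst (x ∈_) e i′
          ...   | here refl = <⇒≱ (above le) (Block.≤q B i)
          go (inj₂ c) | q′ , B′ , le , inj₂ c′ = <-irrefl (cong num (proj₁ (same-chord c c′ B B′ i i′)))
            (above le)

        vacant : blk κ ≡ []
        vacant with blocks κ
        ... | inj₁ e = e
        ... | inj₂ (_ , B′ , _) = contradiction (Block.κ∈ B′) (untouched (Block.κ∈ B))

        at-κ : update blk κ mid κ ≡ mid
        at-κ with κ Finₚ.≟ κ
        ... | yes _ = refl
        ... | no ne = contradiction refl ne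

        keep-old : ∀ {x v} → x ∈ blk v → x ∈ update blk κ mid v
        keep-old {x} {v} i with v Finₚ.≟ κ
        ... | yes refl = contradiction (subst (x ∈_) vacant i) λ ()
        ... | no _ = i

        old : ∀ {v} → v ≢ κ → update blk κ mid v ≡ blk v
        old {v} ne with v Finₚ.≟ κ
        ... | yes e = contradiction e ne
        ... | no _ = refl

        add-found : Found (suc j) (update blk κ mid)
        add-found = record
          { blocks = blocks′
          ; apart = λ {x} {v} {v′} → apart′ {x} {v} {v′}
          ; reached = λ ne le → [ (λ { refl → κ , subst (q ∈_) (sym at-κ) (Block.q∈ B) }) ,
                                  (λ le′ → let v , i = reached ne le′ in v , keep-old i) ]′ (later le)
          ; chords = λ c le → [ (λ { refl → κ , subst (Block q (pt q) κ) (sym at-κ) B }) ,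
                                (λ le′ → let v , B′ = chords c le′ in v ,
                                   subst (Block _ (pt _) v) (sym
                                       (old λ { refl → contradiction (subst (_ ∈_) vacant (Block.κ∈ B′))
                                       λ () })) B′) ]′ (later le) }
          where
          blocks′ : ∀ v → update blk κ mid v ≡ [] ⊎ (∃[ q ] Block q (pt q) v (update blk κ mid v) ×
              n ≤ num q + suc j × Kind q v (update blk κ mid v))
          blocks′ v with v Finₚ.≟ κ
          ... | yes refl = inj₂ (q , B , ≤-reflexive (sym num-q) , k)
          ... | no _ = [ inj₁ , (λ (q′ , B′ , le , k′) → inj₂ (q′ , B′ , more le , k′)) ]′ (blocks v)
          apart′ : ∀ {x v v′} → x ∈ update blk κ mid v → x ∈ update blk κ mid v′ → v ≡ v′
          apart′ {x} {v} {v′} i i′ with v Finₚ.≟ κ | v′ Finₚ.≟ κ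
          ... | yes refl | yes refl = refl
          ... | yes refl | no _ = contradiction i′ (untouched i)
          ... | no _ | yes refl = contradiction i (untouched i′)
          ... | no _ | no _ = apart i i′

    module Finished (1≤n : 1 ≤ n) {blk} (F : Found (n ∸ 1) blk) where
      open Found F

      everywhere : ∀ {q} → q ≢ root → n ≤ num q + (n ∸ 1)
      everywhere {q} ne = ≤-trans (≤-reflexive (sym (m+[n∸m]≡n 1≤n)))
        (+-monoˡ-≤ (n ∸ 1) (n≢0⇒n>0 λ z → ne (num-inj (trans z (sym num-root)))))

      decomposition : Decomposition G
      decomposition = record
        { root = root ; par = par ; num = num ; ord = ord ; blk = blk
        ; num<n = num<n ; num-ord = num-ord ; ord-num = ord-num ; num-root = num-root ; par< = par<
        ; root∉ = λ i → above-root (Block.top< (proj₁ (proj₂ (block-of i))) i) refl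
        ; key∈ = λ i → Block.κ∈ (proj₁ (proj₂ (block-of i)))
        ; key≤ = λ i → Block.κ≤ (proj₁ (proj₂ (block-of i))) i
        ; disjoint = apart
        ; unique = unique′
        ; cover = λ ne → reached ne (everywhere ne)
        ; adjacent = λ {v} i k → adjacent′ v (block-of i) k
        ; edge-in = λ adj → [ (λ lt → let v , vv , lk = edge′ (adj-sym adj) lt in v , vv ,
          Linked-sym (par v ∷ blk v ++ par v ∷ []) lk) , edge′ adj ]′ (rising adj) }
        where
        unique′ : ∀ v → Unique (blk v)
        unique′ v with blocks v
        ... | inj₁ e = subst Unique (sym e) []
        ... | inj₂ (_ , B , _) = Block.simple B
        adjacent′ : ∀ v → (∃[ q ] Block q (pt q) v (blk v) × n ≤ num q + (n ∸ 1) × Kind q v (blk v)) →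
                    ∀ {x y} → (x , y) ∈ pairs (par v ∷ blk v ++ par v ∷ []) → Adj x y
        adjacent′ v (q , B , le , k) i = link-adj
          (pt-adj (partner (above-root (Block.top< B (Block.q∈ B)))))
          (λ k′ → above-root (Block.top< B k′)) (Block.links B i)
          where
          pt-adj : _ → Adj q (pt q)
          pt-adj (inj₁ (e , _)) = subst (Adj q) (sym e)
            (adj-sym (par-adj (above-root (Block.top< B (Block.q∈ B)))))
          pt-adj (inj₂ (a , _)) = a
        edge′ : ∀ {x y} → Adj x y → num y < num x → ∃[ v ] v ∈ blk v ×
            Linked x y (par v ∷ blk v ++ par v ∷ [])
        edge′ {x} {y} adj lt with y Finₚ.≟ par x
        ... | yes refl = let v , i = reached (above-root lt) (everywhere (above-root lt)) ; _ , B , _ =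
                               block-of i in v , Block.κ∈ B , Block.tree B i
        ... | no ne with partner (above-root lt)
        ...   | inj₁ (_ , none) = contradiction (adj , lt , ne) (none y)
        ...   | inj₂ c = let v , B = chords c (everywhere (above-root lt)) in v , Block.κ∈ B ,
                  inj₁ (subst (λ z → (x , z) ∈ pairs (par v ∷ blk v ++ par v ∷ []))
                      (chord-unique c (adj , lt , ne)) (Block.closes B))

      blk≤ : ∀ {Dm} → 1 ≤ Dm → (SimpleCycle G → n ≤ Dm) → ∀ v → length (blk v) ≤ Dm
      blk≤ 1≤ long v with blocks v
      ... | inj₁ e rewrite e = z≤n
      ... | inj₂ (q , B , _ , inj₁ (_ , e)) rewrite e = 1≤
      ... | inj₂ (q , B , _ , inj₂ c) = ≤-trans (unique-length (Block.simple B)) (long (cycle-of c B))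

-- Searching the graph

contents-tabulate : ∀ {n} (f : Fin n → ℕ) v → contents (map f (allFin n)) (toℕ v) ≡ f v
contents-tabulate f v = trans (cong (λ l → contents l (toℕ v)) (map-tabulate id f)) (go f v)
  where
  open import Data.List.Properties using (map-tabulate)
  go : ∀ {n} (f : Fin n → ℕ) v → contents (tabulate f) (toℕ v) ≡ f v
  go f zero = refl
  go f (suc v) = go (f ∘ suc) v

contents-lookup : ∀ {A : Set} (f : A → ℕ) xs i → contents (map f xs) (toℕ i) ≡ f (lookup xs i)
contents-lookup f (x ∷ xs) zero = refl
contents-lookup f (x ∷ xs) (suc i) = contents-lookup f xs i

record Input (I : Instance) (σ : Store) : Set where
  open Instance I
  open Graph graph
  field
    at-n : σ 0 0 ≡ n
    at-m : σ 0 1 ≡ length edges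
    at-l : σ 0 2 ≡ l
    at-u : σ 0 3 ≡ u
    at-p : σ 0 4 ≡ p
    at-w : ∀ (v : Fin n) → σ 1 (toℕ v) ≡ w v
    at-s : ∀ (v : Fin n) → σ 2 (toℕ v) ≡ s v
    at-x : ∀ i → σ 3 (toℕ i) ≡ toℕ (proj₁ (lookup edges i))
    at-y : ∀ i → σ 4 (toℕ i) ≡ toℕ (proj₂ (lookup edges i))

input-Input : ∀ I → Input I (input I)
input-Input I = record
  { at-n = refl ; at-m = refl ; at-l = refl ; at-u = refl ; at-p = refl
  ; at-w = contents-tabulate w ; at-s = contents-tabulate s
  ; at-x = contents-lookup (toℕ ∘ proj₁) edges ; at-y = contents-lookup (toℕ ∘ proj₂) edges }
  where
  open Instance I
  open Graph graph

Input-agree : ∀ {I c σ τ} → {T (free 0 c)} → {T (free 1 c)} → {T (free 2 c)} → {T (free 3 c)} →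
    {T (free 4 c)} →
              Agree c σ τ → Input I σ → Input I τ
Input-agree {σ = σ} {_} {f0} {f1} {f2} {f3} {f4} ag inp = record
  { at-n = trans (ag 0 f0 0) at-n ; at-m = trans (ag 0 f0 1) at-m ; at-l = trans (ag 0 f0 2) at-l
  ; at-u = trans (ag 0 f0 3) at-u ; at-p = trans (ag 0 f0 4) at-p
  ; at-w = λ v → trans (ag 1 f1 _) (at-w v) ; at-s = λ v → trans (ag 2 f2 _) (at-s v)
  ; at-x = λ i → trans (ag 3 f3 _) (at-x i) ; at-y = λ i → trans (ag 4 f4 _) (at-y i) }
  where open Input inp

constants : Program
constants =
  set 25 (op add (lit 1) (read 0 (lit 3))) ⨟ set 24 (op mul (read 0 (lit 4)) (var 25)) ⨟
  set 23 (op mul (op add (lit 1) (read 0 (lit 4))) (var 25)) ⨟ set 74 (lit 1) ⨟ set 22 (lit 0) ⨟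
  for 72 (read 0 (lit 0)) (
    write 10 (var 72) (var 74) ⨟ set 74 (op mul (var 74) base) ⨟
    set 22 (op add (read 2 (var 72)) (var 22)) ⨟ write 12 (var 72) (lit 1))

-- An ordered pair (x , y) of vertices is coded as the positive digit
-- n x + y + 1 in base n² + 1, and a list of pairs by its digits, head first.
pairBase : Exp
pairBase = op add (lit 1) (op mul (read 0 (lit 0)) (read 0 (lit 0)))

push : Exp → Exp → Program
push a b =
  write 11 a (op add (op mul (read 11 a) pairBase)
      (op add (lit 1) (op add (op mul a (read 0 (lit 0))) b))) ⨟
  write 12 a (op mul (read 12 a) pairBase)

adjacency : Program
adjacency = for 72 (read 0 (lit 1)) (push (read 3 (var 72)) (read 4 (var 72)) ⨟
  push (read 4 (var 72)) (read 3 (var 72)))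

module Adjacency (I : Instance) where
  open Instance I
  open Graph graph

  m : ℕ
  m = length edges

  pb : ℕ
  pb = suc (n * n)

  code : Fin n × Fin n → ℕ
  code (x , y) = suc (toℕ x * n + toℕ y)

  codes : List (Fin n × Fin n) → ℕ
  codes [] = 0
  codes (e ∷ es) = codes es * pb + code e

  codes-++ : ∀ as bs → codes (as ++ bs) ≡ codes bs * pb ^ length as + codes as
  codes-++ [] bs = trans (sym (*-identityʳ _)) (sym (+-identityʳ _))
  codes-++ (a ∷ as) bs rewrite codes-++ as bs = lem (codes bs) (pb ^ length as) (codes as) pb (code a)
    where
    lem : ∀ q r a b c → (q * r + a) * b + c ≡ q * (b * r) + (a * b + c)
    lem = solve-∀

  Rep : (Fin n → List (Fin n × Fin n)) → (ℕ → ℕ) → (ℕ → ℕ) → Set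
  Rep adj f g = ∀ v → f (toℕ v) ≡ codes (adj v) × g (toℕ v) ≡ pb ^ length (adj v)

  pushed : (Fin n → List (Fin n × Fin n)) → Fin n → Fin n × Fin n → Fin n → List (Fin n × Fin n)
  pushed adj x e v = if does (v Finₚ.≟ x) then e ∷ adj v else adj v

  push-rep : ∀ {adj f g x e a b c} → a ≡ toℕ x → b ≡ pb → c ≡ code e → Rep adj f g →
             Rep (pushed adj x e) (λ j → if a ≡ᵇ j then f a * b + c else f j)
                 (λ j → if a ≡ᵇ j then g a * b else g j)
  push-rep {adj} {f} {g} {x} {e} refl refl refl R v with v Finₚ.≟ x
  ... | yes refl = trans (if-same {toℕ v} refl) (cong (λ z → z * pb + code e) (proj₁ (R v))) ,
                   trans (if-same {toℕ v} refl) (trans (cong (_* pb) (proj₂ (R v))) (*-comm _ pb))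
  ... | no ne = trans (if-other (ne ∘ sym ∘ toℕ-injective)) (proj₁ (R v)) ,
                trans (if-other (ne ∘ sym ∘ toℕ-injective)) (proj₂ (R v))

  Joined : ℕ → Fin n → Fin n → Set
  Joined k x y = ∃[ i ] toℕ i < k × SameEdge (x , y) (lookup edges i)

  record Lists (k : ℕ) (adj : Fin n → List (Fin n × Fin n)) : Set where
    field
      sound : ∀ {v x y} → (x , y) ∈ adj v → x ≡ v × Adj x y
      all   : ∀ {x y} → Joined k x y → (x , y) ∈ adj x
      amount : ∑ (λ v → length (adj v)) ≡ 2 * k

  pushed-∈ : ∀ adj x e v {e′} → e′ ∈ pushed adj x e v → e′ ∈ adj v ⊎ (v ≡ x × e′ ≡ e)
  pushed-∈ adj x e v i with v Finₚ.≟ x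
  pushed-∈ adj x e v (here refl) | yes q = inj₂ (q , refl)
  pushed-∈ adj x e v (there i)   | yes q = inj₁ i
  pushed-∈ adj x e v i           | no _  = inj₁ i

  ∈-pushed : ∀ adj x e v {e′} → e′ ∈ adj v ⊎ (v ≡ x × e′ ≡ e) → e′ ∈ pushed adj x e v
  ∈-pushed adj x e v i with v Finₚ.≟ x
  ∈-pushed adj x e v (inj₁ i)          | yes q = there i
  ∈-pushed adj x e v (inj₂ (_ , refl)) | yes q = here refl
  ∈-pushed adj x e v (inj₁ i)          | no _  = i
  ∈-pushed adj x e v (inj₂ (q , _))    | no ne = contradiction q ne

  pushed-length : ∀ adj x e → ∑ (λ v → length (pushed adj x e v)) ≡ suc (∑ (λ v → length (adj v)))
  pushed-length adj x e = trans (∑-cong go) (trans (∑-+ (λ v → δ v x) (λ v → length (adj v)))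
    (cong (_+ ∑ (λ v → length (adj v))) (∑-δ1 x)))
    where
    go : ∀ v → length (pushed adj x e v) ≡ δ v x + length (adj v)
    go v with v Finₚ.≟ x
    ... | yes _ = refl
    ... | no _ = refl

  adj-of : ∀ {x y} → Adj x y → Joined m x y
  adj-of {x} {y} (inj₁ i) = Any.index i , toℕ<n _ , inj₁ (lookup-index i)
    where open import Data.List.Relation.Unary.Any.Properties using (lookup-index)
  adj-of {x} {y} (inj₂ i) = Any.index i , toℕ<n _ , inj₂ (cong (λ (a , b) → b , a) (lookup-index i))
    where open import Data.List.Relation.Unary.Any.Properties using (lookup-index)

  edge-adj : ∀ i → Adj (proj₁ (lookup edges i)) (proj₂ (lookup edges i))
  edge-adj i = inj₁ (∈-lookup i)
    where open import Data.List.Membership.Propositional.Properties using (∈-lookup)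

  lists-push : ∀ {k adj} i → toℕ i ≡ k → Lists k adj →
               let x , y = lookup edges i in Lists (suc k) (pushed (pushed adj x (x , y)) y (y , x))
  lists-push {k} {adj} i refl L = record
    { sound = λ {v} j → [ (λ j′ → [ sound , (λ { (refl , refl) → refl , edge-adj i }) ]′
      (pushed-∈ adj x (x , y) v j′)) ,
                          (λ { (refl , refl) → refl , [ inj₂ , inj₁ ]′ (edge-adj i) }) ]′
                              (pushed-∈ adj₁ y (y , x) v j)
    ; all = λ {a} → λ { (i′ , lt , se) →
      [ (λ lt′ → ∈-pushed adj₁ y (y , x) a
      (inj₁ (∈-pushed adj x (x , y) a (inj₁ (all (i′ , lt′ , se)))))) ,
                                            (λ eq → new i′ (toℕ-injective eq) se) ]′
                                                (m≤n⇒m<n∨m≡n (s≤s⁻¹ lt)) }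
    ; amount = trans (pushed-length adj₁ y (y , x)) (trans (cong suc (pushed-length adj x (x , y)))
      (trans (cong (2 +_) amount) (sym (*-suc 2 (toℕ i))))) }
    where
    open Lists L
    x = proj₁ (lookup edges i)
    y = proj₂ (lookup edges i)
    adj₁ = pushed adj x (x , y)
    new : ∀ {a b} i′ → i′ ≡ i → SameEdge (a , b) (lookup edges i′) → (a , b) ∈ pushed adj₁ y (y , x) a
    new _ refl (inj₁ refl) = ∈-pushed adj₁ y (y , x) x
      (inj₁ (∈-pushed adj x (x , y) x (inj₂ (refl , refl))))
    new _ refl (inj₂ refl) = ∈-pushed adj₁ y (y , x) y (inj₂ (refl , refl))

  record Constants (σ : Store) : Set where
    field
      at-S   : σ 22 0 ≡ ∑ s
      at-N   : σ 23 0 ≡ suc p * suc u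
      at-q   : σ 24 0 ≡ p * suc u
      at-d   : σ 25 0 ≡ suc u
      at-pow : ∀ (v : Fin n) → σ 10 (toℕ v) ≡ suc n ^ toℕ v

  constantsE : ∀ {σ} → Input I σ → Exec n constants σ 200 (λ τ → Constants τ ×
      (∀ (v : Fin n) → τ 12 (toℕ v) ≡ 1))
  constantsE {σ} inp = weaken tt $ seqE $ writeE $ seqE $ writeE $ seqE $ writeE $ seqE $ writeE $
    seqE $ writeE $
    agreeMap fin $ scale (≤-reflexive (*-identityʳ n)) $
    forE n Inv {tt} (λ τ ag → trans (ag 0 tt 0) at-n) (refl , refl , λ _ ())
      (λ k τ k<n ag tk (e74 , e22 , old) → seqE $ writeE $ seqE $ writeE $ seqE $ writeE $ writeE λ x →
        trans (cong₂ _*_ e74 (cong suc (trans (ag 0 tt 0) at-n))) (*-comm (suc n ^ k) (suc n)) ,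
        cong₂ _+_ (trans (ag 2 tt _) (cong (σ 2) tk)) e22 ,
        λ v lt → [ (λ lt′ → let ne = λ e → <⇒≢ lt′ (trans (sym e) tk) in trans (if-other ne)
          (proj₁ (old v lt′)) , trans (if-other ne) (proj₂ (old v lt′))) ,
                   (λ e → let e′ = trans tk (sym e) in trans (if-same e′)
                     (trans e74 (cong (suc n ^_) (sym e))) , if-same e′) ]′ (m≤n⇒m<n∨m≡n (s≤s⁻¹ lt)))
    where
    open Input inp
    Inv : ℕ → Store → Set
    Inv k τ = τ 74 0 ≡ suc n ^ k × τ 22 0 ≡ sumTo k (σ 2) × (∀ (v : Fin n) → toℕ v < k → τ 10 (toℕ v) ≡
      suc n ^ toℕ v × τ 12 (toℕ v) ≡ 1)
    σ₀ : Store
    σ₀ = ((((σ [ 25 , 0 ↦ suc (σ 0 3) ]) [ 24 , 0 ↦ σ 0 4 * suc (σ 0 3) ]) [ 23 ,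
      0 ↦ suc (σ 0 4) * suc (σ 0 3) ]) [ 74 , 0 ↦ 1 ]) [ 22 , 0 ↦ 0 ]
    loop = for 72 (read 0 (lit 0)) (write 10 (var 72) (var 74) ⨟ set 74 (op mul (var 74) base) ⨟
      set 22 (op add (read 2 (var 72)) (var 22)) ⨟ write 12 (var 72) (lit 1))
    fin : ∀ τ → Agree loop σ₀ τ → Inv n τ → Constants τ × (∀ (v : Fin n) → τ 12 (toℕ v) ≡ 1)
    fin τ ag (_ , e22 , arr) = record
      { at-S = trans e22 (trans (sym (∑-toℕ n (σ 2))) (∑-cong at-s))
      ; at-N = trans (ag 23 tt 0) (cong₂ (λ a b → suc a * suc b) at-p at-u)
      ; at-q = trans (ag 24 tt 0) (cong₂ (λ a b → a * suc b) at-p at-u)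
      ; at-d = trans (ag 25 tt 0) (cong suc at-u)
      ; at-pow = λ v → proj₁ (arr v (toℕ<n v)) } , λ v → proj₂ (arr v (toℕ<n v))

  adjacencyE : ∀ {σ} → Input I σ → (∀ (v : Fin n) → σ 11 (toℕ v) ≡ 0) →
      (∀ (v : Fin n) → σ 12 (toℕ v) ≡ 1) →
               Exec m adjacency σ 200 (λ τ → ∃[ adj ] Rep adj (τ 11) (τ 12) × Lists m adj)
  adjacencyE {σ} inp z11 o12 = weaken tt $ scale (≤-reflexive (*-identityʳ m)) $
    forE m (λ k τ → ∃[ adj ] Rep adj (τ 11) (τ 12) × Lists k adj) {tt} (λ τ ag → trans (ag 0 tt 1) at-m)
      ((λ _ → []) , (λ v → z11 v , o12 v) , record { sound = λ () ; all = λ () ; amount =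
        ∑-zero {n} λ _ → refl })
      (λ k τ k<m ag tk (adj , R , L) →
        let i = fromℕ< k<m
            ik = toℕ-fromℕ< k<m
            ex = trans (cong (τ 3) (trans tk (sym ik))) (trans (ag 3 tt _) (at-x i))
            ey = trans (cong (τ 4) (trans tk (sym ik))) (trans (ag 4 tt _) (at-y i))
            en = trans (ag 0 tt 0) at-n
            eb = cong suc (cong₂ _*_ en en)
            x = proj₁ (lookup edges i)
            y = proj₂ (lookup edges i)
            a = τ 3 (τ 72 0)
            b = τ 4 (τ 72 0)
            B = suc (τ 0 0 * τ 0 0)
        in seqE $ seqE $ writeE $ writeE $ seqE $ writeE $ writeE λ _ →
           pushed (pushed adj x (x , y)) y (y , x) ,
           push-rep {pushed adj x (x , y)} {λ j → if a ≡ᵇ j then τ 11 a * B + suc (a * τ 0 0 + b) else τ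
               11 j} {λ j → if a ≡ᵇ j then τ 12 a * B else τ 12 j} {y} {y , x} ey eb
               (cong suc (cong₂ _+_ (cong₂ _*_ ey en) ex))
             (push-rep {adj} {τ 11} {τ 12} {x = x} {e = x , y} ex eb
               (cong suc (cong₂ _+_ (cong₂ _*_ ex en) ey)) R) ,
           lists-push i ik L)
    where open Input inp

uncode enter visit explore : Program
uncode =
  set 77 (op sub (modE (var 76) pairBase) (lit 1)) ⨟ set 76 (op div (var 76) pairBase) ⨟
  set 78 (op div (var 77) (read 0 (lit 0))) ⨟ set 79 (modE (var 77) (read 0 (lit 0)))
enter =
  write 13 (var 79) (lit 1) ⨟ write 14 (var 75) (var 79) ⨟ write 15 (var 79) (var 75) ⨟
  write 16 (var 79) (var 78) ⨟ write 17 (var 79) (var 78) ⨟ set 75 (op add (lit 1) (var 75)) ⨟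
  set 76 (op add (op mul (var 76) (read 12 (var 79))) (read 11 (var 79)))
visit = uncode ⨟ cond (read 13 (var 79)) skip enter
explore = write 13 (lit 0) (lit 1) ⨟ set 75 (lit 1) ⨟ set 76 (read 11 (lit 0)) ⨟ while (var 76) visit

div-unique : ∀ {d} q {r} → r < d → applyOp div (q * d + r) d ≡ q
div-unique {suc d} q {r} r<d = divmod-unique d q r r<d

mod-unique : ∀ {d} q {r} → r < d → modulo (q * d + r) d ≡ r
mod-unique {suc d} q {r} r<d = modulo-ix d q r r<d

-- Abstract, so that f, y and a can be inferred from updF f y a.
abstract
  updF : ∀ {n} {A : Set} → (Fin n → A) → Fin n → A → Fin n → A
  updF f y a v = if does (v Finₚ.≟ y) then a else f v

  updF-same : ∀ {n} {A : Set} {f : Fin n → A} {y a} → updF f y a y ≡ a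
  updF-same {y = y} with y Finₚ.≟ y
  ... | yes _ = refl
  ... | no ne = contradiction refl ne

  updF-other : ∀ {n} {A : Set} {f : Fin n → A} {y a v} → v ≢ y → updF f y a v ≡ f v
  updF-other {y = y} {v = v} ne with v Finₚ.≟ y
  ... | yes e = contradiction e ne
  ... | no _ = refl

  upd : ∀ {A : Set} → (ℕ → A) → ℕ → A → ℕ → A
  upd f k a i = if does (i ≟ℕ k) then a else f i

  upd-same : ∀ {A : Set} {f : ℕ → A} {k a} → upd f k a k ≡ a
  upd-same {k = k} rewrite ≡ᵇ-refl k = refl

  upd-other : ∀ {A : Set} {f : ℕ → A} {k a i} → i ≢ k → upd f k a i ≡ f i
  upd-other ne rewrite ≢⇒≡ᵇ ne = refl

module Explore (I : Instance) (connected : Connected (Instance.graph I)) where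
  open Instance I
  open Graph graph
  open Adjacency I

  1≤n : 1 ≤ n
  1≤n = ≤-trans 0<p p≤n

  start : Fin n
  start = fromℕ< 1≤n

  toℕ-start : toℕ start ≡ 0
  toℕ-start = toℕ-fromℕ< 1≤n

  record Explored (vis : Fin n → Bool) (num : Fin n → ℕ) (par : Fin n → Fin n) (ord : ℕ → Fin n)
                  (cnt : ℕ) (Q : List (Fin n × Fin n)) : Set where
    field
      vis-root : vis start ≡ true
      num-root : num start ≡ 0
      num<     : ∀ {v} → vis v ≡ true → num v < cnt
      ord-num  : ∀ {v} → vis v ≡ true → ord (num v) ≡ v
      vis-ord  : ∀ {i} → i < cnt → vis (ord i) ≡ true
      num-ord  : ∀ {i} → i < cnt → num (ord i) ≡ i
      par<     : ∀ {v} → vis v ≡ true → v ≢ start → num (par v) < num v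
      par-adj  : ∀ {v} → vis v ≡ true → v ≢ start → Adj (par v) v
      vis-par  : ∀ {v} → vis v ≡ true → v ≢ start → vis (par v) ≡ true
      queued   : ∀ {x y} → (x , y) ∈ Q → vis x ≡ true × Adj x y
      frontier : ∀ {x y} → vis x ≡ true → Adj x y → vis y ≡ true ⊎ (x , y) ∈ Q

  record Held (vis : Fin n → Bool) (num : Fin n → ℕ) (par : Fin n → Fin n) (ord : ℕ → Fin n)
              (cnt : ℕ) (Q : List (Fin n × Fin n)) (a13 a14 a15 a16 a17 : ℕ → ℕ) (s75 s76 : ℕ) :
                  Set where
    field
      at13 : ∀ v → a13 (toℕ v) ≡ fromBool (vis v)
      at14 : ∀ {i} → i < cnt → a14 i ≡ toℕ (ord i)
      at15 : ∀ {v} → vis v ≡ true → a15 (toℕ v) ≡ num v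
      at16 : ∀ {v} → vis v ≡ true → v ≢ start → a16 (toℕ v) ≡ toℕ (par v)
      at17 : ∀ {v} → vis v ≡ true → v ≢ start → a17 (toℕ v) ≡ toℕ (par v)
      at75 : s75 ≡ cnt
      at76 : s76 ≡ codes Q

  code<pb : ∀ e → code e < pb
  code<pb (x , y) = s≤s (≤-trans (+-monoʳ-< (toℕ x * n) (toℕ<n y))
    (≤-trans (≤-reflexive (+-comm (toℕ x * n) n)) (*-monoˡ-≤ n (toℕ<n x))))

  module _ (adj : Fin n → List (Fin n × Fin n)) (L : Lists m adj) where
    open Lists L

    rest : (Fin n → Bool) → ℕ
    rest vis = ∑ (λ v → (1 ∸ fromBool (vis v)) * length (adj v))

    rest-visit : ∀ vis y → vis y ≡ false → rest vis ≡ length (adj y) + rest (updF vis y true)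
    rest-visit vis y ny = trans (∑-cong go)
      (trans (∑-+ (λ v → δ v y * length (adj v)) (λ v → (1 ∸ fromBool (updF vis y true v)) * length
      (adj v)))
        (cong (_+ rest (updF vis y true)) (∑-δ y (λ v → length (adj v)))))
      where
      go : ∀ v → (1 ∸ fromBool (vis v)) * length (adj v) ≡
          δ v y * length (adj v) + (1 ∸ fromBool (updF vis y true v)) * length (adj v)
      go v with v Finₚ.≟ y
      ... | yes refl rewrite ny | updF-same {f = vis} {y} {true} = sym (+-identityʳ _)
      ... | no ne rewrite updF-other {f = vis} {y} {true} ne = refl

    module Visit {vis num par ord cnt x y Q} (E : Explored vis num par ord cnt ((x , y) ∷ Q)) where
      open Explored E

      old-visit : vis y ≡ true → Explored vis num par ord cnt Q
      old-visit vy = record { Explored E hiding (queued; frontier) ; queued = queued ∘ there ;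
        frontier = λ vx a → front vx (frontier vx a) }
        where
        front : ∀ {a b} → vis a ≡ true → vis b ≡ true ⊎ (a , b) ∈ ((x , y) ∷ Q) → vis b ≡ true ⊎
            (a , b) ∈ Q
        front _ (inj₁ v) = inj₁ v
        front _ (inj₂ (here refl)) = inj₁ vy
        front _ (inj₂ (there i)) = inj₂ i

      module _ (ny : vis y ≡ false) where
        vis′ : Fin n → Bool
        vis′ = updF vis y true
        num′ : Fin n → ℕ
        num′ = updF num y cnt
        par′ : Fin n → Fin n
        par′ = updF par y x
        ord′ : ℕ → Fin n
        ord′ = upd ord cnt y

        vx : vis x ≡ true
        vx = proj₁ (queued (here refl))

        ≢y : ∀ {v} → vis v ≡ true → v ≢ y
        ≢y vv refl with () ← trans (sym vv) ny

        back : ∀ {v} → vis′ v ≡ true → v ≡ y ⊎ (v ≢ y × vis v ≡ true)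
        back {v} h with v Finₚ.≟ y
        ... | yes e = inj₁ e
        ... | no ne = inj₂ (ne , trans (sym (updF-other ne)) h)

        keepv : ∀ {v} → vis v ≡ true → vis′ v ≡ true
        keepv vv = trans (updF-other (≢y vv)) vv

        num-keep : ∀ {v} → vis v ≡ true → num′ v ≡ num v
        num-keep vv = updF-other (≢y vv)

        new-visit : Explored vis′ num′ par′ ord′ (suc cnt) (adj y ++ Q)
        new-visit = record
          { vis-root = keepv vis-root
          ; num-root = trans (num-keep vis-root) num-root
          ; num< = λ h → [ (λ { refl → s≤s (≤-reflexive updF-same) }) ,
            (λ (ne , vv) → s≤s (≤-trans (≤-reflexive (num-keep vv)) (<⇒≤ (num< vv)))) ]′ (back h)
          ; ord-num = λ h → [ (λ { refl → trans (cong ord′ updF-same) upd-same }) ,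
                              (λ (ne , vv) → trans (cong ord′ (num-keep vv))
                                  (trans (upd-other (<⇒≢ (num< vv))) (ord-num vv))) ]′ (back h)
          ; vis-ord = λ {i} lt → [ (λ lt′ → trans (cong vis′ (upd-other {i = i} (<⇒≢ lt′)))
            (keepv (vis-ord lt′))) ,
                                   (λ { refl → trans (cong vis′ upd-same) updF-same }) ]′
                                       (m≤n⇒m<n∨m≡n (s≤s⁻¹ lt))
          ; num-ord = λ {i} lt → [ (λ lt′ → trans (cong num′ (upd-other {i = i} (<⇒≢ lt′)))
            (trans (num-keep (vis-ord lt′)) (num-ord lt′))) ,
                                   (λ { refl → trans (cong num′ upd-same) updF-same }) ]′
                                       (m≤n⇒m<n∨m≡n (s≤s⁻¹ lt))
          ; par< = λ h ns → [ (λ { refl → subst₂ _<_ (sym (trans (cong num′ updF-same) (num-keep vx)))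
            (sym updF-same) (num< vx) }) ,
                              (λ (ne , vv) → subst₂ _<_
                                  (sym (trans (cong num′ (updF-other ne)) (num-keep (vis-par vv ns))))
                                  (sym (num-keep vv)) (par< vv ns)) ]′ (back h)
          ; par-adj = λ h ns → [ (λ { refl → subst (λ z → Adj z y) (sym updF-same)
            (proj₂ (queued (here refl))) }) ,
                                 (λ (ne , vv) → subst (λ z → Adj z _) (sym (updF-other ne))
                                     (par-adj vv ns)) ]′ (back h)
          ; vis-par = λ h ns → [ (λ { refl → trans (cong vis′ updF-same) (keepv vx) }) ,
                                 (λ (ne , vv) → trans (cong vis′ (updF-other ne))
                                     (keepv (vis-par vv ns))) ]′ (back h)
          ; queued = λ i → [ (λ k → let e , a = sound k in trans (cong vis′ e) updF-same , a) ,
            (λ k → let v , a = queued (there k) in keepv v , a) ]′ (∈-++⁻ (adj y) i)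
          ; frontier = λ h a → [ (λ { refl → inj₂ (∈-++ˡ (all (adj-of a))) }) ,
            (λ (ne , vv) → front (frontier vv a)) ]′ (back h) }
          where
          front : ∀ {a b} → vis b ≡ true ⊎ (a , b) ∈ ((x , y) ∷ Q) → vis′ b ≡ true ⊎
              (a , b) ∈ (adj y ++ Q)
          front (inj₁ v) = inj₁ (keepv v)
          front (inj₂ (here refl)) = inj₁ updF-same
          front (inj₂ (there i)) = inj₂ (∈-++ʳ (adj y) i)

    explored₀ : Explored (updF (λ _ → false) start true) (λ _ → 0) (λ v → v) (λ _ → start) 1 (adj start)
    explored₀ = record
      { vis-root = updF-same ; num-root = refl ; num< = λ _ → ≤-refl ; ord-num = λ h → sym (only h)
      ; vis-ord = λ _ → updF-same ; num-ord = λ { (s≤s z≤n) → refl }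
      ; par< = λ h ne → contradiction (only h) ne ; par-adj = λ h ne → contradiction (only h) ne ;
        vis-par = λ h ne → contradiction (only h) ne
      ; queued = λ i → let e , a = sound i in trans (cong (updF (λ _ → false) start true) e) updF-same ,
        a
      ; frontier = λ h a → inj₂ (subst (λ z → (_ , _) ∈ adj z) (only h) (all (adj-of a))) }
      where
      only : ∀ {v} → updF (λ _ → false) start true v ≡ true → v ≡ start
      only {v} h with v Finₚ.≟ start
      ... | yes e = e
      ... | no ne = contradiction (trans (sym h) (updF-other ne)) λ ()

    complete : ∀ {vis num par ord cnt} → Explored vis num par ord cnt [] → (∀ v → vis v ≡ true) × cnt ≡
        n
    complete {vis} {num} {par} {ord} {cnt} E = every , ≤-antisym
        (Finₚ.injective⇒≤ {f = λ i → ord (toℕ i)} λ {i} {j} e →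
          toℕ-injective (trans (sym (num-ord (toℕ<n i))) (trans (cong num e) (num-ord (toℕ<n j)))))
        (Finₚ.injective⇒≤ {f = λ v → fromℕ< (num< (every v))} λ {v} {v′} e →
          trans (sym (ord-num (every v)))
           (trans (cong ord (trans (sym (toℕ-fromℕ< _)) (trans (cong toℕ e) (toℕ-fromℕ< _))))
               (ord-num (every v′))))
      where
      open Explored E
      reach : ∀ {a b} → Star (λ a b → Adj a b × ⊤ × ⊤) a b → vis a ≡ true → vis b ≡ true
      reach ε v = v
      reach ((a , _) ◅ st) v = reach st ([ id , (λ ()) ]′ (frontier v a))
      every : ∀ v → vis v ≡ true
      every v = reach (connected {start} {v} tt tt) vis-root

    searchTree : ∀ {vis num par ord cnt} → Explored vis num par ord cnt [] → SearchTree graph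
    searchTree {vis} {num} {par} {ord} {cnt} E = record
      { root = start ; par = par ; num = num ; ord = ord
      ; num<n = λ v → subst (num v <_) full (num< (every v)) ; num-ord = λ lt →
        num-ord (subst (_ <_) (sym full) lt)
      ; ord-num = λ v → ord-num (every v) ; num-root = num-root ; par< = λ {v} → par< (every v) ;
        par-adj = λ {v} → par-adj (every v) }
      where
      open Explored E
      every = proj₁ (complete E)
      full = proj₂ (complete E)

  record Mapped (T : SearchTree graph) (σ : Store) : Set where
    open SearchTree T
    field
      at-ord : ∀ {i} → i < n → σ 14 i ≡ toℕ (ord i)
      at-num : ∀ v → σ 15 (toℕ v) ≡ num v
      at-par : ∀ {v} → v ≢ root → σ 16 (toℕ v) ≡ toℕ (par v)

  uncodeE : ∀ {τ x y Q} → τ 0 0 ≡ n → τ 76 0 ≡ codes ((x , y) ∷ Q) →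
            Exec 0 uncode τ 70 (λ υ → υ 76 0 ≡ codes Q × υ 78 0 ≡ toℕ x × υ 79 0 ≡ toℕ y)
  uncodeE {τ} {x} {y} {Q} e0 e76 = weaken tt $ seqE $ writeE $ seqE $ writeE $ seqE $ writeE $
    writeE (eQ , ex , ey)
    where
    ebase : suc (τ 0 0 * τ 0 0) ≡ pb
    ebase = cong (λ z → suc (z * z)) e0
    c₁ : ℕ
    c₁ = modulo (τ 76 0) (suc (τ 0 0 * τ 0 0)) ∸ 1
    ec : c₁ ≡ toℕ x * n + toℕ y
    ec = cong (_∸ 1) (trans (cong₂ modulo e76 ebase) (mod-unique (codes Q) (code<pb (x , y))))
    eQ : applyOp div (τ 76 0) (suc (τ 0 0 * τ 0 0)) ≡ codes Q
    eQ = trans (cong₂ (applyOp div) e76 ebase) (div-unique (codes Q) (code<pb (x , y)))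
    ex : applyOp div c₁ (τ 0 0) ≡ toℕ x
    ex = trans (cong₂ (applyOp div) ec e0) (div-unique (toℕ x) (toℕ<n y))
    ey : modulo c₁ (τ 0 0) ≡ toℕ y
    ey = trans (cong₂ modulo ec e0) (mod-unique (toℕ x) (toℕ<n y))

  held-new : ∀ {vis num par ord cnt x y Q Q′ a13 a14 a15 a16 a17 s76 sx sy sc z} (ny : vis y ≡ false) →
    Held vis num par ord cnt Q a13 a14 a15 a16 a17 sc s76 → sx ≡ toℕ x → sy ≡ toℕ y → z ≡ codes Q′ →
    Held (updF vis y true) (updF num y cnt) (updF par y x) (upd ord cnt y) (suc cnt) Q′
      (λ j → if sy ≡ᵇ j then 1 else a13 j) (λ j → if sc ≡ᵇ j then sy else a14 j)
          (λ j → if sy ≡ᵇ j then sc else a15 j)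
      (λ j → if sy ≡ᵇ j then sx else a16 j) (λ j → if sy ≡ᵇ j then sx else a17 j) (suc sc) z
  held-new {vis} {num} {par} {ord} {cnt} {x} {y} {a13 = a13} {a14} {a15} {a16} {a17} {sx = sx} {sy} {sc}
    ny H ex ey ez = record
    { at13 = at13′
    ; at14 = λ {i} lt → [ (λ lt′ → trans
      (if-other {sc} {i} {sy} {a14 i} (λ e → <⇒≢ lt′ (trans (sym e) at75)))
      (trans (at14 lt′) (cong toℕ (sym (upd-other (<⇒≢ lt′)))))) ,
                      (λ { refl → trans (if-same {sc} at75) (trans ey (cong toℕ (sym upd-same))) }) ]′
                          (m≤n⇒m<n∨m≡n (s≤s⁻¹ lt))
    ; at15 = λ {v} → at15′ {v}
    ; at16 = λ {v} → at16′ {v} {a16} (λ vv ns → at16 vv ns)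
    ; at17 = λ {v} → at16′ {v} {a17} (λ vv ns → at17 vv ns)
    ; at75 = cong suc at75
    ; at76 = ez }
    where
    open Held H
    off : ∀ {v} → v ≢ y → sy ≢ toℕ v
    off ne e = ne (toℕ-injective (trans (sym e) ey))
    seen : ∀ {v} → v ≢ y → updF vis y true v ≡ true → vis v ≡ true
    seen ne h = trans (sym (updF-other ne)) h
    at13′ : ∀ v → (if sy ≡ᵇ toℕ v then 1 else a13 (toℕ v)) ≡ fromBool (updF vis y true v)
    at13′ v with v Finₚ.≟ y
    ... | yes refl = trans (if-same {sy} ey) (cong fromBool (sym updF-same))
    ... | no ne = trans (if-other {sy} (off ne)) (trans (at13 v) (cong fromBool (sym (updF-other ne))))
    at15′ : ∀ {v} → updF vis y true v ≡ true → (if sy ≡ᵇ toℕ v then sc else a15 (toℕ v)) ≡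
        updF num y cnt v
    at15′ {v} h with v Finₚ.≟ y
    ... | yes refl = trans (if-same {sy} ey) (trans at75 (sym updF-same))
    ... | no ne = trans (if-other {sy} (off ne)) (trans (at15 (seen ne h)) (sym (updF-other ne)))
    at16′ : ∀ {v} {a : ℕ → ℕ} → (vis v ≡ true → v ≢ start → a (toℕ v) ≡ toℕ (par v)) →
            updF vis y true v ≡ true → v ≢ start → (if sy ≡ᵇ toℕ v then sx else a (toℕ v)) ≡
                toℕ (updF par y x v)
    at16′ {v} old h ns with v Finₚ.≟ y
    ... | yes refl = trans (if-same {sy} ey) (trans ex (cong toℕ (sym updF-same)))
    ... | no ne = trans (if-other {sy} (off ne))
        (trans (old (seen ne h) ns) (cong toℕ (sym (updF-other ne))))

  Reached : Store → Set
  Reached τ = ∃[ T ] Mapped T τ × (∀ {v} → v ≢ SearchTree.root T → τ 17 (toℕ v) ≡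
    toℕ (SearchTree.par T v))

  module Exploration {σ : Store} {adj} (inp : Input I σ) (R : Rep adj (σ 11) (σ 12))
      (L : Lists m adj) where
    Exploring : ℕ → Store → Set
    Exploring B τ = ∃[ vis ] ∃[ num ] ∃[ par ] ∃[ ord ] ∃[ cnt ] ∃[ Q ] B ≡ length Q + rest adj L vis ×
      Explored vis num par ord cnt Q ×
      Held vis num par ord cnt Q (τ 13) (τ 14) (τ 15) (τ 16) (τ 17) (τ 75 0) (τ 76 0) × τ 0 0 ≡ σ 0 0 ×
          (∀ i → τ 11 i ≡ σ 11 i) × (∀ i → τ 12 i ≡ σ 12 i)

    enterE : ∀ {υ vis num par ord cnt x y Q} (E : Explored vis num par ord cnt ((x , y) ∷ Q)) → vis y ≡
        false →
      Held vis num par ord cnt Q (υ 13) (υ 14) (υ 15) (υ 16) (υ 17) (υ 75 0) (υ 76 0) →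
      υ 78 0 ≡ toℕ x → υ 79 0 ≡ toℕ y → υ 0 0 ≡ σ 0 0 → (∀ i → υ 11 i ≡ σ 11 i) →
          (∀ i → υ 12 i ≡ σ 12 i) →
      Exec 0 enter υ 90 (Exploring (length Q + rest adj L vis))
    enterE {υ} {vis} {num} {par} {ord} {cnt} {x} {y} {Q} E ny H ex ey e0 e11 e12 = weaken tt $
      seqE $ writeE $ seqE $ writeE $ seqE $ writeE $ seqE $ writeE $ seqE $ writeE $ seqE $ writeE $
          writeE
        (updF vis y true , updF num y cnt , updF par y x , upd ord cnt y , suc cnt , adj y ++ Q , eB ,
            Visit.new-visit adj L E ny ,
         held-new {a13 = υ 13} {υ 14} {υ 15} {υ 16} {υ 17} {sx = υ 78 0} {υ 79 0} {υ 75 0} ny H ex ey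
           eQ , e0 , e11 , e12)
      where
      eQ : υ 76 0 * υ 12 (υ 79 0) + υ 11 (υ 79 0) ≡ codes (adj y ++ Q)
      eQ = trans (cong₂ _+_ (cong₂ _*_ (Held.at76 H)
        (trans (cong (υ 12) ey) (trans (e12 _) (proj₂ (R y)))))
        (trans (cong (υ 11) ey) (trans (e11 _) (proj₁ (R y)))))
                 (sym (codes-++ (adj y) Q))
      eB : length Q + rest adj L vis ≡ length (adj y ++ Q) + rest adj L (updF vis y true)
      eB = trans (cong (length Q +_) (rest-visit adj L vis y ny))
        (trans (lem (length Q) (length (adj y)) _) (cong (_+ rest adj L (updF vis y true))
        (sym (length-++ (adj y)))))
        where
        lem : ∀ a b c → a + (b + c) ≡ b + a + c
        lem = solve-∀

    visitE : ∀ B τ → Exploring B τ → (eval (var 76) τ ≡ 0 × Reached τ) ⊎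
             (eval (var 76) τ ≢ 0 × ∃[ x ] ∃[ B′ ] suc x + B′ ≤ B × Exec x visit τ 180 (Exploring B′))
    visitE B τ (vis , num , par , ord , cnt , [] , eB , E , H , _) = inj₁ (at76 , searchTree adj L E ,
        record { at-ord = λ lt → at14 (subst (_ <_) (sym (proj₂ (complete adj L E))) lt) ; at-num =
          λ v → at15 (proj₁ (complete adj L E) v)
               ; at-par = λ {v} → at16 (proj₁ (complete adj L E) v) } , λ {v} →
                 at17 (proj₁ (complete adj L E) v))
      where open Held H
    visitE B τ (vis , num , par , ord , cnt , (x , y) ∷ Q , eB , E , H , e0 , e11 , e12) =
      inj₂ ((λ z → nz (trans (sym at76) z)) , 0 , length Q + rest adj L vis , ≤-reflexive (sym eB) ,
        weaken tt (seqE $ agreeMap next (uncodeE {τ} {x} {y} {Q} (trans e0 (Input.at-n inp)) at76)))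
      where
      open Held H
      nz : codes Q * pb + code (x , y) ≢ 0
      nz z = 1+n≢0 (m+n≡0⇒n≡0 (codes Q * pb) z)
      next : ∀ υ → Agree uncode τ υ → υ 76 0 ≡ codes Q × υ 78 0 ≡ toℕ x × υ 79 0 ≡ toℕ y →
             Exec 0 (cond (read 13 (var 79)) skip enter) υ _ (Exploring (length Q + rest adj L vis))
      next υ ag (eQ , ex , ey) = condE
        (λ g → skipE (vis , num , par , ord , cnt , Q , refl ,
            Visit.old-visit adj L E (seen (λ z → g (trans (cong (υ 13) ey) (trans (ag 13 tt _) z)))) ,
            H′ ,
               trans (ag 0 tt 0) e0 , (λ i → trans (ag 11 tt i) (e11 i)) ,
                   (λ i → trans (ag 12 tt i) (e12 i))))
        (λ g → enterE {υ} E (unseen (trans (sym (ag 13 tt _)) (trans (cong (υ 13) (sym ey)) g))) H′ ex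
            ey
               (trans (ag 0 tt 0) e0) (λ i → trans (ag 11 tt i) (e11 i))
                   (λ i → trans (ag 12 tt i) (e12 i)))
        where
        H′ : Held vis num par ord cnt Q (υ 13) (υ 14) (υ 15) (υ 16) (υ 17) (υ 75 0) (υ 76 0)
        H′ = record { at13 = λ v → trans (ag 13 tt _) (at13 v) ; at14 = λ lt →
          trans (ag 14 tt _) (at14 lt) ; at15 = λ h → trans (ag 15 tt _) (at15 h)
                    ; at16 = λ h ns → trans (ag 16 tt _) (at16 h ns) ; at17 = λ h ns →
                      trans (ag 17 tt _) (at17 h ns) ; at75 = trans (ag 75 tt 0) at75 ; at76 = eQ }
        seen : τ 13 (toℕ y) ≢ 0 → vis y ≡ true
        seen h with vis y in eq
        ... | true = refl
        ... | false = contradiction (trans (at13 y) (cong fromBool eq)) h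
        unseen : τ 13 (toℕ y) ≡ 0 → vis y ≡ false
        unseen h with vis y in eq
        ... | false = refl
        ... | true with () ← trans (sym h) (trans (at13 y) (cong fromBool eq))

  exploreE : ∀ {σ adj} → Input I σ → Rep adj (σ 11) (σ 12) → Lists m adj → (∀ i → σ 13 i ≡ 0) → σ 14 0 ≡
      0 → σ 15 0 ≡ 0 →
             Exec (2 * m) explore σ 300 Reached
  exploreE {σ} {adj} inp R L z13 z14 z15 = weaken tt $ seqE $ writeE $ seqE $ writeE $ seqE $ writeE $
    scale (≤-reflexive budget) $ whileE Exploring visitE _
      (updF (λ _ → false) start true , (λ _ → 0) , (λ v → v) , (λ _ → start) , 1 , adj start , refl ,
          explored₀ adj L ,
       record { at13 = at13₀ ; at14 = λ { (s≤s z≤n) → trans z14 (sym toℕ-start) } ; at15 = λ {v} h →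
         trans (cong (σ 15) (trans (cong toℕ (only h)) toℕ-start)) z15
              ; at16 = λ h ne → contradiction (only h) ne ; at17 = λ h ne → contradiction (only h) ne ;
                at75 = refl
              ; at76 = trans (cong (σ 11) (sym toℕ-start)) (proj₁ (R start)) } , refl , (λ _ → refl) ,
                (λ _ → refl))
    where
    open Exploration {σ} {adj} inp R L
    only : ∀ {v} → updF (λ _ → false) start true v ≡ true → v ≡ start
    only {v} h with v Finₚ.≟ start
    ... | yes e = e
    ... | no ne = contradiction (trans (sym h) (updF-other ne)) λ ()
    at13₀ : ∀ v → (if 0 ≡ᵇ toℕ v then 1 else σ 13 (toℕ v)) ≡ fromBool (updF (λ _ → false) start true v)
    at13₀ v with v Finₚ.≟ start
    ... | yes refl = trans (if-same (sym toℕ-start)) (cong fromBool (sym updF-same))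
    ... | no ne = trans (if-other (λ e → ne (toℕ-injective (trans (sym e) (sym toℕ-start)))))
        (trans (z13 _) (cong fromBool (sym (updF-other ne))))
    budget : length (adj start) + rest adj L (updF (λ _ → false) start true) ≡ 2 * m
    budget = trans (sym (rest-visit adj L (λ _ → false) start refl))
      (trans (∑-cong λ v → *-identityˡ (length (adj v))) (Lists.amount L))

-- Finding the blocks

direct : ℕ → ℕ → Program
direct q y = cond (op equal (read 16 (var q)) (var y)) skip (write 17 (var q) (var y))

partners : Program
partners = for 72 (read 0 (lit 1)) (set 82 (read 3 (var 72)) ⨟ set 83 (read 4 (var 72)) ⨟
  cond (op less (read 15 (var 82)) (read 15 (var 83))) (direct 83 82) (direct 82 83))

ascend climb contract : Program
ascend = cond (op less (read 15 (var 83)) (read 15 (var 82)))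
  (set 84 (op sub (var 84) (lit 1)) ⨟ write 21 (var 84) (var 82) ⨟ write 18 (var 82) (lit 1) ⨟
   set 86 (var 82) ⨟ set 82 (read 16 (var 82)))
  (write 21 (var 85) (var 83) ⨟ set 85 (op add (lit 1) (var 85)) ⨟ write 18 (var 83) (lit 1) ⨟
   set 86 (var 83) ⨟ set 83 (read 16 (var 83)))
climb =
  set 82 (var 81) ⨟ set 83 (read 17 (var 81)) ⨟ set 84 (op add (var 80) (read 0 (lit 0))) ⨟
      set 85 (var 84) ⨟
  while (op sub (lit 1) (op equal (var 82) (var 83))) ascend ⨟
  write 19 (var 86) (var 84) ⨟ write 20 (var 86) (op sub (var 85) (var 84)) ⨟ set 80 (var 85)
contract = set 80 (lit 0) ⨟ for 72 (op sub (read 0 (lit 0)) (lit 1))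
  (set 81 (read 14 (op sub (read 0 (lit 0)) (op add (lit 1) (var 72)))) ⨟ cond (read 18 (var 81)) skip
      climb)

At : ∀ {n} → (ℕ → ℕ) → ℕ → List (Fin n) → Set
At a lo L = ∀ pre c post → L ≡ pre ++ c ∷ post → a (lo + length pre) ≡ toℕ c

At-cons : ∀ {n} {a a′ : ℕ → ℕ} {lo L} {c : Fin n} → a′ lo ≡ toℕ c → (∀ i → lo < i → a′ i ≡ a i) →
    At a (suc lo) L → At a′ lo (c ∷ L)
At-cons {a′ = a′} {lo} e oth r [] c post refl = trans (cong a′ (+-identityʳ lo)) e
At-cons {a = a} {lo = lo} e oth r (x ∷ pre) c post refl = trans (oth _ (m<m+n lo z<s))
  (trans (cong a (+-suc lo (length pre))) (r pre c post refl))

At-snoc : ∀ {n} {a a′ : ℕ → ℕ} {lo} L {c : Fin n} → a′ (lo + length L) ≡ toℕ c →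
    (∀ i → i < lo + length L → a′ i ≡ a i) → At a lo L → At a′ lo (L ++ c ∷ [])
At-snoc {a = a} {a′} {lo} L {c} e oth r pre c′ post eq with initLast post
... | [] = let e₁ , e₂ = ∷ʳ-injective L pre eq in trans (cong (λ z → a′ (lo + length z)) (sym e₁))
    (trans e (cong toℕ e₂))
  where open import Data.List.Properties using (∷ʳ-injective)
... | post′ ∷ʳ′ z = trans (oth _ (+-monoʳ-< lo
    (≤-trans (m<m+n (length pre) z<s) (≤-reflexive (sym (trans (cong length shape) (length-++ pre)))))))
                      (r pre c′ post′ shape)
  where
  open import Data.List.Properties using (∷ʳ-injective)
  shape : L ≡ pre ++ c′ ∷ post′
  shape = proj₁ (∷ʳ-injective L (pre ++ c′ ∷ post′)
    (trans eq (sym (++-assoc pre (c′ ∷ post′) (z ∷ [])))))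

At-same : ∀ {n} {a a′ : ℕ → ℕ} {lo} {L : List (Fin n)} → (∀ i → i < lo + length L → a′ i ≡ a i) →
    At a lo L → At a′ lo L
At-same {lo = lo} oth r pre c post refl =
  trans (oth _ (+-monoʳ-< lo (≤-trans (m<m+n (length pre) z<s) (≤-reflexive (sym (length-++ pre))))))
  (r pre c post refl)

module Contract (I : Instance) (cactus : IsCactus (Instance.graph I))
    (ST : SearchTree (Instance.graph I)) where
  open Instance I
  open Graph graph hiding (simple)
  open SearchTree ST
  open Fundamental ST
  open Cactus cactus
  open Assembly ST cactus
  open Adjacency I using (m; Joined; adj-of; edge-adj)
  open Explore I (proj₁ cactus) using (Mapped; 1≤n)

  Partner : ℕ → (Fin n → Fin n) → Set
  Partner k pt = ∀ {q} → q ≢ root → (pt q ≡ par q × (∀ y → Chord q y → ¬ Joined k q y)) ⊎ Chord q (pt q)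

  Mapped-agree : ∀ {c σ τ} → {T (free 14 c)} → {T (free 15 c)} → {T (free 16 c)} → Agree c σ τ →
      Mapped ST σ → Mapped ST τ
  Mapped-agree {_} {_} {_} {f14} {f15} {f16} ag mp = record
    { at-ord = λ lt → trans (ag 14 f14 _) (at-ord lt) ; at-num = λ v → trans (ag 15 f15 _) (at-num v) ;
      at-par = λ ne → trans (ag 16 f16 _) (at-par ne) }
    where open Mapped mp

  partnersE : ∀ {σ} → Input I σ → Mapped ST σ → (∀ {v} → v ≢ root → σ 17 (toℕ v) ≡ toℕ (par v)) →
    Exec m partners σ 100 (λ τ → ∃[ pt ] (∀ {v} → v ≢ root → τ 17 (toℕ v) ≡ toℕ (pt v)) × Partner m pt)
  partnersE {σ} inp mp e17 = weaken tt $ scale (≤-reflexive (*-identityʳ m)) $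
    forE m (λ k τ → ∃[ pt ] (∀ {v} → v ≢ root → τ 17 (toℕ v) ≡ toℕ (pt v)) × Partner k pt) {tt}
      (λ τ ag → trans (ag 0 tt 1) (Input.at-m inp))
      (par , (λ {v} → e17 {v}) , λ ne → inj₁ (refl , λ { y _ (_ , () , _) }))
      body
    where
    module Edge {k pt} (P : Partner k pt) (i : Fin m) (ik : toℕ i ≡ k) {q y} (adj : Adj q y)
        (lt : num y < num q)
                (se : SameEdge (q , y) (lookup edges i)) where
      only : ∀ {q′ y′} i′ → i′ ≡ i → num y′ < num q′ → SameEdge (q′ , y′) (lookup edges i′) → q′ ≡ q ×
          y′ ≡ y
      only _ refl lt′ se′ = go se se′ {lt′}
        where
        go : ∀ {e q′ y′} → SameEdge (q , y) e → SameEdge (q′ , y′) e → {num y′ < num q′} → q′ ≡ q × y′ ≡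
            y
        go (inj₁ refl) (inj₁ refl) = refl , refl
        go (inj₁ refl) (inj₂ refl) {l} = contradiction lt (<⇒≯ l)
        go (inj₂ refl) (inj₁ refl) {l} = contradiction lt (<⇒≯ l)
        go (inj₂ refl) (inj₂ refl) = refl , refl
      stay : y ≡ par q → Partner (suc k) pt
      stay e {q′} ne = [ (λ (e′ , none) →
        inj₁ (e′ , λ { y′ c (i′ , lt′ , se′) → [ (λ l → none y′ c (i′ , l , se′)) ,
          (λ eq → tree c (only i′ (toℕ-injective (trans eq (sym ik))) (proj₁ (proj₂ c)) se′)) ]′
              (m≤n⇒m<n∨m≡n (s≤s⁻¹ lt′)) })) , inj₂ ]′ (P ne)
        where
        tree : ∀ {y′} → Chord q′ y′ → q′ ≡ q × y′ ≡ y → ⊥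
        tree (_ , _ , np) (refl , refl) = np e
      move : y ≢ par q → Partner (suc k) (updF pt q y)
      move np {q′} ne with q′ Finₚ.≟ q
      ... | yes refl = inj₂ (subst (Chord q) (sym updF-same) (adj , lt , np))
      ... | no nq = subst (λ z → (z ≡ par q′ × (∀ y → Chord q′ y → ¬ Joined (suc k) q′ y)) ⊎ Chord q′ z)
          (sym (updF-other nq)) $ [ (λ (e′ , none) →
          inj₁ (e′ , λ { y′ c (i′ , lt′ , se′) → [ (λ l → none y′ c (i′ , l , se′)) ,
          (λ eq → nq (proj₁ (only i′ (toℕ-injective (trans eq (sym ik))) (proj₁ (proj₂ c)) se′))) ]′
              (m≤n⇒m<n∨m≡n (s≤s⁻¹ lt′)) })) , inj₂ ]′ (P ne)

    written : ∀ {τ17 : ℕ → ℕ} {pt q a b} {y : Fin n} → a ≡ toℕ q → b ≡ toℕ y →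
        (∀ {v} → v ≢ root → τ17 (toℕ v) ≡ toℕ (pt v)) →
              ∀ {v} → v ≢ root → (if a ≡ᵇ toℕ v then b else τ17 (toℕ v)) ≡ toℕ (updF pt q y v)
    written {q = q} ea eb old {v} ne with v Finₚ.≟ q
    ... | yes refl = trans (if-same ea) (trans eb (cong toℕ (sym updF-same)))
    ... | no nq = trans (if-other (λ e → nq (toℕ-injective (trans (sym e) ea))))
        (trans (old ne) (cong toℕ (sym (updF-other nq))))

    body : ∀ k τ → k < m → Agree partners σ τ → τ 72 0 ≡ k →
        (∃[ pt ] (∀ {v} → v ≢ root → τ 17 (toℕ v) ≡ toℕ (pt v)) × Partner k pt) →
           Exec 0 _ τ _ (λ υ → ∀ x → ∃[ pt ] (∀ {v} → v ≢ root → υ 17 (toℕ v) ≡ toℕ (pt v)) ×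
               Partner (suc k) pt)
    body k τ k<m ag tk (pt , old , P) = seqE $ writeE $ seqE $ writeE $ condE
      (λ g → let lt = subst₂ _<_ na nb (less≢0 g)
                 open Edge P i ik {b} {a} (adj-sym (edge-adj i)) lt (inj₂ refl) in condE
        (λ h → skipE λ _ → pt , (λ {v} → old {v}) , λ {z} →
            stay (toℕ-injective (trans (sym eb) (trans (sym (equal≢0 h)) (parent (above-root lt) ea)))))
        (λ h → writeE λ _ → updF pt b a , (λ {v} → written {τ 17} {pt} {b} ea eb old {v}) , λ {z} →
            move λ e → equal≡0 h (trans (parent (above-root lt) ea)
            (trans (cong toℕ (sym e)) (sym eb)))))
      (λ g → let lt = [ id , (λ e → ⊥-elim (All.lookup loopless (∈-lookup i) (num-inj (sym e)))) ]′
                   (m≤n⇒m<n∨m≡n (subst₂ _≤_ nb na (less≡0 g)))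
                 open Edge P i ik {a} {b} (edge-adj i) lt (inj₁ refl) in condE
        (λ h → skipE λ _ → pt , (λ {v} → old {v}) , λ {z} →
            stay (toℕ-injective (trans (sym ea) (trans (sym (equal≢0 h)) (parent (above-root lt) eb)))))
        (λ h → writeE λ _ → updF pt a b , (λ {v} → written {τ 17} {pt} {a} eb ea old {v}) , λ {z} →
            move λ e → equal≡0 h (trans (parent (above-root lt) eb)
            (trans (cong toℕ (sym e)) (sym ea)))))
      where
      open import Data.List.Membership.Propositional.Properties using (∈-lookup)
      i : Fin m
      i = fromℕ< k<m
      ik = toℕ-fromℕ< k<m
      a b : Fin n
      a = proj₁ (lookup edges i)
      b = proj₂ (lookup edges i)
      eb : τ 3 (τ 72 0) ≡ toℕ a
      eb = trans (cong (τ 3) (trans tk (sym ik))) (trans (ag 3 tt _) (Input.at-x inp i))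
      ea : τ 4 (τ 72 0) ≡ toℕ b
      ea = trans (cong (τ 4) (trans tk (sym ik))) (trans (ag 4 tt _) (Input.at-y inp i))
      na : τ 15 (τ 3 (τ 72 0)) ≡ num a
      na = trans (cong (τ 15) eb) (trans (ag 15 tt _) (Mapped.at-num mp a))
      nb : τ 15 (τ 4 (τ 72 0)) ≡ num b
      nb = trans (cong (τ 15) ea) (trans (ag 15 tt _) (Mapped.at-num mp b))
      parent : ∀ {v z} → v ≢ root → z ≡ toℕ v → τ 16 z ≡ toℕ (par v)
      parent ne refl = trans (ag 16 tt _) (Mapped.at-par mp ne)

  module Climbs (pt : Fin n → Fin n) (partner : ∀ {q} → q ≢ root →
      (pt q ≡ par q × (∀ y → ¬ Chord q y)) ⊎ Chord q (pt q)) where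

    pt< : ∀ {q} → q ≢ root → num (pt q) < num q
    pt< {q} ne = [ (λ (e , _) → subst (λ z → num z < num q) (sym e) (par< ne)) ,
      (λ (_ , lt , _) → lt) ]′ (partner ne)

    module _ (q : Fin n) (q≢ : q ≢ root) where
      -- A bridge is climbed in a single step.
      Budget : ℕ → Fin n → Fin n → Fin n → List (Fin n) → Set
      Budget B x y κ mid = (B ≡ num x + num y × Chord q (pt q)) ⊎
        (pt q ≡ par q × ((mid ≡ [] × x ≡ q × y ≡ pt q × B ≡ 1) ⊎
            (mid ≡ q ∷ [] × κ ≡ q × x ≡ y × B ≡ 0)))

      Marks : List (Fin n) → (ℕ → ℕ) → (ℕ → ℕ) → Set
      Marks mid old new = ∀ v → (v ∈ mid × new (toℕ v) ≡ 1) ⊎ (v ∉ mid × new (toℕ v) ≡ old (toℕ v))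

      marks-add : ∀ {mid mid′ old new x a} → a ≡ toℕ x → (∀ {v} → v ∈ mid′ → v ≡ x ⊎ v ∈ mid) →
          (∀ {v} → v ≡ x ⊎ v ∈ mid → v ∈ mid′) →
                  Marks mid old new → Marks mid′ old (λ j → if a ≡ᵇ j then 1 else new j)
      marks-add {x = x} ea from to M v with v Finₚ.≟ x
      ... | yes refl = inj₁ (to (inj₁ refl) , if-same ea)
      ... | no ne = [ (λ (i , e) → inj₁ (to (inj₂ i) , trans (if-other off) e)) ,
                      (λ (i , e) → inj₂ ((λ k → [ ne , i ]′ (from k)) , trans (if-other off) e)) ]′
                          (M v)
        where
        off : _ ≢ toℕ v
        off e = ne (toℕ-injective (trans (sym e) ea))

      module _ (σ : Store) (g : ℕ) (mp : Mapped ST σ) where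
        Climbing : ℕ → Store → Set
        Climbing B τ = ∃[ x ] ∃[ y ] ∃[ κ ] ∃[ mid ] ∃[ lo ] Walk q (pt q) x y κ mid ×
          Budget B x y κ mid ×
          (τ 82 0 ≡ toℕ x × τ 83 0 ≡ toℕ y × (mid ≢ [] → τ 86 0 ≡ toℕ κ) × τ 84 0 ≡ lo × τ 85 0 ≡
              lo + length mid × g + n ≤ lo + length mid) ×
          Marks mid (σ 18) (τ 18) × At (τ 21) lo mid × (∀ i → i < g → τ 21 i ≡ σ 21 i) ×
              (∀ i → τ 15 i ≡ σ 15 i) × (∀ i → τ 16 i ≡ σ 16 i)

        Climbed : Store → Set
        Climbed τ = ∃[ κ ] ∃[ mid ] ∃[ lo ] Block q (pt q) κ mid × Kind pt partner q κ mid ×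
          (τ 86 0 ≡ toℕ κ × τ 84 0 ≡ lo × τ 85 0 ≡ lo + length mid × g ≤ lo) ×
          Marks mid (σ 18) (τ 18) × At (τ 21) lo mid × (∀ i → i < g → τ 21 i ≡ σ 21 i)

        low : ∀ {lo} {mid : List (Fin n)} → g + n ≤ lo + length mid → Unique mid → g ≤ lo
        low {lo} {mid} le un = +-cancelʳ-≤ n g lo (≤-trans le (+-monoʳ-≤ lo (unique-length un)))

        ascendE : ∀ B τ → Climbing B τ → (eval (op sub (lit 1) (op equal (var 82) (var 83))) τ ≡ 0 ×
            Climbed τ) ⊎
                    (eval (op sub (lit 1) (op equal (var 82) (var 83))) τ ≢ 0 ×
                        ∃[ x ] ∃[ B′ ] suc x + B′ ≤ B × Exec x ascend τ 100 (Climbing B′))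
        ascendE B τ (x , y , κ , mid , lo , W , bud , (e82 , e83 , e86 , e84 , e85 , le) , M , A ,
            below , e15 , e16) with x Finₚ.≟ y
        ... | yes refl = inj₁ (trans (cong (λ z → 1 ∸ fromBool z)
            (trans (cong₂ _≡ᵇ_ e82 e83) (≡ᵇ-refl (toℕ x)))) refl ,
              κ , mid , lo , blk , kind′ bud , (e86 (λ { refl → contradiction (Block.κ∈ blk) λ () }) ,
                  e84 , e85 , low le (Walk.simple W)) , M , A , below)
          where
          blk : Block q (pt q) κ mid
          blk = finish (pt< q≢) W
          kind′ : Budget B x x κ mid → Kind pt partner q κ mid
          kind′ (inj₁ (_ , c)) = inj₂ c
          kind′ (inj₂ (_ , inj₁ (refl , _))) = contradiction (Block.κ∈ blk) λ ()
          kind′ (inj₂ (_ , inj₂ (e , e′ , _))) = inj₁ (e′ , e)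
        ... | no x≢y = inj₂ ((λ z → 1+n≢0
            (trans (sym (cong (λ z → 1 ∸ fromBool z)
            (trans (cong₂ _≡ᵇ_ e82 e83) (≢⇒≡ᵇ (x≢y ∘ toℕ-injective))))) z)) , step bud)
          where
          nx : τ 15 (τ 82 0) ≡ num x
          nx = trans (cong (τ 15) e82) (trans (e15 _) (Mapped.at-num mp x))
          ny : τ 15 (τ 83 0) ≡ num y
          ny = trans (cong (τ 15) e83) (trans (e15 _) (Mapped.at-num mp y))
          px : num y < num x → τ 16 (τ 82 0) ≡ toℕ (par x)
          px lt = trans (cong (τ 16) e82) (trans (e16 _) (Mapped.at-par mp (above-root lt)))
          py : num x < num y → τ 16 (τ 83 0) ≡ toℕ (par y)
          py lt = trans (cong (τ 16) e83) (trans (e16 _) (Mapped.at-par mp (above-root lt)))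
          branch : ∀ {B′} → (num y < num x → Budget B′ (par x) y x (x ∷ mid)) →
              (num x < num y → Budget B′ x (par y) y (mid ++ y ∷ [])) →
                   Exec 0 ascend τ 100 (Climbing B′)
          branch {B′} bx by = weaken tt $ condE
            (λ h → seqE $ writeE $ seqE $ writeE $ seqE $ writeE $ seqE $ writeE $
                writeE (left (subst₂ _<_ ny nx (less≢0 h))))
            (λ h → seqE $ writeE $ seqE $ writeE $ seqE $ writeE $ seqE $ writeE $ writeE
               (right ([ id , (λ e → contradiction (num-inj e) x≢y) ]′
                   (m≤n⇒m<n∨m≡n (subst₂ _≤_ nx ny (less≡0 h))))))
            where
            τˡ τʳ : Store
            τˡ = ((((τ [ 84 , 0 ↦ τ 84 0 ∸ 1 ]) [ 21 , τ 84 0 ∸ 1 ↦ τ 82 0 ]) [ 18 , τ 82 0 ↦ 1 ]) [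
              86 , 0 ↦ τ 82 0 ]) [ 82 , 0 ↦ τ 16 (τ 82 0) ]
            τʳ = ((((τ [ 21 , τ 85 0 ↦ τ 83 0 ]) [ 85 , 0 ↦ suc (τ 85 0) ]) [ 18 , τ 83 0 ↦ 1 ]) [ 86 ,
              0 ↦ τ 83 0 ]) [ 83 , 0 ↦ τ 16 (τ 83 0) ]
            left : num y < num x → Climbing B′ τˡ
            left lt = par x , y , x , x ∷ mid , lo ∸ 1 , W′ , bx lt ,
              (px lt , e83 , (λ _ → e82) , cong (_∸ 1) e84 , trans e85 sum′ ,
                  subst (g + n ≤_) sum′ le) ,
              marks-add {mid} {x ∷ mid} {σ 18} {τ 18} e82 (λ { (here e) → inj₁ e ; (there i) → inj₂ i })
                  (λ { (inj₁ refl) → here refl ; (inj₂ i) → there i }) M ,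
              At-cons {a = τ 21} {λ i → if τ 84 0 ∸ 1 ≡ᵇ i then τ 82 0 else τ 21 i}
                (trans (if-same (cong (_∸ 1) e84)) e82)
                (λ i l → if-other (λ e → <⇒≢ l (trans (sym (cong (_∸ 1) e84)) e)))
                 (subst (λ z → At (τ 21) z mid) lo≡ A) ,
              (λ i l → trans (if-other (λ e → <⇒≢ (≤-trans l g≤) (trans (sym e) (cong (_∸ 1) e84))))
                  (below i l)) , e15 , e16
              where
              W′ = step-x lt W
              1+g≤ : suc g ≤ lo
              1+g≤ = +-cancelʳ-≤ (length mid) (suc g) lo
                (≤-trans (≤-trans (≤-reflexive (sym (+-suc g (length mid))))
                (+-monoʳ-≤ g (unique-length (Walk.simple W′)))) le)
              lo≡ : lo ≡ suc (lo ∸ 1)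
              lo≡ = sym (m+[n∸m]≡n (≤-trans (s≤s z≤n) 1+g≤))
              g≤ : g ≤ lo ∸ 1
              g≤ = s≤s⁻¹ (subst (suc g ≤_) lo≡ 1+g≤)
              sum′ : lo + length mid ≡ (lo ∸ 1) + suc (length mid)
              sum′ = trans (cong (_+ length mid) lo≡) (sym (+-suc (lo ∸ 1) (length mid)))
            right : num x < num y → Climbing B′ τʳ
            right lt = x , par y , y , mid ++ y ∷ [] , lo , W′ , by lt ,
              (e82 , py lt , (λ _ → e83) , e84 , trans (cong suc e85) sum′ ,
                  ≤-trans le (≤-trans (n≤1+n _) (≤-reflexive sum′))) ,
              marks-add {mid} {mid ++ y ∷ []} {σ 18} {τ 18} e83 (λ i → [ inj₂ ,
                  (λ { (here e) → inj₁ e }) ]′ (∈-++⁻ mid i))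
                  (λ { (inj₁ refl) → ∈-++ʳ mid (here refl) ; (inj₂ i) → ∈-++ˡ i }) M ,
              At-snoc {a = τ 21} {λ i → if τ 85 0 ≡ᵇ i then τ 83 0 else τ 21 i} mid
                (trans (if-same e85) e83) (λ i l → if-other (λ e → <⇒≢ l (trans (sym e) e85))) A ,
              (λ i l → trans (if-other (λ e → <⇒≢ (≤-trans l (≤-trans (m≤m+n g n) le))
                  (trans (sym e) e85))) (below i l)) , e15 , e16
              where
              W′ = step-y lt W
              sum′ : suc (lo + length mid) ≡ lo + length (mid ++ y ∷ [])
              sum′ = trans (sym (+-suc lo (length mid)))
                (cong (lo +_) (trans (sym (+-comm (length mid) 1)) (sym (length-++ mid))))
          step : Budget B x y κ mid → ∃[ x ] ∃[ B′ ] suc x + B′ ≤ B × Exec x ascend τ 100 (Climbing B′)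
          step (inj₂ (e , inj₂ (_ , _ , e′ , _))) = contradiction e′ x≢y
          step (inj₂ (e , inj₁ (refl , refl , refl , refl))) = 0 , 0 , ≤-refl ,
            branch (λ _ → inj₂ (e , inj₂ (refl , refl , sym e , refl)))
                (λ lt → contradiction (pt< q≢) (<⇒≯ lt))
          step (inj₁ (refl , c)) with <-cmp (num x) (num y)
          ... | tri≈ _ e _ = contradiction (num-inj e) x≢y
          ... | tri< lt _ _ = 0 , num x + num (par y) , ≤-trans (≤-reflexive (sym (+-suc (num x) _)))
              (+-monoʳ-≤ (num x) (par< (above-root lt))) ,
                 branch (λ gt → contradiction gt (<⇒≯ lt)) (λ _ → inj₁ (refl , c))
          ... | tri> _ _ gt = 0 , num (par x) + num y , +-monoˡ-≤ (num y) (par< (above-root gt)) ,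
                 branch (λ _ → inj₁ (refl , c)) (λ lt → contradiction lt (<⇒≯ gt))

module Contracting (I : Instance) (cactus : IsCactus (Instance.graph I))
    (ST : SearchTree (Instance.graph I))
    (Dm : ℕ) (1≤Dm : 1 ≤ Dm) (long : SimpleCycle (Instance.graph I) → Instance.n I ≤ Dm)
    (pt : Fin (Instance.n I) → Fin (Instance.n I))
    (partner : ∀ {q} → q ≢ SearchTree.root ST →
        (pt q ≡ SearchTree.par ST q × (∀ y → ¬ Fundamental.Chord ST q y)) ⊎
        Fundamental.Chord ST q (pt q)) where
  open Instance I
  open SearchTree ST
  open Fundamental ST
  open Assembly ST cactus
  open Explore I (proj₁ cactus) using (Mapped; 1≤n)
  open Contract I cactus ST using (Mapped-agree; module Climbs)
  open Climbs pt partner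

  climbE : ∀ {q σ} (q≢ : q ≢ root) → σ 0 0 ≡ n → σ 81 0 ≡ toℕ q → σ 17 (toℕ q) ≡ toℕ (pt q) →
      Mapped ST σ →
    Exec (2 * Dm) climb σ 200 (λ τ → ∃[ κ ] ∃[ mid ] ∃[ lo ] Block q (pt q) κ mid ×
        Kind pt partner q κ mid ×
      Marks q q≢ mid (σ 18) (τ 18) × At (τ 21) lo mid × (∀ i → i < σ 80 0 → τ 21 i ≡ σ 21 i) ×
          σ 80 0 ≤ lo × τ 80 0 ≡ lo + length mid ×
      (τ 19 (toℕ κ) ≡ lo × (∀ i → i ≢ toℕ κ → τ 19 i ≡ σ 19 i)) ×
          (τ 20 (toℕ κ) ≡ length mid × (∀ i → i ≢ toℕ κ → τ 20 i ≡ σ 20 i)))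
  climbE {q} {σ} q≢ en e81 e17 mp = weaken tt $ seqE $ writeE $ seqE $ writeE $ seqE $ writeE $ seqE $
    writeE $ seqE $
    agreeMap fin $ scale (proj₂ (proj₂ begin)) $
    whileE (Climbing q q≢ σ g mp) (ascendE q q≢ σ g mp) (proj₁ begin)
      (q , pt q , root , [] , σ 80 0 + σ 0 0 , start (<⇒≤ (pt< q≢)) , proj₁ (proj₂ begin) ,
       (e81 , trans (cong (σ 17) e81) e17 , (λ ne → contradiction refl ne) , refl ,
           sym (+-identityʳ _) , ≤-reflexive (trans (cong (g +_) (sym en)) (sym (+-identityʳ _)))) ,
       (λ v → inj₂ ((λ ()) , refl)) , (λ { [] _ _ () ; (_ ∷ _) _ _ () }) , (λ _ _ → refl) ,
           (λ _ → refl) , (λ _ → refl))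
    where
    g = σ 80 0
    begin : ∃[ B ] Budget q q≢ B q (pt q) root [] × B ≤ 2 * Dm
    begin with partner q≢
    ... | inj₁ (e , _) = 1 , inj₂ (e , inj₁ (refl , refl , refl , refl)) , ≤-trans 1≤Dm (m≤m+n Dm _)
    ... | inj₂ c = num q + num (pt q) , inj₁ (refl , c) ,
        ≤-trans (+-mono-≤ (≤-trans (<⇒≤ (num<n q)) n≤) (≤-trans (<⇒≤ (num<n (pt q))) n≤))
        (≤-reflexive (cong (Dm +_) (sym (+-identityʳ Dm))))
      where
      n≤ : n ≤ Dm
      n≤ = let _ , _ , B = walk-total (pt< q≢) in long (cycle-of c B)
    σ₀ : Store
    σ₀ = (((σ [ 82 , 0 ↦ σ 81 0 ]) [ 83 , 0 ↦ σ 17 (σ 81 0) ]) [ 84 , 0 ↦ σ 80 0 + σ 0 0 ]) [ 85 ,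
      0 ↦ σ 80 0 + σ 0 0 ]
    fin : ∀ υ → Agree (while (op sub (lit 1) (op equal (var 82) (var 83))) ascend) σ₀ υ →
        Climbed q q≢ σ g mp υ → Exec (2 * Dm) _ υ _ _
    fin υ ag (κ , mid , lo , blk , k , (e86 , e84 , e85 , g≤) , M , A , below) = seqE $ writeE $ seqE $
      writeE $ writeE
      (κ , mid , lo , blk , k , M , A , below , g≤ , e85 ,
       (trans (if-same e86) e84 , λ i ne → trans (if-other (λ e → ne (trans (sym e) e86))) (ag 19 tt i))
           ,
       (trans (if-same e86) (trans (cong₂ _∸_ e85 e84) (m+n∸m≡n lo (length mid))) , λ i ne →
           trans (if-other (λ e → ne (trans (sym e) e86))) (ag 20 tt i)))

  Marked : (Fin n → List (Fin n)) → (ℕ → ℕ) → Set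
  Marked blk a = ∀ v → (a (toℕ v) ≡ 0 × (∀ v′ → v ∉ blk v′)) ⊎ (a (toℕ v) ≢ 0 × ∃[ v′ ] v ∈ blk v′)

  Laid : (Fin n → List (Fin n)) → (a19 a20 a21 : ℕ → ℕ) → ℕ → Set
  Laid blk a19 a20 a21 g = ∀ v → a20 (toℕ v) ≡ length (blk v) × At a21 (a19 (toℕ v)) (blk v) ×
    (blk v ≢ [] → a19 (toℕ v) + length (blk v) ≤ g)

  Contracted : ℕ → Store → Set
  Contracted j τ = ∃[ blk ] Found pt partner j blk × Marked blk (τ 18) × Laid blk (τ 19) (τ 20) (τ 21)
    (τ 80 0)

  contractE : ∀ {σ} → σ 0 0 ≡ n → Mapped ST σ → (∀ {v} → v ≢ root → σ 17 (toℕ v) ≡ toℕ (pt v)) →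
      (∀ i → σ 18 i ≡ 0) → (∀ i → σ 20 i ≡ 0) →
    Exec (n * suc (2 * Dm)) contract σ 400 (λ τ → ∃[ blk ] Σ (Found pt partner (n ∸ 1) blk) λ F →
        Stored (Finished.decomposition pt partner 1≤n F) τ)
  contractE {σ} en mp e17 z18 z20 = weaken tt $ seqE $ writeE $
    agreeMap (λ τ ag (blk , F , _ , laid) → blk , F , record
      { at-ord = Mapped.at-ord (Mapped-agree {contract′} ag mp₀)
      ; at-par = λ i → Mapped.at-par (Mapped-agree {contract′} ag mp₀)
        (above-root (Block.top< (proj₁ (proj₂ (Found.block-of F i))) i))
      ; at-len = λ v → proj₁ (laid v)
      ; at-blk = λ v → proj₁ (proj₂ (laid v)) }) $
    scale (*-monoˡ-≤ (suc (2 * Dm)) (m∸n≤m n 1)) $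
    forE (n ∸ 1) Contracted {tt} (λ τ ag → cong (_∸ 1) (trans (ag 0 tt 0) en))
      ((λ _ → []) , found₀ pt partner , (λ v → inj₁ (z18 _ , λ _ → nil∉)) , λ v → z20 _ ,
          (λ { [] _ _ () ; (_ ∷ _) _ _ () }) , λ ne → contradiction refl ne)
      body
    where
    contract′ = for 72 (op sub (read 0 (lit 0)) (lit 1))
      (set 81 (read 14 (op sub (read 0 (lit 0)) (op add (lit 1) (var 72)))) ⨟
          cond (read 18 (var 81)) skip climb)
    σ₁ : Store
    σ₁ = σ [ 80 , 0 ↦ 0 ]
    mp₀ : Mapped ST σ₁
    mp₀ = record { Mapped mp }
    body : ∀ j τ → j < n ∸ 1 → Agree contract′ σ₁ τ → τ 72 0 ≡ j → Contracted j τ →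
           Exec (2 * Dm) _ τ _ (λ υ → ∀ x → Contracted (suc j) (υ [ 72 , 0 ↦ x ]))
    body j τ j< ag tj (blk , F , marked , laid) = seqE $ writeE $ condE
      (λ h → skipE λ _ → blk , [ (λ (z , _) → contradiction (trans (cong (τ 18) e81) z) h) ,
          (λ (_ , v , i) → skip-found i) ]′ (marked q) , marked , laid)
      (λ h → [ (λ (_ , free′) → mapE (λ υ c x → next {υ} free′ c)
                  (climbE q≢ (trans (ag 0 tt 0) en) e81 (trans (ag 17 tt _) (e17 q≢))
                      (record { Mapped (Mapped-agree {contract′} ag mp₀) })))
             , (λ (nz , _) → contradiction (trans (cong (τ 18) (sym e81)) h) nz) ]′ (marked q))
      where
      j<n = ≤-trans j< (m∸n≤m n 1)
      open Next pt partner j<n F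
      e81 : τ 14 (τ 0 0 ∸ (1 + τ 72 0)) ≡ toℕ q
      e81 = trans (cong (τ 14) (cong₂ (λ a b → a ∸ suc b) (trans (ag 0 tt 0) en) tj))
        (Mapped.at-ord (Mapped-agree {contract′} ag mp₀) (∸-monoʳ-< {n} z<s j<n))
      q≢ : q ≢ root
      q≢ e = <⇒≢ (≤-trans (s≤s j<) (≤-reflexive (m+[n∸m]≡n 1≤n)))
        (trans (cong (_+ suc j) (sym (trans (cong num e) num-root))) num-q)
      next : ∀ {υ : Store} → (∀ v → q ∉ blk v) → (∃[ κ ] ∃[ mid ] ∃[ lo ] Block q (pt q) κ mid ×
          Kind pt partner q κ mid ×
        Marks q q≢ mid (τ 18) (υ 18) × At (υ 21) lo mid × (∀ i → i < τ 80 0 → υ 21 i ≡ τ 21 i) ×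
            τ 80 0 ≤ lo × υ 80 0 ≡ lo + length mid ×
        (υ 19 (toℕ κ) ≡ lo × (∀ i → i ≢ toℕ κ → υ 19 i ≡ τ 19 i)) ×
            (υ 20 (toℕ κ) ≡ length mid × (∀ i → i ≢ toℕ κ → υ 20 i ≡ τ 20 i))) → Contracted (suc j) υ
      next {υ} free′ (κ , mid , lo , B , k , M , A , below , g≤ , e80 , (lo≡ , oth19) ,
          (len≡ , oth20)) =
        blk′ , add-found free′ B k , marked′ , laid′
        where
        blk′ = update pt partner blk κ mid
        marked′ : Marked blk′ (υ 18)
        marked′ v with M v | marked v
        ... | inj₁ (i , e) | _ = inj₂ ((λ z → 1+n≢0 (trans (sym e) z)) , κ ,
            subst (v ∈_) (sym (at-κ free′ B k)) i)
        ... | inj₂ (_ , e) | inj₂ (nz , v′ , i) = inj₂ ((λ z → nz (trans (sym e) z)) , v′ ,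
            keep-old free′ B k i)
        ... | inj₂ (v∉ , e) | inj₁ (z , none) = inj₁ (trans e z , λ v′ i → gone v′ i)
          where
          gone : ∀ v′ → v ∉ blk′ v′
          gone v′ i with v′ Finₚ.≟ κ
          ... | yes _ = v∉ i
          ... | no _ = none v′ i
        laid′ : Laid blk′ (υ 19) (υ 20) (υ 21) (υ 80 0)
        laid′ v with v Finₚ.≟ κ
        ... | yes refl = len≡ , subst (λ z → At (υ 21) z mid) (sym lo≡) A , λ _ →
            ≤-reflexive (trans (cong (_+ length mid) lo≡) (sym e80))
        ... | no ne = trans (oth20 _ (ne ∘ toℕ-injective)) (proj₁ (laid v)) ,
              subst (λ z → At (υ 21) z (blk v)) (sym (oth19 _ (ne ∘ toℕ-injective)))
                  (keep (blk v) refl) ,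
              λ nz → ≤-trans (≤-trans (≤-reflexive
                  (cong (_+ length (blk v)) (oth19 _ (ne ∘ toℕ-injective))))
                  (proj₂ (proj₂ (laid v)) nz)) (≤-trans g≤
                  (≤-trans (m≤m+n lo (length mid)) (≤-reflexive (sym e80))))
          where
          keep : ∀ L → L ≡ blk v → At (υ 21) (τ 19 (toℕ v)) (blk v)
          keep [] e = subst (At (υ 21) (τ 19 (toℕ v))) e (λ { [] _ _ () ; (_ ∷ _) _ _ () })
          keep (_ ∷ _) e = At-same (λ i l →
            below i (≤-trans l (proj₂ (proj₂ (laid v)) λ z → case trans e z of λ ())))
            (proj₁ (proj₂ (laid v)))

-- The complete program

solve : Problem → Program
solve P = constants ⨟ adjacency ⨟ explore ⨟ partners ⨟ contract ⨟ search P

-- Abstract, lest the numeral be expanded in unary.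
abstract
  factor : ℕ
  factor = 20000 * 223

  factor-≡ : 20000 * 223 ≡ factor
  factor-≡ = refl

module Solution (P : Problem) (I : Instance) (cactus : IsCactus (Instance.graph I))
                (Dm : ℕ) (1≤Dm : 1 ≤ Dm) (long : SimpleCycle (Instance.graph I) →
                    Instance.n I ≤ Dm) where
  open Instance I
  open Graph graph
  open Adjacency I
  open Explore I (proj₁ cactus)

  module Bounds where
    N unit S₁ Z Y : ℕ
    N = suc p * suc u
    unit = N * suc (N * 1)
    S₁ = suc (Dm * suc unit)
    Z = 5 * (n * S₁)
    Y = suc ⌊log₂ (∑ s ⊔ 2) ⌋ * suc Z

  open Bounds using (Y)

  5nS≤Y : Bounds.Z ≤ Y
  5nS≤Y = ≤-trans (n≤1+n Bounds.Z) (m≤m+n (suc Bounds.Z) _)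

  kn≤Y : ∀ k → k ≤ 5 → k * n ≤ Y
  kn≤Y k k≤ = ≤-trans (*-mono-≤ k≤ (m≤m*n n Bounds.S₁)) 5nS≤Y

  n≤Y : n ≤ Y
  n≤Y = ≤-trans (≤-reflexive (sym (*-identityˡ n))) (kn≤Y 1 (s≤s z≤n))

  contract≤Y : n * suc (2 * Dm) ≤ Y
  contract≤Y = ≤-trans (≤-trans (*-monoʳ-≤ n le) (≤-reflexive (lem n Bounds.S₁))) 5nS≤Y
    where
    lem : ∀ n x → n * (5 * x) ≡ 5 * (n * x)
    lem = solve-∀
    le : suc (2 * Dm) ≤ 5 * Bounds.S₁
    le = ≤-trans (+-mono-≤ (≤ᵇ⇒≤ 1 5 tt) (*-monoˡ-≤ Dm (≤ᵇ⇒≤ 2 5 tt)))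
      (≤-trans (≤-reflexive (lem′ Dm)) (*-monoʳ-≤ 5 (s≤s (m≤m*n Dm (suc Bounds.unit)))))
      where
      lem′ : ∀ d → 5 + 5 * d ≡ 5 * suc d
      lem′ = solve-∀

  inp₁ : ∀ {σ} → Agree constants (input I) σ → Input I σ
  inp₁ ag = Input-agree {I} {constants} ag (input-Input I)

  inp₂ : ∀ {σ τ} → Agree adjacency σ τ → Input I σ → Input I τ
  inp₂ = Input-agree {I} {adjacency}

  mappingE : Exec (n + 2 * m) (constants ⨟ adjacency ⨟ explore) (input I) 900 Reached
  mappingE = weaken tt $ seqE $ agreeMap (λ σ₁ ag₁ (_ , o12) →
      seqE $ agreeMap (λ σ₂ ag₂ (adj , R , L) →
        scale (m≤n+m (2 * m) n) $ exploreE (inp₂ ag₂ (inp₁ ag₁)) R L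
            (λ i → trans (ag₂ 13 tt i) (ag₁ 13 tt i))
          (trans (ag₂ 14 tt 0) (ag₁ 14 tt 0)) (trans (ag₂ 15 tt 0) (ag₁ 15 tt 0))) $
      scale (≤-trans (m≤m+n m _) (m≤n+m (2 * m) n)) $ adjacencyE (inp₁ ag₁) (λ v → ag₁ 11 tt _) o12) $
    scale (m≤m+n n (2 * m)) $ constantsE (input-Input I)

  m≤2n : m ≤ 2 * n
  m≤2n = Assembly.edges≤ (proj₁ (Exec.post mappingE)) cactus

  m≤Y : m ≤ Y
  m≤Y = ≤-trans m≤2n (kn≤Y 2 (≤ᵇ⇒≤ 2 5 tt))

  2m≤Y : 2 * m ≤ Y
  2m≤Y = ≤-trans (≤-trans (*-monoʳ-≤ 2 m≤2n) (≤-reflexive (sym (*-assoc 2 2 n)))) (kn≤Y 4 (≤ᵇ⇒≤ 4 5 tt))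

  runE : Exec Y (solve P) (input I) 20000 (CorrectOutput P I)
  runE = weaken tt $ seqE $ agreeMap step₁ $ scale n≤Y $ constantsE (input-Input I)
    where
    σ₀ : Store
    σ₀ = input I
    step₁ : ∀ σ₁ → Agree constants σ₀ σ₁ → Constants σ₁ × (∀ (v : Fin n) → σ₁ 12 (toℕ v) ≡ 1) →
            Exec Y (adjacency ⨟ explore ⨟ partners ⨟ contract ⨟ search P) σ₁ _ (CorrectOutput P I)
    step₁ σ₁ ag₁ (cs₁ , o12) = seqE $ agreeMap step₂ $ scale m≤Y $
      adjacencyE (inp₁ ag₁) (λ v → ag₁ 11 tt _) o12
      where
      step₂ : ∀ σ₂ → Agree adjacency σ₁ σ₂ → (∃[ adj ] Rep adj (σ₂ 11) (σ₂ 12) × Lists m adj) →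
              Exec Y (explore ⨟ partners ⨟ contract ⨟ search P) σ₂ _ (CorrectOutput P I)
      step₂ σ₂ ag₂ (adj , R , L) = seqE $ agreeMap step₃ $ scale 2m≤Y $
        exploreE (inp₂ ag₂ (inp₁ ag₁)) R L (λ i → trans (ag₂ 13 tt i) (ag₁ 13 tt i))
          (trans (ag₂ 14 tt 0) (ag₁ 14 tt 0)) (trans (ag₂ 15 tt 0) (ag₁ 15 tt 0))
        where
        step₃ : ∀ σ₃ → Agree explore σ₂ σ₃ → Reached σ₃ → Exec Y (partners ⨟ contract ⨟ search P) σ₃ _
            (CorrectOutput P I)
        step₃ σ₃ ag₃ (ST , mp , e17) = seqE $ agreeMap step₄ $ scale m≤Y $ Contract.partnersE I cactus
          ST inp₃ mp (λ {v} → e17 {v})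
          where
          inp₃ : Input I σ₃
          inp₃ = Input-agree {I} {explore} ag₃ (inp₂ ag₂ (inp₁ ag₁))
          open SearchTree ST
          open Fundamental ST using (Chord)
          step₄ : ∀ σ₄ → Agree partners σ₃ σ₄ →
              (∃[ pt ] (∀ {v} → v ≢ root → σ₄ 17 (toℕ v) ≡ toℕ (pt v)) × Contract.Partner I cactus ST m
              pt) →
                  Exec Y (contract ⨟ search P) σ₄ _ (CorrectOutput P I)
          step₄ σ₄ ag₄ (pt , e17′ , pm) = seqE $ agreeMap step₅ $ scale contract≤Y $
            Contracting.contractE I cactus ST Dm 1≤Dm long pt partner (Input.at-n inp₄)
                (Contract.Mapped-agree I cactus ST {partners} ag₄ mp)
              (λ {v} → e17′ {v}) (λ i → trans (ag₄ 18 tt i)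
                  (trans (ag₃ 18 tt i) (trans (ag₂ 18 tt i) (ag₁ 18 tt i))))
              (λ i → trans (ag₄ 20 tt i) (trans (ag₃ 20 tt i) (trans (ag₂ 20 tt i) (ag₁ 20 tt i))))
            where
            inp₄ : Input I σ₄
            inp₄ = Input-agree {I} {partners} ag₄ inp₃
            partner : ∀ {q} → q ≢ root → (pt q ≡ par q × (∀ y → ¬ Chord q y)) ⊎ Chord q (pt q)
            partner ne = [ (λ (e , none) → inj₁ (e , λ y c → none y c (adj-of (proj₁ c)))) ,
              inj₂ ]′ (pm ne)
            open Assembly ST cactus
            step₅ : ∀ σ₅ → Agree contract σ₄ σ₅ → (∃[ blk ] Σ (Found pt partner (n ∸ 1) blk) λ F →
                Stored (Finished.decomposition pt partner 1≤n F) σ₅) →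
                    Exec Y (search P) σ₅ 13000 (CorrectOutput P I)
            step₅ σ₅ ag₅ (blk , F , st) = Bisection.searchE P I
              (Finished.decomposition pt partner 1≤n F) Dm
                (Finished.blk≤ pt partner 1≤n F 1≤Dm long) 1≤Dm (record
                  { at-n = Input.at-n inp₅ ; at-l = Input.at-l inp₅
                  ; at-S = trans (thru 22 0) at-S ; at-N = trans (thru 23 0) at-N ; at-q =
                    trans (thru 24 0) at-q ; at-d = trans (thru 25 0) at-d
                  ; at-5 = trans (thru 5 0) (ag₁ 5 tt 0)
                  ; weighted = record { at-w = Input.at-w inp₅ ; at-s = Input.at-s inp₅ ; at-pow = λ v →
                    trans (thru 10 _) (at-pow v) }
                  ; stored = st })
              where
              open Constants cs₁
              inp₅ : Input I σ₅
              inp₅ = Input-agree {I} {contract} ag₅ inp₄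
              thru : ∀ a i → {T (free a contract)} → {T (free a partners)} → {T (free a explore)} →
                  {T (free a adjacency)} → σ₅ a i ≡ σ₁ a i
              thru a i {f₅} {f₄} {f₃} {f₂} = trans (ag₅ a f₅ i)
                (trans (ag₄ a f₄ i) (trans (ag₃ a f₃ i) (ag₂ a f₂ i)))

  -- Abstract, lest the run be evaluated.
  abstract
    solveE : Exec Y (solve P) (input I) 20000 (CorrectOutput P I)
    solveE = runE

  private
    W X L : ℕ
    W = p * (u ⊔ 1)
    X = n * (Dm * (W * W))
    L = ⌊log₂ (∑ s ⊔ 2) ⌋

  1≤U : 1 ≤ u ⊔ 1
  1≤U = m≤n⊔m u 1

  1≤W : 1 ≤ W
  1≤W = *-mono-≤ 0<p 1≤U

  1≤X : 1 ≤ X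
  1≤X = *-mono-≤ 1≤n (*-mono-≤ 1≤Dm (*-mono-≤ 1≤W 1≤W))

  1≤L : 1 ≤ L
  1≤L = ⌊log₂⌋-mono-≤ {2} (m≤n⊔m (∑ s) 2)
    where open import Data.Nat.Logarithm using (⌊log₂⌋-mono-≤)

  absorb : ∀ {a b x} → 1 ≤ x → b ≤ a * x → suc b ≤ suc a * x
  absorb {a} {x = x} 1≤x le = +-mono-≤ 1≤x le

  scaled : ∀ {a b x y z} → x ≤ a * z → y ≤ b * z → x * y ≤ a * b * (z * z)
  scaled {a} {b} {z = z} x≤ y≤ = ≤-trans (*-mono-≤ x≤ y≤) (≤-reflexive (lem a b z))
    where
    lem : ∀ a b z → a * z * (b * z) ≡ a * b * (z * z)
    lem = solve-∀

  swap-in : ∀ d a z → d * (a * z) ≡ a * (d * z)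
  swap-in = solve-∀

  N≤ : Bounds.N ≤ 2 * 2 * W
  N≤ = ≤-trans (*-mono-≤ (absorb {1} 0<p (≤-reflexive (sym (*-identityˡ p))))
    (absorb {1} 1≤U (≤-trans (m≤m⊔n u 1) (≤-reflexive (sym (*-identityˡ (u ⊔ 1)))))))
         (≤-reflexive (lem 2 p (u ⊔ 1)))
    where
    lem : ∀ c a b → c * a * (c * b) ≡ c * c * (a * b)
    lem = solve-∀

  unit≤ : suc Bounds.unit ≤ 21 * (W * W)
  unit≤ = absorb {20} (*-mono-≤ 1≤W 1≤W)
    (scaled {4} {5} {z = W} N≤ (absorb {4} 1≤W (≤-trans (≤-reflexive (*-identityʳ Bounds.N)) N≤)))

  Z≤ : suc Bounds.Z ≤ 111 * X
  Z≤ = absorb {110} 1≤X (≤-trans (*-monoʳ-≤ 5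
    (≤-trans (*-monoʳ-≤ n (absorb {21} (*-mono-≤ 1≤Dm (*-mono-≤ 1≤W 1≤W))
         (≤-trans (*-monoʳ-≤ Dm unit≤) (≤-reflexive (swap-in Dm 21 (W * W))))))
             (≤-reflexive (swap-in n 22 (Dm * (W * W))))))
         (≤-reflexive (sym (*-assoc 5 22 X))))

  Y≤ : suc Y ≤ 223 * (X * L)
  Y≤ = absorb {222} (*-mono-≤ 1≤X 1≤L)
    (≤-trans (*-mono-≤ (absorb {1} 1≤L (≤-reflexive (sym (*-identityˡ L)))) Z≤)
    (≤-reflexive (lem 2 L 111 X)))
    where
    lem : ∀ a l b x → a * l * (b * x) ≡ a * b * (x * l)
    lem = solve-∀

  total-s : total s ≡ ∑ s
  total-s = sum-allFin s

  F≡ : X * L ≡ (u ⊔ 1) ^ 2 * p ^ 2 * n * Dm * ⌊log₂ (total s ⊔ 2) ⌋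
  F≡ = trans (lem (u ⊔ 1) p n Dm L) (cong (λ z → (u ⊔ 1) ^ 2 * p ^ 2 * n * Dm * ⌊log₂ (z ⊔ 2) ⌋)
    (sym total-s))
    where
    lem : ∀ a p n d l → n * (d * (p * a * (p * a))) * l ≡ a * (a * 1) * (p * (p * 1)) * n * d * l
    lem = solve-∀

  time≤ : Exec.time solveE ≤ factor * ((u ⊔ 1) ^ 2 * p ^ 2 * n * Dm * ⌊log₂ (total s ⊔ 2) ⌋)
  time≤ = subst (λ k → Exec.time solveE ≤ k * ((u ⊔ 1) ^ 2 * p ^ 2 * n * Dm * ⌊log₂ (total s ⊔ 2) ⌋))
    factor-≡
    (combine {f = (u ⊔ 1) ^ 2 * p ^ 2 * n * Dm * ⌊log₂ (total s ⊔ 2) ⌋} 20000 223 (Exec.bound solveE)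
      (≤-trans Y≤ (≤-reflexive (cong (223 *_) F≡))))
    where
    combine : ∀ {t y f} a b → t ≤ a * y → y ≤ b * f → t ≤ a * b * f
    combine {f = f} a b t≤ y≤ = ≤-trans t≤
      (≤-trans (*-monoʳ-≤ a y≤) (≤-reflexive (sym (*-assoc a b f))))

tree⇒cactus : ∀ {n} {G : Graph n} → IsTree G → IsCactus G
tree⇒cactus (conn , acyclic) = conn , λ C → ⊥-elim (acyclic C)

theorem6 : ∀ (P : Problem) →
    SolvableInO P IsTree (λ I → let open Instance I in
    (u ⊔ 1) ^ 2 * p ^ 2 * n * ⌊log₂ (total s ⊔ 2) ⌋)
    × SolvableInO P IsCactus (λ I → let open Instance I in
    (u ⊔ 1) ^ 2 * p ^ 2 * n ^ 2 * ⌊log₂ (total s ⊔ 2) ⌋)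
theorem6 P =
  (solve P , factor , λ I tree →
    let open Instance I
        module S = Solution P I (tree⇒cactus tree) 1 ≤-refl (λ C → ⊥-elim (proj₂ tree C))
    in Exec.time S.solveE , Exec.final S.solveE , Exec.run S.solveE ,
       subst (λ z → Exec.time S.solveE ≤ factor * (z * ⌊log₂ (total s ⊔ 2) ⌋)) (*-identityʳ ((u ⊔ 1) ^ 2 * p ^ 2 * n)) S.time≤ ,
       Exec.post S.solveE) ,
  (solve P , factor , λ I cactus →
    let open Instance I
        module S = Solution P I cactus n (≤-trans 0<p p≤n) (λ _ → ≤-refl)
    in Exec.time S.solveE , Exec.final S.solveE , Exec.run S.solveE ,
       subst (λ z → Exec.time S.solveE ≤ factor * (z * ⌊log₂ (total s ⊔ 2) ⌋)) (square (u ⊔ 1) p n) S.time≤ ,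
       Exec.post S.solveE)
  where
  square : ∀ a p n → a * (a * 1) * (p * (p * 1)) * n * n ≡ a * (a * 1) * (p * (p * 1)) * (n * (n * 1))
  square = solve-∀
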